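{- Let $D\in\mathrm{BPD}(\pi)$ and let $x_k$, $y_l$ be biletters with $l\le k$. If $\pi\ne\mathrm{id}$, let $d_1$ and $d_2$ be the first and last descent positions of $\pi$, and suppose furthermore that $k\ge d_2$ and $l\le d_1$. Then left insertion of $x_k$ commutes with right insertion of $y_l$: $(x_k\rightarrow D)\leftarrow y_l=x_k\rightarrow(D\leftarrow y_l)$.
   Context: Permutations are in one-line notation, $\ell$ is length, $\pi t_{ab}$ swaps the entries of $\pi$ in positions $a,b$; $\rho\lessdot_k\pi$ means $\pi=\rho t_{ab}$ with $a\le k<b$ and $\ell(\pi)=\ell(\rho)+1$. A descent of $\pi$ is an $i$ with $\pi(i)>\pi(i+1)$. Bumpless pipe dreams. Cells $(i,j)$ of the $n\times n$ grid (row $i$ from the top, column $j$ from the left) carry tiles recording which cell edges are joined by pipe segments: blank (none), horizontal (W–E), vertical (S–N), cross (W–E and S–N, two pipes), r-elbow (S–E), j-elbow (W–N), and, in intermediate stages only, bump (a W–N elbow and an S–E elbow carried by two different pipes). A bumpless pipe dream (BPD) of $\pi\in S_n$ is a tiling by the first six tiles whose segments form pipes such that for each $c$ the pipe $c$ enters at the bottom of column $c$, moves only north and east, and exits at the right end of row $\pi^{ -1}(c)$ ("pipe $c$ exits from row $\pi^{ -1}(c)$"), any two pipes crossing at most once; $\mathrm{BPD}(\pi)$ is the set of these and $\mathrm{perm}(D)=\pi$. During the algorithms one cell may be a bump; pipes, exits and crossings are traced the same way. A pipe has an r-turn at a cell where it enters from the south and leaves east (r-elbow or SE part of a bump). Moves.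 min-droop at $(a,b)$, where pipe $p$ has an r-turn: let $x>0$ be smallest with $(a+x,b)$ not a cross and $y>0$ smallest with $(a,b+y)$ not a cross. Within the rectangle with corners $(a,b)$ and $(a+x,b+y)$, $p$ runs up the left column from $(a+x,b)$ to $(a,b)$ and then along the top row to $(a,b+y)$; replace this by the route along the bottom row from $(a+x,b)$ to $(a+x,b+y)$ and up the right column to $(a,b+y)$, other pipes unchanged, tiles redetermined by the segments (so $p$ gets a W–N turn at $(a+x,b+y)$, which becomes a j-elbow if it was blank and a bump if it was an r-elbow). Set $\operatorname{min-droop}(a,b)=(a+x,b+y)$. cross-bump-swap at a bump $(a,b)$ whose two pipes also cross at $(a',b')$: $(a,b)$ becomes a cross and $(a',b')$ a bump; $\operatorname{cross-bump-swap}(a,b)=(a',b')$. A biletter $b_k$ is a pair of positive integers with $b\le k$. Left insertion $b_k\rightarrow D$: let $(i,j)$ be the r-elbow in row $b$ with $j$ minimal. (1) min-droop at $(i,j)$; let $(i_1,j_1)=\operatorname{min-droop}(i,j)$. (2) If $(i_1,j_1)$ is a j-elbow: (a) if $i_1\le k$, let $(i_1,j_2)$ be the r-elbow in row $i_1$ with $j_2>j_1$ minimal, set $(i,j)=(i_1,j_2)$, go to (1); (b) otherwise let $(i_1,j_0)$ be the r-elbow in row $i_1$ with $j_0<j_1$ maximal, set $(i,j)=(i_1,j_0)$, go to (1). (3) Otherwise $(i_1,j_1)$ is a bump: (a) if the pipe with the r-turn there exits from a row $r\le k$, set $(i,j)=(i_1,j_1)$ and go to (1); (b) otherwise, if the two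 pipes through $(i_1,j_1)$ cross somewhere, perform cross-bump-swap, set $(i,j)=\operatorname{cross-bump-swap}(i_1,j_1)$ and go to (1); if not, replace the bump by a cross and stop. Right insertion $D\leftarrow b_k$: let $(i,j)$ be the r-elbow in row $b$ with $j$ maximal. (1) min-droop at $(i,j)$; $(i_1,j_1)=\operatorname{min-droop}(i,j)$. (2) If $(i_1,j_1)$ is a j-elbow, let $(i_1,j_2)$ be the r-elbow in row $i_1$ with $j_2<j_1$ maximal, set $(i,j)=(i_1,j_2)$, go to (1). (3) If it is a bump: (a) if its two pipes cross somewhere, perform cross-bump-swap, set $(i,j)=\operatorname{cross-bump-swap}(i_1,j_1)$, go to (1); (b) otherwise let $p$ be the pipe with the r-turn there; if $p$ exits from a row $r\le k$, set $(i,j)=(i_1,j_1)$ and go to (1); otherwise replace the bump by a cross and stop. For $D\in\mathrm{BPD}(\pi)$ the outputs of both insertions of $b_k$ lie in $\mathrm{BPD}(\pi t_{\alpha\beta})$ for some $\alpha\le k<\beta$ with $\pi\lessdot_k\pi t_{\alpha\beta}$. -}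

module Defs where

-- Bumpless pipe dreams (BPDs) and the left / right insertion algorithms.
-- Conventions:
--  * rows and columns are 1-indexed natural numbers; row i counted from the
--    top, column j from the left;
--  * a grid is a function  ℕ → ℕ → Tile  (an infinite grid); a BPD of a
--    permutation in S_n is given by its n×n block and viewed as an infinite
--    grid via the standard stable extension  ext  (so the algorithms never
--    "run out of room"; this is the usual identification S_n ⊂ S_{n+1} ⊂ …);
--  * permutations are written in one-line notation as functions ℕ → ℕ,
--    only the values π 1, …, π n being relevant.

open import Data.Nat using (ℕ; zero; suc; _+_; _*_; _∸_; _≤_; _<_; _⊔_; _≤ᵇ_; _<ᵇ_; _≡ᵇ_)
open import Data.Bool using (Bool; true; false; _∧_; _∨_; not; if_then_else_)
open import Data.Maybe using (Maybe; just; nothing; _>>=_)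
open import Data.List using (List; []; _∷_; _++_; length; map; upTo; reverse)
open import Data.Product using (_×_; _,_; proj₁; proj₂; Σ; ∃)
open import Relation.Nullary using (¬_)
open import Relation.Binary.PropositionalEquality using (_≡_; _≢_)

data Tile : Set where
  blank horiz vert cross relb jelb bump : Tile
-- horiz = W–E, vert = S–N, cross = W–E and S–N (two pipes),
-- relb = r-elbow S–E, jelb = j-elbow W–N,
-- bump = a W–N elbow and an S–E elbow carried by two different pipes.

-- A pipe enters a cell from the west or the south and leaves it to the
-- north or the east; a connection is such an (entry, exit) pair.
data In : Set where
  inW inS : In

data Out : Set where
  outN outE : Out

Conn : Set
Conn = In × Out

record Conns : Set where
  constructor conns
  field
    we sn se wn : Bool

toConns : Tile → Conns
toConns blank = conns false false false false
toConns horiz = conns true  false false false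
toConns vert  = conns false true  false false
toConns cross = conns true  true  false false
toConns relb  = conns false false true  false
toConns jelb  = conns false false false true
toConns bump  = conns false false true  true

fromConns : Conns → Maybe Tile
fromConns (conns false false false false) = just blank
fromConns (conns true  false false false) = just horiz
fromConns (conns false true  false false) = just vert
fromConns (conns true  true  false false) = just cross
fromConns (conns false false true  false) = just relb
fromConns (conns false false false true ) = just jelb
fromConns (conns false false true  true ) = just bump
fromConns _ = nothing

hasConn : Conn → Conns → Bool
hasConn (inW , outE) c = Conns.we c
hasConn (inS , outN) c = Conns.sn c
hasConn (inS , outE) c = Conns.se c
hasConn (inW , outN) c = Conns.wn c

setConn : Conn → Bool → Conns → Conns
setConn (inW , outE) b (conns we sn se wn) = conns b sn se wn
setConn (inS , outN) b (conns we sn se wn) = conns we b se wn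
setConn (inS , outE) b (conns we sn se wn) = conns we sn b wn
setConn (inW , outN) b (conns we sn se wn) = conns we sn se b

addConn : Conn → Tile → Maybe Tile
addConn c t = if hasConn c (toConns t) then nothing
              else fromConns (setConn c true (toConns t))

removeConn : Conn → Tile → Maybe Tile
removeConn c t = if hasConn c (toConns t)
                 then fromConns (setConn c false (toConns t))
                 else nothing

hasW hasE hasS hasN : Tile → Bool
hasW t = Conns.we (toConns t) ∨ Conns.wn (toConns t)
hasE t = Conns.we (toConns t) ∨ Conns.se (toConns t)
hasS t = Conns.sn (toConns t) ∨ Conns.se (toConns t)
hasN t = Conns.sn (toConns t) ∨ Conns.wn (toConns t)

exitDir : Tile → In → Maybe Out
exitDir t inW = if Conns.we (toConns t) then just outE
                else if Conns.wn (toConns t) then just outN else nothing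
exitDir t inS = if Conns.sn (toConns t) then just outN
                else if Conns.se (toConns t) then just outE else nothing

isCross isRelb isJelb isBump : Tile → Bool
isCross cross = true
isCross _ = false
isRelb relb = true
isRelb _ = false
isJelb jelb = true
isJelb _ = false
isBump bump = true
isBump _ = false

inEq : In → In → Bool
inEq inW inW = true
inEq inS inS = true
inEq _ _ = false

Grid : Set
Grid = ℕ → ℕ → Tile

-- the tiles of the standard (Rothe) BPD of the identity: used outside
-- the n×n block in the stable extension
std : ℕ → ℕ → Tile
std i j = if i <ᵇ j then horiz else (if j <ᵇ i then vert else relb)

ext : ℕ → Grid → Grid
ext n D i j = if (i ≤ᵇ n) ∧ (j ≤ᵇ n) then D i j else std i j

set : Grid → ℕ → ℕ → Tile → Grid
set G i j t i' j' = if (i' ≡ᵇ i) ∧ (j' ≡ᵇ j) then t else G i' j'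

modify : Grid → ℕ → ℕ → (Tile → Maybe Tile) → Maybe Grid
modify G i j f = f (G i j) >>= λ t → just (set G i j t)

modifyAll : Grid → List (ℕ × ℕ) → (Tile → Maybe Tile) → Maybe Grid
modifyAll G [] f = just G
modifyAll G ((i , j) ∷ cs) f = modify G i j f >>= λ G' → modifyAll G' cs f

range : ℕ → ℕ → List ℕ
range lo cnt = map (lo +_) (upTo cnt)

firstWhere : (ℕ → Bool) → List ℕ → Maybe ℕ
firstWhere p [] = nothing
firstWhere p (x ∷ xs) = if p x then just x else firstWhere p xs

lastWhere : (ℕ → Bool) → List ℕ → Maybe ℕ
lastWhere p xs = firstWhere p (reverse xs)

-- Tracing pipes.  A bound M means: all cells (i , j) with i > M or j > M
-- carry the standard tiles, so a pipe reaching the east side of column M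
-- in row i exits from row i.

trace : ℕ → Grid → ℕ → ℕ → ℕ → In → Maybe (List (ℕ × ℕ × In) × ℕ)
trace zero G M i j s = nothing
trace (suc fuel) G M i j s with exitDir (G i j) s
... | nothing = nothing
... | just outN with i ≤ᵇ 1
...   | true = nothing
...   | false = trace fuel G M (i ∸ 1) j inS >>= λ { (cs , r) → just ((i , j , s) ∷ cs , r) }
trace (suc fuel) G M i j s | just outE with M ≤ᵇ j
...   | true = just ((i , j , s) ∷ [] , i)
...   | false = trace fuel G M i (suc j) inW >>= λ { (cs , r) → just ((i , j , s) ∷ cs , r) }

-- pipe c enters at the bottom of column c (cell (M , c), from the south)
pipeTrace : Grid → ℕ → ℕ → Maybe (List (ℕ × ℕ × In) × ℕ)
pipeTrace G M c = trace (2 * M + 2) G M M c inS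

exitRow : Grid → ℕ → ℕ → Maybe ℕ
exitRow G M c = pipeTrace G M c >>= λ p → just (proj₂ p)

pipeCells : Grid → ℕ → ℕ → List (ℕ × ℕ × In)
pipeCells G M c with pipeTrace G M c
... | nothing = []
... | just (cs , r) = cs

visits : ℕ → ℕ → In → List (ℕ × ℕ × In) → Bool
visits i j s [] = false
visits i j s ((i' , j' , s') ∷ cs) =
  ((i ≡ᵇ i') ∧ (j ≡ᵇ j') ∧ inEq s s') ∨ visits i j s cs

visitsCell : ℕ → ℕ → List (ℕ × ℕ × In) → Bool
visitsCell i j [] = false
visitsCell i j ((i' , j' , s') ∷ cs) = ((i ≡ᵇ i') ∧ (j ≡ᵇ j')) ∨ visitsCell i j cs

crossingsIn : Grid → List (ℕ × ℕ × In) → List (ℕ × ℕ × In) → List (ℕ × ℕ)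
crossingsIn G [] ds = []
crossingsIn G ((i , j , s) ∷ cs) ds =
  if isCross (G i j) ∧ visitsCell i j ds
  then (i , j) ∷ crossingsIn G cs ds else crossingsIn G cs ds

crossings : Grid → ℕ → ℕ → ℕ → List (ℕ × ℕ)
crossings G M c d = crossingsIn G (pipeCells G M c) (pipeCells G M d)

pipeThrough : Grid → ℕ → ℕ → ℕ → In → Maybe ℕ
pipeThrough G M i j s = firstWhere (λ c → visits i j s (pipeCells G M c)) (range 1 M)

IsPerm : ℕ → (ℕ → ℕ) → Set
IsPerm n π = (∀ r → 1 ≤ r → r ≤ n → (1 ≤ π r) × (π r ≤ n))
           × (∀ r s → 1 ≤ r → r ≤ n → 1 ≤ s → s ≤ n → π r ≡ π s → r ≡ s)

record IsBPD (n : ℕ) (π : ℕ → ℕ) (D : Grid) : Set where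
  field
    perm      : IsPerm n π
    noBump    : ∀ i j → 1 ≤ i → i ≤ n → 1 ≤ j → j ≤ n → D i j ≢ bump
    compatEW  : ∀ i j → 1 ≤ i → i ≤ n → 1 ≤ j → j < n → hasE (D i j) ≡ hasW (D i (suc j))
    compatSN  : ∀ i j → 1 ≤ i → i < n → 1 ≤ j → j ≤ n → hasS (D i j) ≡ hasN (D (suc i) j)
    top       : ∀ j → 1 ≤ j → j ≤ n → hasN (D 1 j) ≡ false
    left      : ∀ i → 1 ≤ i → i ≤ n → hasW (D i 1) ≡ false
    bottom    : ∀ j → 1 ≤ j → j ≤ n → hasS (D n j) ≡ true
    right     : ∀ i → 1 ≤ i → i ≤ n → hasE (D i n) ≡ true
    exits     : ∀ c → 1 ≤ c → c ≤ n → Σ ℕ λ r → (exitRow D n c ≡ just r) × (π r ≡ c)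
    crossOnce : ∀ c d → 1 ≤ c → c ≤ n → 1 ≤ d → d ≤ n → c ≢ d → length (crossings D n c d) ≤ 1

minDroop : Grid → ℕ → ℕ → ℕ → Maybe (Grid × ℕ × ℕ)
minDroop G M a b =
  firstWhere (λ x → not (isCross (G (a + x) b))) (range 1 (suc M)) >>= λ x →
  firstWhere (λ y → not (isCross (G a (b + y)))) (range 1 (suc M)) >>= λ y →
  entryBL (G (a + x) b) >>= λ e →
  exitTR (G a (b + y)) >>= λ f →
  modify G a b (removeConn (inS , outE)) >>= λ G₁ →
  modifyAll G₁ (map (λ t → (a + t , b)) (range 1 (x ∸ 1))) (removeConn (inS , outN)) >>= λ G₂ →
  modify G₂ (a + x) b (λ t → removeConn (e , outN) t >>= addConn (e , outE)) >>= λ G₃ →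
  modifyAll G₃ (map (λ s → (a , b + s)) (range 1 (y ∸ 1))) (removeConn (inW , outE)) >>= λ G₄ →
  modify G₄ a (b + y) (λ t → removeConn (inW , f) t >>= addConn (inS , f)) >>= λ G₅ →
  modifyAll G₅ (map (λ s → (a + x , b + s)) (range 1 (y ∸ 1))) (addConn (inW , outE)) >>= λ G₆ →
  modify G₆ (a + x) (b + y) (addConn (inW , outN)) >>= λ G₇ →
  modifyAll G₇ (map (λ t → (a + t , b + y)) (range 1 (x ∸ 1))) (addConn (inS , outN)) >>= λ G₈ →
  just (G₈ , a + x , b + y)
  where
  -- side from which p enters the bottom-left corner (p leaves it north)
  entryBL : Tile → Maybe In
  entryBL t = if Conns.sn (toConns t) then just inS
              else if Conns.wn (toConns t) then just inW else nothing
  -- side through which p leaves the top-right corner (p enters it from the west)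
  exitTR : Tile → Maybe Out
  exitTR t = if Conns.we (toConns t) then just outE
             else if Conns.wn (toConns t) then just outN else nothing

record State : Set where
  constructor st
  field
    grid  : Grid
    bound : ℕ
    row   : ℕ
    col   : ℕ

data Outcome : Set where
  continue : State → Outcome
  done     : Grid → ℕ → Outcome
  stuck    : Outcome

isRelbAt : Grid → ℕ → ℕ → Bool
isRelbAt G i j = isRelb (G i j)

-- cross-bump-swap at the bump (i , j) whose pipes cross at (a' , b')
swapAt : Grid → ℕ → ℕ → ℕ → ℕ → Grid
swapAt G i j a' b' = set (set G i j cross) a' b' bump

-- pipe with the r-turn (S–E part) at a bump, and the other one (W–N part)
rPipe wPipe : Grid → ℕ → ℕ → ℕ → Maybe ℕ
rPipe G M i j = pipeThrough G M i j inS
wPipe G M i j = pipeThrough G M i j inW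

firstCrossing : Grid → ℕ → ℕ → ℕ → Maybe (ℕ × ℕ)
firstCrossing G M c d with crossings G M c d
... | [] = nothing
... | (p ∷ _) = just p

stepL : ℕ → State → Outcome
stepL k (st G M i j) with minDroop G M i j
... | nothing = stuck
... | just (G' , i₁ , j₁) = after (G' i₁ j₁)
  where
  M' = M ⊔ i₁ ⊔ j₁
  onBump : Maybe ℕ → Maybe ℕ → Outcome
  onBump (just p) (just q) with exitRow G' M' p
  ... | nothing = stuck
  ... | just r = if r ≤ᵇ k then continue (st G' M' i₁ j₁)
                 else (case-cross (firstCrossing G' M' p q))
    where
    case-cross : Maybe (ℕ × ℕ) → Outcome
    case-cross (just (a' , b')) = continue (st (swapAt G' i₁ j₁ a' b') M' a' b')
    case-cross nothing = done (set G' i₁ j₁ cross) M'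
  onBump _ _ = stuck
  onJ : Maybe ℕ → Outcome
  onJ (just c) = continue (st G' M' i₁ c)
  onJ nothing = stuck
  after : Tile → Outcome
  after jelb = if i₁ ≤ᵇ k
               then onJ (firstWhere (isRelbAt G' i₁) (range (suc j₁) (M' + i₁)))
               else onJ (lastWhere (isRelbAt G' i₁) (range 1 (j₁ ∸ 1)))
  after bump = onBump (rPipe G' M' i₁ j₁) (wPipe G' M' i₁ j₁)
  after _ = stuck

stepR : ℕ → State → Outcome
stepR k (st G M i j) with minDroop G M i j
... | nothing = stuck
... | just (G' , i₁ , j₁) = after (G' i₁ j₁)
  where
  M' = M ⊔ i₁ ⊔ j₁
  onBump : Maybe ℕ → Maybe ℕ → Outcome
  onBump (just p) (just q) with firstCrossing G' M' p q
  ... | just (a' , b') = continue (st (swapAt G' i₁ j₁ a' b') M' a' b')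
  ... | nothing with exitRow G' M' p
  ...   | nothing = stuck
  ...   | just r = if r ≤ᵇ k then continue (st G' M' i₁ j₁)
                   else done (set G' i₁ j₁ cross) M'
  onBump _ _ = stuck
  onJ : Maybe ℕ → Outcome
  onJ (just c) = continue (st G' M' i₁ c)
  onJ nothing = stuck
  after : Tile → Outcome
  after jelb = onJ (lastWhere (isRelbAt G' i₁) (range 1 (j₁ ∸ 1)))
  after bump = onBump (rPipe G' M' i₁ j₁) (wPipe G' M' i₁ j₁)
  after _ = stuck

data Runs (step : State → Outcome) : State → Grid × ℕ → Set where
  stop : ∀ {s G M} → step s ≡ done G M → Runs step s (G , M)
  next : ∀ {s s' r} → step s ≡ continue s' → Runs step s' r → Runs step s r

-- A grid together with a bound M (cells outside [1..M]² are standard).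
-- Left insertion  b_k → (G , M) : start at the r-elbow in row b with minimal column.
LeftIns : ℕ → ℕ → Grid × ℕ → Grid × ℕ → Set
LeftIns b k (G , M) out =
  Σ ℕ λ j → (firstWhere (isRelbAt G b) (range 1 (M + b)) ≡ just j)
          × Runs (stepL k) (st G (M ⊔ b) b j) out

RightIns : ℕ → ℕ → Grid × ℕ → Grid × ℕ → Set
RightIns b k (G , M) out =
  Σ ℕ λ j → (lastWhere (isRelbAt G b) (range 1 (M + b)) ≡ just j)
          × Runs (stepR k) (st G (M ⊔ b) b j) out

Biletter : ℕ → ℕ → Set
Biletter b k = (1 ≤ b) × (b ≤ k)

IsId : ℕ → (ℕ → ℕ) → Set
IsId n π = ∀ r → 1 ≤ r → r ≤ n → π r ≡ r

Descent : ℕ → (ℕ → ℕ) → ℕ → Set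
Descent n π i = (1 ≤ i) × (i < n) × (π (suc i) < π i)

FirstDescent LastDescent : ℕ → (ℕ → ℕ) → ℕ → Set
FirstDescent n π d = Descent n π d × (∀ i → Descent n π i → d ≤ i)
LastDescent  n π d = Descent n π d × (∀ i → Descent n π i → i ≤ d)

{-# OPTIONS --safe #-}
-- Follow the pipes downwards from their exits, naming a pipe by its exit row.  Left
-- insertion moves one pipe per row to the next free column; right insertion either
-- moves one pipe by one column or exchanges the names of two pipes.  Both are
-- therefore determined row by row by a small state (LStep, RStep), and the two orders
-- of insertion are compared one row at a time (square); below row k no pipe turns and
-- there is nothing left to compare.
module Submission where

open import Defs
open import Data.Bool as Bool using (Bool; true; false; _∧_; _∨_; not; if_then_else_)
open import Data.Char using (Char; toℕ; isDigit; isLower)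
open import Data.Empty using (⊥; ⊥-elim)
open import Data.List using (List; []; _∷_; _++_; map; length; upTo; reverse; applyUpTo; applyDownFrom)
open import Data.List.Properties using (reverse-applyUpTo)
open import Data.List.Membership.Propositional using (_∈_)
open import Data.List.Relation.Unary.Any using (here; there)
open import Data.Maybe using (Maybe; just; nothing; _>>=_)
open import Data.Maybe.Properties using (just-injective)
open import Data.Nat using (ℕ; zero; suc; _+_; _*_; _∸_; _≤_; _<_; _⊔_; _≤ᵇ_; _<ᵇ_; _≡ᵇ_; z≤n; s≤s; _≟_; _≤?_; _<?_)
open import Data.Nat.Properties
open import Data.Product using (_×_; _,_; proj₁; proj₂; Σ; ∃)
open import Data.String using (String; toList)
open import Data.Sum using (_⊎_; inj₁; inj₂; [_,_]′)
open import Data.Unit using (⊤; tt)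
open import Relation.Nullary using (¬_; Dec; yes; no)
open import Relation.Binary.PropositionalEquality using (_≡_; _≢_; refl; sym; trans; cong; cong₂; subst; subst₂; ≢-sym; module ≡-Reasoning)
open import Relation.Binary.Definitions using (tri<; tri≈; tri>)

-- The obstacle is that both algorithms are nonlocal: a cross-bump-swap continues at a distant
-- crossing, and the last bump becomes a cross only because two pipes meet nowhere else. With pipes
-- named by exit row this becomes local: between a bump and the later crossing two pipes have merely
-- traded names, so the state `wait q z` is carried down until they meet; if they never do, the bump
-- was the final cross. The descents of the permutation enter through two properties of rows. Pipes
-- named below `l` leave before the first descent is passed, so they never cross, and this decides
-- at each bump whether right insertion hands over or trades names. After row `k`, which is at least
-- the last descent, only the pipe leaving in a row turns and no column to its left is free; so left
-- insertion stops as soon as it lands there. The two orders may move different pipes at the same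
-- height; `Sq` lists the ways in which this happens, a list closed under one row of both
-- algorithms. What remains are difference constraints between a few columns and names, settled by
-- stored refutations that the type checker evaluates.

-- Difference logic over ℕ.  The term i ⊕ n denotes n + (i-th entry of the
-- environment), entries being counted from 1; entry 0 is the constant 0.
record Lin : Set where
 constructor _⊕_
 field
  idx off : ℕ

infix 40 _⊕_
infix 30 _<=_ _<<_ _==_ _/=_
infixr 25 _&_
infixr 24 _||_

data Fm : Set where
 _<=_ _==_ _/=_ : Lin -> Lin -> Fm
 _&_ _||_ : Fm -> Fm -> Fm
 ⊥' : Fm

_<<_ : Lin -> Lin -> Fm
(i ⊕ a) << s = (i ⊕ suc a) <= s

Env : Set
Env = List ℕ

entry : Env -> ℕ -> ℕ
entry ρ zero = 0
entry [] (suc i) = 0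
entry (a ∷ ρ) (suc zero) = a
entry (a ∷ ρ) (suc (suc i)) = entry ρ (suc i)

Tuple : ℕ -> Set
Tuple zero = ⊤
Tuple (suc zero) = ℕ
Tuple (suc (suc n)) = ℕ × Tuple (suc n)

toEnv : ∀ n -> Tuple n -> Env
toEnv zero _ = []
toEnv (suc zero) a = a ∷ []
toEnv (suc (suc n)) (a , as) = a ∷ toEnv (suc n) as

⟦_⟧ᵗ : Lin -> Env -> ℕ
⟦ i ⊕ n ⟧ᵗ ρ = n + entry ρ i

⟦_⟧ : Fm -> Env -> Set
⟦ s <= t ⟧ ρ = ⟦ s ⟧ᵗ ρ ≤ ⟦ t ⟧ᵗ ρ
⟦ s == t ⟧ ρ = ⟦ s ⟧ᵗ ρ ≡ ⟦ t ⟧ᵗ ρ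
⟦ s /= t ⟧ ρ = ⟦ s ⟧ᵗ ρ ≢ ⟦ t ⟧ᵗ ρ
⟦ f & g ⟧ ρ = ⟦ f ⟧ ρ × ⟦ g ⟧ ρ
⟦ f || g ⟧ ρ = ⟦ f ⟧ ρ ⊎ ⟦ g ⟧ ρ
⟦ ⊥' ⟧ ρ = ⊥

⟦_⟧* : List Fm -> Env -> Set
⟦ [] ⟧* ρ = ⊤
⟦ f ∷ fs ⟧* ρ = ⟦ f ⟧ ρ × ⟦ fs ⟧* ρ

-- A refutation splits disjunctions of the context Γ (entries counted from the
-- most recent one) and closes each branch by a cycle of inequalities of
-- positive weight.
data Refutation : Set where
 cycle : List ℕ -> Refutation
 split : ℕ -> Refutation -> Refutation -> Refutation

-- Equations are stored as two inequalities, disequations as disjunctions, and conjunctions are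
-- flattened: apart from `⊥'`, a context consists of the two kinds of entries that a refutation can
-- use.
push : Fm -> List Fm -> List Fm
push (s <= t) Γ = s <= t ∷ Γ
push (s == t) Γ = t <= s ∷ s <= t ∷ Γ
push (s /= t) Γ = (s << t || t << s) ∷ Γ
push (f & g) Γ = push g (push f Γ)
push (f || g) Γ = (f || g) ∷ Γ
push ⊥' Γ = ⊥' ∷ Γ

push-sound : ∀ ρ f Γ -> ⟦ f ⟧ ρ -> ⟦ Γ ⟧* ρ -> ⟦ push f Γ ⟧* ρ
push-sound ρ (s <= t) Γ h hs = h , hs
push-sound ρ (s == t) Γ h hs = ≤-reflexive (sym h) , ≤-reflexive h , hs
push-sound ρ (s /= t) Γ h hs with <-cmp (⟦ s ⟧ᵗ ρ) (⟦ t ⟧ᵗ ρ)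
... | tri< a _ _ = inj₁ a , hs
... | tri≈ _ e _ = ⊥-elim (h e)
... | tri> _ _ c = inj₂ c , hs
push-sound ρ (f & g) Γ (h , h') hs = push-sound ρ g (push f Γ) h' (push-sound ρ f Γ h hs)
push-sound ρ (f || g) Γ h hs = h , hs

nth : List Fm -> ℕ -> Fm
-- The default is a true formula, so soundness needs no bound on the index.
nth [] i = 0 ⊕ 0 <= 0 ⊕ 0
nth (f ∷ Γ) zero = f
nth (f ∷ Γ) (suc i) = nth Γ i

nth-sound : ∀ ρ Γ i -> ⟦ Γ ⟧* ρ -> ⟦ nth Γ i ⟧ ρ
nth-sound ρ [] i hs = z≤n
nth-sound ρ (f ∷ Γ) zero (h , hs) = h
nth-sound ρ (f ∷ Γ) (suc i) (h , hs) = nth-sound ρ Γ i hs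

-- An inequality `i ⊕ a <= k ⊕ b` is chained with the listed entries by adding offsets on both
-- sides. Once it has returned to its first atom, that atom cancels and `b < a` is the
-- contradiction.
closes : List Fm -> Lin -> Lin -> List ℕ -> Bool
closes Γ (i ⊕ a) (j ⊕ b) [] = (i ≡ᵇ j) ∧ (b <ᵇ a)
closes Γ (i ⊕ a) (k ⊕ b) (n ∷ ns) with nth Γ n
... | (k' ⊕ c) <= (j ⊕ d) = (k ≡ᵇ k') ∧ closes Γ (i ⊕ (c + a)) (j ⊕ (b + d)) ns
... | _ = false

≡ᵇ-true : ∀ {i j} -> (i ≡ᵇ j) ≡ true -> i ≡ j
≡ᵇ-true {i} {j} e = ≡ᵇ⇒≡ i j (subst Bool.T (sym e) tt)

∧-true : ∀ {a b} -> a ∧ b ≡ true -> a ≡ true × b ≡ true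
∧-true {true} {true} eq = refl , refl

closes-sound : ∀ ρ Γ s t ns -> ⟦ Γ ⟧* ρ -> ⟦ s ⟧ᵗ ρ ≤ ⟦ t ⟧ᵗ ρ -> closes Γ s t ns ≡ true -> ⊥
closes-sound ρ Γ (i ⊕ a) (j ⊕ b) [] hs h eq with ∧-true {i ≡ᵇ j} eq
... | e , e' with refl ← ≡ᵇ-true {i} e =
 <⇒≱ (<ᵇ⇒< b a (subst Bool.T (sym e') tt)) (+-cancelʳ-≤ (entry ρ i) a b h)
closes-sound ρ Γ (i ⊕ a) (k ⊕ b) (n ∷ ns) hs h eq with nth Γ n | nth-sound ρ Γ n hs
... | (k' ⊕ c) <= (j ⊕ d) | h' with ∧-true {k ≡ᵇ k'} eq
... | e , e' with refl ← ≡ᵇ-true {k} e = closes-sound ρ Γ (i ⊕ (c + a)) (j ⊕ (b + d)) ns hs (begin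
  c + a + entry ρ i     ≡⟨ +-assoc c a _ ⟩
  c + (a + entry ρ i)   ≤⟨ +-monoʳ-≤ c h ⟩
  c + (b + entry ρ k)   ≡⟨ trans (sym (+-assoc c b _)) (trans (cong (_+ entry ρ k) (+-comm c b)) (+-assoc b c _)) ⟩
  b + (c + entry ρ k)   ≤⟨ +-monoʳ-≤ b h' ⟩
  b + (d + entry ρ j)   ≡⟨ sym (+-assoc b d _) ⟩
  b + d + entry ρ j     ∎) e'
 where open ≤-Reasoning

check : List Fm -> Refutation -> Bool
check Γ (cycle []) = false
check Γ (cycle (n ∷ ns)) with nth Γ n
... | s <= t = closes Γ s t ns
... | _ = false
check Γ (split n c d) with nth Γ n
... | f || g = check (push f Γ) c ∧ check (push g Γ) d
... | _ = false

check-sound : ∀ ρ Γ c -> check Γ c ≡ true -> ⟦ Γ ⟧* ρ -> ⊥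
check-sound ρ Γ (cycle (n ∷ ns)) eq hs with nth Γ n | nth-sound ρ Γ n hs
... | s <= t | h = closes-sound ρ Γ s t ns hs h eq
check-sound ρ Γ (split n c d) eq hs with nth Γ n | nth-sound ρ Γ n hs
... | f || g | inj₁ h = check-sound ρ (push f Γ) c (proj₁ (∧-true eq)) (push-sound ρ f Γ h hs)
... | f || g | inj₂ h = check-sound ρ (push g Γ) d (proj₂ (∧-true {check (push f Γ) c} eq)) (push-sound ρ g Γ h hs)

negate : Fm -> Fm
negate (s <= t) = t << s
negate (s == t) = s /= t
negate (s /= t) = s == t
negate (f & g) = negate f || negate g
negate (f || g) = negate f & negate g
negate ⊥' = 0 ⊕ 0 <= 0 ⊕ 0

-- Formulas are decidable, so a goal may be proved by refuting its negation.
decide : ∀ ρ f -> ⟦ f ⟧ ρ ⊎ ⟦ negate f ⟧ ρ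
decide ρ (s <= t) with ⟦ s ⟧ᵗ ρ ≤? ⟦ t ⟧ᵗ ρ
... | yes p = inj₁ p
... | no p = inj₂ (≰⇒> p)
decide ρ (s == t) with ⟦ s ⟧ᵗ ρ ≟ ⟦ t ⟧ᵗ ρ
... | yes p = inj₁ p
... | no p = inj₂ p
decide ρ (s /= t) with ⟦ s ⟧ᵗ ρ ≟ ⟦ t ⟧ᵗ ρ
... | yes p = inj₂ p
... | no p = inj₁ p
decide ρ (f & g) with decide ρ f | decide ρ g
... | inj₁ p | inj₁ q = inj₁ (p , q)
... | inj₂ p | _ = inj₂ (inj₁ p)
... | inj₁ _ | inj₂ q = inj₂ (inj₂ q)
decide ρ (f || g) with decide ρ f | decide ρ g
... | inj₁ p | _ = inj₁ (inj₁ p)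
... | inj₂ _ | inj₁ q = inj₁ (inj₂ q)
... | inj₂ p | inj₂ q = inj₂ (p , q)
decide ρ ⊥' = inj₂ z≤n

-- Unfolds definitionally to `Apart` below, so that proofs of `Apart` can be passed to `lia` as they
-- are.
apart' : (l p q tp bp tq bq : Lin) -> Fm
apart' l p q tp bp tq bq =
 tp << bq & (p << q || l <= p) || tq << bp & (q << p || l <= q) ||
 p << q & l <= q & bq << tp & tp << tq & bp == tp ||
 q << p & l <= p & bp << tq & tq << tp & bq == tq

-- A sequent is written as a string: letters name the atoms in order (` is the
-- constant 0), a digit before a letter is an offset, - is ≤, & and | are postfix, @
-- stands for apart' of the preceding seven letters, and the semicolon is the turnstile.
-- The characters 0–9, a–z, A–Z after the blank are the digits of a refutation: a
-- positive n announces a cycle through the entries given by the next n digits, and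
-- 0 a split of the next entry.
data Token : Set where
 ≤ᵗ <ᵗ =ᵗ ≠ᵗ andᵗ orᵗ apartᵗ endᵗ : Token
 digit letter : ℕ -> Token

token : Char -> Token
token c = if isDigit c then digit (toℕ c ∸ 48) else code (toℕ c)
 where
 code : ℕ -> Token
 code n = if n ≡ᵇ 45 then ≤ᵗ else if n ≡ᵇ 60 then <ᵗ else if n ≡ᵇ 61 then =ᵗ else if n ≡ᵇ 8800 then ≠ᵗ else if n ≡ᵇ 38 then andᵗ
  else if n ≡ᵇ 124 then orᵗ else if n ≡ᵇ 64 then apartᵗ else if (n ≡ᵇ 59) ∨ (n ≡ᵇ 32) then endᵗ else letter (n ∸ 96)

formulas : List Char -> ℕ -> List Lin -> Maybe (Lin -> Fm) -> List Fm -> List Fm × List Char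
formulas [] _ _ _ fs = fs , []
formulas (c ∷ cs) o ss r fs with token c
formulas (c ∷ cs) o (s ∷ ss) r fs | ≤ᵗ = formulas cs 0 ss (just (s <=_)) fs
formulas (c ∷ cs) o (s ∷ ss) r fs | <ᵗ = formulas cs 0 ss (just (s <<_)) fs
formulas (c ∷ cs) o (s ∷ ss) r fs | =ᵗ = formulas cs 0 ss (just (s ==_)) fs
formulas (c ∷ cs) o (s ∷ ss) r fs | ≠ᵗ = formulas cs 0 ss (just (s /=_)) fs
formulas (c ∷ cs) o ss r (g ∷ f ∷ fs) | andᵗ = formulas cs 0 ss r (f & g ∷ fs)
formulas (c ∷ cs) o ss r (g ∷ f ∷ fs) | orᵗ = formulas cs 0 ss r ((f || g) ∷ fs)
formulas (c ∷ cs) o (bq ∷ tq ∷ bp ∷ tp ∷ q ∷ p ∷ l ∷ ss) r fs | apartᵗ = formulas cs 0 ss r (apart' l p q tp bp tq bq ∷ fs)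
formulas (c ∷ cs) o ss r fs | digit d = formulas cs d ss r fs
formulas (c ∷ cs) o ss nothing fs | letter n = formulas cs 0 (n ⊕ o ∷ ss) nothing fs
formulas (c ∷ cs) o ss (just R) fs | letter n = formulas cs 0 ss nothing (R (n ⊕ o) ∷ fs)
formulas (c ∷ cs) o ss r fs | _ = fs , cs

value : Char -> ℕ
value c = if isDigit c then toℕ c ∸ 48 else if isLower c then toℕ c ∸ 87 else toℕ c ∸ 29

entries : ℕ -> List Char -> List ℕ × List Char
entries (suc k) (c ∷ cs) with entries k cs
... | ns , cs' = value c ∷ ns , cs'
entries _ cs = [] , cs

refutation : ℕ -> List Char -> Refutation × List Char
refutation (suc f) (c ∷ d ∷ cs) with value c
... | suc k with entries (suc k) (d ∷ cs)
... | ns , cs' = cycle ns , cs'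
refutation (suc f) (c ∷ d ∷ cs) | zero with refutation f cs
... | l , cs' with refutation f cs'
... | r , cs'' = split (value d) l r , cs''
refutation _ cs = cycle [] , cs

-- The stack has the last formula on top; nesting to the right makes the meaning of the hypotheses
-- the type of an ordinary tuple.
conj : List Fm -> Fm -> Fm
conj [] g = g
conj (f ∷ fs) g = conj fs (f & g)

unstack : List Fm -> (List Fm -> Fm -> Fm) -> Fm
unstack [] k = ⊥'
unstack (f ∷ fs) k = k fs f

module Sequent (s : String) where
 hyps-rest = formulas (toList s) 0 [] nothing []
 goal-rest = formulas (proj₂ hyps-rest) 0 [] nothing []
 hyp = unstack (proj₁ hyps-rest) conj
 goal = unstack (proj₁ goal-rest) conj
 -- The number bounds the nesting of splits; too small a bound could only make the check fail.
 certificate = proj₁ (refutation 100 (proj₂ goal-rest))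

atom-count : List Char -> ℕ
atom-count [] = 0
-- Scanning stops at the blank, since the refutation behind it uses letters as digits.
atom-count (c ∷ cs) = if toℕ c ≡ᵇ 32 then 0 else (if isLower c then toℕ c ∸ 96 else 0) ⊔ atom-count cs

T⇒true : ∀ {b} -> Bool.T b -> b ≡ true
T⇒true {true} _ = refl

-- The types of the hypotheses and of the result are computed from the string. The unnamed implicit
-- argument reduces to `⊤` exactly when the refutation is accepted, and is then filled in by the
-- type checker.
lia : (s : String) (as : Tuple (atom-count (toList s))) -> let open Sequent s; ρ = toEnv _ as in
 {_ : Bool.T (check (push hyp (push (negate goal) [])) certificate)} -> ⟦ hyp ⟧ ρ -> ⟦ goal ⟧ ρ
lia s as {c} p with decide (toEnv _ as) (Sequent.goal s)
... | inj₁ q = q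
... | inj₂ q = ⊥-elim (check-sound ρ _ certificate (T⇒true c) (push-sound ρ hyp _ p (push-sound ρ (negate goal) [] q tt)))
 where
 open Sequent s
 ρ = toEnv _ as

clash : {A : Set} (s : String) (as : Tuple (atom-count (toList s))) -> let open Sequent s; ρ = toEnv _ as in
 {_ : Bool.T (check (push hyp []) certificate)} -> ⟦ hyp ⟧ ρ -> A
clash s as {c} p = ⊥-elim (check-sound ρ _ certificate (T⇒true c) (push-sound ρ hyp [] p tt))
 where
 open Sequent s
 ρ = toEnv _ as

-- Pipes in a single row

-- The positions of two pipes p, q in one row of the grid.  A pipe runs in the
-- row from its column b at the bottom edge to its column t ≥ b at the top edge;
-- pipes are named by their exit row, so a pipe crossed horizontally by another
-- one has the smaller name (no two pipes cross twice).  The pipes below l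
-- never cross each other.
Apart : (l p q tp bp tq bq : ℕ) -> Set
Apart l p q tp bp tq bq =
 (tp < bq × (p < q ⊎ l ≤ p)) ⊎ (tq < bp × (q < p ⊎ l ≤ q)) ⊎
 (p < q × l ≤ q × bq < tp × tp < tq × bp ≡ tp) ⊎
 (q < p × l ≤ p × bp < tq × tq < tp × bq ≡ tq)


apart-sym : ∀ {l p q tp bp tq bq} -> Apart l p q tp bp tq bq -> Apart l q p tq bq tp bp
apart-sym (inj₁ h) = inj₂ (inj₁ h)
apart-sym (inj₂ (inj₁ h)) = inj₁ h
apart-sym (inj₂ (inj₂ (inj₁ h))) = inj₂ (inj₂ (inj₂ h))
apart-sym (inj₂ (inj₂ (inj₂ h))) = inj₂ (inj₂ (inj₁ h))

-- Pipe r leaves the grid in this row: its top column is w, standing for ∞.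
record Row (l b w r : ℕ) (T B : ℕ -> ℕ) : Set where
 field
  top  : T r ≡ w
  lo   : ∀ p -> p ≤ r -> 1 ≤ B p
  le   : ∀ p -> p ≤ r -> B p ≤ T p
  hi   : ∀ p -> p < r -> T p < w
  bd   : ∀ p -> p ≤ r -> B p ≤ b
  bw   : b < w
  pair : ∀ p q -> p ≤ r -> q ≤ r -> p ≢ q -> Apart l p q (T p) (B p) (T q) (B q)

Occ : ℕ -> (ℕ -> ℕ) -> ℕ -> Set
Occ n B j = ∃ \p -> p < n × B p ≡ j

record Gap (n : ℕ) (B : ℕ -> ℕ) (c g : ℕ) : Set where
 field
  lt   : c < g
  free : ∀ p -> p < n -> B p ≢ g
  fill : ∀ j -> c < j -> j < g -> Occ n B j

-- Pipe `m` is moved from `T m` to the next free column `g`. In the row where the move begins, the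
-- pipes it jumps over are crossed by its horizontal part, hence `low`: their names are smaller.
record LMove (w r : ℕ) (T : ℕ -> ℕ) (m g : ℕ) : Set where
 field
  m<r : m < r
  g<w : g < w
  gap : Gap r T (T m) g
  low : ∀ p -> p < r -> T p ≤ T m ⊎ g < T p ⊎ p < m

-- Right insertion starts with the pipe leaving in row `y ≤ l` and hands over only to pipes below
-- `l`, hence `red`. Such a pipe crosses no other one horizontally, which is why its droop goes just
-- one column to the right.
record RAct (l w r : ℕ) (T : ℕ -> ℕ) (q : ℕ) : Set where
 field
  red  : q < l
  q<r  : q < r
  q<w  : suc (T q) < w
  free : ∀ p -> p < r -> T p ≢ suc (T q)

-- The bump of `q` with a pipe `z` not below `l` makes the two trade places. A pipe standing between
-- them may cross the left one horizontally further down; after the trade that one is `z`, and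
-- `high` supplies the naming rule for this crossing.
record RWait (l r : ℕ) (T : ℕ -> ℕ) (q z : ℕ) : Set where
 field
  red  : q < l
  blue : l ≤ z
  z<r  : z < r
  lt   : T q < T z
  high : ∀ y -> y < r -> T y ≤ T q ⊎ T z ≤ T y ⊎ z < y

-- Pipe `m` has the leftmost r-turn weakly right of `g`. This one notion covers the first elbow of
-- the start row (`g = 0`), the elbow following a new j-elbow, and the turn inside a new bump
-- (`B m = g`).
First : (r : ℕ) (T B : ℕ -> ℕ) (g m : ℕ) -> Set
First r T B g m = m ≤ r × g ≤ B m × B m < T m ×
 (∀ z -> z ≤ r -> B z < g ⊎ T z ≤ B z ⊎ B m ≤ B z)

-- Some pipe runs horizontally across column `c`: a pipe that is vertical there sits in a cross, so
-- that its droop does not end in this row.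
Inside : (r : ℕ) (T B : ℕ -> ℕ) (c : ℕ) -> Set
Inside r T B c = ∃ \s -> s ≤ r × B s < c × c < T s

Outside : (r : ℕ) (T B : ℕ -> ℕ) (c : ℕ) -> Set
Outside r T B c = ∀ s -> s ≤ r -> c ≤ B s ⊎ T s ≤ c

pair-upd₁ : ∀ {l b w r T B} (T' B' : ℕ -> ℕ) (q : ℕ) -> Row l b w r T B ->
 (∀ p -> p ≢ q -> T' p ≡ T p) -> (∀ p -> p ≢ q -> B' p ≡ B p) ->
 (∀ p -> p ≤ r -> p ≢ q -> Apart l q p (T' q) (B' q) (T p) (B p)) ->
 ∀ p p' -> p ≤ r -> p' ≤ r -> p ≢ p' -> Apart l p p' (T' p) (B' p) (T' p') (B' p')
pair-upd₁ {l} {T = T} {B} T' B' q row eT eB new p p' p≤ p'≤ ne with p ≟ q | p' ≟ q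
... | yes refl | yes refl = ⊥-elim (ne refl)
... | yes refl | no n rewrite eT p' n | eB p' n = new p' p'≤ n
... | no n | yes refl rewrite eT p n | eB p n = apart-sym {l} {p'} {p} (new p p≤ n)
... | no n | no n' rewrite eT p n | eB p n | eT p' n' | eB p' n' = Row.pair row p p' p≤ p'≤ ne

pair-upd₂ : ∀ {l b w r T B} (T' B' : ℕ -> ℕ) (q z : ℕ) -> Row l b w r T B ->
 (∀ p -> p ≢ q -> p ≢ z -> T' p ≡ T p) -> (∀ p -> p ≢ q -> p ≢ z -> B' p ≡ B p) ->
 Apart l q z (T' q) (B' q) (T' z) (B' z) ->
 (∀ p -> p ≤ r -> p ≢ q -> p ≢ z -> Apart l q p (T' q) (B' q) (T p) (B p)) ->
 (∀ p -> p ≤ r -> p ≢ q -> p ≢ z -> Apart l z p (T' z) (B' z) (T p) (B p)) ->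
 ∀ p p' -> p ≤ r -> p' ≤ r -> p ≢ p' -> Apart l p p' (T' p) (B' p) (T' p') (B' p')
pair-upd₂ {l} T' B' q z row eT eB qz newq newz p p' p≤ p'≤ ne with p ≟ q | p ≟ z | p' ≟ q | p' ≟ z
... | yes refl | _ | yes refl | _ = ⊥-elim (ne refl)
... | yes refl | _ | no _ | yes refl = qz
... | yes refl | _ | no n | no n' rewrite eT p' n n' | eB p' n n' = newq p' p'≤ n n'
... | no _ | yes refl | yes refl | _ = apart-sym {l} {p'} {p} qz
... | no _ | yes refl | no _ | yes refl = ⊥-elim (ne refl)
... | no _ | yes refl | no n | no n' rewrite eT p' n n' | eB p' n n' = newz p' p'≤ n n'
... | no n | no n' | yes refl | _ rewrite eT p n n' | eB p n n' = apart-sym {l} {p'} {p} (newq p p≤ n n')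
... | no n | no n' | no _ | yes refl rewrite eT p n n' | eB p n n' = apart-sym {l} {p'} {p} (newz p p≤ n n')
... | no n | no n' | no o | no o' rewrite eT p n n' | eB p n n' | eT p' o o' | eB p' o o' = Row.pair row p p' p≤ p'≤ ne

module RowFacts {l b w r T B} (row : Row l b w r T B) where
 open Row row public

 inj-B : ∀ p q -> p ≤ r -> q ≤ r -> B p ≡ B q -> p ≡ q
 inj-B p q p≤ q≤ e with p ≟ q
 ... | yes eq = eq
 ... | no ne = lia "c-de-fc=egabdcfe@;a=b 003613003615003a303930" (p , q , B p , T p , B q , T q , l) (le p p≤ , le q q≤ , e , pair p q p≤ q≤ ne)

 inj-T : ∀ p q -> p ≤ r -> q ≤ r -> T p ≡ T q -> p ≡ q
 inj-T p q p≤ q≤ e with p ≟ q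
 ... | yes eq = eq
 ... | no ne = lia "c-de-fd=fgabdcfe@;a=b 003531003751002922a2" (p , q , B p , T p , B q , T q , l) (le p p≤ , le q q≤ , e , pair p q p≤ q≤ ne)

 -- The pipe leaving in this row always turns in it: `B r ≤ b < w = T r`.
 r-hop = lia "c<da-cb=d;a<b 43042" (B r , T r , b , w) (bw , bd r ≤-refl , top)

-- Right insertion

data RState : Set where
 none : RState
 act  : ℕ -> RState
 wait : ℕ -> ℕ -> RState

-- In row `y` the rightmost r-elbow is that of the pipe leaving there (`rs`). In `ra` either `q` is
-- crossed and its droop goes on, or it lands in a j-elbow and the next elbow to the left is again
-- that of `q`. In `rb` and `rc` it lands in a bump with `z`: two pipes below `l` do not cross, so
-- `z` takes over; any other `z` trades places with `q`. The row of `wx` is where `q` and `z` cross,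
-- the target of the cross-bump-swap, from which `q` moves on; if there is none, `ww` goes on
-- forever and the bump was the final cross.
data RStep (l y r : ℕ) (T B : ℕ -> ℕ) : RState -> RState -> Set where
 rn : suc r ≢ y -> RStep l y r T B none none
 rs : suc r ≡ y -> RStep l y r T B none (act r)
 ra : ∀ {q} -> (∀ z -> z ≤ r -> B z ≢ suc (T q)) -> RStep l y r T B (act q) (act q)
 rb : ∀ {q} z -> z ≤ r -> B z ≡ suc (T q) -> z < l -> RStep l y r T B (act q) (act z)
 rc : ∀ {q} z -> z ≤ r -> B z ≡ suc (T q) -> l ≤ z -> RStep l y r T B (act q) (wait q z)
 wx : ∀ {q z} -> B z < B q -> RStep l y r T B (wait q z) (act q)
 ww : ∀ {q z} -> B q < B z -> RStep l y r T B (wait q z) (wait q z)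

data RMoved (T T' : ℕ -> ℕ) : RState -> Set where
 mnone : (∀ p -> T' p ≡ T p) -> RMoved T T' none
 mact  : ∀ {q} -> T' q ≡ suc (T q) -> (∀ p -> p ≢ q -> T' p ≡ T p) -> RMoved T T' (act q)
 mwait : ∀ {q z} -> T' q ≡ T z -> T' z ≡ T q -> (∀ p -> p ≢ q -> p ≢ z -> T' p ≡ T p) ->
  RMoved T T' (wait q z)

RValid : (l w r : ℕ) (T : ℕ -> ℕ) -> RState -> Set
RValid l w r T none = ⊤
RValid l w r T (act q) = RAct l w r T q
RValid l w r T (wait q z) = RWait l r T q z

module ActFacts {l b w r T B} (row : Row l b w r T B) {q} (a : RAct l w r T q) where
 open RowFacts row
 open RAct a

 free≤ : ∀ p -> p ≤ r -> T p ≢ suc (T q)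
 free≤ p p≤ e with p ≟ r
 ... | yes refl = clash "a=b1c<ba=1c; 3312" (T p , w , T q) (top , q<w , e)
 ... | no n = free p (≤∧≢⇒< p≤ n) e

 q≤ : q ≤ r
 q≤ = <⇒≤ q<r

module WaitFacts {l b w r T B} (row : Row l b w r T B) {q z} (a : RWait l r T q z) where
 open RowFacts row
 open RWait a

 z≤ : z ≤ r
 z≤ = <⇒≤ z<r
 q≤ = lia "a<cc-dd<b;a-b 43210" (q , r , l , z) (red , blue , z<r)
 q≢z = lia "a<cc-b;a≠b 3210" (q , z , l) (red , blue)

module _ {l b w r T B} (row : Row l b w r T B) (T' B' : ℕ -> ℕ) (bw' : suc b < w) where
 open RowFacts row

 -- This and the following lemmas propagate two things at once: the new state is admissible at the
 -- bottom edge, and the moved pipes form a `Row` again, so that the other insertion can be run on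
 -- them.
 ra-valid : ∀ {q} -> RAct l w r T q -> (∀ z -> z ≤ r -> B z ≢ suc (T q)) ->
  T' q ≡ suc (T q) -> (∀ p -> p ≢ q -> T' p ≡ T p) ->
  B' q ≡ suc (B q) -> (∀ p -> p ≢ q -> B' p ≡ B p) ->
  RAct l (suc w) (suc r) B q × Row l (suc b) w r T' B'
 ra-valid {q} a nb eq₁ eT eq₂ eB = record
   { red = red ; q<r = (lia "a<b;a<1b 210" (q , r) q<r) ; q<w = (lia "1c<ba-c;1a<1b 3201" (B q , w , T q) (q<w , le q q≤)) ; free = \p p< e -> free' p (≤-pred p<) e }
  , record
   { top = trans (eT r (\{ refl -> <-irrefl refl q<r })) top
   ; lo = lo' ; le = le' ; hi = hi' ; bd = bd' ; bw = bw'
   ; pair = pair-upd₁ T' B' q row eT eB new }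
  where
  open RAct a
  open ActFacts row a
  free' : ∀ p -> p ≤ r -> B p ≢ suc (B q)
  free' p p≤ e with p ≟ q
  ... | yes refl = clash "a=1a; 10" (B p) e
  ... | no ne = clash "a<bc-de-fe=1ce≠1dbagdcfe@; 010145216003816003b302f43604" (q , l , B q , T q , B p , T p , p) (red , le q q≤ , le p p≤ , e , nb p p≤ , pair q p q≤ p≤ (≢-sym ne))
  lo' : ∀ p -> p ≤ r -> 1 ≤ B' p
  lo' p p≤ with p ≟ q
  ... | yes refl = lia "`-ba=1b;`<a 3320" (B' p , B p) (z≤n , eq₂)
  ... | no ne = lia "`<ba=b;`<a 3320" (B' p , B p) (lo p p≤ , eB p ne)
  le' : ∀ p -> p ≤ r -> B' p ≤ T' p
  le' p p≤ with p ≟ q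
  ... | yes refl = lia "c-da=1cb=1d;a-b 44053" (B' p , T' p , B p , T p) (le p p≤ , eq₂ , eq₁)
  ... | no ne = lia "c-da=cb=d;a-b 44053" (B' p , T' p , B p , T p) (le p p≤ , eB p ne , eT p ne)
  hi' : ∀ p -> p < r -> T' p < w
  hi' p p< with p ≟ q
  ... | yes refl = lia "1c<ba=1c;a<b 3312" (T' p , w , T p) (q<w , eq₁)
  ... | no ne = lia "c<ba=c;a<b 3312" (T' p , w , T p) (hi p p< , eT p ne)
  bd' : ∀ p -> p ≤ r -> B' p ≤ suc b
  bd' p p≤ with p ≟ q
  ... | yes refl = lia "c-ba=1c;a-1b 3312" (B' p , b , B p) (bd p p≤ , eq₂)
  ... | no ne = lia "c-ba=c;a-1b 3312" (B' p , b , B p) (bd p p≤ , eB p ne)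
  new : ∀ p -> p ≤ r -> p ≢ q -> Apart l q p (T' q) (B' q) (T p) (B p)
  new p p≤ ne = lia "c<eg=1ha=1ib≠1if≠1iecdihfb@;ecdagfb@ 0b030248127000f3b0202220210000j26000260003g060e4i60h013j10004l0k64j0m72h436010c03002502d0003b31002a52i404002602e000002503f07002b5295" (T' q , B p , q , p , l , T p , B' q , B q , T q) (red , eq₂ , eq₁ , nb p p≤ , free≤ p p≤ , pair q p q≤ p≤ (≢-sym ne))

 -- Common to all cases in which two pipes change. Pipe `z` may be the one leaving in this row,
 -- whence the two assumptions on its top column.
 module Two {q z} (q≢z : q ≢ z) (q< : q < r) (z≤ : z ≤ r)
  (eT : ∀ p -> p ≢ q -> p ≢ z -> T' p ≡ T p) (eB : ∀ p -> p ≢ q -> p ≢ z -> B' p ≡ B p)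
  (tz : z ≢ r -> T' z < w) (tr : z ≡ r -> T' z ≡ w) (tq : T' q < w)
  (loq : 1 ≤ B' q) (loz : 1 ≤ B' z) (leq : B' q ≤ T' q) (lez : B' z ≤ T' z)
  (bdq : B' q ≤ suc b) (bdz : B' z ≤ suc b)
  (qz : Apart l q z (T' q) (B' q) (T' z) (B' z))
  (newq : ∀ p -> p ≤ r -> p ≢ q -> p ≢ z -> Apart l q p (T' q) (B' q) (T p) (B p))
  (newz : ∀ p -> p ≤ r -> p ≢ q -> p ≢ z -> Apart l z p (T' z) (B' z) (T p) (B p)) where

  two-row : Row l (suc b) w r T' B'
  two-row = record
   { top = top' ; lo = lo' ; le = le' ; hi = hi' ; bd = bd' ; bw = bw'
   ; pair = pair-upd₂ T' B' q z row eT eB qz newq newz }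
   where
   top' : T' r ≡ w
   top' with r ≟ z
   ... | yes e = subst (\y -> T' y ≡ w) (sym e) (tr (sym e))
   ... | no n = trans (eT r (\{ refl -> <-irrefl refl q< }) n) top
   lo' : ∀ p -> p ≤ r -> 1 ≤ B' p
   lo' p p≤ with p ≟ q | p ≟ z
   ... | yes refl | _ = loq
   ... | no _ | yes refl = loz
   ... | no n | no n' = subst (1 ≤_) (sym (eB p n n')) (lo p p≤)
   le' : ∀ p -> p ≤ r -> B' p ≤ T' p
   le' p p≤ with p ≟ q | p ≟ z
   ... | yes refl | _ = leq
   ... | no _ | yes refl = lez
   ... | no n | no n' = lia "c-da=cb=d;a-b 44053" (B' p , T' p , B p , T p) (le p p≤ , eB p n n' , eT p n n')
   hi' : ∀ p -> p < r -> T' p < w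
   hi' p p< with p ≟ q | p ≟ z
   ... | yes refl | _ = tq
   ... | no _ | yes refl = tz (\{ refl -> <-irrefl refl p< })
   ... | no n | no n' = lia "c<ba=c;a<b 3312" (T' p , w , T p) (hi p p< , eT p n n')
   bd' : ∀ p -> p ≤ r -> B' p ≤ suc b
   bd' p p≤ with p ≟ q | p ≟ z
   ... | yes refl | _ = bdq
   ... | no _ | yes refl = bdz
   ... | no n | no n' = lia "c-ba=c;a-1b 3312" (B' p , b , B p) (bd p p≤ , eB p n n')

 rb-valid : ∀ {q z} -> RAct l w r T q -> z ≤ r -> B z ≡ suc (T q) -> z < l ->
  T' q ≡ suc (T q) -> (∀ p -> p ≢ q -> T' p ≡ T p) ->
  B' z ≡ suc (B z) -> (∀ p -> p ≢ z -> B' p ≡ B p) ->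
  RAct l (suc w) (suc r) B z × Row l (suc b) w r T' B'
 rb-valid {q} {z} a z≤ bz redz eq₁ eT eq₂ eB = record
   { red = redz ; q<r = s≤s z≤ ; q<w = (lia "1c<ba-c;1a<1b 3201" (B z , w , b) (bw' , bd z z≤)) ; free = \p p< e -> free' p (≤-pred p<) e }
  , Two.two-row q≢z q<r z≤ (\p n _ -> eT p n) (\p _ n -> eB p n)
    (\n -> (lia "c<ba=c;a<b 3312" (T' z , w , T z) (hi z (≤∧≢⇒< z≤ n) , tz))) (\{ refl -> trans tz top }) (lia "1c<ba=1c;a<b 3312" (T' q , w , T q) (q<w , eq₁))
    (lia "`<ba=b;`<a 3320" (B' q , B q) (lo q q≤ , bq)) (lia "`-ba=1b;`<a 3320" (B' z , B z) (z≤n , eq₂)) (lia "c-da=cb=1d;a-b 44053" (B' q , T' q , B q , T q) (le q q≤ , bq , eq₁)) (lia "c-dc=1eb=da=1cd≠1e;a-b 003806570493" (B' z , T' z , B z , T z , T q) (le z z≤ , bz , tz , eq₂ , free≤ z z≤))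
    (lia "c-ba=c;a-1b 3312" (B' q , b , B q) (bd q q≤ , bq)) (lia "c-ba=1c;a-1b 3312" (B' z , b , B z) (bd z z≤ , eq₂))
    (lia "h=1if=jg=kb=1ha=1iecdikjh@;ecdagfb@ 0e4a4030f0300250240004e1b3002a529404002604650400002503760002b5295" (T' q , B' z , q , z , l , T' z , B' q , B z , T q , T z , B q) (bz , tz , bq , eq₂ , eq₁ , pq)) newq newz
  where
  open RAct a
  open ActFacts row a
  q≢z : q ≢ z
  q≢z refl = clash "a-ba=1b; 220" (B q , T q) (le q q≤ , bz)
  tz : T' z ≡ T z
  tz = eT z (≢-sym q≢z)
  bq : B' q ≡ B q
  bq = eB q q≢z
  pq : Apart l q z (T q) (B q) (T z) (B z)
  pq = pair q z q≤ z≤ q≢z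
  free' : ∀ p -> p ≤ r -> B p ≢ suc (B z)
  free' p p≤ e with p ≟ z
  ... | yes refl = clash "a=1a; 10" (B p) e
  ... | no ne = clash "a<bc-de-fe=1cc=1gd≠1gbhafedc@; 0138030139170047319002h43d30" (z , l , B z , T z , B p , T p , T q , p) (redz , le z z≤ , le p p≤ , e , bz , free≤ z z≤ , pair p z p≤ z≤ ne)
  newq : ∀ p -> p ≤ r -> p ≢ q -> p ≢ z -> Apart l q p (T' q) (B' q) (T p) (B p)
  newq p p≤ n n' = lia "h-ib-fh=1jg=ka=1ji≠1jedcfbjk@edlfbih@;ecdagfb@ 023b080f0f043a2100064h1g3006h817dg005cil303md0000m26000260005n0k63005ni06m002502p00b5341l2005md16l004bq303ri0050024023000074i1h3006i918eh005djm302b4002952840g053b210000260250002942a506002403650000027047605002952b5" (T' q , B p , q , p , l , T p , B' q , B z , T z , T q , B q , z) (le z z≤ , le p p≤ , bz , bq , eq₁ , free≤ z z≤ , pair p q p≤ q≤ n , pair p z p≤ z≤ n')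
  newz : ∀ p -> p ≤ r -> p ≢ q -> p ≢ z -> Apart l z p (T' z) (B' z) (T p) (B p)
  newz p p≤ n n' = lia "c<eh=1ia=jg=1hj≠1iedcfbjh@;ecdagfb@ 0c0c025a621b003a14002i40b5g0h2f3i010300240230003b15002952840d035b721c00002602f0002j42a504002403f0600002702g0002952b5" (T' z , B p , z , p , l , T p , B' z , B z , T q , T z) (redz , bz , tz , eq₂ , free≤ z z≤ , pair p z p≤ z≤ n')

 rc-valid : ∀ {q z} -> RAct l w r T q -> z ≤ r -> B z ≡ suc (T q) -> l ≤ z ->
  T' q ≡ suc (T q) -> (∀ p -> p ≢ q -> T' p ≡ T p) ->
  B' q ≡ B z -> B' z ≡ B q -> (∀ p -> p ≢ q -> p ≢ z -> B' p ≡ B p) ->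
  RWait l (suc r) B q z × Row l (suc b) w r T' B'
 rc-valid {q} {z} a z≤ bz bluez eq₁ eT eq₂ eq₃ eB = record
   { red = red ; blue = bluez ; z<r = s≤s z≤ ; lt = (lia "a-cb=1c;a<b 3320" (B q , B z , T q) (le q q≤ , bz)) ; high = \y y< -> high y (≤-pred y<) }
  , Two.two-row q≢z q<r z≤ (\p n _ -> eT p n) eB
    (\n -> (lia "c<ba=c;a<b 3312" (T' z , w , T z) (hi z (≤∧≢⇒< z≤ n) , tz))) (\{ refl -> trans tz top }) (lia "1c<ba=1c;a<b 3312" (T' q , w , T q) (q<w , eq₁))
    (lia "`<ba=b;`<a 3320" (B' q , B z) (lo z z≤ , eq₂)) (lia "`<ba=b;`<a 3320" (B' z , B q) (lo q q≤ , eq₃)) (lia "c=1da=cb=1d;a-b 45063" (B' q , T' q , B z , T q) (bz , eq₂ , eq₁)) (lia "c-de-fc=1fb=da=e;a-b 6816472" (B' z , T' z , B z , T z , B q , T q) (le z z≤ , le q q≤ , bz , tz , eq₃))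
    (lia "c-ba=c;a-1b 3312" (B' q , b , B z) (bd z z≤ , eq₂)) (lia "c-ba=c;a-1b 3312" (B' z , b , B q) (bd q q≤ , eq₃))
    (lia "c<ee-dh-ij=1if=kb=hg=ja=1ik≠1i;ecdagfb@ 0g0g3fe0002f0004f50a045d0e84014d081004ga094h80b2e0" (T' q , B' z , q , z , l , T' z , B' q , B q , T q , B z , T z) (red , bluez , le q q≤ , bz , tz , eq₃ , eq₂ , eq₁ , free≤ z z≤)) newq newz
  where
  open RAct a
  open ActFacts row a
  q≢z : q ≢ z
  q≢z refl = clash "a-ba=1b; 220" (B q , T q) (le q q≤ , bz)
  tz : T' z ≡ T z
  tz = eT z (≢-sym q≢z)
  pq : Apart l q z (T q) (B q) (T z) (B z)
  pq = pair q z q≤ z≤ q≢z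
  -- No pipe is strictly between: starting there, it would be crossed horizontally by `q`, which is
  -- below `l`.
  high : ∀ y -> y ≤ r -> B y ≤ B q ⊎ B z ≤ B y ⊎ z < y
  high y y≤ with y ≟ q
  ... | yes refl = inj₁ ≤-refl
  ... | no n = lia "f<ga-hc=1igefhaib@;a-bc-ad<e|| 003951003951002c43f30" (B y , B q , B z , z , y , q , l , T y , T q) (red , le y y≤ , bz , pair y q y≤ q≤ n)
  newq : ∀ p -> p ≤ r -> p ≢ q -> p ≢ z -> Apart l q p (T' q) (B' q) (T p) (B p)
  newq p p≤ n n' = lia "h-ib-fj-kh=1kg=ha=1kedcfbkj@edlfbih@;ecdagfb@ 0e0e035ca821035b931c005g159c005aeh30084k152004os920u260002d0005tn063007uswd0p4006vtr0q56vp0su5040024023000064h1f3005j18cf005dhk302b4002952840f045db9210000260250002942a505002403650000027047605002952b5" (T' q , B p , q , p , l , T p , B' q , B z , T z , B q , T q , z) (le z z≤ , le p p≤ , le q q≤ , bz , eq₂ , eq₁ , pair p q p≤ q≤ n , pair p z p≤ z≤ n')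
  newz : ∀ p -> p ≤ r -> p ≢ q -> p ≢ z -> Apart l z p (T' z) (B' z) (T p) (B p)
  newz p p≤ n n' = lia "h<eb-fi-jk=1ja=lg=il≠1jedhfbji@edcfblk@;ecdagfb@ 0f0f03372100074c025064i1g4003f18000q26000260007r0lqo63003n06002502t05k0m8j002l40a5l41k2003j1c004bp300k5p0q2o5s01r905050007002803l03003g19002d53q48240006f16d3e002n4294050007002803l03007g1k5j6f002d53q4824000074j1h3003g19002d52c4002n42940g04382100064i1g30000290280002c42d5002m43a94050007002703l0300002a04m084002c52e5365000074j1h300002a04a908002c52e5002n43ba4" (T' z , B p , z , p , l , T p , B' z , q , B q , T q , B z , T z) (red , le p p≤ , le q q≤ , bz , tz , eq₃ , free≤ z z≤ , pair p q p≤ q≤ n , pair p z p≤ z≤ n')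

 wx-valid : ∀ {q z} -> RWait l r T q z -> B z < B q ->
  T' q ≡ T z -> T' z ≡ T q -> (∀ p -> p ≢ q -> p ≢ z -> T' p ≡ T p) ->
  B' q ≡ suc (B q) -> (∀ p -> p ≢ q -> B' p ≡ B p) ->
  RAct l (suc w) (suc r) B q × Row l (suc b) w r T' B'
 wx-valid {q} {z} a lt' eq₁ eq₂ eT eq₃ eB = record
   { red = red ; q<r = s≤s q≤ ; q<w = (lia "1c<ba-c;1a<1b 3201" (B q , w , b) (bw' , bd q q≤)) ; free = \p p< e -> free' p (≤-pred p<) e }
  , Two.two-row q≢z q<r z≤ eT (\p n _ -> eB p n)
    (\n -> (lia "c<ba=c;a<b 3312" (T' z , w , T q) (hi q q<r , eq₂))) (\{ refl -> ⊥-elim (<-irrefl refl z<r) }) (lia "c<ba=c;a<b 3312" (T' q , w , T z) (hi z z<r , eq₁))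
    (lia "`-ba=1b;`<a 3320" (B' q , B q) (z≤n , eq₃)) (lia "`<ba=b;`<a 3320" (B' z , B z) (lo z z≤ , bz)) (lia "a=1cb=de<fg-fh<ii<dc=i;a-b 5a9126" (B' q , T' q , B q , T z , q , z , l , B z , T q) (eq₃ , eq₁ , pq)) (lia "c-de<ca=eb=d;a-b 550634" (B' z , T' z , B q , T q , B z) (le q q≤ , lt' , bz , eq₂))
    (lia "c-ba=1c;a-1b 3312" (B' q , b , B q) (bd q q≤ , eq₃)) (lia "c-ba=c;a-1b 3312" (B' z , b , B z) (bd z z≤ , bz))
    (lia "g=1hf=ic<de-dj<ii<kh=i;ecdagfb@ 0c49081260" (T' q , B' z , q , z , l , T' z , B' q , B q , T q , B z , T z) (eq₃ , eq₂ , pq)) newq newz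
  where
  open RWait a
  open WaitFacts row a
  q<r : q < r
  q<r = lia "a<cc-dd<b;a<b 43210" (q , r , l , z) (red , blue , z<r)
  bz : B' z ≡ B z
  bz = eB z (≢-sym q≢z)
  pq : q < z × l ≤ z × B z < T q × T q < T z × B q ≡ T q
  pq with pair q z q≤ z≤ q≢z
  ... | h = lia "g-ee<fd<gcabegfd@;a<bc-bd<ee<fg=e 003513003651000c26000260003e0c004fe04002502g02a2" (q , z , l , B z , T q , T z , B q) (le q q≤ , lt , lt' , h)
  high≤ : ∀ y -> y ≤ r -> T y ≤ T q ⊎ T z ≤ T y ⊎ z < y
  high≤ y y≤ with y ≟ r
  ... | yes refl = inj₂ (inj₂ z<r)
  ... | no n = high y (≤∧≢⇒< y≤ n)
  free' : ∀ p -> p ≤ r -> B p ≢ suc (B q)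
  free' p p≤ e with p ≟ z
  ... | yes refl = clash "a=1ba<b; 210" (B p , B q) (e , lt')
  ... | no ne = clash "a-ba=1cd<ef-eg<hh<ic=h&&&&b-hi-be<j||fjebaig@; 014b039015d185b00481d700088cik301jd2605ebh30" (B p , T p , B q , q , z , l , B z , T q , T z , p) (le p p≤ , e , pq , high≤ p p≤ , pair p z p≤ z≤ ne)
  newq : ∀ p -> p ≤ r -> p ≢ q -> p ≢ z -> Apart l q p (T' q) (B' q) (T p) (B p)
  newq p p≤ n n' = lia "b-fg=1ha=ic<je-jk<ll<ih=l&&&&f-li-fj<d||edcfblh@edjfbik@;ecdagfb@ 0h0h044e106035g31b8003g1500084m03l2605l0hgk050500250240007jb1k3ai002a529400056h21dcg003i17004n82m3k5a3c020i043g210000260250002942a50606002503760007kc1l3bj002a52c500076i21cdh000029049807002b52d53e05" (T' q , B p , q , p , l , T p , B' q , B q , T z , z , B z , T q) (le p p≤ , eq₃ , eq₁ , pq , high≤ p p≤ , pair p q p≤ q≤ n , pair p z p≤ z≤ n')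
  newz : ∀ p -> p ≤ r -> p ≢ q -> p ≢ z -> Apart l z p (T' z) (B' z) (T p) (B p)
  newz p p≤ n n' = lia "g=ha=ij<ce-ch<ii<kl=i&&&&edjfbil@edcfbkh@;ecdagfb@ 0f0f023e21004e914000m260002i000360o000f671jo26003q1g005vo3cl4c3u8002502605je0fi3910280" (T' z , B p , z , p , l , T p , B' z , B z , T q , q , T z , B q) (bz , eq₂ , pq , pair p q p≤ q≤ n , pair p z p≤ z≤ n')

 ww-valid : ∀ {q z} -> RWait l r T q z -> B q < B z ->
  T' q ≡ T z -> T' z ≡ T q -> (∀ p -> p ≢ q -> p ≢ z -> T' p ≡ T p) ->
  B' q ≡ B z -> B' z ≡ B q -> (∀ p -> p ≢ q -> p ≢ z -> B' p ≡ B p) ->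
  RWait l (suc r) B q z × Row l (suc b) w r T' B'
 ww-valid {q} {z} a lt' eq₁ eq₂ eT eq₃ eq₄ eB = record
   { red = red ; blue = blue ; z<r = s≤s z≤ ; lt = lt' ; high = \y y< -> high' y (≤-pred y<) }
  , Two.two-row q≢z q<r z≤ eT eB
    (\n -> (lia "c<ba=c;a<b 3312" (T' z , w , T q) (hi q q<r , eq₂))) (\{ refl -> ⊥-elim (<-irrefl refl z<r) }) (lia "c<ba=c;a<b 3312" (T' q , w , T z) (hi z z<r , eq₁))
    (lia "`<ba=b;`<a 3320" (B' q , B z) (lo z z≤ , eq₃)) (lia "`<ba=b;`<a 3320" (B' z , B q) (lo q q≤ , eq₄)) (lia "c-da=cb=d;a-b 44053" (B' q , T' q , B z , T z) (le z z≤ , eq₃ , eq₁)) (lia "c-da=cb=d;a-b 44053" (B' z , T' z , B q , T q) (le q q≤ , eq₄ , eq₂))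
    (lia "c-ba=c;a-1b 3312" (B' q , b , B z) (bd z z≤ , eq₃)) (lia "c-ba=c;a-1b 3312" (B' z , b , B q) (bd q q≤ , eq₄))
    (lia "e-dh<ig=if=h;ecdagfb@ 0845302270" (T' q , B' z , q , z , l , T' z , B' q , T q , B z) (blue , pq , eq₃ , eq₂)) newq newz
  where
  open RWait a
  open WaitFacts row a
  q<r : q < r
  q<r = lia "a<cc-dd<b;a<b 43210" (q , r , l , z) (red , blue , z<r)
  pq : T q < B z
  pq with pair q z q≤ z≤ q≢z
  ... | h = lia "a<cd<bgefadcb@;a<b 0025100465140033092a2" (T q , B z , T z , B q , q , z , l) (lt , lt' , h)
  high≤ : ∀ y -> y ≤ r -> T y ≤ T q ⊎ T z ≤ T y ⊎ z < y
  high≤ y y≤ with y ≟ r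
  ... | yes refl = inj₂ (inj₂ z<r)
  ... | no n = high y (≤∧≢⇒< y≤ n)
  high' : ∀ y -> y ≤ r -> B y ≤ B q ⊎ B z ≤ B y ⊎ z < y
  high' y y≤ with y ≟ q | y ≟ z
  ... | yes refl | _ = inj₁ ≤-refl
  ... | no _ | yes refl = inj₂ (inj₁ ≤-refl)
  ... | no n | no n' = lia "f<gc-ha-ii-jh-id<e||gefiajb@gediahc@;a-bc-ad<e|| 013a510005370200053b21003fc1002822j52b0002d43g30" (B y , B q , B z , z , y , q , l , T z , T y , T q) (red , le z z≤ , le y y≤ , high≤ y y≤ , pair y q y≤ q≤ n , pair y z y≤ z≤ n')
  newq : ∀ p -> p ≤ r -> p ≢ q -> p ≢ z -> Apart l q p (T' q) (B' q) (T p) (B p)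
  newq p p≤ n n' = lia "c<eh<ii-jb-fk-hg=ia=jf-hj-fl<d||edcfbhk@edlfbji@;ecdagfb@ 0f0f044d810033a31003a1500084g03f2600o3n5000260005nh063005o60j4004l0k54pj0m050500250240003f31002a529400053g21003c17004h82g2a40500230250003c17002852a40g045fa21c00002602i0002m42a505002403i0600002702j0002952b5" (T' q , B p , q , p , l , T p , B' q , T q , B z , T z , B q , z) (red , pq , le z z≤ , le p p≤ , le q q≤ , eq₃ , eq₁ , high≤ p p≤ , pair p q p≤ q≤ n , pair p z p≤ z≤ n')
  newz : ∀ p -> p ≤ r -> p ≢ q -> p ≢ z -> Apart l z p (T' z) (B' z) (T p) (B p)
  newz p p≤ n n' = lia "h<ee-ci<jj-kg=la=if-ik-fc<d||edhfbil@edcfbkj@;ecdagfb@ 0e0e033921003914002k40c42301000c3l21004nm18002820w260003v70003q0g007fwv60se004u0tf4s0vg0o210003n20003i08005780k6004m0l74k0n83c102b0" (T' z , B p , z , p , l , T p , B' z , q , T q , B z , T z , B q) (red , blue , pq , le z z≤ , eq₄ , eq₂ , high≤ p p≤ , pair p q p≤ q≤ n , pair p z p≤ z≤ n')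

 rs-valid : r < l -> (∀ p -> T' p ≡ T p) ->
  B' r ≡ suc (B r) -> (∀ p -> p ≢ r -> B' p ≡ B p) ->
  RAct l (suc w) (suc r) B r × Row l (suc b) w r T' B'
 rs-valid red eT eq₂ eB = record
   { red = red ; q<r = ≤-refl ; q<w = (lia "1c<ba-c;1a<1b 3201" (B r , w , b) (bw' , bd r ≤-refl)) ; free = \p p< e -> free' p (≤-pred p<) e }
  , record
   { top = trans (eT r) top
   ; lo = lo' ; le = le' ; hi = \p p< -> subst (_< w) (sym (eT p)) (hi p p<) ; bd = bd' ; bw = bw'
   ; pair = pair-upd₁ T' B' r row (\p _ -> eT p) eB new }
  where
  free' : ∀ p -> p ≤ r -> B p ≢ suc (B r)
  free' p p≤ e with p ≟ r
  ... | yes refl = clash "a=1a; 10" (B p) e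
  ... | no ne = clash "a<bc-de<fc=1ebgadcfe@; 003613003615002d43930" (r , l , B p , T p , B r , T r , p) (red , le p p≤ , r-hop , e , pair p r p≤ ≤-refl ne)
  lo' : ∀ p -> p ≤ r -> 1 ≤ B' p
  lo' p p≤ with p ≟ r
  ... | yes refl = lia "`-ba=1b;`<a 3320" (B' p , B p) (z≤n , eq₂)
  ... | no ne = lia "`<ba=b;`<a 3320" (B' p , B p) (lo p p≤ , eB p ne)
  le' : ∀ p -> p ≤ r -> B' p ≤ T' p
  le' p p≤ with p ≟ r
  ... | yes refl = lia "c<db=da=1c;a-b 45142" (B' p , T' p , B p , T p) (r-hop , eT p , eq₂)
  ... | no ne = lia "c-da=cb=d;a-b 44053" (B' p , T' p , B p , T p) (le p p≤ , eB p ne , eT p)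
  bd' : ∀ p -> p ≤ r -> B' p ≤ suc b
  bd' p p≤ with p ≟ r
  ... | yes refl = lia "c-ba=1c;a-1b 3312" (B' p , b , B p) (bd p p≤ , eq₂)
  ... | no ne = lia "c-ba=c;a-1b 3312" (B' p , b , B p) (bd p p≤ , eB p ne)
  new : ∀ p -> p ≤ r -> p ≢ r -> Apart l r p (T' r) (B' r) (T p) (B p)
  new p p≤ ne = lia "d-cc<eg=1hecdihfb@;ecdagfb@ 070100280270003531002d52c402002904980400002503a90002e5295" (T' r , B p , r , p , l , T p , B' r , B r , T r) (p≤ , red , eq₂ , pair r p ≤-refl p≤ (≢-sym ne))

weaken-b : ∀ {l b w r T B} (T' B' : ℕ -> ℕ) -> Row l b w r T B -> suc b < w ->
 (∀ p -> T' p ≡ T p) -> (∀ p -> B' p ≡ B p) -> Row l (suc b) w r T' B'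
weaken-b {l} {b} {w} {r} {T} {B} T' B' row bw' eT eB = record
 { top = trans (eT r) top
 ; lo = \p p≤ -> (lia "`<ba=b;`<a 3320" (B' p , B p) (lo p p≤ , eB p))
 ; le = \p p≤ -> (lia "c-da=cb=d;a-b 44053" (B' p , T' p , B p , T p) (le p p≤ , eB p , eT p))
 ; hi = \p p< -> (lia "c<ba=c;a<b 3312" (T' p , w , T p) (hi p p< , eT p))
 ; bd = \p p≤ -> (lia "c-ba=c;a-1b 3312" (B' p , b , B p) (bd p p≤ , eB p))
 ; bw = bw'
 ; pair = \p q p≤ q≤ ne -> (lia "a=hg=if=jb=kecdhijk@;ecdagfb@ 0c014b142000f4a09202220210000j26000260004j0e6004g0l6004j0m54l0k60i26000260004f0i6004k0h6004f0i54h0g60d0300250240004a1b3002a529404002604650400002503760002b5295" (T' p , B' q , p , q , l , T' q , B' p , T p , B p , T q , B q) (eT p , eB p , eT q , eB q , pair p q p≤ q≤ ne)) }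
 where open RowFacts row

R-valid : ∀ {l b w y r T B s s'} (T' B' : ℕ -> ℕ) -> Row l b w r T B -> suc b < w -> y ≤ l ->
 RValid l w r T s -> RStep l y r T B s s' -> RMoved T T' s -> RMoved B B' s' ->
 RValid l (suc w) (suc r) B s' × Row l (suc b) w r T' B'
R-valid T' B' row bw' y≤ v (rn _) (mnone eT) (mnone eB) = tt , weaken-b T' B' row bw' eT eB
R-valid T' B' row bw' y≤ v (rs refl) (mnone eT) (mact e eB) = rs-valid row T' B' bw' y≤ eT e eB
R-valid T' B' row bw' y≤ v (ra h) (mact e eT) (mact e' eB) = ra-valid row T' B' bw' v h e eT e' eB
R-valid T' B' row bw' y≤ v (rb z z≤ h h') (mact e eT) (mact e' eB) = rb-valid row T' B' bw' v z≤ h h' e eT e' eB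
R-valid T' B' row bw' y≤ v (rc z z≤ h h') (mact e eT) (mwait e' e'' eB) = rc-valid row T' B' bw' v z≤ h h' e eT e' e'' eB
R-valid T' B' row bw' y≤ v (wx h) (mwait e e' eT) (mact e'' eB) = wx-valid row T' B' bw' v h e e' eT e'' eB
R-valid T' B' row bw' y≤ v (ww h) (mwait e e' eT) (mwait e'' e‴ eB) = ww-valid row T' B' bw' v h e e' eT e'' e‴ eB

R-total : ∀ {l b w y r T B} -> Row l b w r T B -> ∀ s -> RValid l w r T s -> ∃ \s' -> RStep l y r T B s s'
R-total {y = y} {r} row none v with suc r ≟ y
... | yes e = act r , rs e
... | no n = none , rn n
R-total {l} {r = r} {T} {B} row (act q) v with anyUpTo? (\z -> B z ≟ suc (T q)) (suc r)
... | no n = act q , ra (\z z≤ e -> n (z , s≤s z≤ , e))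
... | yes (z , z< , e) with z <? l
... | yes z<l = act z , rb z (≤-pred z<) e z<l
... | no z≮l = wait q z , rc z (≤-pred z<) e (≮⇒≥ z≮l)
R-total {r = r} {T} {B} row (wait q z) v with <-cmp (B q) (B z)
... | tri< h _ _ = wait q z , ww h
... | tri> _ _ h = act q , wx h
... | tri≈ _ e _ = ⊥-elim (q≢z (inj-B q z q≤ z≤ e))
 where
 open RowFacts row
 open WaitFacts row v

R-det : ∀ {l b w y r T B s s₁ s₂} -> Row l b w r T B ->
 RStep l y r T B s s₁ -> RStep l y r T B s s₂ -> s₁ ≡ s₂
R-det row (rn _) (rn _) = refl
R-det row (rn n) (rs e) = ⊥-elim (n e)
R-det row (rs e) (rn n) = ⊥-elim (n e)
R-det row (rs _) (rs _) = refl
R-det row (ra _) (ra _) = refl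
R-det row (ra h) (rb z z≤ e _) = ⊥-elim (h z z≤ e)
R-det row (ra h) (rc z z≤ e _) = ⊥-elim (h z z≤ e)
R-det row (rb z z≤ e _) (ra h) = ⊥-elim (h z z≤ e)
R-det row (rb z z≤ e _) (rb z' z'≤ e' _) = cong act (RowFacts.inj-B row z z' z≤ z'≤ (trans e (sym e')))
R-det row (rb z z≤ e h) (rc z' z'≤ e' h') with refl ← RowFacts.inj-B row z z' z≤ z'≤ (trans e (sym e')) = ⊥-elim (<⇒≱ h h')
R-det row (rc z z≤ e _) (ra h) = ⊥-elim (h z z≤ e)
R-det row (rc z z≤ e h') (rb z' z'≤ e' h) with refl ← RowFacts.inj-B row z z' z≤ z'≤ (trans e (sym e')) = ⊥-elim (<⇒≱ h h')
R-det row (rc z z≤ e _) (rc z' z'≤ e' _) = cong (wait _) (RowFacts.inj-B row z z' z≤ z'≤ (trans e (sym e')))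
R-det row (wx h) (wx _) = refl
R-det row (wx h) (ww h') = ⊥-elim (<-asym h h')
R-det row (ww h') (wx h) = ⊥-elim (<-asym h h')
R-det row (ww _) (ww _) = refl

-- Left insertion

data LState : Set where
 none : LState
 mov  : ℕ -> ℕ -> LState
 dead : ℕ -> ℕ -> LState

-- A droop goes on while its column is crossed (`l1`) and lands otherwise. All pipes of a row up to
-- `k` leave in rows up to `k`, so there, after a bump as after a j-elbow, the first turn weakly
-- right of the landing column takes over (`l2`). After row `k` the only turn is that of pipe `r`;
-- the landing is a bump with it, which becomes the final cross and exchanges `m` and `r` further
-- down (`lf`, `ld`). A j-elbow after row `k` has no constructor because the columns left of that
-- turn are all occupied.
data LStep (k x r : ℕ) (T B : ℕ -> ℕ) : LState -> LState -> Set where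
 ln : suc r ≢ x -> LStep k x r T B none none
 ls : ∀ m g -> suc r ≡ x -> First r T B 0 m -> Gap (suc r) B (B m) g -> LStep k x r T B none (mov m g)
 l1 : ∀ {m g} -> Inside r T B (T m) -> LStep k x r T B (mov m g) (mov m g)
 l2 : ∀ {m g} m' g' -> r < k -> Outside r T B (T m) -> First r T B g m' ->
  Gap (suc r) B (B m') g' -> LStep k x r T B (mov m g) (mov m' g')
 lf : ∀ {m g} -> k ≤ r -> B r ≡ g -> LStep k x r T B (mov m g) (dead m r)
 ld : ∀ {m z} -> LStep k x r T B (dead m z) (dead m z)

data LMoved (T T' : ℕ -> ℕ) : LState -> Set where
 mnone : (∀ p -> T' p ≡ T p) -> LMoved T T' none
 mmov  : ∀ {m g} -> T' m ≡ g -> (∀ p -> p ≢ m -> T' p ≡ T p) -> LMoved T T' (mov m g)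
 mdead : ∀ {m z} -> T' m ≡ T z -> T' z ≡ T m -> (∀ p -> p ≢ m -> p ≢ z -> T' p ≡ T p) ->
  LMoved T T' (dead m z)

-- After the final cross, left insertion has only exchanged the places of `m` and `z`. By `sat`
-- later pipes cannot enter to the left of `T z`, hence they stay clear of both.
record LDead (k r : ℕ) (T : ℕ -> ℕ) (m z : ℕ) : Set where
 field
  m<z : m < z
  z<r : z < r
  k≤z : k ≤ z
  lt  : T m < T z
  low : ∀ p -> p < r -> T p ≤ T m ⊎ T z ≤ T p ⊎ p < m
  sat : ∀ j -> 1 ≤ j -> j < T z -> Occ r T j

LValid : (k w r : ℕ) (T : ℕ -> ℕ) -> LState -> Set
LValid k w r T none = ⊤
LValid k w r T (mov m g) = LMove w r T m g
LValid k w r T (dead m z) = LDead k r T m z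

-- The shape of the rows below all descents.
record Rigid (r : ℕ) (T B : ℕ -> ℕ) : Set where
 field
  upr : ∀ p -> p < r -> B p ≡ T p
  full : ∀ j -> 1 ≤ j -> j < B r -> Occ r T j

module MoveFacts {l b w r T B} (row : Row l b w r T B) {m g} (a : LMove w r T m g) where
 open RowFacts row
 open LMove a
 open Gap gap

 m≤ : m ≤ r
 m≤ = <⇒≤ m<r

 free≤ : ∀ p -> p ≤ r -> T p ≢ g
 free≤ p p≤ e with p ≟ r
 ... | yes refl = clash "a<bc=bc=a; 3421" (g , w , T p) (g<w , top , e)
 ... | no n = free p (≤∧≢⇒< p≤ n) e

 low≤ : ∀ p -> p ≤ r -> T p ≤ T m ⊎ g < T p ⊎ p < m
 low≤ p p≤ with p ≟ r
 ... | yes refl = lia "c<fa=f;a-bc<ad<e|| 3420" (T p , T m , g , p , m , w) (g<w , top)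
 ... | no n = low p (≤∧≢⇒< p≤ n)

 -- The columns strictly between `T m` and `g` are occupied at the top edge, and a cell whose north
 -- edge belongs to one pipe cannot hold the r-turn of another: that would be a bump.
 no-start : ∀ p -> p ≤ r -> T p ≤ B p ⊎ B p ≤ T m ⊎ g ≤ B p
 no-start p p≤ with B p <? T p | T m <? B p | B p <? g
 ... | no h | _ | _ = lia "a<1b;a-bb-cd-b|| 230" (T p , B p , T m , g) (≰⇒> h)
 ... | yes _ | no h | _ = lia "b<1c;a-bb-cd-b|| 220" (T p , B p , T m , g) (≰⇒> h)
 ... | yes _ | yes _ | no h = lia "d<1b;a-bb-cd-b|| 210" (T p , B p , T m , g) (≰⇒> h)
 ... | yes h | yes h' | yes h'' with fill (B p) h' h''
 ... | s , s<r , e with s ≟ p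
 ... | yes refl = lia "a=b;a-bb-cd-b|| 241" (T p , B p , T m , g) e
 ... | no n = lia "e-ff=bighfeab@;a-bb-cd-b|| 002310049165002a33e2a" (T p , B p , T m , g , B s , T s , s , p , l) (le s (<⇒≤ s<r) , e , pair s p (<⇒≤ s<r) p≤ n)

-- The gap after a pipe that moves on horizontally lies below that pipe.
module HopGap {l b w r T B} (row : Row l b w r T B) {m g} (m≤ : m ≤ r) (hop : B m < T m)
 (gap : Gap (suc r) B (B m) g) where
 open RowFacts row
 open Gap gap

 -- If the gap lay beyond `T m`, another pipe would enter from below the cell in which `m` turns
 -- north, which only a bump allows.
 g≤T : g ≤ T m
 g≤T with g ≤? T m
 ... | yes h = h
 ... | no h with fill (T m) hop (≰⇒> h)
 ... | s , s<r , e with s ≟ m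
 ... | yes refl = lia "c=bc<b;a-b 210" (g , T s , B s) (e , hop)
 ... | no n = lia "c-dc=be<bhfgdcbe@;a-b 004613400261003c2a2a3" (g , T m , B s , T s , B m , s , m , l) (le s (≤-pred s<r) , e , hop , pair s m (≤-pred s<r) m≤ n)

 g≤b : g ≤ suc b
 g≤b with g ≤? suc b
 ... | yes h = h
 ... | no h with fill (suc b) (s≤s (bd m m≤)) (≰⇒> h)
 ... | s , s<r , e = lia "c-bc=1b;a-1b 220" (g , b , B s) (bd s (≤-pred s<r) , e)

 move : LMove (suc w) (suc r) B m g
 move = record { m<r = s≤s m≤ ; g<w = (lia "a-1cc<b;a<1b 3210" (g , w , b) (g≤b , bw)) ; gap = gap ; low = low' }
  where
  low' : ∀ p -> p < suc r -> B p ≤ B m ⊎ g < B p ⊎ p < m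
  low' p p< with p ≟ m
  ... | yes refl = inj₁ ≤-refl
  ... | no n = lia "c-fa-ghdegafb@;a-bc<ad<e|| 003731003751002b53d30" (B p , B m , g , p , m , T m , T p , l) (g≤T , le p (≤-pred p<) , pair p m (≤-pred p<) m≤ n)

module _ {l b w r T B} (row : Row l b w r T B) (T' B' : ℕ -> ℕ) (bw' : suc b < w) where
 open RowFacts row

 ls-valid : ∀ {m g} -> First r T B 0 m -> Gap (suc r) B (B m) g ->
  (∀ p -> T' p ≡ T p) -> B' m ≡ g -> (∀ p -> p ≢ m -> B' p ≡ B p) ->
  LMove (suc w) (suc r) B m g × Row l (suc b) w r T' B'
 ls-valid {m} {g} (m≤ , 0≤ , hop , _) gap eT eq eB = move , record
   { top = trans (eT r) top
   ; lo = lo' ; le = le' ; hi = \p p< -> subst (_< w) (sym (eT p)) (hi p p<) ; bd = bd' ; bw = bw'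
   ; pair = pair-upd₁ T' B' m row (\p _ -> eT p) eB new }
  where
  open HopGap row m≤ hop gap
  open Gap gap
  lo' : ∀ p -> p ≤ r -> 1 ≤ B' p
  lo' p p≤ with p ≟ m
  ... | yes refl = lia "b<ca=c`-b;`<a 44031" (B' p , B p , g) (lt , eq , 0≤)
  ... | no ne = lia "`<ba=b;`<a 3320" (B' p , B p) (lo p p≤ , eB p ne)
  le' : ∀ p -> p ≤ r -> B' p ≤ T' p
  le' p p≤ with p ≟ m
  ... | yes refl = lia "c-da=cb=d;a-b 44053" (B' p , T' p , g , T p) (g≤T , eq , eT p)
  ... | no ne = lia "c-da=cb=d;a-b 44053" (B' p , T' p , B p , T p) (le p p≤ , eB p ne , eT p)
  bd' : ∀ p -> p ≤ r -> B' p ≤ suc b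
  bd' p p≤ with p ≟ m
  ... | yes refl = lia "c-1ba=c;a-1b 3312" (B' p , b , g) (g≤b , eq)
  ... | no ne = lia "c-ba=c;a-1b 3312" (B' p , b , B p) (bd p p≤ , eB p ne)
  new : ∀ p -> p ≤ r -> p ≢ m -> Apart l m p (T' m) (B' m) (T p) (B p)
  new p p≤ ne = lia "h<ig=ih<ja=jb≠iedcfbjh@;ecdagfb@ 0b0b024b921003814000i260002600d4ib30014150k003h07002602702e00300240230003915002952840c034ca210000260250002942a504002403650000027047605002952b5" (T' m , B p , m , p , l , T p , B' m , B m , g , T m) (lt , eq , hop , eT m , free p (s≤s p≤) , pair p m p≤ m≤ ne)

 l1-valid : ∀ {m g} -> LMove w r T m g -> Inside r T B (T m) ->
  T' m ≡ g -> (∀ p -> p ≢ m -> T' p ≡ T p) -> B' m ≡ g -> (∀ p -> p ≢ m -> B' p ≡ B p) ->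
  LMove (suc w) (suc r) B m g × Row l (suc b) w r T' B'
 l1-valid {m} {g} a (s , s≤ , i₁ , i₂) eq₁ eT eq₂ eB =
  record { m<r = (lia "a<b;a<1b 210" (m , r) m<r) ; g<w = (lia "a<b;a<1b 210" (g , w) g<w)
     ; gap = record { lt = (lia "c<ba-c;a<b 3201" (B m , g , T m) (lt , le m m≤)) ; free = \p p< e -> freeB p (≤-pred p<) e ; fill = fillB }
     ; low = \p p< -> lowB p (≤-pred p<) }
  , record
   { top = trans (eT r (\{ refl -> <-irrefl refl m<r })) top
   ; lo = lo' ; le = le' ; hi = hi' ; bd = bd' ; bw = bw'
   ; pair = pair-upd₁ T' B' m row eT eB new }
  where
  open LMove a
  open Gap gap
  open MoveFacts row a
  s≢m : s ≢ m
  s≢m refl = clash "a<a; 10" (T m) i₂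
  pm = lia "c-dd<fg<debafgdc@;a<bc=de-b 00354100241002a20c26000002302e0260" (m , s , B m , T m , l , T s , B s) (le m m≤ , i₂ , i₁ , pair s m s≤ m≤ s≢m)
  -- This is what `low` is for: the pipe `s` crossing `m` has the larger name, so it is not among
  -- the pipes jumped over and reaches beyond `g`. It therefore runs across all columns from `T m`
  -- to `g`, and the pipes there are vertical.
  g<s = lia "c<bd<ef=cg-e&&b-ca<be<d||;a<b 0026000280260" (g , T s , T m , m , s , B m , l) (i₂ , pm , low≤ s s≤)
  freeB : ∀ p -> p ≤ r -> B p ≢ g
  freeB p p≤ e with p ≟ s
  ... | yes refl = clash "a<bc=bc<a; 3310" (T m , g , B p) (lt , e , i₁)
  ... | no n = clash "a<bc<ad=ad-ef<ce≠aighedbf@; 0135400149215003b1900380e4g0bf" (g , T s , T m , B p , T p , B s , p , s , l) (g<s , lt , e , le p p≤ , i₁ , free≤ p p≤ , pair p s p≤ s≤ n)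
  fillB : ∀ j -> B m < j -> j < g -> Occ (suc r) B j
  fillB j j₁ j₂ with fill j (lia "c<bd<ec=af-e;a<b 3514" (T m , j , B m , m , s , l) (j₁ , pm)) j₂
  ... | p , p< , e with p ≟ s
  ... | yes refl = clash "a<bb<cc=a; 3321" (j , g , T p) (j₂ , g<s , e)
  ... | no n = p , <⇒≤ (s≤s p<) , (lia "b<cc<de<bf=ba-fg<hi<je=hk-j&&kljfadg@;a=b 0c015ca185004fe13003g084kj2h3907" (B p , j , g , T s , B m , T p , B s , T m , m , s , l , p) (j₂ , g<s , j₁ , e , le p (<⇒≤ p<) , i₁ , pm , pair p s (<⇒≤ p<) s≤ n))
  lowB : ∀ p -> p ≤ r -> B p ≤ B m ⊎ g < B p ⊎ p < m
  lowB p p≤ with p ≟ s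
  ... | yes refl = lia "a<fe<db=fg-d;a-bc<ad<e|| 3741" (B p , B m , g , p , m , T m , l) (i₁ , pm)
  ... | no n = lia "c<fa-gh<ie<jb=ik-j&&g-ic<gd<e||kdjgafh@;a-bc<ad<e|| 014c80400026fe21a7003fd1003k806lki0gd2b0" (B p , B m , g , p , m , T s , T p , B s , T m , s , l) (g<s , le p p≤ , i₁ , pm , low≤ p p≤ , pair p s p≤ s≤ n)
  lo' : ∀ p -> p ≤ r -> 1 ≤ B' p
  lo' p p≤ with p ≟ m
  ... | yes refl = lia "b<ca=c`-b;`<a 44031" (B' p , T p , g) (lt , eq₂ , z≤n)
  ... | no ne = lia "`<ba=b;`<a 3320" (B' p , B p) (lo p p≤ , eB p ne)
  le' : ∀ p -> p ≤ r -> B' p ≤ T' p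
  le' p p≤ with p ≟ m
  ... | yes refl = lia "a=cb=c;a-b 3430" (B' p , T' p , g) (eq₂ , eq₁)
  ... | no ne = lia "c-da=cb=d;a-b 44053" (B' p , T' p , B p , T p) (le p p≤ , eB p ne , eT p ne)
  hi' : ∀ p -> p < r -> T' p < w
  hi' p p< with p ≟ m
  ... | yes refl = lia "c<ba=c;a<b 3312" (T' p , w , g) (g<w , eq₁)
  ... | no ne = lia "c<ba=c;a<b 3312" (T' p , w , T p) (hi p p< , eT p ne)
  g≤b : g ≤ suc b
  g≤b with g ≤? suc b
  ... | yes h = h
  ... | no h with fillB (suc b) (s≤s (bd m m≤)) (≰⇒> h)
  ... | p , p< , e = lia "c-bc=1b;a-1b 220" (g , b , B p) (bd p (≤-pred p<) , e)
  bd' : ∀ p -> p ≤ r -> B' p ≤ suc b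
  bd' p p≤ with p ≟ m
  ... | yes refl = lia "c-1ba=c;a-1b 3312" (B' p , b , g) (g≤b , eq₂)
  ... | no ne = lia "c-ba=c;a-1b 3312" (B' p , b , B p) (bd p p≤ , eB p ne)
  new : ∀ p -> p ≤ r -> p ≢ m -> Apart l m p (T' m) (B' m) (T p) (B p)
  new p p≤ ne with p ≟ s
  ... | yes refl = lia "h<fi<hg=ha=hb<ic<dj=ie-d;ecdagfb@ 0c24000220004c807003e0a003c0b3da0" (T' m , B p , m , p , l , T p , B' m , g , T m , B m) (g<s , lt , eq₂ , eq₁ , i₁ , pm)
  ... | no n = lia "h<ij<hg=ha=hb-fk<jc<lm=je-l&&b≠hf-jh<fd<c||edlfbik@edcfbjm@;ecdagfb@ 0j040k045jh21d003l140049n804q0jp060500250240005e1h3d002a529400074m21g003o17003c803i5a2305f01de0k035jh21b0000260250002942a5070706002603870005f1i3e002b52d500084n21h003p15003a803m5e240055g1dl2000028048706002a52c5" (T' m , B p , m , p , l , T p , B' m , g , T s , T m , B s , s , B m) (g<s , lt , eq₂ , eq₁ , le p p≤ , i₁ , pm , freeB p p≤ , low≤ p p≤ , pair p s p≤ s≤ n , pair p m p≤ m≤ ne)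

 l2-valid : ∀ {m g m' g'} -> LMove w r T m g -> Outside r T B (T m) -> First r T B g m' ->
  Gap (suc r) B (B m') g' ->
  T' m ≡ g -> (∀ p -> p ≢ m -> T' p ≡ T p) -> B' m' ≡ g' -> (∀ p -> p ≢ m' -> B' p ≡ B p) ->
  LMove (suc w) (suc r) B m' g' × Row l (suc b) w r T' B'
 l2-valid {m} {g} {m'} {g'} a out (m'≤ , g≤ , hop , fst) gap' eq₁ eT eq₂ eB = move
  , Two.two-row row T' B' bw' m≢ m<r m'≤ (\p n _ -> eT p n) (\p _ n -> eB p n)
    (\n -> (lia "c<ba=c;a<b 3312" (T' m' , w , T m') (hi m' (≤∧≢⇒< m'≤ n) , tm'))) (\{ refl -> trans tm' top }) (lia "c<ba=c;a<b 3312" (T' m , w , g) (g<w , eq₁))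
    (lia "`<ba=b;`<a 3320" (B' m , B m) (lo m m≤ , bm)) (lia "b<c`-ba=c;`<a 43042" (B' m' , B m' , g') (lt' , z≤n , eq₂)) (lia "c<db=de-ca=e;a-b 561253" (B' m , T' m , T m , g , B m) (lt , eq₁ , le m m≤ , bm)) (lia "c-da=cb=d;a-b 44053" (B' m' , T' m' , g' , T m') (g≤T , eq₂ , tm'))
    (lia "c-ba=c;a-1b 3312" (B' m , b , B m) (bd m m≤ , bm)) (lia "c-1ba=c;a-1b 3312" (B' m' , b , g') (g≤b , eq₂))
    (lia "h<ia=ii-jj<kl-hb=kj<mecdhlmj@;ecdagfb@ 0d5976300200240230005eb61900295284" (T' m , B' m' , m , m' , l , T' m' , B' m , T m , g , B m' , g' , B m , T m') (lt , eq₁ , g≤ , lt' , le m m≤ , eq₂ , hop , pair m m' m≤ m'≤ m≢)) newm newm'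
  where
  open LMove a
  open Gap gap
  open Gap gap' using () renaming (lt to lt'; free to free')
  open MoveFacts row a
  open HopGap row m'≤ hop gap'
  m≢ : m ≢ m'
  m≢ refl = clash "a<bb-cc-a; 3210" (T m , g , B m) (lt , g≤ , le m m≤)
  tm' : T' m' ≡ T m'
  tm' = eT m' (≢-sym m≢)
  bm : B' m ≡ B m
  bm = eB m m≢
  newm : ∀ p -> p ≤ r -> p ≢ m -> p ≢ m' -> Apart l m p (T' m) (B' m) (T p) (B p)
  newm p p≤ n n' = lia "a=hh-ib-fj-kg=ji<ld≠cf≠hk-bf-k|f-kh<fd<c||f-bb-kh-b||b<hf-bi-b||edcfbkj@edmfbli@;ecdagfb@ 0j0j033d2100093i02000a47n10002500b4p10o004aq400b5cs612005trm1d004iyc06ywr08i022100o22000220005n0lm7000i3r100g4dt10002b00h4v10u004gw400h5iy612005zxs1j004oEc06ECx08o000g210002b00h4v10u002400h3612005zxs1j002c06ECx08o2p0000q26000260005p0n630j013t01002602s04t04d0f4m0414m3010a2200a0a074k1j2000d3m02004q06p270002a52b40700250260003l31002a52b40845l10000c0969p51l200241002c52d40a0a002802900043741002d52e40049p500a5br712005sql1c004hxd02f4094n10m0048o40095aq612005rpk1b004gwc02e4090l053f210000250260002a4295221220" (T' m , B p , m , p , l , T p , B' m , g , B m' , B m , T m , T m' , m') (eq₁ , g≤ , le p p≤ , le m m≤ , bm , hop , n , free≤ p p≤ , out p p≤ , low≤ p p≤ , no-start p p≤ , fst p p≤ , pair p m p≤ m≤ n , pair p m' p≤ m'≤ n'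)
  newm' : ∀ p -> p ≤ r -> p ≢ m -> p ≢ m' -> Apart l m' p (T' m') (B' m') (T p) (B p)
  newm' p p≤ n n' = lia "h<ii-jg=ia=jb≠iedcfbjh@;ecdagfb@ 0b0b024b821003814000i260002600d4hb30014150j003h07002602703hg00300240230003915002952840c034c9210000260250002942a504002403650000027047605002952b5" (T' m' , B p , m' , p , l , T p , B' m' , B m' , g' , T m') (lt' , g≤T , eq₂ , tm' , free' p (s≤s p≤) , pair p m' p≤ m'≤ n')

 module _ {k} (rig : Rigid r T B) (l≤k : l ≤ k) (k≤r : k ≤ r) where
  open Rigid rig

  occ-down : ∀ {j} -> Occ r T j -> Occ (suc r) B j
  occ-down (p , p< , e) = p , <⇒≤ (s≤s p<) , trans (upr p p<) e

  r-free : ¬ Occ r T (B r)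
  r-free (p , p< , e) = <⇒≢ p< (inj-B p r (<⇒≤ p<) ≤-refl (trans (upr p p<) e))

  -- With the bump in column `g = B r` turned into a cross, `m` goes straight down in that column,
  -- while pipe `r` crosses it and turns down in the old column of `m`.
  lf-valid : ∀ {m g} -> LMove w r T m g -> B r ≡ g ->
   T' m ≡ g -> (∀ p -> p ≢ m -> T' p ≡ T p) ->
   B' m ≡ B r -> B' r ≡ B m -> (∀ p -> p ≢ m -> p ≢ r -> B' p ≡ B p) ->
   LDead k (suc r) B m r × Row l (suc b) w r T' B'
  lf-valid {m} {g} a br eq₁ eT eq₂ eq₃ eB = record
    { m<z = m<r ; z<r = ≤-refl ; k≤z = k≤r ; lt = (lia "c<db=da=c;a<b 45142" (B m , B r , T m , g) (lt , br , upr m m<r)) ; low = \p p< -> lowB p (≤-pred p<)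
    ; sat = \j j₁ j₂ -> occ-down (full j j₁ j₂) }
   , Two.two-row row T' B' bw' (<⇒≢ m<r) m<r ≤-refl (\p n _ -> eT p n) eB
     (\n -> ⊥-elim (n refl)) (\_ -> trans tr top) (lia "c<ba=c;a<b 3312" (T' m , w , g) (g<w , eq₁))
     (lia "`<ba=b;`<a 3320" (B' m , B r) (lo r ≤-refl , eq₂)) (lia "`<ba=b;`<a 3320" (B' r , B m) (lo m m≤ , eq₃)) (lia "c=db=da=c;a-b 46152" (B' m , T' m , B r , g) (br , eq₁ , eq₂)) (lia "c=de<df-eb=ca=f;a-b 6814562" (B' r , T' r , T r , w , T m , B m) (top , hi m m<r , le m m≤ , tr , eq₃))
     (lia "c-ba=c;a-1b 3312" (B' m , b , B r) (bd r ≤-refl , eq₂)) (lia "c-ba=c;a-1b 3312" (B' r , b , B m) (bd m m≤ , eq₃))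
     (lia "h<ic<de-jj-dk=il<hm=ha=hn=lf=kb=ng=m;ecdagfb@ 0k2i0003ih0005fb06a005mh80d004f50e4gd06" (T' m , B' r , m , r , l , T' r , B' m , g , w , k , T r , T m , B r , B m) (g<w , m<r , l≤k , k≤r , top , lt , br , eq₁ , upr m m<r , tr , eq₃ , eq₂)) newm newr
   where
   open LMove a
   open Gap gap
   open MoveFacts row a
   tr : T' r ≡ T r
   tr = eT r (\e -> <⇒≢ m<r (sym e))
   lowB : ∀ p -> p ≤ r -> B p ≤ B m ⊎ B r ≤ B p ⊎ p < m
   lowB p p≤ with p ≟ r
   ... | yes refl = inj₂ (inj₁ ≤-refl)
   ... | no n = lia "c=fa=gb=hg-hf<gd<e||;a-bc-ad<e|| 004a502004a805290" (B p , B m , B r , p , m , g , T p , T m) (br , upr p (≤∧≢⇒< p≤ n) , upr m m<r , low≤ p p≤)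
   newm : ∀ p -> p ≤ r -> p ≢ m -> p ≢ r -> Apart l m p (T' m) (B' m) (T p) (B p)
   newm p p≤ n n' = lia "h<ij=ia=ib=fk=hg=jf≠if-hi<fd<c||edcfbhk@;ecdagfb@ 0h030i4e601050500250240005e1g3d002a5294004i04h2306e091cd0i056c0f71b046e1cj2d0000270260002a42b5060606002603870005f1h3e002b52d5004j02i240056f1dk2e000028048706002a52c5" (T' m , B p , m , p , l , T p , B' m , T m , g , B r , B m) (lt , br , eq₁ , upr p (≤∧≢⇒< p≤ n') , upr m m<r , eq₂ , free≤ p p≤ , low≤ p p≤ , pair p m p≤ m≤ n)
   newr : ∀ p -> p ≤ r -> p ≢ m -> p ≢ r -> Apart l r p (T' r) (B' r) (T p) (B p)
   newr p p≤ n n' = lia "d-ce-hh-ci=jf<jb=fk=la=ig=kd≠cedmfblk@;ecdagfb@ 0i020i210003ih0045f185e00035h0bf2004kd0j002i02j0005l2i3k5k3ieb2h04gf10" (T' r , B p , r , p , l , T p , B' r , k , T r , w , B m , T m , m) (p≤ , l≤k , k≤r , top , hi p (≤∧≢⇒< p≤ n') , upr p (≤∧≢⇒< p≤ n') , upr m m<r , tr , eq₃ , n' , pair p m p≤ m≤ n)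

  ld-valid : ∀ {m z} -> LDead k r T m z ->
   T' m ≡ T z -> T' z ≡ T m -> (∀ p -> p ≢ m -> p ≢ z -> T' p ≡ T p) ->
   B' m ≡ B z -> B' z ≡ B m -> (∀ p -> p ≢ m -> p ≢ z -> B' p ≡ B p) ->
   LDead k (suc r) B m z × Row l (suc b) w r T' B'
  ld-valid {m} {z} a eq₁ eq₂ eT eq₃ eq₄ eB = record
    { m<z = m<z ; z<r = (lia "a<b;a<1b 210" (z , r) z<r) ; k≤z = k≤z ; lt = (lia "a=cb=dc<d;a<b 45401" (B m , B z , T m , T z) (vm , vz , lt)) ; low = \p p< -> lowB p (≤-pred p<)
    ; sat = \j j₁ j₂ -> occ-down (sat j j₁ (lia "a<cc=b;a<b 3321" (j , T z , B z) (j₂ , vz))) }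
   , Two.two-row row T' B' bw' (<⇒≢ m<z) m<r z≤ eT eB
     (\n -> (lia "c<ba=c;a<b 3312" (T' z , w , T m) (hi m m<r , eq₂))) (\{ refl -> ⊥-elim (<-irrefl refl z<r) }) (lia "c<ba=c;a<b 3312" (T' m , w , T z) (hi z z<r , eq₁))
     (lia "`<ba=b;`<a 3320" (B' m , B z) (lo z z≤ , eq₃)) (lia "`<ba=b;`<a 3320" (B' z , B m) (lo m m≤ , eq₄)) (lia "c=da=cb=d;a-b 45063" (B' m , T' m , B z , T z) (vz , eq₃ , eq₁)) (lia "c=da=cb=d;a-b 45063" (B' z , T' z , B m , T m) (vm , eq₄ , eq₂))
     (lia "c-ba=c;a-1b 3312" (B' m , b , B z) (bd z z≤ , eq₃)) (lia "c-ba=c;a-1b 3312" (B' z , b , B m) (bd m m≤ , eq₄))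
     (lia "e-hh-di<jk=jg=kf=i;ecdagfb@ 0b5753023a90" (T' m , B' z , m , z , l , T' z , B' m , k , T m , T z , B z) (l≤k , k≤z , lt , vz , eq₃ , eq₂)) newm newz
   where
   open LDead a
   m<r : m < r
   m<r = lia "a<cc<b;a<b 3210" (m , r , z) (m<z , z<r)
   m≤ : m ≤ r
   m≤ = <⇒≤ m<r
   z≤ : z ≤ r
   z≤ = <⇒≤ z<r
   vm : B m ≡ T m
   vm = upr m m<r
   vz : B z ≡ T z
   vz = upr z z<r
   low≤ : ∀ p -> p ≤ r -> T p ≤ T m ⊎ T z ≤ T p ⊎ p < m
   low≤ p p≤ with p ≟ r
   ... | yes refl = lia "a=fc<f;a-bc-ad<e|| 3401" (T p , T m , T z , p , m , w) (top , hi z z<r)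
   ... | no n = low p (≤∧≢⇒< p≤ n)
   z<B : T z < B r
   z<B with T z <? B r
   ... | yes h = h
   ... | no h = ⊥-elim (r-free (case-≤ (m≤n⇒m<n∨m≡n (≮⇒≥ h))))
    where
    case-≤ : B r < T z ⊎ B r ≡ T z -> Occ r T (B r)
    case-≤ (inj₁ h') = sat (B r) (lo r ≤-refl) h'
    case-≤ (inj₂ e) = z , z<r , sym e
   lowB : ∀ p -> p ≤ r -> B p ≤ B m ⊎ B z ≤ B p ⊎ p < m
   lowB p p≤ with p ≟ r
   ... | yes refl = lia "f<ac=f;a-bc-ad<e|| 3412" (B p , B m , B z , p , m , T z) (z<B , vz)
   ... | no n = lia "a=fb=gc=hf-gh-fd<e||;a-bc-ad<e|| 004a704004a407290" (B p , B m , B z , p , m , T p , T m , T z) (upr p (≤∧≢⇒< p≤ n) , vm , vz , low≤ p p≤)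
   newm : ∀ p -> p ≤ r -> p ≢ m -> p ≢ z -> Apart l m p (T' m) (B' m) (T p) (B p)
   newm p p≤ n n' with p ≟ r
   ... | yes refl = lia "c<dh<ba=h;ecdagfb@ 073302251" (T' m , B p , m , p , l , T p , B' m , T z) (m<r , z<B , eq₁)
   ... | no o = lia "b=fh=ij=ki<kg=ja=kf-ik-fd<c||edcfbih@edlfbkj@;ecdagfb@ 0h0h025h192g005e149d005i3m9e5m3if8050500250240005i1k3h002a529400055k1g2j005h17cg005l3pch2a42300i048i1gcda2h0000260250002942a50606002503760005j1l3i002a52c500076l1jf2k000029049807002b52d5230" (T' m , B p , m , p , l , T p , B' m , B m , T m , B z , T z , z) (upr p (≤∧≢⇒< p≤ o) , vm , vz , lt , eq₃ , eq₁ , low≤ p p≤ , pair p m p≤ m≤ n , pair p z p≤ z≤ n')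
   newz : ∀ p -> p ≤ r -> p ≢ m -> p ≢ z -> Apart l z p (T' z) (B' z) (T p) (B p)
   newz p p≤ n n' with p ≟ r
   ... | yes refl = lia "c<dh<bi<ha=i;ecdagfb@ 0844023261" (T' z , B p , z , p , l , T p , B' z , T z , T m) (z<r , z<B , lt , eq₂)
   ... | no o = lia "e-hh-cb=fi=jg=ia=jedkfbji@;ecdagfb@ 0e0e025c172b005b147a005f3h9c5h3fd84dc103cb0" (T' z , B p , z , p , l , T p , B' z , k , B m , T m , m) (l≤k , k≤z , upr p (≤∧≢⇒< p≤ o) , vm , eq₄ , eq₂ , pair p m p≤ m≤ n)

-- Existence and uniqueness of the steps of left insertion

argmin : ∀ {P : ℕ -> Set} -> (∀ z -> Dec (P z)) -> (f : ℕ -> ℕ) -> ∀ n ->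
 (∃ \z -> z < n × P z) -> ∃ \z -> z < n × P z × (∀ y -> y < n -> P y -> f z ≤ f y)
argmin P? f zero (z , () , _)
argmin {P} P? f (suc n) (z , z<n , pz) with anyUpTo? P? n
... | no h = n , ≤-refl , subst P z≡n pz , least
 where
 z≡n : z ≡ n
 z≡n with z ≟ n
 ... | yes e = e
 ... | no ne = ⊥-elim (h (z , ≤∧≢⇒< (≤-pred z<n) ne , pz))
 least : ∀ y -> y < suc n -> P y -> f n ≤ f y
 least y y< py with y ≟ n
 ... | yes refl = ≤-refl
 ... | no ne = ⊥-elim (h (y , ≤∧≢⇒< (≤-pred y<) ne , py))
... | yes e with argmin P? f n e | P? n
... | u , u<n , pu , mn | no ¬pn = u , <⇒≤ (s≤s u<n) , pu , least
 where
 least : ∀ y -> y < suc n -> P y -> f u ≤ f y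
 least y y< py with y ≟ n
 ... | yes refl = ⊥-elim (¬pn py)
 ... | no ne = mn y (≤∧≢⇒< (≤-pred y<) ne) py
... | u , u<n , pu , mn | yes pn with f u ≤? f n
... | yes h = u , <⇒≤ (s≤s u<n) , pu , least
 where
 least : ∀ y -> y < suc n -> P y -> f u ≤ f y
 least y y< py with y ≟ n
 ... | yes refl = h
 ... | no ne = mn y (≤∧≢⇒< (≤-pred y<) ne) py
... | no h = n , ≤-refl , pn , least
 where
 least : ∀ y -> y < suc n -> P y -> f n ≤ f y
 least y y< py with y ≟ n
 ... | yes refl = ≤-refl
 ... | no ne = ≤-trans (<⇒≤ (≰⇒> h)) (mn y (≤∧≢⇒< (≤-pred y<) ne) py)

-- An upward search from `g`: all columns beyond `b` are free, so `suc b ≤ d + g` makes `d`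
-- sufficient fuel.
gap-from : ∀ n B c b -> (∀ p -> p < n -> B p ≤ b) -> ∀ d g -> c < g -> suc b ≤ d + g ->
 (∀ j -> c < j -> j < g -> Occ n B j) -> ∃ \g' -> Gap n B c g'
gap-from n B c b bd d g c<g d≥ fill with anyUpTo? (\p -> B p ≟ g) n
... | no h = g , record { lt = c<g ; free = \p p< e -> h (p , p< , e) ; fill = fill }
gap-from n B c b bd zero g c<g d≥ fill | yes (p , p< , e) = clash "a<bc-ac=b; 3302" (b , g , B p) (≤-trans d≥ (≤-refl {g}) , bd p p< , e)
gap-from n B c b bd (suc d) g c<g d≥ fill | yes o =
 gap-from n B c b bd d (suc g) (m<n⇒m<1+n c<g) (≤-trans d≥ (≤-reflexive (sym (+-suc d g)))) fill'
 where
 fill' : ∀ j -> c < j -> j < suc g -> Occ n B j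
 fill' j j₁ j₂ with j ≟ g
 ... | yes refl = o
 ... | no ne = fill j j₁ (≤∧≢⇒< (≤-pred j₂) ne)

gap-exists : ∀ {l b w r T B} -> Row l b w r T B -> ∀ c -> ∃ \g -> Gap (suc r) B c g
gap-exists {b = b} {r = r} {B = B} row c =
 gap-from (suc r) B c b (\p p< -> Row.bd row p (≤-pred p<)) (suc b) (suc c) ≤-refl
  (≤-trans (m≤m+n (suc b) c) (≤-trans (n≤1+n _) (≤-reflexive (sym (+-suc (suc b) c)))))
  (\j j₁ j₂ -> ⊥-elim (<⇒≱ j₁ (≤-pred j₂)))

×-dec : ∀ {P Q : Set} -> Dec P -> Dec Q -> Dec (P × Q)
×-dec (yes a) (yes b) = yes (a , b)
×-dec (no a) _ = no (\h -> a (proj₁ h))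
×-dec (yes _) (no b) = no (\h -> b (proj₂ h))

-- Pipe `r` always turns in its row, so `g ≤ B r` already provides a candidate.
first-exists : ∀ {l b w r T B} -> Row l b w r T B -> ∀ g -> g ≤ B r -> ∃ \m -> First r T B g m
first-exists {r = r} {T} {B} row g g≤
 with argmin {\z -> g ≤ B z × B z < T z} (\z -> ×-dec (g ≤? B z) (B z <? T z)) B (suc r)
    (r , ≤-refl , g≤ , RowFacts.r-hop row)
... | m , m< , (h , h') , mn = m , ≤-pred m< , h , h' , least
 where
 least : ∀ z -> z ≤ r -> B z < g ⊎ T z ≤ B z ⊎ B m ≤ B z
 least z z≤ with g ≤? B z | B z <? T z
 ... | no a | _ = inj₁ (≰⇒> a)
 ... | _ | no b = inj₂ (inj₁ (≮⇒≥ b))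
 ... | yes a | yes b = inj₂ (inj₂ (mn z (s≤s z≤) (a , b)))

inside? : ∀ r T B c -> Inside r T B c ⊎ Outside r T B c
inside? r T B c with anyUpTo? (\s -> ×-dec (B s <? c) (c <? T s)) (suc r)
... | yes (s , s< , h) = inj₁ (s , ≤-pred s< , h)
... | no n = inj₂ out
 where
 out : ∀ s -> s ≤ r -> c ≤ B s ⊎ T s ≤ c
 out s s≤ with B s <? c | c <? T s
 ... | no a | _ = inj₁ (≮⇒≥ a)
 ... | _ | no b = inj₂ (≮⇒≥ b)
 ... | yes a | yes b = ⊥-elim (n (s , s≤s s≤ , a , b))

-- The pipe leaving in this row runs east without end. If it does not cross column `T m`, it turns
-- to the right of that column, and by `no-start` not before `g`.
outside-start : ∀ {l b w r T B m g} -> Row l b w r T B -> LMove w r T m g -> Outside r T B (T m) -> g ≤ B r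
outside-start {l} {b} {w} {r} {T} {B} {m} {g} row v out =
 (lia "c=de<db<cf-ee-bc-e|c-bb-ea-b||ighefcb@;a-b 0202480690003221004c19b002a33h2g2b03706" (g , B r , T r , w , T m , B m , m , r , l) (top , hi m m<r , r-hop , le m m≤ , out r ≤-refl , no-start r ≤-refl , pair m r m≤ ≤-refl (<⇒≢ m<r)))
 where
 open RowFacts row
 open LMove v using (m<r)
 open MoveFacts row v

L-total : ∀ {l b w k x r T B} -> Row l b w r T B -> x ≤ k -> (k ≤ r -> Rigid r T B) ->
 ∀ s -> LValid k w r T s -> ∃ \s' -> LStep k x r T B s s'
L-total {x = x} {r} {T} {B} row x≤k rig none v with suc r ≟ x
... | no n = none , ln n
... | yes e with first-exists row 0 z≤n
... | m , fst with gap-exists row (B m)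
... | g , gp = mov m g , ls m g e fst gp
L-total {k = k} {r = r} {T} {B} row x≤k rig (mov m g) v with inside? r T B (T m)
... | inj₁ i = mov m g , l1 i
... | inj₂ out with r <? k
... | yes r<k with first-exists row g (outside-start row v out)
... | m' , fst with gap-exists row (B m')
... | g' , gp = mov m' g' , l2 m' g' r<k out fst gp
L-total {k = k} {r = r} {T} {B} row x≤k rig (mov m g) v | inj₂ out | no r≮k = dead m r , lf (≮⇒≥ r≮k) br
 where
 open LMove v
 open Gap gap
 open Rigid (rig (≮⇒≥ r≮k))
 -- By rigidity all columns left of the turn of `r` are occupied, while `g` is free: the landing
 -- cell is that of the turn.
 br : B r ≡ g
 br with B r ≤? g
 ... | yes h = ≤-antisym h (outside-start row v out)
 ... | no h with full g (≤-trans (s≤s z≤n) lt) (≰⇒> h)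
 ... | p , p< , e = ⊥-elim (free p p< e)
L-total row x≤k rig (dead m z) v = dead m z , ld

L-valid : ∀ {l b w k x r T B s s'} (T' B' : ℕ -> ℕ) -> Row l b w r T B -> suc b < w -> l ≤ k ->
 (k ≤ r -> Rigid r T B) -> LValid k w r T s -> LStep k x r T B s s' -> LMoved T T' s -> LMoved B B' s' ->
 (∀ {m z} -> s ≡ dead m z -> k ≤ r) ->
 LValid k (suc w) (suc r) B s' × Row l (suc b) w r T' B'
L-valid T' B' row bw' l≤k rig v (ln _) (mnone eT) (mnone eB) k≤ = tt , weaken-b T' B' row bw' eT eB
L-valid T' B' row bw' l≤k rig v (ls m g _ fst gp) (mnone eT) (mmov e eB) k≤ = ls-valid row T' B' bw' fst gp eT e eB
L-valid T' B' row bw' l≤k rig v (l1 i) (mmov e eT) (mmov e' eB) k≤ = l1-valid row T' B' bw' v i e eT e' eB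
L-valid T' B' row bw' l≤k rig v (l2 m' g' _ out fst gp) (mmov e eT) (mmov e' eB) k≤ = l2-valid row T' B' bw' v out fst gp e eT e' eB
L-valid T' B' row bw' l≤k rig v (lf k≤r br) (mmov e eT) (mdead e' e'' eB) k≤ = lf-valid row T' B' bw' (rig k≤r) l≤k k≤r v br e eT e' e'' eB
L-valid T' B' row bw' l≤k rig v ld (mdead e e' eT) (mdead e'' e‴ eB) k≤ = ld-valid row T' B' bw' (rig (k≤ refl)) l≤k (k≤ refl) v e e' eT e'' e‴ eB

gap-unique : ∀ {n B c g g'} -> Gap n B c g -> Gap n B c g' -> g ≡ g'
gap-unique {g = g} {g'} a a' with <-cmp g g'
... | tri≈ _ e _ = e
... | tri< h _ _ with Gap.fill a' g (Gap.lt a) h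
... | p , p< , e = ⊥-elim (Gap.free a p p< e)
gap-unique {g = g} {g'} a a' | tri> _ _ h with Gap.fill a g' (Gap.lt a') h
... | p , p< , e = ⊥-elim (Gap.free a' p p< e)

first-unique : ∀ {l b w r T B g m m'} -> Row l b w r T B -> First r T B g m -> First r T B g m' -> m ≡ m'
first-unique {T = T} {B} {g} {m} {m'} row (m≤ , g≤ , hop , fst) (m'≤ , g≤' , hop' , fst') =
 RowFacts.inj-B row m m' m≤ m'≤ (lia "c-ac-ba<db<ea<cd-ab-a||b<ce-ba-b||;a=b 0126000250082100328000270220" (B m , B m' , g , T m , T m') (g≤ , g≤' , hop , hop' , fst' m m≤ , fst m' m'≤))

inside-outside : ∀ {r T B c} -> Inside r T B c -> Outside r T B c -> ⊥
inside-outside {T = T} {B} {c} (s , s≤ , a , b) out = clash "a<bc<aa-cb-a|; 00220230" (c , T s , B s) (b , a , out s s≤)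

-- Only for rows up to `k`, where `lf` is excluded; further down the runs are compared by rigidity
-- instead.
L-det : ∀ {l b w k x r T B s s₁ s₂} -> Row l b w r T B -> r < k ->
 LStep k x r T B s s₁ -> LStep k x r T B s s₂ -> s₁ ≡ s₂
L-det row r<k (ln _) (ln _) = refl
L-det row r<k (ln n) (ls _ _ e _ _) = ⊥-elim (n e)
L-det row r<k (ls _ _ e _ _) (ln n) = ⊥-elim (n e)
L-det row r<k (ls m g _ f gp) (ls m' g' _ f' gp') with refl ← first-unique row f f' = cong (mov m) (gap-unique gp gp')
L-det row r<k (l1 _) (l1 _) = refl
L-det row r<k (l1 i) (l2 _ _ _ out _ _) = ⊥-elim (inside-outside i out)
L-det row r<k (l2 _ _ _ out _ _) (l1 i) = ⊥-elim (inside-outside i out)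
L-det row r<k (l2 m g _ _ f gp) (l2 m' g' _ _ f' gp') with refl ← first-unique row f f' = cong (mov m) (gap-unique gp gp')
L-det row r<k (l1 _) (lf k≤ _) = ⊥-elim (<⇒≱ r<k k≤)
L-det row r<k (l2 _ _ _ _ _ _) (lf k≤ _) = ⊥-elim (<⇒≱ r<k k≤)
L-det row r<k (lf k≤ _) _ = ⊥-elim (<⇒≱ r<k k≤)
L-det row r<k ld ld = refl

-- The two insertions in one row

-- While `q` and `z` have traded places, the pipe in a given place is called `m` before and `m'`
-- after the trade.
Swap : (q z m m' : ℕ) -> Set
Swap q z m m' = (m ≡ q × m' ≡ z) ⊎ (m ≡ z × m' ≡ q) ⊎ (m ≢ q × m ≢ z × m' ≡ m)

-- The possible states, at one height, of: left insertion into D, right insertion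
-- into D, right insertion after left insertion, left insertion after right insertion.
data Sq (T : ℕ -> ℕ) : LState -> RState -> RState -> LState -> Set where
 idleL    : ∀ {s} -> Sq T none s s none
 idleR    : ∀ {s} -> Sq T s none none s
 disjoint : ∀ {m g q} -> m ≢ q -> g ≢ suc (T q) -> Sq T (mov m g) (act q) (act q) (mov m g)
 twice    : ∀ {q g g'} -> g ≡ suc (T q) -> g' ≡ suc g -> Sq T (mov q g) (act q) (act q) (mov q g')
 chase    : ∀ {p q g g'} -> p ≢ q -> T p ≡ suc (T q) -> g ≡ suc (T p) -> g' ≡ T p ->
  Sq T (mov p g) (act p) (act q) (mov q g')
 release  : ∀ {q z g} -> T z ≡ suc (T q) -> Sq T (mov z g) (wait q z) (act q) (mov z g)
 hold     : ∀ {q m g g'} -> m ≢ q -> g ≡ suc (T q) -> g' ≡ T q ->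
  Sq T (mov m g) (act q) (wait q m) (mov m g')
 both     : ∀ {q z m m' g} -> Swap q z m m' -> Sq T (mov m g) (wait q z) (wait q z) (mov m' g)

gap-suc : ∀ {n B c g} -> Gap n B c g -> (∀ p -> p < n -> B p ≢ suc c) -> g ≡ suc c
gap-suc {c = c} {g} gp fr with g ≟ suc c
... | yes e = e
... | no ne with Gap.fill gp (suc c) ≤-refl (≤∧≢⇒< (Gap.lt gp) (≢-sym ne))
... | p , p< , e = ⊥-elim (fr p p< e)

suc-gap : ∀ {n B c} -> (∀ p -> p < n -> B p ≢ suc c) -> Gap n B c (suc c)
suc-gap fr = record { lt = ≤-refl ; free = fr ; fill = \j j₁ j₂ -> ⊥-elim (<⇒≱ j₁ (≤-pred j₂)) }

Separate : (r : ℕ) (T B : ℕ -> ℕ) (g : ℕ) -> Set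
Separate r T B g = ∀ p -> p ≤ r -> T p ≤ B p ⊎ g ≤ B p ⊎ T p < g

-- By `no-start` a pipe turning left of `g` turns no further right than `T m`. To reach `g` it would
-- have to cross column `T m`, against `Outside`, or to turn in the cell where `m` goes up, which
-- would be a bump.
separate : ∀ {l b w r T B m g} -> Row l b w r T B -> LMove w r T m g -> Outside r T B (T m) -> Separate r T B g
separate {l} {r = r} {T} {B} {m} {g} row v out p p≤ with p ≟ m
... | yes refl = lia "a<c;a-bc-ba<c|| 210" (T m , B m , g) (Gap.lt (LMove.gap v))
... | no ne = lia "d<ce-dd-ba-d|a-bb-dc-b||hfgabde@;a-bc-ba<c|| 020229000034c18400231003i2a2a32903605" (T p , B p , g , T m , B m , p , m , l) (Gap.lt (LMove.gap v) , RowFacts.le row m (MoveFacts.m≤ row v) , out p p≤ , MoveFacts.no-start row v p p≤ , RowFacts.pair row p m p≤ (MoveFacts.m≤ row v) ne)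

Result : (l k x y r : ℕ) (TL BL TR BR B : ℕ -> ℕ) -> LState -> RState -> RState -> LState -> Set
Result l k x y r TL BL TR BR B sL sR sR' sL' = ∃ \sR'' -> ∃ \sL'' ->
 RStep l y r TL BL sR' sR'' × LStep k x r TR BR sL' sL'' × Sq B sL sR sR'' sL''

-- Common to the cases in which left insertion starts, or lands in a column `g` that is the same in
-- both orders. The pipe `m̃` taking over after right insertion need not be the pipe `m` taking over
-- in the original grid.
HopResult : (l y r : ℕ) (TL BL TR BR B : ℕ -> ℕ) (g m g' : ℕ) -> RState -> RState -> Set
HopResult l y r TL BL TR BR B g m g' sR sR' = ∃ \sR'' -> ∃ \m̃ -> ∃ \g̃ ->
 RStep l y r TL BL sR' sR'' × (First r TR BR g m̃ × Gap (suc r) BR (BR m̃) g̃) × Sq B (mov m g') sR sR'' (mov m̃ g̃)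

module _ {l b w y r : ℕ} {T B : ℕ -> ℕ} (row : Row l b w r T B) (TL BL TR BR : ℕ -> ℕ) where
 open RowFacts row

 -- Which shape of `Sq` arises depends on the new pipe `m`: if it is `q` itself, then `twice`, or
 -- `both` when `q` is just trading places; if it is the pipe that `q` bumps into, then `chase` or
 -- `release`; if its gap opens just right of `q`, then `hold`, since after left insertion `m` is in
 -- the way of `q`.
 act-hop : ∀ {q sR g m g'} -> RAct l w r T q -> RStep l y r T B (act q) sR -> RValid l (suc w) (suc r) B sR ->
  RMoved T TR (act q) -> RMoved B BR sR ->
  Separate r T B g -> g ≢ suc (T q) -> TL q ≡ T q ->
  First r T B g m -> Gap (suc r) B (B m) g' -> BL m ≡ g' -> (∀ p -> p ≢ m -> BL p ≡ B p) ->
  HopResult l y r TL BL TR BR B g m g' sR (act q)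
 act-hop {q} {sR} {g} {m} {g'} a (ra nb) a' (mact tq tp) (mact bq bp) sep g≢ tlq (m≤ , g≤ , hop , fst) gp blm bl = main
  where
  open RAct a using (red)
  open ActFacts row a
  open Gap gp
  open HopGap row m≤ hop gp
  freeB : ∀ p -> p ≤ r -> B p ≢ suc (B q)
  freeB p p≤ = RAct.free a' p (s≤s p≤)
  main : HopResult l y r TL BL TR BR B g m g' (act q) (act q)
  main with m ≟ q
  ... | yes refl = act q , q , suc (suc (B q)) , ra nbL ,
    ((m≤ , (lia "a-cb=1c;a-b 3320" (g , BR q , B q) (g≤ , bq)) , (lia "c<da=1cb=1d;a<b 44053" (BR q , TR q , B q , T q) (hop , bq , tq)) , least) , subst (\c -> Gap (suc r) BR c (suc (suc (B q)))) (sym bq) (suc-gap freeR)) ,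
    twice g'≡ (cong suc (sym g'≡))
   where
   g'≡ : g' ≡ suc (B q)
   g'≡ = gap-suc gp (\p p< -> freeB p (≤-pred p<))
   nbL : ∀ z -> z ≤ r -> BL z ≢ suc (TL q)
   nbL z z≤ with z ≟ q
   ... | yes refl = lia "c=1da=cd<eb=e;a≠1b 562074" (BL z , TL z , g' , B z , T z) (g'≡ , blm , hop , tlq)
   ... | no n = lia "a=cb=dc≠1d;a≠1b 004650247304" (BL z , TL q , B z , T q) (bl z n , tlq , nb z z≤)
   least : ∀ z -> z ≤ r -> BR z < g ⊎ TR z ≤ BR z ⊎ BR q ≤ BR z
   least z z≤ with z ≟ q
   ... | yes refl = inj₂ (inj₂ ≤-refl)
   ... | no n = lia "e<fc=ga=hd=1eh<bg-he-h||kijghfe@;a<bc-ad-a|| 013c60004c906025eb128005d19e8004kh0e2i0" (BR z , g , TR z , BR q , B q , T q , T z , B z , z , q , l) (hop , tp z n , bp z n , bq , fst z z≤ , pair z q z≤ m≤ n)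
   freeR : ∀ p -> p < suc r -> BR p ≢ suc (suc (B q))
   freeR p p< e with p ≟ q
   ... | yes refl = clash "a=2ba=1b; 221" (BR p , B p) (e , bq)
   ... | no n = clash "a<bc-de<fg=cg=2ec≠1fbhadcfe@; 01014a158006693187002h44be3047054" (q , l , B p , T p , B q , T q , BR p , p) (red , le p (≤-pred p<) , hop , bp p n , e , nb p (≤-pred p<) , pair p q (≤-pred p<) m≤ n)
  ... | no m≢ with g' ≟ suc (T q)
  ... | yes g'≡ = wait q m , m , T q ,
    rc m m≤ (lia "c=1da=cb=d;a=1b 064530246104" (BL m , TL q , g' , T q) (g'≡ , blm , tlq)) (proj₁ ins) ,
    ((m≤ , (lia "a-cb=c;a-b 3320" (g , BR m , B m) (g≤ , bm)) , (lia "c<da=cb=d;a<b 44053" (BR m , TR m , B m , T m) (hop , bm , tp m m≢)) , least) , record { lt = (lia "a=cd-ef=bc<b;a<b 3650" (BR m , T q , B m , l , m , B q) (bm , ins)) ; free = freeR ; fill = fillR }) ,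
    hold m≢ (trans g'≡ (cong suc (sym (proj₁ (proj₂ ins))))) (sym (proj₁ (proj₂ ins)))
   where
   bm : BR m ≡ B m
   bm = bp m m≢
   -- Pipe `m` jumps into the column just right of `q`, so its horizontal part crosses `q`. Hence
   -- `q` is vertical in this row, and `m`, being the horizontal pipe, is not below `l`.
   ins : l ≤ m × B q ≡ T q × B m < T q
   ins = lia "f-ge<ff=1dc-dabhgedc@;a-bc=de<d 0047134003761003d2a0e25000004e30d4e0cd250" (l , m , B q , T q , B m , g' , T m , q) (g≤T , lt , g'≡ , le q q≤ , pair m q m≤ q≤ m≢)
   least : ∀ z -> z ≤ r -> BR z < g ⊎ TR z ≤ BR z ⊎ BR m ≤ BR z
   least z z≤ with z ≟ q
   ... | yes refl = lia "a=1ec=1fg-he=fi<f;a<bc-ad-a|| 49516" (BR z , g , TR z , BR m , B z , T z , l , m , B m) (bq , tq , ins)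
   ... | no n = lia "c=ea=fd=gf<be-fg-f||;a<bc-ad-a|| 003a50004a80549405" (BR z , g , TR z , BR m , T z , B z , B m) (tp z n , bp z n , bm , fst z z≤)
   freeR : ∀ p -> p < suc r -> BR p ≢ T q
   freeR p p< e with p ≟ q
   ... | yes refl = clash "a=ba=1cd-ec=bf<b; 3714" (BR p , T p , B p , l , m , B m) (e , bq , ins)
   ... | no n = n (inj-B p q (≤-pred p<) q≤ (lia "c=ac=de-fb=dg<d;a=b 084803547620" (B p , B q , BR p , T q , l , m , B m) (bp p n , e , ins)))
   fillR : ∀ j -> BR m < j -> j < T q -> Occ (suc r) BR j
   fillR j j₁ j₂ with fill j (lia "c<bc=a;a<b 3302" (B m , j , BR m) (j₁ , bm)) (lia "a<cb=1c;a<b 3320" (j , g' , T q) (j₂ , g'≡))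
   ... | p , p< , e with p ≟ q
   ... | yes refl = clash "a<bc=ad-ec=bf<b; 3615" (j , T p , B p , l , m , B m) (j₂ , e , ins)
   ... | no n = p , p< , trans (bp p n) e
  ... | no g'≢ = act q , m , g' , ra nbL ,
    ((m≤ , (lia "a-cb=c;a-b 3320" (g , BR m , B m) (g≤ , bm)) , (lia "c<da=cb=d;a<b 44053" (BR m , TR m , B m , T m) (hop , bm , tp m m≢)) , least) , record { lt = (lia "c<ba=c;a<b 3312" (BR m , g' , B m) (lt , bm)) ; free = freeR ; fill = fillR }) ,
    disjoint m≢ g'≢B
   where
   bm : BR m ≡ B m
   bm = bp m m≢
   over : B q ≤ B m ⊎ g' < B q
   over with g' ≤? suc (T q)
   ... | yes h = lia "c-dc-1ea≠cc≠1ehfgdbea@;a-bc<a| 0202023381004b431004g9e03980250260" (B q , B m , g' , T m , T q , m , q , l) (g≤T , h , free q (s≤s q≤) , g'≢ , pair m q m≤ q≤ m≢)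
   ... | no h with suc (T q) ≤? B m
   ... | yes h' = lia "a-dd<b;a-bc<a| 3310" (B q , B m , g' , T q) (le q q≤ , h')
   ... | no h' with fill (suc (T q)) (≰⇒> h') (≰⇒> h)
   ... | p , p< , e = ⊥-elim (nb p (≤-pred p<) e)
   g'≢B : g' ≢ suc (B q)
   g'≢B e = clash "a<bb=1cc≠ac-ab<c|; 01354001210240" (B m , g' , B q) (lt , e , inj , over)
    where
    inj : B q ≢ B m
    inj e' = m≢ (inj-B m q m≤ q≤ (sym e'))
   nbL : ∀ z -> z ≤ r -> BL z ≢ suc (TL q)
   nbL z z≤ with z ≟ m
   ... | yes refl = lia "a=cb=dc≠1d;a≠1b 004650247304" (BL z , TL q , g' , T q) (blm , tlq , g'≢)
   ... | no n = lia "a=cb=dc≠1d;a≠1b 004650247304" (BL z , TL q , B z , T q) (bl z n , tlq , nb z z≤)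
   least : ∀ z -> z ≤ r -> BR z < g ⊎ TR z ≤ BR z ⊎ BR m ≤ BR z
   least z z≤ with z ≟ q
   ... | yes refl = lia "d=ea=1fc=1gg-fb-fg<b||f<bg-fe-f||;a<bc-ad-a|| 014a4050002210004d7084cb084cb50" (BR z , g , TR z , BR m , B m , B z , T z) (bm , bq , tq , sep z z≤ , fst z z≤)
   ... | no n = lia "c=ea=fd=gf<be-fg-f||;a<bc-ad-a|| 003a50004a80549405" (BR z , g , TR z , BR m , T z , B z , B m) (tp z n , bp z n , bm , fst z z≤)
   freeR : ∀ p -> p < suc r -> BR p ≢ g'
   freeR p p< e with p ≟ q
   ... | yes refl = clash "a=ba=1cb≠1c; 0035023430" (BR p , g' , B p) (e , bq , g'≢B)
   ... | no n = clash "a=ba=cc≠b; 0034303502" (BR p , g' , B p) (e , bp p n , free p p<)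
   fillR : ∀ j -> BR m < j -> j < g' -> Occ (suc r) BR j
   fillR j j₁ j₂ with fill j (lia "c<bc=a;a<b 3302" (B m , j , BR m) (j₁ , bm)) j₂
   ... | p , p< , e with p ≟ q
   ... | yes refl = clash "a<bc=ad<ad=ec-eb<c|; 00450243706" (j , g' , B p , BR m , B m) (j₂ , e , j₁ , bm , over)
   ... | no n = p , p< , trans (bp p n) e
 act-hop {q} {sR} {g} {m} {g'} a (rb z z≤ bz redz) a' (mact tq tp) (mact bq bp) sep g≢ tlq (m≤ , g≤ , hop , fst) gp blm bl = main
  where
  open RAct a using (red)
  open ActFacts row a
  open Gap gp
  open HopGap row m≤ hop gp
  q≢z : q ≢ z
  q≢z refl = clash "a-ba=1b; 220" (B q , T q) (le q q≤ , bz)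
  brq : BR q ≡ B q
  brq = bp q q≢z
  trz : TR z ≡ T z
  trz = tp z (≢-sym q≢z)
  main : HopResult l y r TL BL TR BR B g m g' (act z) (act q)
  main with m ≟ z
  ... | yes refl = act q , q , B z , ra nbL ,
    ((q≤ , (lia "a-cd=ec=1eb=da≠1e;a-b 0049062570856" (g , BR q , B m , B q , T q) (g≤ , upq , bz , brq , g≢)) , (lia "c=da=cb=1d;a<b 45063" (BR q , TR q , B q , T q) (upq , brq , tq)) , least) ,
     subst₂ (\c d -> Gap (suc r) BR c d) (trans (sym upq) (sym brq)) (sym bz) (suc-gap freeR)) ,
    chase (≢-sym q≢z) (trans bz (cong suc (sym upq))) (gap-suc gp (RAct.free a')) refl
   where
   -- If `q` turned in this row, its turn would precede that of `z`, hence lie left of `g`. By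
   -- `Separate` also `T q < g`; as `g ≤ B z = T q + 1`, this leaves `g = T q + 1`, which is
   -- excluded.
   upq : B q ≡ T q
   upq = lia "c-da-bd=1bc≠1bb-ac-ab<c||a<cb-ad-a||;a=b 07030322000042100025035902203860260" (B q , T q , g , B m) (g≤ , le q q≤ , bz , g≢ , sep q q≤ , fst q q≤)
   nbL : ∀ p -> p ≤ r -> BL p ≢ suc (TL q)
   nbL p p≤ e with p ≟ z
   ... | yes refl = clash "a<bc=ba=1de=dc=1e; 586134" (B p , g' , BL p , T q , TL q) (lt , blm , bz , tlq , e)
   ... | no n = n (inj-B p z p≤ z≤ (lia "b=1cd=ae=cd=1e;a=b 08560831570524" (B p , B m , T q , BL p , TL q) (bz , bl p n , tlq , e)))
   least : ∀ p -> p ≤ r -> BR p < g ⊎ TR p ≤ BR p ⊎ BR q ≤ BR p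
   least p p≤ with p ≟ z | p ≟ q
   ... | yes refl | _ = lia "e=fg=1fd=ea=1g;a<bc-ad-a|| 574083" (BR p , g , TR p , BR q , B q , T q , B p) (upq , bz , brq , bq)
   ... | no _ | yes refl = inj₂ (inj₂ ≤-refl)
   ... | no n | no n' = lia "e=fg=1fc=ha=id=ei<bh-ig-i||;a<bc-ad-a|| 003e50004e8056c905d4" (BR p , g , TR p , BR q , B q , T q , B m , T p , B p) (upq , bz , tp p n' , bp p n , brq , fst p p≤)
   freeR : ∀ p -> p < suc r -> BR p ≢ suc (T q)
   freeR p p< e with p ≟ z
   ... | yes refl = clash "a=1bc=1bc=1a; 3403" (B p , T q , BR p) (bz , e , bq)
   ... | no n = n (inj-B p z (≤-pred p<) z≤ (lia "b=1cd=ad=1c;a=b 064406145032" (B p , B m , T q , BR p) (bz , bp p n , e)))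
  ... | no m≢ = act z , m , g' , rb z z≤ (lia "c=1da=cb=d;a=1b 064530246104" (BL z , TL q , B z , T q) (bz , bl z (≢-sym m≢) , tlq)) redz ,
    ((m≤ , (lia "a-cb=c;a-b 3320" (g , BR m , B m) (g≤ , bm)) , hopR , least) , record { lt = (lia "c<ba=c;a<b 3312" (BR m , g' , B m) (lt , bm)) ; free = freeR ; fill = fillR }) ,
    disjoint m≢ g'≢
   where
   bm : BR m ≡ B m
   bm = bp m m≢
   pmz : Apart l m z (T m) (B m) (T z) (B z)
   pmz = pair m z m≤ z≤ m≢
   zhop = lia "a-ba=1cb≠1c;a<b 0034023530" (B z , T z , T q) (le z z≤ , bz , free≤ z z≤)
   hopR : BR m < TR m
   hopR with m ≟ q
   ... | yes refl = lia "c<da=cb=1d;a<b 44053" (BR m , TR m , B m , T m) (hop , bm , tq)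
   ... | no n = lia "c<da=cb=d;a<b 44053" (BR m , TR m , B m , T m) (hop , bm , tp m n)
   least : ∀ p -> p ≤ r -> BR p < g ⊎ TR p ≤ BR p ⊎ BR m ≤ BR p
   least p p≤ with p ≟ z | p ≟ q
   ... | yes refl | _ = lia "c=ed=fa=1ge-gb-ge<b||g<be-gf-g||;a<bc-ad-a|| 014a8030002210004db064c9064cb90" (BR p , g , TR p , BR m , T p , B m , B p) (trz , bm , bq , sep p p≤ , fst p p≤)
   ... | no _ | yes refl = lia "e<fg-hi-je=1ha=gd=ig<bh-gi-g||e<bf-ei-e||mkljife@;a<bc-ad-a|| 023f7000035da0h9002f0047f1e4bia003i130038302n04e607" (BR p , g , TR p , BR m , B z , T z , B p , T p , B m , T m , m , z , l) (zhop , le p p≤ , le m m≤ , bz , brq , bm , fst p p≤ , fst z z≤ , pmz)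
   ... | no n | no n' = lia "c=ea=fd=gf<be-fg-f||;a<bc-ad-a|| 003a50004a80549405" (BR p , g , TR p , BR m , T p , B p , B m) (tp p n' , bp p n , bm , fst p p≤)
   g'≢ : g' ≢ suc (B z)
   g'≢ e = clash "a-bc<aa=1dd<ehfgbced@; 0037140047641003d0c4b90a" (g' , T m , B m , B z , T z , m , z , l) (g≤T , lt , e , zhop , pmz)
   freeR : ∀ p -> p < suc r -> BR p ≢ g'
   freeR p p< e with p ≟ z
   ... | yes refl = clash "a=ba=1cb≠1c; 0035023430" (BR p , g' , B p) (e , bq , g'≢)
   ... | no n = clash "a=ba=cc≠b; 0034303502" (BR p , g' , B p) (e , bp p n , free p p<)
   fillR : ∀ j -> BR m < j -> j < g' -> Occ (suc r) BR j
   fillR j j₁ j₂ with fill j (lia "c<bc=a;a<b 3302" (B m , j , BR m) (j₁ , bm)) j₂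
   ... | p , p< , e with p ≟ z
   ... | yes refl = clash "a<bc=ab-de<ac<fe=gjhidgfc@; 004a71900596147005gd09c4eb0f" (j , g' , B p , T m , BR m , T p , B m , m , p , l) (j₂ , e , g≤T , j₁ , zhop , bm , pmz)
   ... | no n = p , p< , trans (bp p n) e
 act-hop {q} {sR} {g} {m} {g'} a (rc z z≤ bz bluez) a' (mact tq tp) (mwait bq bz' bp) sep g≢ tlq (m≤ , g≤ , hop , fst) gp blm bl = main
  where
  open RAct a using (red)
  open ActFacts row a
  open Gap gp
  open HopGap row m≤ hop gp
  q≢z : q ≢ z
  q≢z refl = clash "a-ba=1b; 220" (B q , T q) (le q q≤ , bz)
  trz : TR z ≡ T z
  trz = tp z (≢-sym q≢z)
  zhop = lia "a-ba=1cb≠1c;a<b 0034023530" (B z , T z , T q) (le z z≤ , bz , free≤ z z≤)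
  freeR : ∀ p -> p < suc r -> BR p ≢ g'
  freeR p p< e with p ≟ q | p ≟ z
  ... | yes refl | _ = free z (s≤s z≤) (trans (sym bq) e)
  ... | no _ | yes refl = free q (s≤s q≤) (trans (sym bz') e)
  ... | no n | no n' = free p p< (trans (sym (bp p n n')) e)
  occR : ∀ {j} -> Occ (suc r) B j -> Occ (suc r) BR j
  occR (p , p< , e) with p ≟ q | p ≟ z
  ... | yes refl | _ = z , s≤s z≤ , trans bz' e
  ... | no _ | yes refl = q , s≤s q≤ , trans bq e
  ... | no n | no n' = p , p< , trans (bp p n n') e
  main : HopResult l y r TL BL TR BR B g m g' (wait q z) (act q)
  main with m ≟ z
  ... | yes refl = act q , z , g' , ra nbL ,
    ((z≤ , (lia "a-cd=ec=1eb=da≠1e;a-b 0049062570856" (g , BR m , B m , B q , T q) (g≤ , upq , bz , bz' , g≢)) , (lia "c-de<fe=1db=fa=c;a<b 6817462" (BR m , TR m , B q , T q , B m , T m) (le q q≤ , hop , bz , trz , bz')) , least) , record { lt = (lia "c<bd-ec=1ea=d;a<b 561425" (BR m , g' , B m , B q , T q) (lt , le q q≤ , bz , bz')) ; free = freeR ; fill = fillR }) ,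
    release (trans bz (cong suc (sym upq)))
   where
   upq : B q ≡ T q
   upq = lia "c-da-bd=1bc≠1bb-ac-ab<c||a<cb-ad-a||;a=b 07030322000042100025035902203860260" (B q , T q , g , B m) (g≤ , le q q≤ , bz , g≢ , sep q q≤ , fst q q≤)
   nbL : ∀ p -> p ≤ r -> BL p ≢ suc (TL q)
   nbL p p≤ e with p ≟ z
   ... | yes refl = clash "a<bc=ba=1de=dc=1e; 586134" (B p , g' , BL p , T q , TL q) (lt , blm , bz , tlq , e)
   ... | no n = n (inj-B p z p≤ z≤ (lia "b=1cd=ae=cd=1e;a=b 08560831570524" (B p , B m , T q , BL p , TL q) (bz , bl p n , tlq , e)))
   least : ∀ p -> p ≤ r -> BR p < g ⊎ TR p ≤ BR p ⊎ BR z ≤ BR p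
   least p p≤ with p ≟ q | p ≟ z
   ... | yes refl | _ = lia "e=1fa=ec=1f;a<bc-ad-a|| 47142" (BR p , g , TR p , BR m , B m , T p) (bz , bq , tq)
   ... | no _ | yes refl = inj₂ (inj₂ ≤-refl)
   ... | no n | no n' = lia "e=fg=1fc=ha=id=ei<bh-ig-i||;a<bc-ad-a|| 003e50004e8056c905d4" (BR p , g , TR p , BR m , B q , T q , B m , T p , B p) (upq , bz , tp p n , bp p n n' , bz' , fst p p≤)
   fillR : ∀ j -> BR z < j -> j < g' -> Occ (suc r) BR j
   fillR j j₁ j₂ with B z <? j
   ... | yes h = occR (fill j h j₂)
   ... | no h = q , s≤s q≤ , (lia "b<1cd<be=fc=1fd=ea=c;a=b 0a3a106902673" (BR q , j , B m , BR m , B q , T q) (≰⇒> h , j₁ , upq , bz , bz' , bq))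
  ... | no m≢z with m ≟ q
  ... | yes refl = wait q z , z , g' , rc z z≤ (lia "c=1da=cb=d;a=1b 064530246104" (BL z , TL m , B z , T m) (bz , bl z (≢-sym q≢z) , tlq)) bluez ,
    ((z≤ , (lia "a-cb=c;a-b 3320" (g , BR z , B m) (g≤ , bz')) , (lia "c<de<fc=1fb=da=e;a<b 6816472" (BR z , TR z , B z , T z , B m , T m) (zhop , hop , bz , trz , bz')) , least) , record { lt = (lia "c<ba=c;a<b 3312" (BR z , g' , B m) (lt , bz')) ; free = freeR ; fill = \j j₁ j₂ -> occR (fill j (lia "c<bc=a;a<b 3302" (B m , j , BR z) (j₁ , bz')) j₂) }) ,
    both (inj₁ (refl , refl))
   where
   least : ∀ p -> p ≤ r -> BR p < g ⊎ TR p ≤ BR p ⊎ BR z ≤ BR p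
   least p p≤ with p ≟ q | p ≟ z
   ... | yes refl | _ = lia "e<fg=1fd=ea=g;a<bc-ad-a|| 564073" (BR p , g , TR p , BR z , B p , T p , B z) (hop , bz , bz' , bq)
   ... | no _ | yes refl = inj₂ (inj₂ ≤-refl)
   ... | no n | no n' = lia "c=ea=fd=gf<be-fg-f||;a<bc-ad-a|| 003a50004a80549405" (BR p , g , TR p , BR z , T p , B p , B m) (tp p n , bp p n n' , bz' , fst p p≤)
  ... | no m≢q = wait q z , m , g' , rc z z≤ (lia "c=1da=cb=d;a=1b 064530246104" (BL z , TL q , B z , T q) (bz , bl z (≢-sym m≢z) , tlq)) bluez ,
    ((m≤ , (lia "a-cb=c;a-b 3320" (g , BR m , B m) (g≤ , bm)) , (lia "c<da=cb=d;a<b 44053" (BR m , TR m , B m , T m) (hop , bm , tp m m≢q)) , least) , record { lt = (lia "c<ba=c;a<b 3312" (BR m , g' , B m) (lt , bm)) ; free = freeR ; fill = \j j₁ j₂ -> occR (fill j (lia "c<bc=a;a<b 3302" (B m , j , BR m) (j₁ , bm)) j₂) }) ,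
    both (inj₂ (inj₂ (m≢q , m≢z , refl)))
   where
   bm : BR m ≡ B m
   bm = bp m m≢q m≢z
   least : ∀ p -> p ≤ r -> BR p < g ⊎ TR p ≤ BR p ⊎ BR m ≤ BR p
   least p p≤ with p ≟ q | p ≟ z
   ... | yes refl | _ = lia "e=1fa=ec=1f;a<bc-ad-a|| 47142" (BR p , g , TR p , BR m , B z , T p) (bz , bq , tq)
   ... | no _ | yes refl = lia "e<fg-hi-je=1hd=ia=ge<bf-ei-e||g<bh-gi-g||mkljife@;a<bc-ad-a|| 025b80f5002d0033h7000047f1e29ic003i15003a302n04ga07" (BR p , g , TR p , BR m , B p , T p , B q , T q , B m , T m , m , p , l) (zhop , le q q≤ , le m m≤ , bz , bm , bz' , fst p p≤ , fst q q≤ , pair m p m≤ p≤ m≢z)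
   ... | no n | no n' = lia "c=ea=fd=gf<be-fg-f||;a<bc-ad-a|| 003a50004a80549405" (BR p , g , TR p , BR m , T p , B p , B m) (tp p n , bp p n n' , bm , fst p p≤)

 -- A trade of places changes neither the occupied columns nor the turns, so left insertion picks
 -- the same turn and the same gap, possibly under the other name.
 wait-hop-ww : ∀ {q z g m g'} -> RWait l r T q z -> B q < B z ->
  RMoved T TR (wait q z) -> RMoved B BR (wait q z) ->
  First r T B g m -> Gap (suc r) B (B m) g' -> BL m ≡ g' -> (∀ p -> p ≢ m -> BL p ≡ B p) ->
  ∃ \m̃ -> ∃ \g̃ -> BL q < BL z × (First r TR BR g m̃ × Gap (suc r) BR (BR m̃) g̃) ×
   Sq B (mov m g') (wait q z) (wait q z) (mov m̃ g̃)
 wait-hop-ww {q} {z} {g} {m} {g'} a lt' (mwait tq tz tp) (mwait bq bz bp) (m≤ , g≤ , hop , fst) gp blm bl = main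
  where
  open RWait a renaming (lt to ltT)
  open WaitFacts row a
  open Gap gp
  open HopGap row m≤ hop gp
  freeR : ∀ p -> p < suc r -> BR p ≢ g'
  freeR p p< e with p ≟ q | p ≟ z
  ... | yes refl | _ = free z (s≤s z≤) (trans (sym bq) e)
  ... | no _ | yes refl = free q (s≤s q≤) (trans (sym bz) e)
  ... | no n | no n' = free p p< (trans (sym (bp p n n')) e)
  occR : ∀ {j} -> Occ (suc r) B j -> Occ (suc r) BR j
  occR (p , p< , e) with p ≟ q | p ≟ z
  ... | yes refl | _ = z , s≤s z≤ , trans bz e
  ... | no _ | yes refl = q , s≤s q≤ , trans bq e
  ... | no n | no n' = p , p< , trans (bp p n n') e
  least : ∀ m̃ -> BR m̃ ≡ B m -> ∀ p -> p ≤ r -> BR p < g ⊎ TR p ≤ BR p ⊎ BR m̃ ≤ BR p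
  least m̃ e p p≤ with p ≟ q | p ≟ z
  ... | yes refl | _ = lia "a=ec=fd=ge<bf-eg-e||;a<bc-ad-a|| 003a70004a60749407" (BR p , g , TR p , BR m̃ , B z , T z , B m) (bq , tq , e , fst z z≤)
  ... | no _ | yes refl = lia "a=ec=fd=ge<bf-eg-e||;a<bc-ad-a|| 003a70004a60749407" (BR p , g , TR p , BR m̃ , B q , T q , B m) (bz , tz , e , fst q q≤)
  ... | no n | no n' = lia "c=ea=fd=gf<be-fg-f||;a<bc-ad-a|| 003a50004a80549405" (BR p , g , TR p , BR m̃ , T p , B p , B m) (tp p n n' , bp p n n' , e , fst p p≤)
  gapR : ∀ m̃ -> BR m̃ ≡ B m -> Gap (suc r) BR (BR m̃) g'
  gapR m̃ e = record { lt = (lia "c<ba=c;a<b 3312" (BR m̃ , g' , B m) (lt , e)) ; free = freeR ; fill = \j j₁ j₂ -> occR (fill j (lia "c<bc=a;a<b 3302" (B m , j , BR m̃) (j₁ , e)) j₂) }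
  main : ∃ \m̃ -> ∃ \g̃ -> BL q < BL z × (First r TR BR g m̃ × Gap (suc r) BR (BR m̃) g̃) ×
   Sq B (mov m g') (wait q z) (wait q z) (mov m̃ g̃)
  main with m ≟ q | m ≟ z
  ... | yes refl | _ = z , g' , (lia "c<de-fg-ha=ei<gb=gdcjfihg@;a<b 005913b7003916006f0b9hd2g4" (BL q , BL z , q , l , g' , T q , B z , T z , B q , z) (red , g≤T , le z z≤ , blm , lt' , bl z (≢-sym q≢z) , pair q z q≤ z≤ q≢z)) ,
   ((z≤ , (lia "a-cb=c;a-b 3320" (g , BR z , B q) (g≤ , bz)) , (lia "c<da=cb=d;a<b 44053" (BR z , TR z , B q , T q) (hop , bz , tz)) , least z bz) , gapR z bz) , both (inj₁ (refl , refl))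
  ... | no _ | yes refl = q , g' , (lia "c<db=de<ca=e;a<b 561253" (BL q , BL z , B z , g' , B q) (lt , blm , lt' , bl q q≢z)) ,
   ((q≤ , (lia "a-cb=c;a-b 3320" (g , BR q , B z) (g≤ , bq)) , (lia "c<da=cb=d;a<b 44053" (BR q , TR q , B z , T z) (hop , bq , tq)) , least q bq) , gapR q bq) , both (inj₂ (inj₁ (refl , refl)))
  ... | no n | no n' = m , g' , (lia "c<da=cb=d;a<b 44053" (BL q , BL z , B q , B z) (lt' , bl q (≢-sym n) , bl z (≢-sym n'))) ,
   ((m≤ , (lia "a-cb=c;a-b 3320" (g , BR m , B m) (g≤ , bp m n n')) , (lia "c<da=cb=d;a<b 44053" (BR m , TR m , B m , T m) (hop , bp m n n' , tp m n n')) , least m (bp m n n')) , gapR m (bp m n n')) , both (inj₂ (inj₂ (n , n' , refl)))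

 -- In the row where `z` crosses `q`, left insertion may move `z` into the column just right of `q`.
 -- Then the crossing is gone in the moved grid and right insertion keeps waiting there, although it
 -- resumes in the original one: the shape `hold`.
 wait-hop : ∀ {q z sR g m g'} -> RWait l r T q z -> RStep l y r T B (wait q z) sR -> RValid l (suc w) (suc r) B sR ->
  RMoved T TR (wait q z) -> RMoved B BR sR -> Separate r T B g ->
  First r T B g m -> Gap (suc r) B (B m) g' -> BL m ≡ g' -> (∀ p -> p ≢ m -> BL p ≡ B p) ->
  HopResult l y r TL BL TR BR B g m g' sR (wait q z)
 wait-hop a (ww lt') a' tr br sep f gp blm bl with wait-hop-ww a lt' tr br f gp blm bl
 ... | m̃ , g̃ , h , fg , sq = wait _ _ , m̃ , g̃ , ww h , fg , sq
 wait-hop {q} {z} {sR} {g} {m} {g'} a (wx lt') a' (mwait tq tz tp) (mact bq bp) sep (m≤ , g≤ , hop , fst) gp blm bl = main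
  where
  open RWait a renaming (lt to ltT)
  open WaitFacts row a
  open Gap gp
  open HopGap row m≤ hop gp
  brz : BR z ≡ B z
  brz = bp z (≢-sym q≢z)
  ins = lia "d-bb<ca<dgefbdca@;a<bb<cd=b 0434020024000033216003381002802d2260" (B z , T q , T z , B q , q , z , l) (le q q≤ , ltT , lt' , pair q z q≤ z≤ q≢z)
  m≢q : m ≢ q
  m≢q refl = clash "a<bc<bb<da=b; 240" (B q , T q , B z , T z) (hop , ins)
  bm : BR m ≡ B m
  bm = bp m m≢q
  freeB : ∀ p -> p ≤ r -> B p ≢ suc (B q)
  freeB p p≤ = RAct.free a' p (s≤s p≤)
  main : HopResult l y r TL BL TR BR B g m g' (act q) (wait q z)
  main with m ≟ z
  ... | yes refl with g' ≟ suc (B q)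
  ... | yes g'≡ = wait q z , z , B q , ww (lia "c=1db=ca=d;a<b 46142" (BL q , BL z , g' , B q) (g'≡ , blm , bl q q≢z)) ,
    ((z≤ , (lia "a-cb=c;a-b 3320" (g , BR z , B z) (g≤ , brz)) , (lia "a=cb=dc<dd<ef=d;a<b 48734" (BR z , TR z , B z , T q , T z , B q) (brz , tz , ins)) , least) , record { lt = (lia "c<ba=c;a<b 3312" (BR z , B q , B z) (lt' , brz)) ; free = freeR ; fill = fillR }) ,
    hold (≢-sym q≢z) g'≡ refl
   where
   least : ∀ p -> p ≤ r -> BR p < g ⊎ TR p ≤ BR p ⊎ BR z ≤ BR p
   least p p≤ with p ≟ q | p ≟ z
   ... | yes refl | _ = lia "e<fd=ea=1f;a<bc-ad-a|| 44053" (BR p , g , TR p , BR z , B z , B p) (lt' , brz , bq)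
   ... | no _ | yes refl = inj₂ (inj₂ ≤-refl)
   ... | no n | no n' = lia "c=ea=fd=gf<be-fg-f||;a<bc-ad-a|| 003a50004a80549405" (BR p , g , TR p , BR z , T p , B p , B z) (tp p n n' , bp p n , brz , fst p p≤)
   freeR : ∀ p -> p < suc r -> BR p ≢ B q
   freeR p p< e with p ≟ q
   ... | yes refl = clash "a=ba=1b; 230" (BR p , B p) (e , bq)
   ... | no n = n (inj-B p q (≤-pred p<) q≤ (trans (sym (bp p n)) e))
   fillR : ∀ j -> BR z < j -> j < B q -> Occ (suc r) BR j
   fillR j j₁ j₂ with fill j (lia "c<bc=a;a<b 3302" (B z , j , BR z) (j₁ , brz)) (lia "a<cb=1c;a<b 3320" (j , g' , B q) (j₂ , g'≡))
   ... | p , p< , e with p ≟ q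
   ... | yes refl = clash "a<bb=a; 221" (j , B p) (j₂ , e)
   ... | no n = p , p< , trans (bp p n) e
  ... | no g'≢ = act q , z , g' , wx (lia "c<da=cb=d;a<b 44053" (BL z , BL q , g' , B q) (g'<q , blm , bl q q≢z)) ,
    ((z≤ , (lia "a-cb=c;a-b 3320" (g , BR z , B z) (g≤ , brz)) , (lia "a=cb=dc<dd<ef=d;a<b 48734" (BR z , TR z , B z , T q , T z , B q) (brz , tz , ins)) , least) , record { lt = (lia "c<ba=c;a<b 3312" (BR z , g' , B z) (lt , brz)) ; free = freeR ; fill = fillR }) ,
    disjoint (≢-sym q≢z) g'≢
   where
   g'<q : g' < B q
   g'<q with g' ≤? suc (B q)
   ... | yes h = lia "a-1bb≠aa≠1b;a<b 0101210240240" (g' , B q) (h , free q (s≤s q≤) , g'≢)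
   ... | no h with fill (suc (B q)) (lia "a<b;a<1b 210" (B z , B q) lt') (≰⇒> h)
   ... | p , p< , e = ⊥-elim (freeB p (≤-pred p<) e)
   least : ∀ p -> p ≤ r -> BR p < g ⊎ TR p ≤ BR p ⊎ BR z ≤ BR p
   least p p≤ with p ≟ q | p ≟ z
   ... | yes refl | _ = lia "e<fd=ea=1f;a<bc-ad-a|| 44053" (BR p , g , TR p , BR z , B z , B p) (lt' , brz , bq)
   ... | no _ | yes refl = inj₂ (inj₂ ≤-refl)
   ... | no n | no n' = lia "c=ea=fd=gf<be-fg-f||;a<bc-ad-a|| 003a50004a80549405" (BR p , g , TR p , BR z , T p , B p , B z) (tp p n n' , bp p n , brz , fst p p≤)
   freeR : ∀ p -> p < suc r -> BR p ≢ g'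
   freeR p p< e with p ≟ q
   ... | yes refl = clash "a=ba=1cb≠1c; 0035023430" (BR p , g' , B p) (e , bq , g'≢)
   ... | no n = free p p< (trans (sym (bp p n)) e)
   fillR : ∀ j -> BR z < j -> j < g' -> Occ (suc r) BR j
   fillR j j₁ j₂ with fill j (lia "c<bc=a;a<b 3302" (B z , j , BR z) (j₁ , brz)) j₂
   ... | p , p< , e with p ≟ q
   ... | yes refl = clash "a<bc=ab<c; 3302" (j , g' , B p) (j₂ , e , g'<q)
   ... | no n = p , p< , trans (bp p n) e
  main | no m≢z = act q , m , g' , wx (lia "c<db=da=c;a<b 45142" (BL z , BL q , B z , B q) (lt' , bl q (≢-sym m≢q) , bl z (≢-sym m≢z))) ,
    ((m≤ , (lia "a-cb=c;a-b 3320" (g , BR m , B m) (g≤ , bm)) , (lia "c<da=cb=d;a<b 44053" (BR m , TR m , B m , T m) (hop , bm , tp m m≢q m≢z)) , least) , record { lt = (lia "c<ba=c;a<b 3312" (BR m , g' , B m) (lt , bm)) ; free = freeR ; fill = fillR }) ,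
    disjoint m≢q g'≢
   where
   least : ∀ p -> p ≤ r -> BR p < g ⊎ TR p ≤ BR p ⊎ BR m ≤ BR p
   least p p≤ with p ≟ q | p ≟ z
   ... | yes refl | _ = lia "e<fd=ga=1fc=hh-eb-eh<b||e<bh-eg-e||;a<bc-ad-a|| 015b40950002210005e70c85db0c84dc50" (BR p , g , TR p , BR m , B z , B p , B m , T z) (lt' , bm , bq , tq , sep z z≤ , fst z z≤)
   ... | no _ | yes refl = lia "a=ed=fe<gg<hi=g&&e<bh-ef-e||;a<bc-ad-a|| 003c90005a65094b809" (BR p , g , TR p , BR m , B p , B m , T q , T p , B q) (brz , bm , ins , fst z z≤)
   ... | no n | no n' = lia "c=ea=fd=gf<be-fg-f||;a<bc-ad-a|| 003a50004a80549405" (BR p , g , TR p , BR m , T p , B p , B m) (tp p n n' , bp p n , bm , fst p p≤)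
   over = lia "c-de<ff<ga=f&&jhidbge@;a-bc-a| 0058716300461a5004fed03cb0" (B q , B m , g' , T m , B z , T q , T z , m , z , l) (g≤T , ins , pair m z m≤ z≤ m≢z)
   g'≢ : g' ≢ suc (B q)
   g'≢ e = clash "a<bb=1cc≠ac-ab-c|; 01354001210240" (B m , g' , B q) (lt , e , (\e' -> m≢q (inj-B m q m≤ q≤ (sym e'))) , over)
   freeR : ∀ p -> p < suc r -> BR p ≢ g'
   freeR p p< e with p ≟ q
   ... | yes refl = clash "a=ba=1cb≠1c; 0035023430" (BR p , g' , B p) (e , bq , g'≢)
   ... | no n = free p p< (trans (sym (bp p n)) e)
   fillR : ∀ j -> BR m < j -> j < g' -> Occ (suc r) BR j
   fillR j j₁ j₂ with fill j (lia "c<bc=a;a<b 3302" (B m , j , BR m) (j₁ , bm)) j₂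
   ... | p , p< , e with p ≟ q
   ... | yes refl = clash "a<bc=ad<ad=ec-eb-c|; 00450243706" (j , g' , B p , BR m , B m) (j₂ , e , j₁ , bm , over)
   ... | no n = p , p< , trans (bp p n) e

R-cong : ∀ {l y r T B T' B' s s'} -> (∀ p -> T' p ≡ T p) -> (∀ p -> B' p ≡ B p) ->
 RStep l y r T B s s' -> RStep l y r T' B' s s'
R-cong eT eB (rn n) = rn n
R-cong eT eB (rs e) = rs e
R-cong eT eB (ra {q} h) = ra (\z z≤ e -> h z z≤ (trans (sym (eB z)) (trans e (cong suc (eT q)))))
R-cong eT eB (rb {q} z z≤ e h) = rb z z≤ (trans (eB z) (trans e (cong suc (sym (eT q))))) h
R-cong eT eB (rc {q} z z≤ e h) = rc z z≤ (trans (eB z) (trans e (cong suc (sym (eT q))))) h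
R-cong eT eB (wx {q} {z} h) = wx (subst₂ _<_ (sym (eB z)) (sym (eB q)) h)
R-cong eT eB (ww {q} {z} h) = ww (subst₂ _<_ (sym (eB q)) (sym (eB z)) h)

module _ {r : ℕ} {T B T' B' : ℕ -> ℕ} (eT : ∀ p -> T' p ≡ T p) (eB : ∀ p -> B' p ≡ B p) where
 first-cong : ∀ {g m} -> First r T B g m -> First r T' B' g m
 first-cong {g} {m} (m≤ , g≤ , hop , fst) =
  m≤ , (lia "a-cb=c;a-b 3320" (g , B' m , B m) (g≤ , eB m)) , (lia "c<da=cb=d;a<b 44053" (B' m , T' m , B m , T m) (hop , eB m , eT m)) , \z z≤ -> (lia "d=ea=fc=gf<bg-fe-f||;a<bc-ad-a|| 003a50004a40549805" (B' z , g , T' z , B' m , B m , B z , T z) (eB m , eB z , eT z , fst z z≤))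

 gap-cong : ∀ {n m g} -> Gap n B (B m) g -> Gap n B' (B' m) g
 gap-cong {n} {m} {g} gp = record
  { lt = subst (_< g) (sym (eB m)) (Gap.lt gp)
  ; free = \p p< e -> Gap.free gp p p< (trans (sym (eB p)) e)
  ; fill = \j j₁ j₂ -> let (p , p< , e) = Gap.fill gp j (subst (_< j) (eB m) j₁) j₂ in p , p< , trans (eB p) e }

 L-cong : ∀ {k x s s'} -> LStep k x r T B s s' -> LStep k x r T' B' s s'
 L-cong (ln n) = ln n
 L-cong (ls m g e f gp) = ls m g e (first-cong f) (gap-cong {m = m} gp)
 L-cong (l1 {m} (s , s≤ , a , b)) = l1 (s , s≤ , (lia "c<da=cb=d;a<b 44053" (B' s , T' m , B s , T m) (a , eB s , eT m)) , (lia "c<db=da=c;a<b 45142" (T' m , T' s , T m , T s) (b , eT s , eT m)))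
 L-cong (l2 {m} m' g' r<k out f gp) = l2 m' g' r<k (\s s≤ -> (lia "b=dc=ea=ff-de-f|;a-bc-a| 004930648502" (T' m , B' s , T' s , B s , T s , T m) (eB s , eT s , eT m , out s s≤))) (first-cong f) (gap-cong {m = m'} gp)
 L-cong (lf k≤ e) = lf k≤ (trans (eB r) e)
 L-cong ld = ld

module _ {l b w y r : ℕ} {T B : ℕ -> ℕ} (row : Row l b w r T B) (TL BL TR BR : ℕ -> ℕ) where
 open RowFacts row

 -- All pipes of this row are below `l`, so none crosses another, and every other pipe lies left of
 -- the turn of `r`. A new left move either concerns `r` itself or stays clear of it.
 start-hop : ∀ {g m g'} -> suc b < w -> suc r ≡ y -> RAct l (suc w) (suc r) B r ->
  (∀ p -> TR p ≡ T p) -> RMoved B BR (act r) ->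
  First r T B g m -> Gap (suc r) B (B m) g' ->
  HopResult l y r TL BL TR BR B g m g' (act r) none
 start-hop {g} {m} {g'} bw' e a' tp (mact br bp) (m≤ , g≤ , hop , fst) gp = main
  where
  open Gap gp
  open HopGap row m≤ hop gp
  main : HopResult l y r TL BL TR BR B g m g' (act r) none
  main with m ≟ r
  ... | yes refl = act r , r , suc (suc (B r)) , rs e ,
    ((≤-refl , (lia "a-cb=1c;a-b 3320" (g , BR r , B r) (g≤ , br)) , (lia "1c<db=da=1c;a<b 45142" (BR r , TR r , B r , T r) (wfree , tp r , br)) , least) ,
     subst (\c -> Gap (suc r) BR c (suc (suc (B r)))) (sym br) (suc-gap freeR)) ,
    twice g'≡ (cong suc (sym g'≡))
   where
   g'≡ : g' ≡ suc (B r)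
   g'≡ = gap-suc gp (RAct.free a')
   wfree : suc (B r) < T r
   wfree = lia "1c<da-cb=d;1a<b 43042" (B r , T r , b , w) (bw' , bd r ≤-refl , top)
   least : ∀ z -> z ≤ r -> BR z < g ⊎ TR z ≤ BR z ⊎ BR r ≤ BR z
   least z z≤ with z ≟ r
   ... | yes refl = inj₂ (inj₂ ≤-refl)
   ... | no n = lia "e<fc=ga=hd=1eh<bg-he-h||kijghfe@;a<bc-ad-a|| 013c60004c906025eb128005d19e8004kh0e2i0" (BR z , g , TR z , BR r , B r , T r , T z , B z , z , r , l) (hop , tp z , bp z n , br , fst z z≤ , pair z r z≤ ≤-refl n)
   freeR : ∀ p -> p < suc r -> BR p ≢ suc (suc (B r))
   freeR p p< e with p ≟ r
   ... | yes refl = clash "a=2ba=1b; 221" (BR p , B p) (e , br)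
   ... | no n = clash "a<bc<1ad-ef=df=2gbcaedhg@; 004713600002a02b0002f42e5" (r , l , p , B p , T p , BR p , B r , T r) (RAct.red a' , p< , le p (≤-pred p<) , bp p n , e , pair p r (≤-pred p<) ≤-refl n)
  ... | no m≢ = act r , m , g' , rs e ,
    ((m≤ , (lia "a-cb=c;a-b 3320" (g , BR m , B m) (g≤ , bm)) , (lia "c<da=cb=d;a<b 44053" (BR m , TR m , B m , T m) (hop , bm , tp m)) , least) , record { lt = (lia "c<ba=c;a<b 3312" (BR m , g' , B m) (lt , bm)) ; free = freeR ; fill = fillR }) ,
    disjoint m≢ (lia "a-cc<b;a≠1b 3210" (g' , B r , T m) (g≤T , left))
   where
   bm : BR m ≡ B m
   bm = bp m m≢
   left : T m < B r
   left = lia "c<de-cdecagfb@;a<b 002510000250260002a4295" (T m , B r , r , l , m , T r , B m) (RAct.red a' , m≤ , pair m r m≤ ≤-refl m≢)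
   least : ∀ z -> z ≤ r -> BR z < g ⊎ TR z ≤ BR z ⊎ BR m ≤ BR z
   least z z≤ with z ≟ r
   ... | yes refl = lia "e<fg<ed=ga=1f;a<bc-ad-a|| 550634" (BR z , g , TR z , BR m , T m , B z , B m) (left , hop , bm , br)
   ... | no n = lia "c=ea=fd=gf<be-fg-f||;a<bc-ad-a|| 003a50004a80549405" (BR z , g , TR z , BR m , T z , B z , B m) (tp z , bp z n , bm , fst z z≤)
   freeR : ∀ p -> p < suc r -> BR p ≢ g'
   freeR p p< e with p ≟ r
   ... | yes refl = clash "a-bb<cd=ad=1c; 45403" (g' , T m , B p , BR p) (g≤T , left , e , br)
   ... | no n = clash "a=ba=cc≠b; 0034303502" (BR p , g' , B p) (e , bp p n , free p p<)
   fillR : ∀ j -> BR m < j -> j < g' -> Occ (suc r) BR j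
   fillR j j₁ j₂ with fill j (lia "c<bc=a;a<b 3302" (B m , j , BR m) (j₁ , bm)) j₂
   ... | p , p< , e' with p ≟ r
   ... | yes refl = clash "a<bc=ab-dd<c; 44103" (j , g' , B p , T m) (j₂ , e' , g≤T , left)
   ... | no n = p , p< , trans (bp p n) e'

 -- Ensures that left insertion lands in the same row with or without right insertion before it.
 outside-act : ∀ {q c sR} -> RAct l w r T q -> Occ r T c -> c ≢ T q -> RStep l y r T B (act q) sR ->
  RMoved T TR (act q) -> RMoved B BR sR -> Outside r T B c -> Outside r TR BR c
 outside-act {q} {c} a (m , m< , e) c≢ (ra nb) (mact tq tp) (mact bq bp) out s s≤ with s ≟ q
 ... | yes refl = lia "b=1dc=1ea≠ea-de-a|;a-bc-a| 010139062103740" (c , BR q , TR q , B q , T q) (bq , tq , c≢ , out s s≤)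
 ... | no n = lia "c=db=ea-ed-a|;a-bc-a| 0037023650" (c , BR s , TR s , T s , B s) (tp s n , bp s n , out s s≤)
 outside-act {q} {c} a (m , m< , e) c≢ (rb z z≤ bz _) (mact tq tp) (mact bq bp) out s s≤ with s ≟ q | s ≟ z
 ... | yes refl | yes refl = lia "d-ed=1e;a-bc-a| 220" (c , BR q , TR q , B q , T q) (le s s≤ , bz)
 ... | yes refl | no n' = lia "b=dc=1ea≠ea-de-a|;a-bc-a| 010139062103740" (c , BR q , TR q , B q , T q) (bp s n' , tq , c≢ , out s s≤)
 ... | no n | yes refl = lia "c=db=1ea-ed-a|;a-bc-a| 0037023650" (c , BR s , TR s , T s , B s) (tp s n , bq , out s s≤)
 ... | no n | no n' = lia "c=db=ea-ed-a|;a-bc-a| 0037023650" (c , BR s , TR s , T s , B s) (tp s n , bp s n' , out s s≤)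
 outside-act {q} {c} a (m , m< , e) c≢ (rc z z≤ bz _) (mact tq tp) (mwait bq bz' bp) out s s≤ with s ≟ q | s ≟ z
 ... | yes refl | _ = lia "d=1eb=dc=1e;a-bc-a| 576142" (c , BR q , TR q , B z , T q) (bz , bq , tq)
 ... | no n | yes refl = lia "d=ae=1fc=gb=ha≠fd≠1fa-eg-a|a-hf-a|;a-bc-a| 010305033h084d01c5c0d1b4b0d13d80" (c , BR s , TR s , T m , B s , T q , T s , B q) (e , bz , tp s n , bz' , c≢ , RAct.free a m m< , out s s≤ , out q (<⇒≤ (RAct.q<r a)))
 ... | no n | no n' = lia "c=db=ea-ed-a|;a-bc-a| 0037023650" (c , BR s , TR s , T s , B s) (tp s n , bp s n n' , out s s≤)

 outside-wait : ∀ {q z c sR} -> RWait l r T q z -> RStep l y r T B (wait q z) sR ->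
  RMoved T TR (wait q z) -> RMoved B BR sR -> Outside r T B c -> Outside r TR BR c
 outside-wait {q} {z} {c} a (ww lt) (mwait tq tz tp) (mwait bq bz bp) out s s≤ with s ≟ q | s ≟ z
 ... | yes refl | _ = lia "b=dc=ea-de-a|;a-bc-a| 0037043630" (c , BR q , TR q , B z , T z) (bq , tq , out z (WaitFacts.z≤ row a))
 ... | no n | yes refl = lia "b=dc=ea-de-a|;a-bc-a| 0037043630" (c , BR z , TR z , B q , T q) (bz , tz , out q (WaitFacts.q≤ row a))
 ... | no n | no n' = lia "c=db=ea-ed-a|;a-bc-a| 0037023650" (c , BR s , TR s , T s , B s) (tp s n n' , bp s n n' , out s s≤)
 outside-wait {q} {z} {c} a (wx lt) (mwait tq tz tp) (mact bq bp) out s s≤ with s ≟ q | s ≟ z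
 ... | yes refl | _ = lia "d<eb=1ec=fa-df-a|;a-bc-a| 00480643730" (c , BR q , TR q , B z , B q , T z) (lt , bq , tq , out z (WaitFacts.z≤ row a))
 ... | no n | yes refl = lia "d<eb=fc=da-fe-a|;a-bc-a| 00380446073" (c , BR z , TR z , T q , T z , B z) (RWait.lt a , bp s n , tz , out s s≤)
 ... | no n | no n' = lia "c=db=ea-ed-a|;a-bc-a| 0037023650" (c , BR s , TR s , T s , B s) (tp s n n' , bp s n , out s s≤)

 -- The case where the gap for the left insertion opens just after a vertical pipe a
 -- moved by the right insertion, which makes it open at a instead.
 tail-hop : ∀ {a sR m g'} -> RAct l w r T a -> B a ≡ T a -> RStep l y r T B (act a) sR ->
  RValid l (suc w) (suc r) B sR -> RMoved T TR (act a) -> RMoved B BR sR ->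
  First r T B (suc (T a)) m -> Gap (suc r) B (B m) g' ->
  ∃ \m̃ -> ∃ \g̃ -> (First r TR BR (T a) m̃ × Gap (suc r) BR (BR m̃) g̃) × Sq B (mov m g') sR (act a) (mov m̃ g̃)
 tail-hop {a} {_} {m} {g'} v up (ra nb) v' (mact ta tp) (mact ba bp) (m≤ , g≤ , hop , fst) gp =
  m , g' , ((m≤ , (lia "a<cb=c;a-b 3320" (T a , BR m , B m) (g≤ , bm)) , (lia "c<da=cb=d;a<b 44053" (BR m , TR m , B m , T m) (hop , bm , tp m m≢)) , least) , record { lt = (lia "c<ba=c;a<b 3312" (BR m , g' , B m) (lt , bm)) ; free = freeR ; fill = fillR }) ,
  disjoint m≢ (lia "c<ad<cb=d;a≠1b 45123" (g' , B a , B m , T a) (lt , g≤ , up))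
  where
  open Gap gp
  open ActFacts row v
  m≢ : m ≢ a
  m≢ refl = clash "a<bb<a; 210" (B a , T a) (hop , g≤)
  bm : BR m ≡ B m
  bm = bp m m≢
  least : ∀ z -> z ≤ r -> BR z < T a ⊎ TR z ≤ BR z ⊎ BR m ≤ BR z
  least z z≤ with z ≟ a
  ... | yes refl = lia "e=ba=1ec=1b;a<bc-ad-a|| 44271" (BR z , T z , TR z , BR m , B z) (up , ba , ta)
  ... | no n = lia "e=bc=fa=gd=hg≠eg<1bf-gh-g||;a<bc-ad-a|| 014d60a013a10004ea074d607" (BR z , T a , TR z , BR m , B a , T z , B z , B m) (up , tp z n , bp z n , bm , (\e -> n (inj-B z a z≤ q≤ e)) , fst z z≤)
  freeR : ∀ p -> p < suc r -> BR p ≢ g'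
  freeR p p< e with p ≟ a
  ... | yes refl = clash "a<bc=bd<ae=dc=1e; 575134" (B m , g' , BR p , T p , B p) (lt , e , g≤ , up , ba)
  ... | no n = clash "a=ba=cc≠b; 0034303502" (BR p , g' , B p) (e , bp p n , free p p<)
  fillR : ∀ j -> BR m < j -> j < g' -> Occ (suc r) BR j
  fillR j j₁ j₂ with fill j (lia "c<bc=a;a<b 3302" (B m , j , BR m) (j₁ , bm)) j₂
  ... | p , p< , e with p ≟ a
  ... | yes refl = clash "a=bc<bd<ea=dc=e; 540563" (B p , j , BR m , T p , B m) (e , j₁ , g≤ , up , bm)
  ... | no n = p , p< , trans (bp p n) e
 tail-hop {a} {_} {m} {g'} v up (rb z z≤ bz _) v' (mact ta tp) (mact ba bp) (m≤ , g≤ , hop , fst) gp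
  with refl ← inj-B m z m≤ z≤ (lia "b-cd<ab=1dc≠1db<1dc-ba-b||;a=b 0635040237040225000372046307" (B m , B z , T z , T a) (RowFacts.le row z z≤ , g≤ , bz , ActFacts.free≤ row v z z≤ , fst z z≤)) =
  a , B z , ((q≤ , (lia "c=ab=c;a-b 3420" (T a , BR a , B a) (up , bra)) , (lia "c=da=cb=1d;a<b 45063" (BR a , TR a , B a , T a) (up , bra , ta)) , least) ,
   subst₂ (\c d -> Gap (suc r) BR c d) (trans (sym up) (sym bra)) (sym bz) (suc-gap freeR)) ,
  chase (≢-sym a≢z) (trans bz (cong suc (sym up))) (gap-suc gp (RAct.free v')) refl
  where
  open ActFacts row v
  a≢z : a ≢ z
  a≢z refl = clash "a<bb<a; 210" (B m , T m) (hop , g≤)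
  bra : BR a ≡ B a
  bra = bp a a≢z
  least : ∀ p -> p ≤ r -> BR p < T a ⊎ TR p ≤ BR p ⊎ BR a ≤ BR p
  least p p≤ = lia "e=bd=e;a<bc-ad-a|| 46413" (BR p , T a , TR p , BR a , B a) (up , bra)
  freeR : ∀ p -> p < suc r -> BR p ≢ suc (T a)
  freeR p p< e with p ≟ z
  ... | yes refl = clash "a<bc=1ac=1b; 3403" (T a , B p , BR p) (g≤ , e , ba)
  ... | no n = n (inj-B p z (≤-pred p<) z≤ (lia "b=1cd=ad=1c;a=b 064406145032" (B p , B m , T a , BR p) (bz , bp p n , e)))
 tail-hop {a} {_} {m} {g'} v up (rc z z≤ bz _) v' (mact ta tp) (mwait ba bz' bp) (m≤ , g≤ , hop , fst) gp
  with refl ← inj-B m z m≤ z≤ (lia "b-cd<ab=1dc≠1db<1dc-ba-b||;a=b 0635040237040225000372046307" (B m , B z , T z , T a) (RowFacts.le row z z≤ , g≤ , bz , ActFacts.free≤ row v z z≤ , fst z z≤)) =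
  z , g' , ((z≤ , (lia "c=ab=c;a-b 3420" (T a , BR m , B a) (up , bz')) , (lia "c<de<cf=eb=da=f;a<b 6815672" (BR m , TR m , B m , T m , T a , B a) (hop , g≤ , up , tp z (≢-sym a≢z) , bz')) , least) , record { lt = (lia "c<bd<ce=da=e;a<b 561345" (BR m , g' , B m , T a , B a) (lt , g≤ , up , bz')) ; free = freeR ; fill = fillR }) ,
  release (trans bz (cong suc (sym up)))
  where
  open Gap gp
  open ActFacts row v
  a≢z : a ≢ z
  a≢z refl = clash "a<bb<a; 210" (B m , T m) (hop , g≤)
  least : ∀ p -> p ≤ r -> BR p < T a ⊎ TR p ≤ BR p ⊎ BR z ≤ BR p
  least p p≤ = lia "e=bd=e;a<bc-ad-a|| 46413" (BR p , T a , TR p , BR m , B a) (up , bz')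
  freeR : ∀ p -> p < suc r -> BR p ≢ g'
  freeR p p< e with p ≟ a | p ≟ z
  ... | yes refl | _ = clash "a<bc=bc=a; 3421" (B m , g' , BR p) (lt , e , ba)
  ... | no _ | yes refl = clash "a<bc=bd<ae=dc=e; 575134" (B p , g' , BR p , T a , B a) (lt , e , g≤ , up , bz')
  ... | no n | no n' = clash "a=ba=cc≠b; 0034303502" (BR p , g' , B p) (e , bp p n n' , free p p<)
  fillR : ∀ j -> BR z < j -> j < g' -> Occ (suc r) BR j
  fillR j j₁ j₂ with B z <? j
  ... | no h = a , s≤s q≤ , (lia "b<1cd<bc=1ef=ed=fa=c;a=b 0a3a106902853" (BR a , j , B m , BR m , T a , B a) (≰⇒> h , j₁ , bz , up , bz' , ba))
  ... | yes h with fill j h j₂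
  ... | p , p< , e with p ≟ a | p ≟ z
  ... | yes refl | _ = clash "a=bc<bd<ca=d; 44123" (B p , j , B m , T p) (e , h , g≤ , up)
  ... | no _ | yes refl = clash "a=ba<b; 210" (B p , j) (e , h)
  ... | no n | no n' = p , p< , trans (bp p n n') e

-- The pipes jumped over have smaller names than `m`, so they are below `l` too; but such pipes
-- stand to the left of `m`.
red-gap : ∀ {l b w r T B m g} -> Row l b w r T B -> LMove w r T m g -> m < l -> g ≡ suc (T m)
red-gap {l} {r = r} {T} {B} {m} {g} row v m<l = gap-suc (LMove.gap v) free'
 where
 open RowFacts row
 free' : ∀ p -> p < r -> T p ≢ suc (T m)
 free' p p< e with p ≟ m
 ... | yes refl = clash "a=1a; 10" (T p) e
 ... | no n = clash "a<bc<de-cf=1cf-cd<fg<a||bgafhce@; 0123000370502386100002402c0002g4285" (m , l , T m , g , B m , T p , p , B p) (m<l , Gap.lt (LMove.gap v) , le m (MoveFacts.m≤ row v) , e , LMove.low v p p< , pair p m (<⇒≤ p<) (MoveFacts.m≤ row v) n)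

-- Preservation of `Sq` by one row

module _ {l b w k x y r : ℕ} {T B : ℕ -> ℕ} (row : Row l b w r T B) (bw' : suc b < w) (r<k : r < k)
 (TL BL TR BR : ℕ -> ℕ) where
 open RowFacts row

 hop-result : ∀ {g m g' sR sR' sL'} ->
  (∀ m̃ g̃ -> First r TR BR g m̃ -> Gap (suc r) BR (BR m̃) g̃ -> LStep k x r TR BR sL' (mov m̃ g̃)) ->
  HopResult l y r TL BL TR BR B g m g' sR sR' -> Result l k x y r TL BL TR BR B (mov m g') sR sR' sL'
 hop-result step (sR'' , m̃ , g̃ , rstep , (f , gp) , sq) = sR'' , mov m̃ g̃ , rstep , step m̃ g̃ f gp , sq

 Case : LState -> RState -> RState -> LState -> Set
 Case sL sR sR' sL' = ∀ {sL₂ sR₂} ->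
  LValid k w r T sL -> RValid l w r T sR -> RValid l w r TL sR' -> RValid l (suc w) (suc r) B sR₂ ->
  LMoved T TL sL -> RMoved T TR sR -> LMoved B BL sL₂ -> RMoved B BR sR₂ ->
  LStep k x r T B sL sL₂ -> RStep l y r T B sR sR₂ ->
  Result l k x y r TL BL TR BR B sL₂ sR₂ sR' sL'

 idleL-case : ∀ s -> Case none s s none
 idleL-case s vL vR vR' vR₂ (mnone tl) tr (mnone bl) br (ln n) stepR =
  _ , none , R-cong tl bl stepR , ln n , idleL
 idleL-case none vL vR vR' vR₂ (mnone tl) (mnone tr) (mmov _ _) (mnone br) stepL@(ls m g _ _ _) (rn n) =
  none , mov m g , rn n , L-cong tr br stepL , idleR
 idleL-case none vL vR vR' vR₂ (mnone tl) (mnone tr) (mmov _ _) br (ls m g e f gp) (rs e') =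
  hop-result (\m̃ g̃ -> ls m̃ g̃ e) (start-hop row TL BL TR BR bw' e' vR₂ tr br f gp)
 idleL-case (act q) vL vR vR' vR₂ (mnone tl) tr (mmov e₁ e₂) br (ls m g e f gp) stepR =
  hop-result (\m̃ g̃ -> ls m̃ g̃ e)
   (act-hop row TL BL TR BR vR stepR vR₂ tr br (\p _ -> inj₂ (inj₁ z≤n)) (\()) (tl q) f gp e₁ e₂)
 idleL-case (wait q z) vL vR vR' vR₂ (mnone tl) tr (mmov e₁ e₂) br (ls m g e f gp) stepR =
  hop-result (\m̃ g̃ -> ls m̃ g̃ e)
   (wait-hop row TL BL TR BR vR stepR vR₂ tr br (\p _ -> inj₂ (inj₁ z≤n)) f gp e₁ e₂)

 idleR-case : ∀ m g -> Case (mov m g) none none (mov m g)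
 idleR-case m g vL vR vR' vR₂ tl tr bl br (lf k≤ _) _ = ⊥-elim (<⇒≱ r<k k≤)
 idleR-case m g vL vR vR' vR₂ tl (mnone tr) bl (mnone br) (l1 i) (rn n) =
  none , _ , rn n , L-cong tr br (l1 i) , idleR
 idleR-case m g vL vR vR' vR₂ tl (mnone tr) bl (mnone br) (l2 m' g' r<k' out f gp) (rn n) =
  none , _ , rn n , L-cong tr br (l2 m' g' r<k' out f gp) , idleR
 -- Right insertion starts in this row, so all pipes of the row are below `l`; but a pipe crossing
 -- `m` horizontally is not.
 idleR-case m g vL vR vR' vR₂ tl tr bl br (l1 (s , s≤ , i₁ , i₂)) (rs e) =
  (clash "a-bc<ab-c; 3201" (l , s , r) (inside-blue , RAct.red vR₂ , s≤))
  where
  inside-blue : l ≤ s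
  inside-blue with s ≟ m
  ... | yes refl = lia "c<c;a-b 10" (l , m , T m) i₂
  ... | no n = lia "c-dd<ef<dabgefdc@;a-b 00354100241002a22c4" (l , s , B m , T m , T s , B s , m) (le m (MoveFacts.m≤ row vL) , i₂ , i₁ , pair s m s≤ (MoveFacts.m≤ row vL) n)
 idleR-case m g vL vR vR' vR₂ tl (mnone tr) bl br@(mact e₁ e₂) (l2 m' g' r<k' out f gp) (rs e) =
  hop-result (\m̃ g̃ -> l2 m̃ g̃ r<k' (subst (Outside r TR BR) (sym (tr m)) outR)) (start-hop row TL BL TR BR bw' e vR₂ tr br f gp)
  where
  outR : ∀ s -> s ≤ r -> T m ≤ BR s ⊎ TR s ≤ T m
  outR s s≤ with s ≟ r
  ... | yes refl = lia "c=db=1ea-ed-a|;a-bc-a| 0037023650" (T m , BR s , TR s , T s , B s) (tr s , e₁ , out s s≤)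
  ... | no n = lia "b=dc=ea-de-a|;a-bc-a| 0037043630" (T m , BR s , TR s , B s , T s) (e₂ s n , tr s , out s s≤)

 disjoint-case : ∀ {m g q} -> m ≢ q -> g ≢ suc (T q) -> Case (mov m g) (act q) (act q) (mov m g)
 disjoint-case _ _ vL vR vR' vR₂ tl tr bl br (lf k≤ _) _ = ⊥-elim (<⇒≱ r<k k≤)
 disjoint-case {m} {g} {q} m≢q g≢ vL vR vR' vR₂ (mmov tm tl) tr@(mact tq tp) (mmov bm bl) br@(mact bq bp) (l1 (s , s≤ , i₁ , i₂)) (ra nb) =
  act q , mov m g , ra nbL , l1 (s , s≤ , (lia "c<da=cb=d;a<b 44053" (BR s , TR m , B s , T m) (i₁ , bp s s≢q , tp m m≢q)) , (lia "c<db=da=c;a<b 45142" (TR m , TR s , T m , T s) (i₂ , tp s s≢q , tp m m≢q))) , disjoint m≢q g≢'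
  where
  open ActFacts row vR
  open MoveFacts row vL using (m≤; low≤)
  s≢q : s ≢ q
  s≢q refl = clash "a<bc-dd<ef<dbagefdc@; 00354100241002a22c4" (q , l , B m , T m , T q , B q , m) (RAct.red vR , le m m≤ , i₂ , i₁ , pair s m s≤ m≤ (≢-sym m≢q))
  s≢m : s ≢ m
  s≢m refl = clash "a<a; 10" (T m) i₂
  nbL : ∀ z -> z ≤ r -> BL z ≢ suc (TL q)
  nbL z z≤ with z ≟ m
  ... | yes refl = lia "a=cb=dc≠1d;a≠1b 004650247304" (BL z , TL q , g , T q) (bm , tl q (≢-sym m≢q) , g≢)
  ... | no n = lia "b=ca=dd≠1c;a≠1b 004630447502" (BL z , TL q , T q , B z) (tl q (≢-sym m≢q) , bl z n , nb z z≤)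
  g≢' : g ≢ suc (B q)
  g≢' e = clash "a<bb=1cd-ac-ea<fg<ab≠1ef-ab<fh<i||jhifgad@jhkfgec@; 0303270033b9100291002f2080b3l21004od1i006qt80n93i0r2603a70" (T m , g , B q , B m , T q , T s , B s , s , m , l , q) (Gap.lt (LMove.gap vL) , e , le m m≤ , le q q≤ , i₂ , i₁ , g≢ , low≤ s s≤ , pair s m s≤ m≤ s≢m , pair s q s≤ q≤ s≢q)
 disjoint-case {m} {g} {q} m≢q g≢ vL vR vR' vR₂ (mmov tm tl) tr@(mact tq tp) (mmov bm bl) br@(mact bq bp) (l1 (s , s≤ , i₁ , i₂)) (rb z z≤ bz redz) =
  act z , mov m g , rb z z≤ (lia "c=1da=cb=d;a=1b 064530246104" (BL z , TL q , B z , T q) (bz , bl z (≢-sym m≢z) , tl q (≢-sym m≢q))) redz ,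
   l1 (s , s≤ , (lia "c<da=cb=d;a<b 44053" (BR s , TR m , B s , T m) (i₁ , bp s s≢z , tp m m≢q)) , (lia "c<db=da=c;a<b 45142" (TR m , TR s , T m , T s) (i₂ , tp s s≢q , tp m m≢q))) , disjoint m≢z g≢'
  where
  open ActFacts row vR
  open MoveFacts row vL using (m≤; low≤)
  s≢m : s ≢ m
  s≢m refl = clash "a<a; 10" (T m) i₂
  ins = lia "d-ee<fg<ecbafged@;a<bc-bd=e 00354100241002a20c26000260002302e0" (m , s , l , B m , T m , T s , B s) (le m m≤ , i₂ , i₁ , pair s m s≤ m≤ s≢m)
  s≢q : s ≢ q
  s≢q refl = clash "a<bc<ab-ad=e; 242" (q , l , m , B m , T m) (RAct.red vR , ins)
  s≢z : s ≢ z
  s≢z refl = clash "a<bc<ab-ad=e; 242" (z , l , m , B m , T m) (redz , ins)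
  zhop = lia "a-ba=1cb≠1c;a<b 0034023530" (B z , T z , T q) (le z z≤ , bz , free≤ z z≤)
  m≢z : m ≢ z
  m≢z refl = clash "a<bc<de-da=b; 240" (B m , T m , m , s , l) (zhop , ins)
  g≢' : g ≢ suc (B z)
  g≢' e = clash "a<bb=1cc<da<ef<ag<hi-hj=a&&e-ab<eh<g||ihkefdc@; 0128000023d21005gfd1b004l80g4ki0j270" (T m , g , B z , T z , T s , B s , m , s , l , B m , z) (Gap.lt (LMove.gap vL) , e , zhop , i₂ , i₁ , ins , low≤ s s≤ , pair s z s≤ z≤ s≢z)
 disjoint-case {m} {g} {q} m≢q g≢ vL vR vR' vR₂ (mmov tm tl) tr@(mact tq tp) (mmov bm bl) br@(mwait bq bz' bp) (l1 (s , s≤ , i₁ , i₂)) (rc z z≤ bz bluez) =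
  wait q z , mov m g , rc z z≤ (lia "c=1da=cb=d;a=1b 064530246104" (BL z , TL q , B z , T q) (bz , bl z (≢-sym m≢z) , tl q (≢-sym m≢q))) bluez ,
   l1 (s , s≤ , (lia "a<cb=c;a<b 3320" (BR s , TR m , T m) (bs , tp m m≢q)) , (lia "c<db=da=c;a<b 45142" (TR m , TR s , T m , T s) (i₂ , tp s s≢q , tp m m≢q))) , both (inj₂ (inj₂ (m≢q , m≢z , refl)))
  where
  open ActFacts row vR
  open MoveFacts row vL using (m≤)
  s≢m : s ≢ m
  s≢m refl = clash "a<a; 10" (T m) i₂
  ins = lia "d-ee<fg<ecbafged@;a<bc-bd=e 00354100241002a20c26000260002302e0" (m , s , l , B m , T m , T s , B s) (le m m≤ , i₂ , i₁ , pair s m s≤ m≤ s≢m)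
  s≢q : s ≢ q
  s≢q refl = clash "a<bc<ab-ad=e; 242" (q , l , m , B m , T m) (RAct.red vR , ins)
  m≢z : m ≢ z
  m≢z refl = clash "a=1bc<de-da=f&&f≠1b; 0036303702" (B m , T q , m , s , l , T m) (bz , ins , free≤ z z≤)
  bs : BR s < T m
  bs with s ≟ z
  ... | yes refl = lia "c-de=1de<ba=c;a<b 561532" (BR z , T m , B q , T q , B z) (le q q≤ , bz , i₁ , bz')
  ... | no n = lia "c<ba=c;a<b 3312" (BR s , T m , B s) (i₁ , bp s s≢q n)
 disjoint-case {m} {g} {q} m≢q g≢ vL vR vR' vR₂ (mmov tm tl) tr@(mact tq tp) (mmov bm bl) br (l2 m' g' r<k' out f gp) stepR =
  hop-result (\m̃ g̃ -> l2 m̃ g̃ r<k' (subst (Outside r TR BR) (sym (tp m m≢q))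
    (outside-act row TL BL TR BR vR (m , LMove.m<r vL , refl) (\e -> m≢q (inj-T m q (MoveFacts.m≤ row vL) (ActFacts.q≤ row vR) e)) stepR tr br out)))
   (act-hop row TL BL TR BR vR stepR vR₂ tr br (separate row vL out) g≢ (tl q (≢-sym m≢q)) f gp bm bl)

 -- Both insertions move `q` by one column, so in either order it is moved by two.
 twice-case : ∀ {q g g'} -> g ≡ suc (T q) -> g' ≡ suc g -> Case (mov q g) (act q) (act q) (mov q g')
 twice-case _ _ vL vR vR' vR₂ tl tr bl br (lf k≤ _) _ = ⊥-elim (<⇒≱ r<k k≤)
 twice-case {q} {g} {g'} g≡ g'≡ vL vR vR' vR₂ (mmov tm tl) (mact tq tp) (mmov bm bl) (mact bq bp) (l1 (s , s≤ , i₁ , i₂)) (ra nb) =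
  act q , mov q g' , ra nbL , l1 (s , s≤ , (lia "c<da=cb=1d;a<b 44053" (BR s , TR q , B s , T q) (i₁ , bp s s≢q , tq)) , (lia "c<db=da=1cd≠1c;a<b 0026047304" (TR q , TR s , T q , T s) (i₂ , tp s s≢q , tq , free≤ s s≤))) ,
  twice (trans g≡ (cong suc (sym (proj₂ ins)))) g'≡
  where
  open ActFacts row vR
  s≢q : s ≢ q
  s≢q refl = clash "a<a; 10" (T q) i₂
  ins : l ≤ s × B q ≡ T q
  ins = lia "c-dd<ef<dabgefdc@;a-bc=d 00354100241002a20c250002202d0" (l , s , B q , T q , T s , B s , q) (le q q≤ , i₂ , i₁ , pair s q s≤ q≤ s≢q)
  free₂ : ∀ p -> p ≢ q -> p ≤ r -> T p ≢ suc (suc (T q))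
  free₂ p n p≤ e with p ≟ r
  ... | yes refl = clash "a=bc=1d1e<be=ca=2d; 571524" (T p , w , g , T q , TL q) (top , g≡ , RAct.q<w vR' , tm , e)
  ... | no n' = RAct.free vR' p (≤∧≢⇒< p≤ n') (lia "c=1db=ce=2da=e;a=1b 08583106575024" (TL p , TL q , g , T q , T p) (g≡ , tm , e , tl p n))
  nbL : ∀ z -> z ≤ r -> BL z ≢ suc (TL q)
  nbL z z≤ e with z ≟ q | z ≟ s
  ... | yes refl | _ = clash "a=bc=ba=1c; 3520" (BL z , g , TL z) (bm , tm , e)
  ... | no n | yes refl = clash "a=1bc=ad<be=de=1c; 575034" (g , T q , TL q , B z , BL z) (g≡ , tm , i₁ , bl z n , e)
  ... | no n | no n' = clash "a=1bc=ad-eb<fg<bh=dh=1ce≠2bf≠1bkijedfg@; 026a0db47024fa0e02b98fh31bge7a006i31a9g006feln907kdg30hm" (g , T q , TL q , B z , T z , T s , B s , BL z , z , s , l) (g≡ , tm , le z z≤ , i₂ , i₁ , bl z n , e , free₂ z n z≤ , free≤ s s≤ , pair z s z≤ s≤ n')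
 twice-case {q} g≡ _ vL vR vR' vR₂ _ _ _ _ (l1 (s , s≤ , i₁ , i₂)) (rb z z≤ bz _) =
  ⊥-elim (no-hop-in-hop z z≤ bz s s≤ i₁ i₂)
  where
  open ActFacts row vR
  -- A pipe crossing column `T q` continues into the next cell, which holds the r-turn of `z`; only
  -- a bump could hold both.
  no-hop-in-hop : ∀ z -> z ≤ r -> B z ≡ suc (T q) -> ∀ s -> s ≤ r -> B s < T q -> T q < T s -> ⊥
  no-hop-in-hop z z≤ bz s s≤ i₁ i₂ with s ≟ z
  ... | yes refl = clash "a<ba=1b; 220" (B z , T q) (i₁ , bz)
  ... | no n = clash "a-bc<de<ca=1cb≠1chfgdeba@; 01370301381600573186004b30d3c80" (B z , T z , T q , T s , B s , s , z , l) (le z z≤ , i₂ , i₁ , bz , free≤ z z≤ , pair s z s≤ z≤ n)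
 twice-case {q} g≡ _ vL vR vR' vR₂ _ _ _ _ (l1 (s , s≤ , i₁ , i₂)) (rc z z≤ bz _) with s ≟ z
 ... | yes refl = clash "a=1ba<b; 210" (B s , T q) (bz , i₁)
 ... | no n = clash "a-ba=1cc<de<cb≠1chfgdeba@; 0137050138610059316800430bd3e80" (B z , T z , T q , T s , B s , s , z , l) (le z z≤ , bz , i₂ , i₁ , ActFacts.free≤ row vR z z≤ , pair s z s≤ z≤ n)
 twice-case {q} {g} {g'} refl refl vL vR vR' vR₂ (mmov tm tl) (mact tq tp) (mmov bm bl) (mact bq bp) (l2 m' g₂ r<k' out (m≤ , g≤ , hop , fst) gp) (ra nb) =
  act q , mov m' g₂ , ra nbL ,
  l2 m' g₂ r<k' outR (m≤ , (lia "a<cb=cc≠1a;1a<b 005540423502" (T q , BR m' , B m') (g≤ , brm , nb m' m≤)) , (lia "c<da=cb=d;a<b 44053" (BR m' , TR m' , B m' , T m') (hop , brm , tp m' m≢)) , least)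
   (record { lt = (lia "c<ba=c;a<b 3312" (BR m' , g₂ , B m') (lt , brm)) ; free = freeR ; fill = fillR }) ,
  disjoint m≢ (lia "c<ab-dd<c;a≠1b 44102" (g₂ , B q , B m' , T q) (lt , le q q≤ , g≤))
  where
  open ActFacts row vR
  open Gap gp
  m≢ : m' ≢ q
  m≢ refl = clash "a<bb<a; 210" (B q , T q) (hop , g≤)
  brm : BR m' ≡ B m'
  brm = bp m' m≢
  free₂ : ∀ p -> p ≢ q -> p ≤ r -> T p ≢ suc (suc (T q))
  free₂ p n p≤ e with p ≟ r
  ... | yes refl = clash "a=b1c<ba=2dc=1d; 45304" (T p , w , TL q , T q) (top , RAct.q<w vR' , e , tm)
  ... | no n' = RAct.free vR' p (≤∧≢⇒< p≤ n') (lia "c=2da=cb=1d;a=1b 064530246104" (TL p , TL q , T p , T q) (e , tl p n , tm))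
  nbL : ∀ z -> z ≤ r -> BL z ≢ suc (TL q)
  nbL z z≤ e with z ≟ m'
  ... | yes refl = clash "a<bc<ad=be=1cd=1ea≠1c; 00280550963" (B z , g₂ , T q , BL z , TL q) (lt , g≤ , bm , tm , e , nb z z≤)
  ... | no n with z ≟ q
  ... | yes refl = clash "a-bc=ad=1bc=1d; 46205" (B z , T z , BL z , TL z) (le z z≤ , bl z n , tm , e)
  ... | no n' = n (inj-B z m' z≤ m≤ (lia "a-cd=ae<bf=1ed=1fc≠2eb≠1ea<1ec-ab-a||;a=b 025b064a022900d034d097005d9b408a8e20d9b510b79" (B z , B m' , T z , BL z , T q , TL q) (le z z≤ , bl z n , g≤ , tm , e , free₂ z n' z≤ , nb m' m≤ , fst z z≤)))
  outR : ∀ s -> s ≤ r -> TR q ≤ BR s ⊎ TR s ≤ TR q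
  outR s s≤ with s ≟ q
  ... | yes refl = inj₂ ≤-refl
  ... | no n = lia "d-ec=fb=ga=1ee-gf-e|jhifged@;a-bc-a| 01017dca1b27004e718006jig28d4e38d4a803" (TR q , BR s , TR s , B q , T q , T s , B s , s , q , l) (le q q≤ , tp s n , bp s n , tq , out s s≤ , pair s q s≤ q≤ n)
  least : ∀ z -> z ≤ r -> BR z < suc (suc (T q)) ⊎ TR z ≤ BR z ⊎ BR m' ≤ BR z
  least z z≤ with z ≟ q
  ... | yes refl = lia "e-ba=1e;a<2bc-ad-a|| 3512" (BR z , T z , TR z , BR m' , B z) (le z z≤ , bq)
  ... | no n = lia "c=ea=fd=gf<1be-fg-f||;a<2bc-ad-a|| 003a50004a80549405" (BR z , T q , TR z , BR m' , T z , B z , B m') (tp z n , bp z n , brm , fst z z≤)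
  freeR : ∀ p -> p < suc r -> BR p ≢ g₂
  freeR p p< e with p ≟ q
  ... | yes refl = clash "a<bc-de=bd<ae=1c; 563152" (B m' , g₂ , B p , T p , BR p) (lt , le p q≤ , e , g≤ , bq)
  ... | no n = clash "a=ba=cc≠b; 0034303502" (BR p , g₂ , B p) (e , bp p n , free p p<)
  fillR : ∀ j -> BR m' < j -> j < g₂ -> Occ (suc r) BR j
  fillR j j₁ j₂ with fill j (lia "c<bc=a;a<b 3302" (B m' , j , BR m') (j₁ , brm)) j₂
  ... | p , p< , e with p ≟ q
  ... | yes refl = clash "a=ba-cd<bc<ed=e; 554203" (B p , j , T p , BR m' , B m') (e , le p q≤ , j₁ , g≤ , brm)
  ... | no n = p , p< , trans (bp p n) e
 -- The turn of `z` lies in the landing column `T q + 1` itself, so it is the leftmost candidate and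
 -- `m'` is `z`.
 twice-case {q} {g} {g'} refl refl vL vR vR' vR₂ (mmov tm tl) (mact tq tp) (mmov bm bl) (mact bz' bp) (l2 m' g₂ r<k' out (m≤ , g≤ , hop , fst) gp) (rb z z≤ bz redz)
  with refl ← inj-B m' z m≤ z≤ (lia "b-cb=1dd<ac≠1db<1dc-ba-b||;a=b 06353002370502260003820230" (B m' , B z , T z , T q) (le z z≤ , bz , g≤ , ActFacts.free≤ row vR z z≤ , fst z z≤)) =
  act z , mov z (suc (suc (B z))) , rb z z≤ (lia "c=1dd=1ea=cb=1e;a=1b 08573025586104" (BL m' , TL q , g₂ , B m' , T q) (g₂≡ , bz , bm , tm)) redz ,
  l2 z (suc (suc (B z))) r<k' outR (z≤ , (lia "c=1ab=1c;1a<b 3420" (T q , BR m' , B m') (bz , bz')) , (lia "c=1dc<eb=ea=1ce≠2d;a<b 003760580493" (BR m' , TR m' , B m' , T q , T m') (bz , hop , tp z z≢q , bz' , free₂ z z≢q z≤)) , least)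
   (subst (\c -> Gap (suc r) BR c (suc (suc (B z)))) (sym bz') (suc-gap freeR)) ,
  twice g₂≡ (cong suc (sym g₂≡))
  where
  open ActFacts row vR
  g₂≡ : g₂ ≡ suc (B z)
  g₂≡ = gap-suc gp (RAct.free vR₂)
  z≢q : z ≢ q
  z≢q refl = clash "a=1ba<b; 210" (B m' , T m') (bz , hop)
  zhop : B z < T z
  zhop = hop
  free₂ : ∀ p -> p ≢ q -> p ≤ r -> T p ≢ suc (suc (T q))
  free₂ p n p≤ e with p ≟ r
  ... | yes refl = clash "a=b1c<ba=2dc=1d; 45304" (T p , w , TL q , T q) (top , RAct.q<w vR' , e , tm)
  ... | no n' = RAct.free vR' p (≤∧≢⇒< p≤ n') (lia "c=2da=cb=1d;a=1b 064530246104" (TL p , TL q , T p , T q) (e , tl p n , tm))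
  outR : ∀ s -> s ≤ r -> TR q ≤ BR s ⊎ TR s ≤ TR q
  outR s s≤ with s ≟ q | s ≟ z
  ... | yes refl | _ = inj₂ ≤-refl
  ... | no n | yes refl = lia "d<eb=1ea=1d;a-bc-a| 46142" (TR q , BR s , TR s , T q , B s) (g≤ , bz' , tq)
  ... | no n | no n' = lia "d-ec=fb=ga=1ee-gf-e|jhifged@;a-bc-a| 01017dca1b27004e718006jig28d4e38d4a803" (TR q , BR s , TR s , B q , T q , T s , B s , s , q , l) (le q q≤ , tp s n , bp s n' , tq , out s s≤ , pair s q s≤ q≤ n)
  least : ∀ p -> p ≤ r -> BR p < suc (suc (T q)) ⊎ TR p ≤ BR p ⊎ BR z ≤ BR p
  least p p≤ = lia "e=1bd=1e;a<2bc-ad-a|| 46413" (BR p , T q , TR p , BR m' , B m') (bz , bz')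
  freeR : ∀ p -> p < suc r -> BR p ≢ suc (suc (B z))
  freeR p p< e with p ≟ z
  ... | yes refl = clash "a=2ba=1b; 221" (BR p , B p) (e , bz')
  ... | no n = clash "a<bc-de=cf=1ge=2ff<hh≠2gbiadchf@; 013630014c16b00531b8a002j46ech30f" (m' , l , B p , T p , BR p , B m' , T q , T m' , p) (redz , le p (≤-pred p<) , bp p n , bz , e , hop , free₂ z z≢q z≤ , pair p z (≤-pred p<) z≤ n)
 -- After right insertion `z` runs across the column of `q`, so left insertion keeps moving `q`,
 -- while in the original grid it lands and hands over to `z`. With `q` and `z` having traded
 -- places, this is the same move under the other name.
 twice-case {q} {g} {g'} refl refl vL vR vR' vR₂ (mmov tm tl) (mact tq tp) (mmov bm bl) (mwait bq bz' bp) (l2 m' g₂ r<k' out (m≤ , g≤ , hop , fst) gp) (rc z z≤ bz bluez)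
  with refl ← inj-B m' z m≤ z≤ (lia "b-cb=1dd<ac≠1db<1dc-ba-b||;a=b 06353002370502260003820230" (B m' , B z , T z , T q) (le z z≤ , bz , g≤ , ActFacts.free≤ row vR z z≤ , fst z z≤)) =
  wait q z , mov q g' , rc z z≤ (lia "c=1dd=1ea=cb=1e;a=1b 08573025586104" (BL m' , TL q , g₂ , B m' , T q) (g₂≡ , bz , bm , tm)) bluez ,
  l1 (z , z≤ , (lia "c-db=1da=c;a<b 45142" (BR m' , TR q , B q , T q) (le q q≤ , tq , bz')) , (lia "c=1da=1dc<eb=e;a<b 552074" (TR q , TR m' , B m' , T q , T m') (bz , tq , hop , tp z z≢q))) ,
  subst (\c -> Sq B (mov z g₂) (wait q z) (wait q z) (mov q c)) g₂≡' (both (inj₂ (inj₁ (refl , refl))))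
  where
  open ActFacts row vR
  z≢q : z ≢ q
  z≢q refl = clash "a-ba=1b; 220" (B m' , T m') (le z z≤ , bz)
  free₂ : ∀ p -> p ≢ q -> p ≤ r -> T p ≢ suc (suc (T q))
  free₂ p n p≤ e with p ≟ r
  ... | yes refl = clash "a=b1c<ba=2dc=1d; 45304" (T p , w , TL q , T q) (top , RAct.q<w vR' , e , tm)
  ... | no n' = RAct.free vR' p (≤∧≢⇒< p≤ n') (lia "c=2da=cb=1d;a=1b 064530246104" (TL p , TL q , T p , T q) (e , tl p n , tm))
  freeB : ∀ p -> p < suc r -> B p ≢ suc (B z)
  freeB p p< e with p ≟ z | p ≟ q
  ... | yes refl | _ = clash "a=1a; 10" (B p) e
  ... | no n | yes refl = clash "a-ba=1cc=1b; 3402" (B p , T p , B m') (le p q≤ , e , bz)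
  ... | no n | no n' = clash "a-ba=1cc=1dc<eb≠2dhfgbaec@; 014804601597218003a61004fd80330e" (B p , T p , B m' , T q , T m' , p , m' , l) (le p (≤-pred p<) , e , bz , hop , free₂ p n' (≤-pred p<) , pair p z (≤-pred p<) z≤ n)
  g₂≡ : g₂ ≡ suc (B z)
  g₂≡ = gap-suc gp freeB
  g₂≡' : g₂ ≡ suc (suc (T q))
  g₂≡' = lia "a=1cc=1b;a=2b 0433013420" (g₂ , T q , B m') (g₂≡ , bz)

 -- Both insertions would move `p`, the right neighbour of `q`. Whichever comes first takes `p` one
 -- column further, and the second one then moves `q` into the column vacated by `p`.
 chase-case : ∀ {p q g g'} -> p ≢ q -> T p ≡ suc (T q) -> g ≡ suc (T p) -> g' ≡ T p ->
  Case (mov p g) (act p) (act q) (mov q g')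
 chase-case _ _ _ _ vL vR vR' vR₂ tl tr bl br (lf k≤ _) _ = ⊥-elim (<⇒≱ r<k k≤)
 chase-case {p} {q} {g} {g'} p≢q tpq g≡ g'≡ vL vR vR' vR₂ (mmov tm tl) (mact tp' tp) (mmov bm bl) (mact bp' bp) (l1 (s , s≤ , i₁ , i₂)) (ra nb) =
  act q , mov q g' , ra nbL , l1 (s , s≤ , (lia "c-de<fg<ee=1da=gb=djhifgdc@;a<b 004a1b7003a91003g2d4ic39" (BR s , TR q , B q , T q , T p , T s , B s , s , q , l) (le q q≤ , i₂ , i₁ , tpq , bp s s≢p , tp q (≢-sym p≢q) , pair s q s≤ q≤ s≢q)) , (lia "c<dc=1eb=da=e;a<b 571462" (TR q , TR s , T p , T s , T q) (i₂ , tpq , tp s s≢p , tp q (≢-sym p≢q)))) ,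
  chase p≢q (lia "b=cd=1ce-fa=d;a=1b 074741046025" (B p , B q , T q , T p , l , s) (insq , tpq , ins)) (lia "a=1cd-eb=c;a=1b 0534023510" (g , B p , T p , l , s) (g≡ , ins)) (lia "a=cd-eb=c;a=b 0534023510" (g' , B p , T p , l , s) (g'≡ , ins))
  where
  p≤ : p ≤ r
  p≤ = ActFacts.q≤ row vR
  q≤ : q ≤ r
  q≤ = <⇒≤ (RAct.q<r vR')
  s≢p : s ≢ p
  s≢p refl = clash "a<a; 10" (T p) i₂
  ins : l ≤ s × B p ≡ T p
  ins = lia "c-dd<ef<dabgefdc@;a-bc=d 00354100241002a20c250002202d0" (l , s , B p , T p , T s , B s , p) (le p p≤ , i₂ , i₁ , pair s p s≤ p≤ s≢p)
  s≢q : s ≢ q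
  s≢q refl = clash "a<ba=1b; 220" (T p , T q) (i₂ , tpq)
  insq : B q ≡ T q
  insq = lia "a-bc<de<cc=1bhfgdeba@;a=b 060147124003761003d2a280260" (B q , T q , T p , T s , B s , s , q , l) (le q q≤ , i₂ , i₁ , tpq , pair s q s≤ q≤ s≢q)
  nbL : ∀ z -> z ≤ r -> BL z ≢ suc (TL q)
  nbL z z≤ e with z ≟ p
  ... | yes refl = clash "a=1bc=ab=1de=dc=1e; 586134" (g , T z , BL z , T q , TL q) (g≡ , bm , tpq , tl q (≢-sym p≢q) , e)
  ... | no n = n (inj-B z p z≤ p≤ (lia "c=1de=df=af=1eg-hb=c;a=b 0b6702b846a10659" (B z , B p , T p , T q , TL q , BL z , l , s) (tpq , tl q (≢-sym p≢q) , bl z n , e , ins)))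
 chase-case {p} _ _ _ _ vL vR vR' vR₂ _ _ _ _ (l1 (s , s≤ , i₁ , i₂)) (rb z z≤ bz _) with s ≟ z
 ... | yes refl = clash "a=1ba<b; 210" (B s , T p) (bz , i₁)
 ... | no n = clash "a-ba=1cc<de<cb≠1chfgdeba@; 0137050138610059316800430bd3e80" (B z , T z , T p , T s , B s , s , z , l) (le z z≤ , bz , i₂ , i₁ , ActFacts.free≤ row vR z z≤ , pair s z s≤ z≤ n)
 chase-case {p} _ _ _ _ vL vR vR' vR₂ _ _ _ _ (l1 (s , s≤ , i₁ , i₂)) (rc z z≤ bz _) with s ≟ z
 ... | yes refl = clash "a=1ba<b; 210" (B s , T p) (bz , i₁)
 ... | no n = clash "a-ba=1cc<de<cb≠1chfgdeba@; 0137050138610059316800430bd3e80" (B z , T z , T p , T s , B s , s , z , l) (le z z≤ , bz , i₂ , i₁ , ActFacts.free≤ row vR z z≤ , pair s z s≤ z≤ n)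
 chase-case {p} {q} {g} {g'} p≢q tpq refl refl vL vR vR' vR₂ (mmov tm tl) tr@(mact tp' tp) (mmov bm bl) br (l2 m' g₂ r<k' out f@(m≤ , g≤ , hop , fst) gp) stepR =
  finish (tail-hop row TL BL TR BR vR up stepR vR₂ tr br f gp)
  where
  p≤ : p ≤ r
  p≤ = ActFacts.q≤ row vR
  q≤ : q ≤ r
  q≤ = <⇒≤ (RAct.q<r vR')
  up : B p ≡ T p
  up = lia "c<da-be-fb=1fdcgbafe@;a=b 06013641003361002a22e4250" (B p , T p , p , l , B q , T q , q) (RAct.red vR , le p p≤ , le q q≤ , tpq , pair p q p≤ q≤ p≢q)
  p≢m : p ≢ m'
  p≢m refl = clash "a<bb<a; 210" (B p , T p) (hop , g≤)
  outR : Outside r TR BR (T q)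
  outR = outside-act row TL BL TR BR vR (q , RAct.q<r vR' , refl) (lia "b=1a;a≠b 220" (T q , T p) tpq) stepR tr br outq
   where
   outq : Outside r T B (T q)
   outq s s≤ with s ≟ q | s ≟ p
   ... | yes refl | _ = inj₂ ≤-refl
   ... | no n | yes refl = lia "b=c;a-bc-a| 3320" (T q , B s , T s) up
   ... | no n | no n' = lia "d=ee=1ae-bc-e|hfgcbed@;a-bc-a| 01560835014918600591b68003d384e28d" (T q , B s , T s , B p , T p , s , p , l) (up , tpq , out s s≤ , pair s p s≤ p≤ n')
  finish : (∃ \m̃ -> ∃ \g̃ -> (First r TR BR (T p) m̃ × Gap (suc r) BR (BR m̃) g̃) × Sq B (mov m' g₂) _ (act p) (mov m̃ g̃)) ->
   Result l k x y r TL BL TR BR B (mov m' g₂) _ (act q) (mov q (T p))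
  finish (m̃ , g̃ , (fR , gpR) , sq) = act p , mov m̃ g̃ ,
   rb p p≤ (lia "c=dd=1eb=ea=c;a=1b 08571045586302" (BL p , TL q , B p , T p , T q) (up , tpq , tl q (≢-sym p≢q) , bl p p≢m)) (RAct.red vR) ,
   l2 m̃ g̃ r<k' (subst (Outside r TR BR) (sym (tp q (≢-sym p≢q))) outR) fR gpR , sq

 -- In the original grid right insertion makes the neighbours `q` and `z` trade places. If left
 -- insertion has taken `z` away before, the column of `z` is free and `q` simply moves into it.
 release-case : ∀ {q z g} -> T z ≡ suc (T q) -> Case (mov z g) (wait q z) (act q) (mov z g)
 release-case _ vL vR vR' vR₂ tl tr bl br (lf k≤ _) _ = ⊥-elim (<⇒≱ r<k k≤)
 release-case {q} {z} {g} tz≡ vL vR vR' vR₂ (mmov tm tl) (mwait tq tz tp) (mmov bm bl) (mwait bq bz bp) (l1 (s , s≤ , i₁ , i₂)) (ww lt') =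
  act q , mov z g , ra nbL , l1 (s , s≤ , (lia "c-de<fg<ee=1da=gb=djhifgdc@;a<b 004a1b7003a91003g2d4ic39" (BR s , TR z , B q , T q , T z , T s , B s , s , q , l) (le q q≤ , i₂ , i₁ , tz≡ , bp s s≢q s≢z , tz , pair s q s≤ q≤ s≢q)) , (lia "c<dc=1eb=da=e;a<b 571462" (TR z , TR s , T z , T s , T q) (i₂ , tz≡ , tp s s≢q s≢z , tz))) ,
  release (lia "b=cd=1ce-fa=d;a=1b 074741046025" (B z , B q , T q , T z , l , s) (insq , tz≡ , ins))
  where
  open WaitFacts row vR
  s≢z : s ≢ z
  s≢z refl = clash "a<a; 10" (T z) i₂
  ins : l ≤ s × B z ≡ T z
  ins = lia "c-dd<ef<dabgefdc@;a-bc=d 00354100241002a20c250002202d0" (l , s , B z , T z , T s , B s , z) (le z z≤ , i₂ , i₁ , pair s z s≤ z≤ s≢z)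
  s≢q : s ≢ q
  s≢q refl = clash "a<ba=1b; 220" (T z , T q) (i₂ , tz≡)
  insq : B q ≡ T q
  insq = lia "a-bc<de<cc=1bhfgdeba@;a=b 060147124003761003d2a280260" (B q , T q , T z , T s , B s , s , q , l) (le q q≤ , i₂ , i₁ , tz≡ , pair s q s≤ q≤ s≢q)
  nbL : ∀ p -> p ≤ r -> BL p ≢ suc (TL q)
  nbL p p≤ e with p ≟ z
  ... | yes refl = clash "a<bc=ba=1de=dc=1e; 586134" (T p , g , BL p , T q , TL q) (Gap.lt (LMove.gap vL) , bm , tz≡ , tl q q≢z , e)
  ... | no n = n (inj-B p z p≤ z≤ (lia "c=1de=df=af=1eg-hb=c;a=b 0b6702b846a10659" (B p , B z , T z , T q , TL q , BL p , l , s) (tz≡ , tl q q≢z , bl p n , e , ins)))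
 release-case {q} {z} {g} tz≡ vL vR vR' vR₂ _ _ _ _ (l1 (s , s≤ , i₁ , i₂)) (wx lt') with s ≟ z
 ... | yes refl = clash "a<a; 10" (T z) i₂
 ... | no n = clash "a-bc<ad<ef<dd=1bighefdc@; 0056178300261002c24e90d" (B q , T q , B z , T z , T s , B s , s , z , l) (le q q≤ , lt' , i₂ , i₁ , tz≡ , pair s z s≤ z≤ n)
  where open WaitFacts row vR
 release-case {q} {z} {g} tz≡ vL vR vR' vR₂ (mmov tm tl) tr@(mwait tq tz tp) (mmov bm bl) br@(mwait bq bz bp) (l2 m' g₂ r<k' out f gp) stepR@(ww lt') =
  finish (wait-hop-ww {y = y} row TL BL TR BR vR lt' tr br f gp bm bl)
  where
  open WaitFacts row vR
  m≢z : m' ≢ z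
  m≢z refl = clash "a<bb-cc-a; 3210" (T z , g , B z) (Gap.lt (LMove.gap vL) , proj₁ (proj₂ f) , le z z≤)
  upz = lia "a-bc<ab=1dgefdcba@;a=b 0501325100331700330c2a2250" (B z , T z , B q , T q , q , z , l) (le z z≤ , lt' , tz≡ , pair q z q≤ z≤ q≢z)
  outq : Outside r T B (T q)
  outq s s≤ with s ≟ q | s ≟ z
  ... | yes refl | _ = inj₂ ≤-refl
  ... | no n | yes refl = lia "b=c;a-bc-a| 3320" (T q , B s , T s) upz
  ... | no n | no n' = lia "d=ee=1ae-bc-e|hfgcbed@;a-bc-a| 01560835014918600591b68003d384e28d" (T q , B s , T s , B z , T z , s , z , l) (upz , tz≡ , out s s≤ , pair s z s≤ z≤ n')
  finish : (∃ \m̃ -> ∃ \g̃ -> BL q < BL z × (First r TR BR g m̃ × Gap (suc r) BR (BR m̃) g̃) × Sq B (mov m' g₂) (wait q z) (wait q z) (mov m̃ g̃)) ->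
   Result l k x y r TL BL TR BR B (mov m' g₂) (wait q z) (act q) (mov z g)
  finish (m̃ , g̃ , _ , (fR , gpR) , sq) =
   wait q z , mov m̃ g̃ , rc z z≤ (lia "c=dd=1ea=cb=e;a=1b 08573025586104" (BL z , TL q , B z , T z , T q) (upz , tz≡ , bl z (≢-sym m≢z) , tl q q≢z)) (RWait.blue vR) ,
   l2 m̃ g̃ r<k' (subst (Outside r TR BR) (sym tz) (outside-wait row TL BL TR BR vR stepR tr br outq)) fR gpR , sq
 release-case {q} {z} {g} tz≡ vL vR vR' vR₂ (mmov tm tl) tr@(mwait tq tz tp) (mmov bm bl) br@(mact bq bp) (l2 m' g₂ r<k' out f@(m≤ , g≤ , hop , fst) gp) stepR@(wx lt') =
  act q , mov m' g₂ , ra nbL ,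
  l2 m' g₂ r<k' (subst (Outside r TR BR) (sym tz) outR)
   (m≤ , (lia "a-cb=c;a-b 3320" (g , BR m' , B m') (g≤ , brm)) , (lia "c<da=cb=d;a<b 44053" (BR m' , TR m' , B m' , T m') (hop , brm , tp m' m≢q m≢z)) , least) (record { lt = (lia "c<ba=c;a<b 3312" (BR m' , g₂ , B m') (lt , brm)) ; free = freeR ; fill = fillR }) ,
  disjoint m≢q (lia "c<dd-ee<af<gg<cb=g;a≠1b 6812654" (g₂ , B q , T z , g , B m' , B z , T q) (Gap.lt (LMove.gap vL) , g≤ , lt , ins))
  where
  open WaitFacts row vR
  open Gap gp
  m≢z : m' ≢ z
  m≢z refl = clash "a<bb-cc-a; 3210" (T z , g , B z) (Gap.lt (LMove.gap vL) , g≤ , le z z≤)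
  ins : B z < T q × T q < T z × B q ≡ T q
  ins = lia "d-ba<dc=1bgefbdca@;a<bb<cd=b 0535040023000033218003371002802c2270" (B z , T q , T z , B q , q , z , l) (le q q≤ , lt' , tz≡ , pair q z q≤ z≤ q≢z)
  m≢q : m' ≢ q
  m≢q refl = clash "a<bc<bb<da=b; 240" (B q , T q , B z , T z) (hop , ins)
  brm : BR m' ≡ B m'
  brm = bp m' m≢q
  nbL : ∀ p -> p ≤ r -> BL p ≢ suc (TL q)
  nbL p p≤ e with p ≟ m'
  ... | yes refl = clash "a<bb-cc<de=da=1fg=fe=1g; 7a986134" (T z , g , B p , g₂ , BL p , T q , TL q) (Gap.lt (LMove.gap vL) , g≤ , lt , bm , tz≡ , tl q q≢z , e)
  ... | no n = RAct.free vR₂ p (s≤s p≤) (lia "c=de=ae=1cf<dd<gb=d;a=1b 0a5802955a1076" (B p , B q , TL q , T q , BL p , B z , T z) (tl q q≢z , bl p n , e , ins))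
  outR : Outside r TR BR (T q)
  outR s s≤ with s ≟ q | s ≟ z
  ... | yes refl | _ = lia "b=1de<aa<fd=a;a-bc-a| 3704" (T s , BR s , TR s , B s , B z , T z) (bq , ins)
  ... | no n | yes refl = lia "c=a;a-bc-a| 221" (T q , BR s , TR s) tz
  ... | no n | no n' = lia "b=dc=ef<aa<gh=a&&kijedgf@;a-bc-a| 004b816004d61a005ihe0f3cb0" (T q , BR s , TR s , B s , T s , B z , T z , B q , s , z , l) (bp s n , tp s n n' , ins , pair s z s≤ z≤ n')
  least : ∀ p -> p ≤ r -> BR p < g ⊎ TR p ≤ BR p ⊎ BR m' ≤ BR p
  least p p≤ with p ≟ q | p ≟ z
  ... | yes refl | _ = lia "e=1fa=1gc=eh<ff<eg=f;a<bc-ad-a|| 5906b5" (BR p , g , TR p , BR m' , T z , T p , B p , B z) (tz≡ , bq , tq , ins)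
  ... | no n | yes refl = lia "e<be=1fc=f;a<bc-ad-a|| 576124" (BR p , g , TR p , BR m' , T p , T q) (Gap.lt (LMove.gap vL) , tz≡ , tz)
  ... | no n | no n' = lia "c=ea=fd=gf<be-fg-f||;a<bc-ad-a|| 003a50004a80549405" (BR p , g , TR p , BR m' , T p , B p , B m') (tp p n n' , bp p n , brm , fst p p≤)
  freeR : ∀ p -> p < suc r -> BR p ≢ g₂
  freeR p p< e with p ≟ q
  ... | yes refl = clash "a<bb-cc<de=de=1fg<hh<af=h; 7a986512" (T z , g , B m' , g₂ , BR p , B p , B z , T p) (Gap.lt (LMove.gap vL) , g≤ , lt , e , bq , ins)
  ... | no n = clash "a=ba=cc≠b; 0034303502" (BR p , g₂ , B p) (e , bp p n , free p p<)
  fillR : ∀ j -> BR m' < j -> j < g₂ -> Occ (suc r) BR j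
  fillR j j₁ j₂ with fill j (lia "c<bc=a;a<b 3302" (B m' , j , BR m') (j₁ , brm)) j₂
  ... | p , p< , e with p ≟ q
  ... | yes refl = clash "a<bc=db-ef<df=eg<hh<ac=h; 7812a746" (T z , g , B p , j , B m' , BR m' , B z , T p) (Gap.lt (LMove.gap vL) , e , g≤ , j₁ , brm , ins)
  ... | no n = p , p< , trans (bp p n) e

 -- Left insertion puts `m` into the column just right of `q`. If it comes first, `m` is in the way
 -- and right insertion makes `q` and `m` trade places; if it comes second, `q` has gone to that
 -- column and `m` fills the one vacated by `q`.
 hold-case : ∀ {q m g g'} -> m ≢ q -> g ≡ suc (T q) -> g' ≡ T q -> Case (mov m g) (act q) (wait q m) (mov m g')
 hold-case _ _ _ vL vR vR' vR₂ tl tr bl br (lf k≤ _) _ = ⊥-elim (<⇒≱ r<k k≤)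
 hold-case {q} {m} {g} {g'} m≢q g≡ g'≡ vL vR vR' vR₂ (mmov tm tl) (mact tq tp) (mmov bm bl) (mact bq bp) (l1 (s , s≤ , i₁ , i₂)) (ra nb) =
  wait q m , mov m g' , ww (lia "c=1db=ce-da=e;a<b 571253" (BL q , BL m , g , T q , B q) (g≡ , bm , le q q≤ , bl q (≢-sym m≢q))) ,
  l1 (s , s≤ , (lia "c<da=cb=d;a<b 44053" (BR s , TR m , B s , T m) (i₁ , bp s s≢q , tp m m≢q)) , (lia "c<db=da=c;a<b 45142" (TR m , TR s , T m , T s) (i₂ , tp s s≢q , tp m m≢q))) ,
  hold m≢q (lia "a=1cb=c;a=1b 0433023410" (g , B q , T q) (g≡ , insq)) (lia "a=cb=c;a=b 0433023410" (g' , B q , T q) (g'≡ , insq))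
  where
  open ActFacts row vR
  open MoveFacts row vL using (m≤; low≤)
  s≢m : s ≢ m
  s≢m refl = clash "a<a; 10" (T m) i₂
  ins = lia "d-ee<fg<ecbafged@;a<bc-bd=e 00354100241002a20c26000260002302e0" (m , s , l , B m , T m , T s , B s) (le m m≤ , i₂ , i₁ , pair s m s≤ m≤ s≢m)
  s≢q : s ≢ q
  s≢q refl = clash "a<bc<ab-ad=e; 242" (q , l , m , B m , T m) (RAct.red vR , ins)
  insq : B q ≡ T q
  insq = lia "c<dd=1ba-bc<ef<cg<hi-hj=c&&e-cd<eh<g||ihkefba@;a=b 0c0229000034e214004hg1c003k824l0ak2804b09a" (B q , T q , T m , g , T s , B s , m , s , l , B m , q) (Gap.lt (LMove.gap vL) , g≡ , le q q≤ , i₂ , i₁ , ins , low≤ s s≤ , pair s q s≤ q≤ s≢q)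
 hold-case {q} {m} {g} _ g≡ _ vL vR vR' vR₂ _ _ _ _ (l1 (s , s≤ , i₁ , i₂)) (rb z z≤ bz _) =
  ⊥-elim (no-start-below z z≤ bz s s≤ i₁ i₂)
  where
  no-start-below : ∀ z -> z ≤ r -> B z ≡ suc (T q) -> ∀ s -> s ≤ r -> B s < T m -> T m < T s -> ⊥
  no-start-below z z≤ bz s s≤ i₁ i₂ with s ≟ z | s ≟ m
  ... | yes refl | _ = clash "a<bb=1cd<ad=1c; 45402" (T m , g , T q , B z) (Gap.lt (LMove.gap vL) , g≡ , i₁ , bz)
  ... | no n | yes refl = clash "a<a; 10" (T m) i₂
  ... | no n | no n' = clash "a<bb=1cd-ef-aa<gh<ad=1ce≠1cg-ab<gi<j||likghed@lijghaf@; 033a0503290023cb1002b1002h2080c4n21i007jd1kqpi006rv80p93oi0260" (T m , g , T q , B z , T z , B m , T s , B s , s , m , z , l) (Gap.lt (LMove.gap vL) , g≡ , le z z≤ , le m (MoveFacts.m≤ row vL) , i₂ , i₁ , bz , ActFacts.free≤ row vR z z≤ , MoveFacts.low≤ row vL s s≤ , pair s z s≤ z≤ n , pair s m s≤ (MoveFacts.m≤ row vL) n')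
 hold-case {q} {m} {g} _ g≡ _ vL vR vR' vR₂ _ _ _ _ (l1 (s , s≤ , i₁ , i₂)) (rc z z≤ bz _) with s ≟ z | s ≟ m
 ... | yes refl | _ = clash "a<bb=1cd=1cd<a; 45410" (T m , g , T q , B s) (Gap.lt (LMove.gap vL) , g≡ , bz , i₁)
 ... | no n | yes refl = clash "a<a; 10" (T m) i₂
 ... | no n | no n' = clash "a<bb=1cd-ef-ad=1ca<gh<ae≠1cg-ab<gi<j||likghed@lijghaf@; 033a0703270023c9100291002f2080c4n21k007ld1iqpk006rv80n93qi0260" (T m , g , T q , B z , T z , B m , T s , B s , s , m , z , l) (Gap.lt (LMove.gap vL) , g≡ , le z z≤ , le m (MoveFacts.m≤ row vL) , bz , i₂ , i₁ , ActFacts.free≤ row vR z z≤ , MoveFacts.low≤ row vL s s≤ , pair s z s≤ z≤ n , pair s m s≤ (MoveFacts.m≤ row vL) n')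
 hold-case {q} {m} {g} {g'} m≢q refl refl vL vR vR' vR₂ (mmov tm tl) tr@(mact tq tp) (mmov bm bl) br (l2 m' g₂ r<k' out f@(m≤' , g≤ , hop , fst) gp) stepR =
  finish (tail-hop row TL BL TR BR vR up stepR vR₂ tr br f gp)
  where
  open ActFacts row vR
  open MoveFacts row vL using (m≤; no-start)
  up : B q ≡ T q
  up = lia "c<da-be-ff<1bb-aa-fb<a||dgcfeba@;a=b 06022100003221003981002g42d2220250" (B q , T q , q , l , B m , T m , m) (RAct.red vR , le q q≤ , le m m≤ , Gap.lt (LMove.gap vL) , no-start q q≤ , pair m q m≤ q≤ m≢q)
  m<q = lia "a<1ba≠b;a<b 00230220" (T m , T q) (Gap.lt (LMove.gap vL) , (\e -> m≢q (inj-T m q m≤ q≤ e)))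
  m'≢m : m' ≢ m
  m'≢m refl = clash "a-bb<cc<a; 3210" (B m , T m , T q) (le m m≤ , m<q , g≤)
  m'≢q : m' ≢ q
  m'≢q refl = clash "a<bb<a; 210" (B q , T q) (hop , g≤)
  finish : (∃ \m̃ -> ∃ \g̃ -> (First r TR BR (T q) m̃ × Gap (suc r) BR (BR m̃) g̃) × Sq B (mov m' g₂) _ (act q) (mov m̃ g̃)) ->
   Result l k x y r TL BL TR BR B (mov m' g₂) _ (wait q m) (mov m (T q))
  finish (m̃ , g̃ , (fR , gpR) , sq) = act q , mov m̃ g̃ ,
   wx (lia "c-de=fd<fa=cb=e;a<b 6508374" (BL m , BL q , B m , T m , B q , T q) (le m m≤ , up , m<q , bl m (≢-sym m'≢m) , bl q (≢-sym m'≢q))) ,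
   l2 m̃ g̃ r<k' (subst (Outside r TR BR) (sym (tp m m≢q))
    (outside-act row TL BL TR BR vR (m , LMove.m<r vL , refl) (<⇒≢ m<q) stepR tr br out)) fR gpR , sq

 -- A trade of places does not change which place left insertion moves. The delicate row is the one
 -- in which `q` and `z` cross, since right insertion removes this crossing.
 both-case : ∀ {q z m m' g} -> Swap q z m m' -> Case (mov m g) (wait q z) (wait q z) (mov m' g)
 both-case _ vL vR vR' vR₂ tl tr bl br (lf k≤ _) _ = ⊥-elim (<⇒≱ r<k k≤)
 both-case {q} {z} {m} {m'} {g} sw vL vR vR' vR₂ (mmov tm tl) (mwait tq tz tp) (mmov bm bl) (mwait bq bz bp) (l1 (s , s≤ , i₁ , i₂)) (ww lt') =
  wait q z , mov m' g , ww (lt'' sw) , l1 (subst (Inside r TR BR) (sym (swap-col sw)) ins') , both sw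
  where
  open WaitFacts row vR
  open MoveFacts row vL using (m≤; low≤; free≤)
  swap-col : Swap q z m m' -> TR m' ≡ T m
  swap-col (inj₁ (refl , refl)) = tz
  swap-col (inj₂ (inj₁ (refl , refl))) = tq
  swap-col (inj₂ (inj₂ (n , n' , refl))) = tp m n n'
  ins' : Inside r TR BR (T m)
  ins' with s ≟ q | s ≟ z
  ... | yes refl | _ = z , z≤ , (lia "c<ba=c;a<b 3312" (BR z , T m , B q) (i₁ , bz)) , (lia "a<cb=c;a<b 3320" (T m , TR z , T q) (i₂ , tz))
  ... | no _ | yes refl = q , q≤ , (lia "c<ba=c;a<b 3312" (BR q , T m , B z) (i₁ , bq)) , (lia "a<cb=c;a<b 3320" (T m , TR q , T z) (i₂ , tq))
  ... | no n | no n' = s , s≤ , (lia "c<ba=c;a<b 3312" (BR s , T m , B s) (i₁ , bp s n n')) , (lia "a<cb=c;a<b 3320" (T m , TR s , T s) (i₂ , tp s n n'))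
  lt'' : Swap q z m m' -> BL q < BL z
  lt'' (inj₂ (inj₁ (refl , refl))) = lia "c<db=de<cf-ea=f;a<b 6712364" (BL q , BL z , T z , g , T q , B q) (Gap.lt (LMove.gap vL) , bm , RWait.lt vR , le q q≤ , bl q q≢z)
  lt'' (inj₂ (inj₂ (n , n' , refl))) = lia "c<da=cb=d;a<b 44053" (BL q , BL z , B q , B z) (lt' , bl q (≢-sym n) , bl z (≢-sym n'))
  lt'' (inj₁ (refl , refl)) with s ≟ q | s ≟ z
  ... | yes refl | _ = lia "c<c;a<b 10" (BL q , BL z , T q) i₂
  ... | no n | yes refl = lia "c<de<fd<eighecfd@;a<b 002310045164003b902a2" (BL q , BL z , B q , B z , T q , T z , q , z , l) (lt' , i₂ , i₁ , pair q z q≤ z≤ q≢z)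
  ... | no n | no n' = lia "a=cd=ce-fe<gf<hi<fb=gj=kd<jh-fc<hl<m||nlmhife@nlohikg@;a<b 022a0023ec1002c1002i2080a5sr21i00ai1l4njtspg008soyx80q97n0oyxul260" (BL q , BL z , g , TL q , B q , T q , B z , T s , B s , TL z , T z , s , q , l , z) (bm , tm , le q q≤ , lt' , i₂ , i₁ , bl z (≢-sym q≢z) , tl z (≢-sym q≢z) , RWait.lt vR' , low≤ s s≤ , pair s q s≤ q≤ n , pair s z s≤ z≤ n')
 both-case {q} {z} {m} {m'} {g} sw vL vR vR' vR₂ (mmov tm tl) (mwait tq tz tp) (mmov bm bl) (mact bq bp) (l1 (s , s≤ , i₁ , i₂)) (wx lt') = main sw
  where
  open WaitFacts row vR
  open MoveFacts row vL using (m≤; low≤; free≤)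
  ins = lia "f-dd<ec<fgabdfec@;a<bc<dd<ef=d 003513003651000c260003d0b004ed03002402f02a2" (q , z , B z , T q , T z , B q , l) (le q q≤ , RWait.lt vR , lt' , pair q z q≤ z≤ q≢z)
  brz : BR z ≡ B z
  brz = bp z (≢-sym q≢z)
  s≢m : s ≢ m
  s≢m refl = clash "a<a; 10" (T m) i₂
  insm = lia "c-dd<fg<debafgdc@;a<bc=de-b 00354100241002a20c26000002302e0260" (m , s , B m , T m , l , T s , B s) (le m m≤ , i₂ , i₁ , pair s m s≤ m≤ s≢m)
  main : Swap q z m m' -> Result l k x y r TL BL TR BR B (mov m g) (act q) (wait q z) (mov m' g)
  main (inj₂ (inj₁ (refl , refl))) = clash "a<bc=de-b&&f<ac<gg<dh=g; 3632" (z , s , B z , T z , l , q , T q , B q) (insm , ins)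
  -- The crossing by `z` carried the left move of `q` through this row. After right insertion
  -- nothing crosses that column any more: left insertion lands here and hands over to `q`, which
  -- from now on both insertions move.
  main (inj₁ (refl , refl)) = act q , mov q (suc (suc (B q))) , wx (lia "c<db=da=ef<ge<cc<hi=c;a<b 5a6397" (BL z , BL q , T q , g , B z , q , z , T z , B q) (Gap.lt (LMove.gap vL) , bm , bl z (≢-sym q≢z) , ins)) ,
   l2 q (suc (suc (B q))) r<k (\t t≤ -> (lia "a-bc-a|;a-bc-a| 00230220" (TR z , BR t , TR t) (outR t t≤)))
    (q≤ , (lia "a=1cb=1de<fg<cc<hd=c;a-b 49805" (g , BR q , T q , B q , q , z , B z , T z) (g≡ , bq , ins)) , (lia "c=1da=1eb=fg<hi<dd<fe=d&&&f≠c;a<b 00580c476b07da3" (BR q , TR q , g , T q , B q , T z , q , z , B z) (g≡ , bq , tq , ins , free≤ z z≤)) , \p p≤ -> (lia "b=1ed=1fg<hi<ee<jf=e;a<bc-ad-a|| 5b9617" (BR p , g , TR p , BR q , T q , B q , q , z , B z , T z) (g≡ , bq , ins)))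
    (subst (\c -> Gap (suc r) BR c (suc (suc (B q)))) (sym bq) (suc-gap freeR)) ,
   twice (lia "a=1cd<ef<cc<gb=c;a=1b 0736023710" (g , B q , T q , q , z , B z , T z) (g≡ , ins)) (lia "b=1cd<ef<cc<ga=c;2a=1b 0737103602" (B q , g , T q , q , z , B z , T z) (g≡ , ins))
   where
   g≡ : g ≡ suc (T q)
   g≡ = red-gap row vL (RWait.red vR)
   outR : ∀ t -> t ≤ r -> TR z ≤ BR t ⊎ TR t ≤ TR z
   outR t t≤ with t ≟ q | t ≟ z
   ... | yes refl | _ = lia "b=1da=ef<gh<ee<id=e;a-bc-a| 4a607" (TR z , BR t , TR t , B t , T t , t , z , B z , T z) (bq , tz , ins)
   ... | no _ | yes refl = inj₂ ≤-refl
   ... | no n | no n' = lia "b=dc=ea=fg<hi<ff<jk=f&&&mlhedji@;a-bc-a| 005eb168005ga61d005lkh0i5fb0ce" (TR z , BR t , TR t , B t , T t , T q , q , z , B z , T z , B q , t , l) (bp t n , tp t n n' , tz , ins , pair t z t≤ z≤ n')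
   freeR : ∀ p -> p < suc r -> BR p ≢ suc (suc (B q))
   freeR p p< e with p ≟ q | p ≟ z | p ≟ r
   ... | yes refl | _ | _ = clash "a=2ba=1b; 221" (BR p , B p) (e , bq)
   ... | no _ | yes refl | _ = clash "a<bc=ac=2b; 3403" (B p , B q , BR p) (lt' , brz , e)
   ... | no n | no n' | yes refl = clash "a=1bc<de=ce=2fg<hi<bb<jf=b&&&j≠alkhdcji@; 013e50016e185ad00631dc7g002k08mbgj30el" (g , T q , B p , T p , BR p , B q , q , z , B z , T z , p , l) (g≡ , r-hop , bp p n , e , ins , free≤ z z≤ , pair p z ≤-refl z≤ n')
   ... | no n | no n' | no n'' = clash "a=1bc=ad-ef=dg=eh=if=2jk<lm<bb<ij=b&&&i≠ag-ch-gl<n||onledim@; 025c0l6b028ie0km5ah026k1a7cj008g1je9o4f00084l0o32608l0gdip3k" (g , T q , TL q , B p , T p , BR p , TL p , TL z , T z , B q , q , z , B z , p , l) (g≡ , tm , le p (≤-pred p<) , bp p n , tl p n , tl z (≢-sym q≢z) , e , ins , free≤ z z≤ , RWait.high vR' p (≤∧≢⇒< (≤-pred p<) n'') , pair p z (≤-pred p<) z≤ n')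
  main (inj₂ (inj₂ (n , n' , refl))) = act q , mov m g , wx (lia "c<db=da=c;a<b 45142" (BL z , BL q , B z , B q) (lt' , bl q (≢-sym n) , bl z (≢-sym n'))) ,
   l1 (subst (Inside r TR BR) (sym (tp m n n')) insR) , disjoint n g≢
   where
   s≢q : s ≢ q
   s≢q refl = clash "a<bc<ad=eb-a; 240" (q , l , m , B m , T m) (RWait.red vR , insm)
   pqm : Apart l m q (T m) (B m) (T q) (B q)
   pqm = pair m q m≤ q≤ n
   insR : Inside r TR BR (T m)
   insR with s ≟ z
   ... | yes refl = z , z≤ , (lia "c<ba=c;a<b 3312" (BR z , T m , B z) (i₁ , brz)) , (lia "a<cb=de<fg=ah-f&&i<fj<dd<ck=d&&&a-dc-af<e||heiagdk@;a<b 004g15d00045g2d0f002i02f0005ka32j4mg3j" (T m , TR z , T z , T q , m , z , B m , l , q , B z , B q) (i₂ , tz , insm , ins , RWait.high vR m (LMove.m<r vL) , pqm))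
   ... | no o = s , s≤ , (lia "c<ba=c;a<b 3312" (BR s , T m , B s) (i₁ , bp s s≢q)) , (lia "a<cb=c;a<b 3320" (T m , TR s , T s) (i₂ , tp s s≢q o))
   g≢ : g ≢ suc (B q)
   g≢ e with s ≟ z
   ... | yes refl = clash "a<bb=1cd=be=fg=hi<jk=al-j&&m<jn<ff<hc=f&&&h-ab<hj<i||d-eg-dj<i||; 017d0kj45c00025ki0h5004f0k22e02c0" (T m , g , B q , TL m , TL q , T q , TL z , T z , m , z , B m , l , q , B z) (Gap.lt (LMove.gap vL) , e , tm , tl q (≢-sym n) , tl z (≢-sym n') , insm , ins , low≤ z z≤ , RWait.high vR' m (LMove.m<r vL))
   ... | no o = clash "a<bb=1ca<de<af<gh=ai-g&&j<kl<mm<nc=m&&&d-ab<dg<f||igkdenl@; 012d000025h219600691gkj8004p80l3fe02c0" (T m , g , B q , T s , B s , m , s , B m , l , q , z , B z , T q , T z) (Gap.lt (LMove.gap vL) , e , i₂ , i₁ , insm , ins , low≤ s s≤ , pair s z s≤ z≤ o)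
 both-case {q} {z} {m} {m'} {g} sw vL vR vR' vR₂ (mmov tm tl) tr@(mwait tq tz tp) (mmov bm bl) br (l2 m₂ g₂ r<k' out f gp) stepR =
  hop-result (\m̃ g̃ -> l2 m̃ g̃ r<k' (subst (Outside r TR BR) (sym (swap-col sw)) (outside-wait row TL BL TR BR vR stepR tr br out)))
   (wait-hop row TL BL TR BR vR stepR vR₂ tr br (separate row vL out) f gp bm bl)
  where
  swap-col : Swap q z m m' -> TR m' ≡ T m
  swap-col (inj₁ (refl , refl)) = tz
  swap-col (inj₂ (inj₁ (refl , refl))) = tq
  swap-col (inj₂ (inj₂ (n , n' , refl))) = tp m n n'

 square : ∀ {sL sR sR' sL'} -> Sq T sL sR sR' sL' -> Case sL sR sR' sL'
 square (idleL {s}) = idleL-case s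
 square (idleR {none}) = idleL-case none
 square (idleR {mov m g}) = idleR-case m g
 square (idleR {dead m z}) vL = ⊥-elim (<⇒≱ r<k (≤-trans (LDead.k≤z vL) (<⇒≤ (LDead.z<r vL))))
 square (disjoint h h') = disjoint-case h h'
 square (twice h h') = twice-case h h'
 square (chase h h' h'' h‴) = chase-case h h' h'' h‴
 square (release h) = release-case h
 square (hold h h' h'') = hold-case h h' h''
 square (both h) = both-case h

-- Whole pipe dreams.  pos t p is the column in which pipe p crosses the bottom
-- edge of row t; row t + 1 of the grid goes from pos t (top) to pos (suc t) (bottom).

-- The column standing for ∞ at height `t`. It has to grow with `t`, since in the standard part the
-- pipe leaving in row `t + 1` goes down in column `t + 1`.
wd : ℕ -> ℕ -> ℕ
wd K t = suc (t + K)

Full : ℕ -> (ℕ -> ℕ) -> Set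
Full t T = (∀ p -> p < t -> T p ≤ t) × (∀ j -> 1 ≤ j -> j ≤ t -> Occ t T j)

-- All that the insertions need to know of a pipe dream. Columns used at the bottom of row `t + 1`
-- are at most `b + t`, and from height `f` on the first columns are filled without gaps; an
-- insertion raises `b` and `f` by one each.
record World (l k K b f : ℕ) : Set where
 field
  pos  : ℕ -> ℕ -> ℕ
  row  : ∀ t -> Row l (b + t) (wd K t) t (pos t) (pos (suc t))
  rig  : ∀ t -> k ≤ t -> Rigid t (pos t) (pos (suc t))
  full : ∀ t -> f ≤ t -> Full t (pos t)

if-yes : ∀ {A P : Set} (d : Dec P) -> P -> {a b : A} -> (if Dec.does d then a else b) ≡ a
if-yes (yes _) p = refl
if-yes (no n) p = ⊥-elim (n p)

if-no : ∀ {A P : Set} (d : Dec P) -> ¬ P -> {a b : A} -> (if Dec.does d then a else b) ≡ b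
if-no (yes p) n = ⊥-elim (n p)
if-no (no _) n = refl

upd : ℕ -> ℕ -> (ℕ -> ℕ) -> ℕ -> ℕ
upd m g T p = if Dec.does (p ≟ m) then g else T p

rmove : RState -> (ℕ -> ℕ) -> ℕ -> ℕ
rmove none T = T
rmove (act q) T = upd q (suc (T q)) T
rmove (wait q z) T = upd q (T z) (upd z (T q) T)

lmove : LState -> (ℕ -> ℕ) -> ℕ -> ℕ
lmove none T = T
lmove (mov m g) T = upd m g T
lmove (dead m z) T = upd m (T z) (upd z (T m) T)

upd-at : ∀ m g T -> upd m g T m ≡ g
upd-at m g T = if-yes (m ≟ m) refl

upd-off : ∀ m g T p -> p ≢ m -> upd m g T p ≡ T p
upd-off m g T p n = if-no (p ≟ m) n

swap-at : ∀ m z (T : ℕ -> ℕ) -> upd m (T z) (upd z (T m) T) z ≡ T m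
swap-at m z T with z ≟ m
... | yes refl = upd-at m (T m) (upd m (T m) T)
... | no n = trans (upd-off m (T z) (upd z (T m) T) z n) (upd-at z (T m) T)

r-moved : ∀ s T -> RMoved T (rmove s T) s
r-moved none T = mnone (\p -> refl)
r-moved (act q) T = mact (upd-at q _ T) (upd-off q _ T)
r-moved (wait q z) T = mwait (upd-at q (T z) (upd z (T q) T)) (swap-at q z T)
 (\p n n' -> trans (upd-off q (T z) (upd z (T q) T) p n) (upd-off z (T q) T p n'))

l-moved : ∀ s T -> LMoved T (lmove s T) s
l-moved none T = mnone (\p -> refl)
l-moved (mov m g) T = mmov (upd-at m _ T) (upd-off m _ T)
l-moved (dead m z) T = mdead (upd-at m (T z) (upd z (T m) T)) (swap-at m z T)
 (\p n n' -> trans (upd-off m (T z) (upd z (T m) T) p n) (upd-off z (T m) T p n'))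

wait-q< : ∀ {l r T q z} -> RWait l r T q z -> q < r
wait-q< v = ≤-trans (RWait.red v) (≤-trans (RWait.blue v) (<⇒≤ (RWait.z<r v)))

dead-m< : ∀ {k r T m z} -> LDead k r T m z -> m < r
dead-m< v = <-trans (LDead.m<z v) (LDead.z<r v)

slack : ∀ {b K} -> b < K -> ∀ t -> suc (b + t) < wd K t
slack {b} {K} h t = s≤s (≤-trans (≤-reflexive (cong suc (+-comm b t))) (≤-trans (≤-reflexive (sym (+-suc t b))) (+-monoʳ-≤ t h)))

swap-rigid : ∀ {t T B} {T' B' : ℕ -> ℕ} {q z} -> q < t -> z < t -> Rigid t T B ->
 T' q ≡ T z -> T' z ≡ T q -> (∀ p -> p ≢ q -> p ≢ z -> T' p ≡ T p) ->
 B' q ≡ B z -> B' z ≡ B q -> (∀ p -> p ≢ q -> p ≢ z -> B' p ≡ B p) -> Rigid t T' B'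
swap-rigid {t} {T} {B} {T'} {B'} {q} {z} q<t z<t rg tq tz tp bq bz bp = record { upr = upr' ; full = full' }
 where
 open Rigid rg
 upr' : ∀ p -> p < t -> B' p ≡ T' p
 upr' p p< with p ≟ q | p ≟ z
 ... | yes refl | _ = lia "c=da=cb=d;a=b 064530246104" (B' p , T' p , B z , T z) (upr z z<t , bq , tq)
 ... | no _ | yes refl = lia "c=da=cb=d;a=b 064530246104" (B' p , T' p , B q , T q) (upr q q<t , bz , tz)
 ... | no n | no n' = lia "c=da=cb=d;a=b 064530246104" (B' p , T' p , B p , T p) (upr p p< , bp p n n' , tp p n n')
 full' : ∀ j -> 1 ≤ j -> j < B' t -> Occ t T' j
 full' j j₁ j₂ with full j j₁ (lia "a<cc=b;a<b 3321" (j , B t , B' t) (j₂ , bp t (\e -> <⇒≢ q<t (sym e)) (\e -> <⇒≢ z<t (sym e))))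
 ... | p , p< , e with p ≟ q | p ≟ z
 ... | yes refl | _ = z , z<t , trans tz e
 ... | no _ | yes refl = q , q<t , trans tq e
 ... | no n | no n' = p , p< , trans (tp p n n') e

module _ {t : ℕ} {T : ℕ -> ℕ} where
 swap-full : ∀ {T' : ℕ -> ℕ} {q z} -> q < t -> z < t -> T' q ≡ T z -> T' z ≡ T q ->
  (∀ p -> p ≢ q -> p ≢ z -> T' p ≡ T p) -> Full t T -> Full t T'
 swap-full {T'} {q} {z} q<t z<t tq tz tp (hi , occ) = hi' , occ'
  where
  hi' : ∀ p -> p < t -> T' p ≤ t
  hi' p p< with p ≟ q | p ≟ z
  ... | yes refl | _ = lia "c-ba=c;a-b 3312" (T' p , t , T z) (hi z z<t , tq)
  ... | no _ | yes refl = lia "c-ba=c;a-b 3312" (T' p , t , T q) (hi q q<t , tz)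
  ... | no n | no n' = lia "c-ba=c;a-b 3312" (T' p , t , T p) (hi p p< , tp p n n')
  occ' : ∀ j -> 1 ≤ j -> j ≤ t -> Occ t T' j
  occ' j j₁ j₂ with occ j j₁ j₂
  ... | p , p< , e with p ≟ q | p ≟ z
  ... | yes refl | _ = z , z<t , trans tz e
  ... | no _ | yes refl = q , q<t , trans tq e
  ... | no n | no n' = p , p< , trans (tp p n n') e

 wait-full : ∀ {T' l q z} -> RWait l t T q z -> RMoved T T' (wait q z) -> Full t T -> Full t T'
 wait-full v (mwait tq tz tp) = swap-full (wait-q< v) (RWait.z<r v) tq tz tp

 dead-full : ∀ {T' k m z} -> LDead k t T m z -> LMoved T T' (dead m z) -> Full t T -> Full t T'
 dead-full v (mdead tm tz tp) = swap-full (dead-m< v) (LDead.z<r v) tm tz tp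

new-last : ∀ {l b w t T B} -> Row l b w t T B -> Full t T -> Full (suc t) B -> B t ≡ suc t
new-last {t = t} {T} {B} row (hi , _) (_ , occ) with occ (suc t) (s≤s z≤n) ≤-refl
... | z , z< , e with z ≟ t
... | yes refl = e
... | no n = lia "c-bd=1bd-c;a=1b 3310" (B t , t , T z , B z) (hi z (≤∧≢⇒< (≤-pred z<) n) , e , Row.le row z (≤-pred z<))

-- In a filled row the column after `q` is free only if `T q` is the last occupied one, `t`; but the
-- new pipe goes down in column `t + 1`. So a moving `q` bumps into it, and this pipe is not below
-- `l`.
r-waits : ∀ {l b w y t T B s s'} -> Row l b w t T B -> Full t T -> Full (suc t) B -> Rigid t T B -> l ≤ t ->
 s ≢ none -> RValid l w t T s -> RStep l y t T B s s' -> ∃ \q -> ∃ \z -> s' ≡ wait q z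
r-waits row full full' rg l≤t ne v (rn _) = ⊥-elim (ne refl)
r-waits row full full' rg l≤t ne v (rs _) = ⊥-elim (ne refl)
r-waits {t = t} {T} {B} row full@(hi , occ) full' rg l≤t ne v (ra {q} nb) =
 ⊥-elim (nb t ≤-refl (lia "a=1cc-bb-c;a=1b 0433013420" (B t , T q , t) (new-last row full full' , q≥ , hi q (RAct.q<r v))))
 where
 q≥ : t ≤ T q
 q≥ with t ≤? T q
 ... | yes h = h
 ... | no h with occ (suc (T q)) (s≤s z≤n) (≰⇒> h)
 ... | p , p< , e = ⊥-elim (RAct.free v p p< e)
r-waits {l} {t = t} {T} {B} row full full' rg l≤t ne v (rb {q} z z≤ bz red) with z ≟ t
... | yes refl = clash "a<bb-a; 210" (t , l) (red , l≤t)
... | no n = clash "a=ba=1cb≠1c; 0035023430" (B z , T z , T q) (Rigid.upr rg z (≤∧≢⇒< z≤ n) , bz , RAct.free v z (≤∧≢⇒< z≤ n))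
r-waits row full full' rg l≤t ne v (rc {q} z _ _ _) = q , z , refl
r-waits row full full' rg l≤t ne v (ww {q} {z} _) = q , z , refl
r-waits {T = T} {B} row full full' rg l≤t ne v (wx {q} {z} h) =
 (clash "a=bc=dd<ba<c; 44031" (B z , T z , B q , T q) (Rigid.upr rg z (RWait.z<r v) , Rigid.upr rg q (wait-q< v) , RWait.lt v , h))

-- Lets left insertion be run after right insertion. Pipes being vertical after row `k`, no waiting
-- pair crosses there, and only the pipe just leaving can be bumped into.
r-rigid : ∀ {l k b w y t T B T' B' s s'} -> Row l b w t T B -> l ≤ k -> k ≤ t -> y ≤ l -> Rigid t T B ->
 RValid l w t T s -> RStep l y t T B s s' -> RMoved T T' s -> RMoved B B' s' -> Rigid t T' B'
r-rigid {t = t} {T} {B} {T'} {B'} row l≤k k≤t y≤l rg v (rn _) (mnone eT) (mnone eB) = record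
 { upr = \p p< -> (lia "c=da=cb=d;a=b 064530246104" (B' p , T' p , B p , T p) (Rigid.upr rg p p< , eB p , eT p))
 ; full = \j j₁ j₂ -> let (p , p< , e) = Rigid.full rg j j₁ (subst (j <_) (eB t) j₂) in p , p< , trans (eT p) e }
r-rigid {l} {k} {y = y} {t} row l≤k k≤t y≤l rg v (rs refl) _ _ = ⊥-elim (<⇒≱ (≤-trans y≤l l≤k) k≤t)
r-rigid {t = t} {T} {B} {T'} {B'} row l≤k k≤t y≤l rg v (ra {q} nb) (mact tq tp) (mact bq bp) = record { upr = upr' ; full = full' }
 where
 open Rigid rg
 open RAct v
 upr' : ∀ p -> p < t -> B' p ≡ T' p
 upr' p p< with p ≟ q
 ... | yes refl = lia "c=da=1cb=1d;a=b 064530246104" (B' p , T' p , B p , T p) (upr p p< , bq , tq)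
 ... | no n = lia "c=da=cb=d;a=b 064530246104" (B' p , T' p , B p , T p) (upr p p< , bp p n , tp p n)
 bt : B' t ≡ B t
 bt = bp t (\e -> <⇒≢ q<r (sym e))
 full' : ∀ j -> 1 ≤ j -> j < B' t -> Occ t T' j
 full' j j₁ j₂ with full j j₁ (lia "a<cc=b;a<b 3321" (j , B t , B' t) (j₂ , bt))
 ... | p , p< , e with p ≟ q
 ... | no n = p , p< , trans (tp p n) e
 ... | yes refl with full (suc (T p)) (s≤s z≤n) (lia "a=cc<dd=bb≠1a;1a<b 0046430270" (T p , B t , j , B' t) (e , j₂ , bt , nb t ≤-refl))
 ... | p' , p'< , e' = ⊥-elim (free p' p'< e')
r-rigid {l} {k} {t = t} {T} {B} row l≤k k≤t y≤l rg v (rb {q} z z≤ bz red) _ _ with z ≟ t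
... | yes refl = clash "a<bc-ab-c; 3201" (t , l , k) (red , k≤t , l≤k)
... | no n = clash "a=ba=1cb≠1c; 0035023430" (B z , T z , T q) (Rigid.upr rg z (≤∧≢⇒< z≤ n) , bz , RAct.free v z (≤∧≢⇒< z≤ n))
r-rigid {t = t} {T} {B} {T'} {B'} row l≤k k≤t y≤l rg v (rc {q} z z≤ bz blue) (mact tq tp) (mwait bq bz' bp) with z ≟ t
... | no n = clash "a=ba=1cb≠1c; 0035023430" (B z , T z , T q) (Rigid.upr rg z (≤∧≢⇒< z≤ n) , bz , RAct.free v z (≤∧≢⇒< z≤ n))
... | yes refl = record { upr = upr' ; full = full' }
 where
 open Rigid rg
 open RAct v
 upr' : ∀ p -> p < t -> B' p ≡ T' p
 upr' p p< with p ≟ q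
 ... | yes refl = lia "c=1da=cb=1d;a=b 064530246104" (B' p , T' p , B t , T p) (bz , bq , tq)
 ... | no n = lia "c=da=cb=d;a=b 064530246104" (B' p , T' p , B p , T p) (upr p p< , bp p n (<⇒≢ p<) , tp p n)
 full' : ∀ j -> 1 ≤ j -> j < B' t -> Occ t T' j
 full' j j₁ j₂ with full j j₁ (lia "a<cd=eb=1ec=d;a<b 576152" (j , B t , B' t , B q , T q) (j₂ , upr q q<r , bz , bz'))
 ... | p , p< , e with p ≟ q
 ... | no n = p , p< , trans (tp p n) e
 ... | yes refl = clash "a=bb<cd=ac=d; 46413" (T p , j , B' t , B p) (e , j₂ , upr p q<r , bz')
r-rigid {T = T} {B} row l≤k k≤t y≤l rg v (wx {q} {z} h) _ _ =
 (clash "a=bc=dd<ba<c; 44031" (B z , T z , B q , T q) (Rigid.upr rg z (RWait.z<r v) , Rigid.upr rg q (wait-q< v) , RWait.lt v , h))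
r-rigid {t = t} {T} {B} {T'} {B'} row l≤k k≤t y≤l rg v (ww {q} {z} h) (mwait tq tz tp) (mwait bq bz bp) =
 swap-rigid (wait-q< v) (RWait.z<r v) rg tq tz tp bq bz bp

-- In such a row all pipes are vertical except the new one, which stays right of all others. So
-- nothing crosses the moving pipe; it lands, and left insertion is over.
l-dies : ∀ {l k b w x t T B s s'} -> Row l b w t T B -> Full t T -> Full (suc t) B -> Rigid t T B -> k ≤ t ->
 s ≢ none -> LValid k w t T s -> LStep k x t T B s s' -> ∃ \m -> ∃ \z -> s' ≡ dead m z
l-dies row full full' rg k≤t ne v (ln _) = ⊥-elim (ne refl)
l-dies row full full' rg k≤t ne v (ls _ _ _ _ _) = ⊥-elim (ne refl)
l-dies {t = t} {T} {B} row full@(hi , _) full' rg k≤t ne v (l1 {m} (s , s≤ , i₁ , i₂)) with s ≟ t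
... | yes refl = clash "a=1bc-ba<c; 3201" (B t , t , T m) (new-last row full full' , hi m (LMove.m<r v) , i₁)
... | no n = clash "a=bc<ba<c; 3201" (B s , T s , T m) (Rigid.upr rg s (≤∧≢⇒< s≤ n) , i₂ , i₁)
l-dies row full full' rg k≤t ne v (l2 _ _ r<k _ _ _) = ⊥-elim (<⇒≱ r<k k≤t)
l-dies {t = t} row full full' rg k≤t ne v (lf {m} _ _) = m , t , refl
l-dies row full full' rg k≤t ne v (ld {m} {z}) = m , z , refl

l-rigid : ∀ {k w x t T B T' B' s s'} -> k ≤ t -> x ≤ k -> Rigid t T B ->
 LValid k w t T s -> LStep k x t T B s s' -> LMoved T T' s -> LMoved B B' s' -> Rigid t T' B'
l-rigid {t = t} {T} {B} {T'} {B'} k≤t x≤k rg v (ln _) (mnone eT) (mnone eB) = record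
 { upr = \p p< -> (lia "c=da=cb=d;a=b 064530246104" (B' p , T' p , B p , T p) (Rigid.upr rg p p< , eB p , eT p))
 ; full = \j j₁ j₂ -> let (p , p< , e) = Rigid.full rg j j₁ (subst (j <_) (eB t) j₂) in p , p< , trans (eT p) e }
l-rigid {k} {x = x} {t} k≤t x≤k rg v (ls _ _ refl _ _) _ _ = ⊥-elim (<⇒≱ x≤k k≤t)
l-rigid k≤t x≤k rg v (l2 _ _ r<k _ _ _) _ _ = ⊥-elim (<⇒≱ r<k k≤t)
l-rigid {t = t} {T} {B} {T'} {B'} k≤t x≤k rg v (l1 {m} {g} (s , s≤ , i₁ , i₂)) (mmov tm tp) (mmov bm bp) with s ≟ t
... | no n = clash "a=bc<ba<c; 3201" (B s , T s , T m) (Rigid.upr rg s (≤∧≢⇒< s≤ n) , i₂ , i₁)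
... | yes refl = record { upr = upr' ; full = full' }
 where
 open Rigid rg
 open LMove v
 upr' : ∀ p -> p < t -> B' p ≡ T' p
 upr' p p< with p ≟ m
 ... | yes refl = lia "a=cb=c;a=b 0433023410" (B' p , T' p , g) (bm , tm)
 ... | no n = lia "c=da=cb=d;a=b 064530246104" (B' p , T' p , B p , T p) (upr p p< , bp p n , tp p n)
 bt : B' t ≡ B t
 bt = bp t (\e -> <⇒≢ m<r (sym e))
 full' : ∀ j -> 1 ≤ j -> j < B' t -> Occ t T' j
 full' j j₁ j₂ with full j j₁ (lia "a<cc=b;a<b 3321" (j , B t , B' t) (j₂ , bt))
 ... | p , p< , e with p ≟ m
 ... | no n = p , p< , trans (tp p n) e
 ... | yes refl = clash "a=bb<cd<ac=d; 45312" (T p , j , B' t , B t) (e , j₂ , i₁ , bt)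
l-rigid {t = t} {T} {B} {T'} {B'} k≤t x≤k rg v (lf {m} {g} _ bt) (mmov tm tp) (mdead bm bt' bp) = record { upr = upr' ; full = full' }
 where
 open Rigid rg
 open LMove v
 upr' : ∀ p -> p < t -> B' p ≡ T' p
 upr' p p< with p ≟ m
 ... | yes refl = lia "c=db=da=c;a=b 064510446302" (B' p , T' p , B t , g) (bt , tm , bm)
 ... | no n = lia "c=da=cb=d;a=b 064530246104" (B' p , T' p , B p , T p) (upr p p< , bp p n (<⇒≢ p<) , tp p n)
 full' : ∀ j -> 1 ≤ j -> j < B' t -> Occ t T' j
 full' j j₁ j₂ with full j j₁ (lia "c<db=da<ef=ce=f;a<b 6841375" (j , B t , T m , g , B' t , B m) (Gap.lt gap , bt , j₂ , upr m m<r , bt'))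
 ... | p , p< , e with p ≟ m
 ... | no n = p , p< , trans (tp p n) e
 ... | yes refl = clash "a=bb<cd=ac=d; 46413" (T p , j , B' t , B p) (e , j₂ , upr p m<r , bt')
l-rigid k≤t x≤k rg v ld (mdead tm tz tp) (mdead bm bz bp) =
 swap-rigid (dead-m< v) (LDead.z<r v) rg tm tz tp bm bz bp

-- Insertions run through all rows, and their comparison

record RRun (l K y : ℕ) (pos : ℕ -> ℕ -> ℕ) : Set where
 field
  st′   : ℕ -> RState
  start : st′ 0 ≡ none
  valid : ∀ t -> RValid l (wd K t) t (pos t) (st′ t)
  step  : ∀ t -> RStep l y t (pos t) (pos (suc t)) (st′ t) (st′ (suc t))

-- States and their validity are constructed together, because the existence of a step rests on the
-- validity of the state before it.
r-run : ∀ {l k K b f y} (W : World l k K b f) -> b < K -> y ≤ l -> RRun l K y (World.pos W)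
r-run {l} {K = K} {y = y} W b<K y≤l = record
 { st′ = \t -> proj₁ (state t) ; start = refl ; valid = \t -> proj₂ (state t) ; step = \t -> proj₂ (next-state t) }
 where
 open World W
 state : ∀ t -> ∃ \s -> RValid l (wd K t) t (pos t) s
 next-state : ∀ t -> ∃ \s' -> RStep l y t (pos t) (pos (suc t)) (proj₁ (state t)) s'
 next-state t = R-total (row t) (proj₁ (state t)) (proj₂ (state t))
 state zero = none , tt
 state (suc t) = proj₁ (next-state t) ,
  proj₁ (R-valid (rmove (proj₁ (state t)) (pos t)) (rmove (proj₁ (next-state t)) (pos (suc t))) (row t) (slack b<K t) y≤l
   (proj₂ (state t)) (proj₂ (next-state t)) (r-moved _ _) (r-moved _ _))

module RChain {l k K b f} (W : World l k K b f) (b<K : b < K) (l≤k : l ≤ k) (k≤f : k ≤ f) {y} (y≤l : y ≤ l)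
 (run : RRun l K y (World.pos W)) where
 open World W
 open RRun run public

 pos′ : ℕ -> ℕ -> ℕ
 pos′ t = rmove (st′ t) (pos t)

 moved : ∀ t -> RMoved (pos t) (pos′ t) (st′ t)
 moved t = r-moved (st′ t) (pos t)

 row′ : ∀ t -> Row l (suc b + t) (wd K t) t (pos′ t) (pos′ (suc t))
 row′ t = proj₂ (R-valid (pos′ t) (pos′ (suc t)) (row t) (slack b<K t) y≤l (valid t) (step t) (moved t) (moved (suc t)))

 none-early : ∀ t -> st′ t ≡ none -> t < y ⊎ y ≡ 0
 none-early zero e with y ≟ 0
 ... | yes h = inj₂ h
 ... | no h = inj₁ (n≢0⇒n>0 h)
 none-early (suc t) e with st′ t in e' | st′ (suc t) | step t
 ... | none | none | rn n with none-early t e'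
 ... | inj₁ h = inj₁ (≤∧≢⇒< h n)
 ... | inj₂ h = inj₂ h

 started : 1 ≤ y -> ∀ t -> f ≤ t -> st′ t ≢ none
 started 1≤y t f≤t e with none-early t e
 ... | inj₁ h = <⇒≱ h (≤-trans y≤l (≤-trans l≤k (≤-trans k≤f f≤t)))
 ... | inj₂ h = <⇒≢ 1≤y (sym h)

 waits : 1 ≤ y -> ∀ t -> suc f ≤ t -> ∃ \q -> ∃ \z -> st′ t ≡ wait q z
 waits 1≤y (suc t) f<t = r-waits (row t) (full t f≤t) (full (suc t) (≤-trans f≤t (n≤1+n t)))
  (rig t (≤-trans k≤f f≤t)) (≤-trans l≤k (≤-trans k≤f f≤t)) (started 1≤y t f≤t) (valid t) (step t)
  where
  f≤t : f ≤ t
  f≤t = ≤-pred f<t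

 world : 1 ≤ y -> World l k K (suc b) (suc f)
 world 1≤y = record
  { pos = pos′ ; row = row′
  ; rig = \t k≤t -> r-rigid (row t) l≤k k≤t y≤l (rig t k≤t) (valid t) (step t) (moved t) (moved (suc t))
  ; full = full′ }
  where
  full′ : ∀ t -> suc f ≤ t -> Full t (pos′ t)
  full′ t f<t with waits 1≤y t f<t
  ... | q , z , e = wait-full (subst (RValid l (wd K t) t (pos t)) e (valid t)) (subst (RMoved (pos t) (pos′ t)) e (moved t))
   (full t (<⇒≤ f<t))

dead-late : ∀ {k w t T} s -> LValid k w t T s -> ∀ {m z} -> s ≡ dead m z -> k ≤ t
dead-late (dead m z) v refl = ≤-trans (LDead.k≤z v) (<⇒≤ (LDead.z<r v))

record LRun (k K x : ℕ) (pos : ℕ -> ℕ -> ℕ) : Set where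
 field
  st′   : ℕ -> LState
  start : st′ 0 ≡ none
  valid : ∀ t -> LValid k (wd K t) t (pos t) (st′ t)
  step  : ∀ t -> LStep k x t (pos t) (pos (suc t)) (st′ t) (st′ (suc t))

l-run : ∀ {l k K b f x} (W : World l k K b f) -> b < K -> l ≤ k -> x ≤ k -> LRun k K x (World.pos W)
l-run {k = k} {K} {x = x} W b<K l≤k x≤k = record
 { st′ = \t -> proj₁ (state t) ; start = refl ; valid = \t -> proj₂ (state t) ; step = \t -> proj₂ (next-state t) }
 where
 open World W
 state : ∀ t -> ∃ \s -> LValid k (wd K t) t (pos t) s
 next-state : ∀ t -> ∃ \s' -> LStep k x t (pos t) (pos (suc t)) (proj₁ (state t)) s'
 next-state t = L-total (row t) x≤k (rig t) (proj₁ (state t)) (proj₂ (state t))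
 state zero = none , tt
 state (suc t) = proj₁ (next-state t) ,
  proj₁ (L-valid (lmove (proj₁ (state t)) (pos t)) (lmove (proj₁ (next-state t)) (pos (suc t))) (row t) (slack b<K t) l≤k (rig t)
   (proj₂ (state t)) (proj₂ (next-state t)) (l-moved _ _) (l-moved _ _) (dead-late _ (proj₂ (state t))))

module LChain {l k K b f} (W : World l k K b f) (b<K : b < K) (l≤k : l ≤ k) (k≤f : k ≤ f) {x} (x≤k : x ≤ k)
 (run : LRun k K x (World.pos W)) where
 open World W
 open LRun run public

 pos′ : ℕ -> ℕ -> ℕ
 pos′ t = lmove (st′ t) (pos t)

 moved : ∀ t -> LMoved (pos t) (pos′ t) (st′ t)
 moved t = l-moved (st′ t) (pos t)

 row′ : ∀ t -> Row l (suc b + t) (wd K t) t (pos′ t) (pos′ (suc t))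
 row′ t = proj₂ (L-valid (pos′ t) (pos′ (suc t)) (row t) (slack b<K t) l≤k (rig t) (valid t) (step t) (moved t) (moved (suc t)) (dead-late _ (valid t)))

 none-early : ∀ t -> st′ t ≡ none -> t < x ⊎ x ≡ 0
 none-early zero e with x ≟ 0
 ... | yes h = inj₂ h
 ... | no h = inj₁ (n≢0⇒n>0 h)
 none-early (suc t) e with st′ t in e' | st′ (suc t) | step t
 ... | none | none | ln n with none-early t e'
 ... | inj₁ h = inj₁ (≤∧≢⇒< h n)
 ... | inj₂ h = inj₂ h

 started : 1 ≤ x -> ∀ t -> k ≤ t -> st′ t ≢ none
 started 1≤x t k≤t e with none-early t e
 ... | inj₁ h = <⇒≱ h (≤-trans x≤k k≤t)
 ... | inj₂ h = <⇒≢ 1≤x (sym h)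

 dies : 1 ≤ x -> ∀ t -> suc f ≤ t -> ∃ \m -> ∃ \z -> st′ t ≡ dead m z
 dies 1≤x (suc t) f<t = l-dies (row t) (full t f≤t) (full (suc t) (≤-trans f≤t (n≤1+n t)))
  (rig t (≤-trans k≤f f≤t)) (≤-trans k≤f f≤t) (started 1≤x t (≤-trans k≤f f≤t)) (valid t) (step t)
  where
  f≤t : f ≤ t
  f≤t = ≤-pred f<t

 world : 1 ≤ x -> World l k K (suc b) (suc f)
 world 1≤x = record
  { pos = pos′ ; row = row′
  ; rig = \t k≤t -> l-rigid k≤t x≤k (rig t k≤t) (valid t) (step t) (moved t) (moved (suc t))
  ; full = full′ }
  where
  full′ : ∀ t -> suc f ≤ t -> Full t (pos′ t)
  full′ t f<t with dies 1≤x t f<t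
  ... | m , z , e = dead-full (subst (LValid k (wd K t) t (pos t)) e (valid t)) (subst (LMoved (pos t) (pos′ t)) e (moved t))
   (full t (<⇒≤ f<t))

sq-commutes : ∀ {T TL TR T₁ T₂ : ℕ -> ℕ} {sL sR sR' sL'} -> Sq T sL sR sR' sL' ->
 LMoved T TL sL -> RMoved T TR sR -> RMoved TL T₁ sR' -> LMoved TR T₂ sL' -> ∀ p -> T₁ p ≡ T₂ p
sq-commutes {T} {TL} {TR} {T₁} {T₂} sq tl tr t₁ t₂ p = go sq tl tr t₁ t₂
 where
 go : ∀ {sL sR sR' sL'} -> Sq T sL sR sR' sL' ->
  LMoved T TL sL -> RMoved T TR sR -> RMoved TL T₁ sR' -> LMoved TR T₂ sL' -> T₁ p ≡ T₂ p
 go idleL (mnone a) (mnone b) (mnone c) (mnone d) = lia "c=de=da=cb=e;a=b 08573026585104" (T₁ p , T₂ p , TL p , T p , TR p) (a p , b p , c p , d p)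
 go (idleL {act q}) (mnone a) (mact b b') (mact c c') (mnone d) with p ≟ q
 ... | yes refl = lia "c=de=1db=ea=1c;a=b 08571046585302" (T₁ q , T₂ q , TL q , T q , TR q) (a p , b , d p , c)
 ... | no n = lia "c=de=da=cb=e;a=b 08573026585104" (T₁ p , T₂ p , TL p , T p , TR p) (a p , b' p n , c' p n , d p)
 go (idleL {wait q z}) (mnone a) (mwait b b' b'') (mwait c c' c'') (mnone d) with p ≟ q | p ≟ z
 ... | yes refl | _ = lia "c=de=db=ea=c;a=b 08571046585302" (T₁ q , T₂ q , TL z , T z , TR q) (a z , b , d p , c)
 ... | no _ | yes refl = lia "c=de=db=ea=c;a=b 08571046585302" (T₁ z , T₂ z , TL q , T q , TR z) (a q , b' , d p , c')
 ... | no n | no n' = lia "c=de=da=cb=e;a=b 08573026585104" (T₁ p , T₂ p , TL p , T p , TR p) (a p , b'' p n n' , c'' p n n' , d p)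
 go (idleR {none}) (mnone a) (mnone b) (mnone c) (mnone d) = lia "c=de=da=cb=e;a=b 08573026585104" (T₁ p , T₂ p , TL p , T p , TR p) (a p , b p , c p , d p)
 go (idleR {mov m g}) (mmov a a') (mnone b) (mnone c) (mmov d d') with p ≟ m
 ... | yes refl = lia "b=cd=ca=d;a=b 064631045024" (T₁ m , T₂ m , g , TL m) (d , a , c p)
 ... | no n = lia "c=de=da=eb=c;a=b 08585302571046" (T₁ p , T₂ p , TR p , T p , TL p) (b p , a' p n , c p , d' p n)
 go (idleR {dead m z}) (mdead a a' a'') (mnone b) (mnone c) (mdead d d' d'') with p ≟ m | p ≟ z
 ... | yes refl | _ = lia "c=de=da=eb=c;a=b 08585302571046" (T₁ m , T₂ m , TR z , T z , TL m) (b z , a , c p , d)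
 ... | no _ | yes refl = lia "c=de=da=eb=c;a=b 08585302571046" (T₁ z , T₂ z , TR m , T m , TL z) (b m , a' , c p , d')
 ... | no n | no n' = lia "c=de=da=eb=c;a=b 08585302571046" (T₁ p , T₂ p , TR p , T p , TL p) (b p , a'' p n n' , c p , d'' p n n')
 go (disjoint {m} {g} {q} m≢q _) (mmov a a') (mact b b') (mact c c') (mmov d d') with p ≟ q | p ≟ m
 ... | yes refl | yes refl = ⊥-elim (m≢q refl)
 ... | yes refl | no n = lia "c=de=1db=ea=1c;a=b 08571046585302" (T₁ q , T₂ q , TL q , T q , TR q) (a' p n , b , d' p n , c)
 ... | no n | yes refl = lia "b=cd=ca=d;a=b 064631045024" (T₁ m , T₂ m , g , TL m) (d , a , c' p n)
 ... | no n | no n' = lia "c=de=da=cb=e;a=b 08573026585104" (T₁ p , T₂ p , TL p , T p , TR p) (a' p n' , b' p n , c' p n , d' p n')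
 go (twice {q} {g} {g'} e e') (mmov a a') (mact b b') (mact c c') (mmov d d') with p ≟ q
 ... | yes refl = lia "c=1de=db=ca=1e;a=b 08585104573026" (T₁ q , T₂ q , g' , g , TL q) (e' , a , d , c)
 ... | no n = lia "c=de=da=cb=e;a=b 08573026585104" (T₁ p , T₂ p , TL p , T p , TR p) (a' p n , b' p n , c' p n , d' p n)
 go (chase {p'} {q} {g} {g'} ne e e' e'') (mmov a a') (mact b b') (mact c c') (mmov d d') with p ≟ q | p ≟ p'
 ... | yes refl | yes refl = ⊥-elim (ne refl)
 ... | yes refl | no n = lia "b=cc=de=fd=1fa=1e;a=b 0a6510a846902637" (T₁ q , T₂ q , g' , T p' , TL q , T q) (d , e'' , a' p n , e , c)
 ... | no n | yes refl = lia "c=1de=cf=1da=eb=f;a=b 0a69730266a51048" (T₁ p' , T₂ p' , g , T p' , TL p' , TR p') (e' , a , b , c' p n , d' p n)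
 ... | no n | no n' = lia "c=de=da=cb=e;a=b 08573026585104" (T₁ p , T₂ p , TL p , T p , TR p) (a' p n' , b' p n' , c' p n , d' p n)
 go (release {q} {z} {g} e) (mmov a a') (mwait b b' b'') (mact c c') (mmov d d') with p ≟ q | p ≟ z
 ... | yes refl | yes refl = lia "c=1c;a=b 10" (T₁ q , T₂ q , T q) e
 ... | yes refl | no n = lia "c=1de=df=cb=fa=1e;a=b 0a6a710466953028" (T₁ q , T₂ q , T z , T q , TL q , TR q) (e , a' p n , b , d' p n , c)
 ... | no n | yes refl = lia "b=cd=ca=d;a=b 064631045024" (T₁ z , T₂ z , g , TL z) (d , a , c' p n)
 ... | no n | no n' = lia "c=de=da=cb=e;a=b 08573026585104" (T₁ p , T₂ p , TL p , T p , TR p) (a' p n' , b'' p n n' , c' p n , d' p n')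
 go (hold {q} {m} {g} {g'} ne e e') (mmov a a') (mact b b') (mwait c c' c'') (mmov d d') with p ≟ q | p ≟ m
 ... | yes refl | yes refl = ⊥-elim (ne refl)
 ... | yes refl | no n = lia "c=1de=cf=1db=fa=e;a=b 0a69710466a53028" (T₁ q , T₂ q , g , T q , TL m , TR q) (e , a , b , d' p n , c)
 ... | no n | yes refl = lia "c=db=ce=da=e;a=b 08583106575024" (T₁ m , T₂ m , g' , T q , TL q) (e' , d , a' q (≢-sym n) , c')
 ... | no n | no n' = lia "c=de=da=cb=e;a=b 08573026585104" (T₁ p , T₂ p , TL p , T p , TR p) (a' p n' , b' p n , c'' p n n' , d' p n')
 go (both {q} {z} {m} {m'} {g} sw) (mmov a a') (mwait b b' b'') (mwait c c' c'') (mmov d d') = bothSw sw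
  where
  bothSw : Swap q z m m' -> T₁ p ≡ T₂ p
  bothSw (inj₁ (refl , refl)) with p ≟ q | p ≟ z
  ... | yes refl | yes refl = lia "b=cd=ca=d;a=b 064631045024" (T₁ p , T₂ p , g , TL p) (d , a , c')
  ... | yes refl | no n = lia "c=de=db=ea=c;a=b 08571046585302" (T₁ p , T₂ p , TL z , T z , TR p) (a' z (≢-sym n) , b , d' p n , c)
  ... | no n | yes refl = lia "b=cd=ca=d;a=b 064631045024" (T₁ p , T₂ p , g , TL q) (d , a , c')
  ... | no n | no n' = lia "c=de=da=cb=e;a=b 08573026585104" (T₁ p , T₂ p , TL p , T p , TR p) (a' p n , b'' p n n' , c'' p n n' , d' p n')
  bothSw (inj₂ (inj₁ (refl , refl))) with p ≟ q | p ≟ z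
  ... | yes refl | _ = lia "b=cd=ca=d;a=b 064631045024" (T₁ p , T₂ p , g , TL z) (d , a , c)
  ... | no n | yes refl = lia "c=de=db=ea=c;a=b 08571046585302" (T₁ p , T₂ p , TL q , T q , TR p) (a' q (≢-sym n) , b' , d' p n , c')
  ... | no n | no n' = lia "c=de=da=cb=e;a=b 08573026585104" (T₁ p , T₂ p , TL p , T p , TR p) (a' p n' , b'' p n n' , c'' p n n' , d' p n)
  bothSw (inj₂ (inj₂ (o , o' , refl))) with p ≟ q | p ≟ z | p ≟ m
  ... | yes refl | _ | _ = lia "c=de=db=ea=c;a=b 08571046585302" (T₁ p , T₂ p , TL z , T z , TR p) (a' z (≢-sym o') , b , d' p (≢-sym o) , c)
  ... | no n | yes refl | _ = lia "c=de=db=ea=c;a=b 08571046585302" (T₁ p , T₂ p , TL q , T q , TR p) (a' q (≢-sym o) , b' , d' p (≢-sym o') , c')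
  ... | no n | no n' | yes refl = lia "b=cd=ca=d;a=b 064631045024" (T₁ p , T₂ p , g , TL p) (d , a , c'' p n n')
  ... | no n | no n' | no n'' = lia "c=de=da=cb=e;a=b 08573026585104" (T₁ p , T₂ p , TL p , T p , TR p) (a' p n'' , b'' p n n' , c'' p n n' , d' p n'')

module Commute {l k K b f} (W : World l k K b f) (b<K : suc b < K) (l≤k : l ≤ k) (k≤f : k ≤ f)
 {x y} (1≤x : 1 ≤ x) (x≤k : x ≤ k) (1≤y : 1 ≤ y) (y≤l : y ≤ l) where
 open World W
 module L = LChain W (<⇒≤ b<K) l≤k k≤f x≤k (l-run W (<⇒≤ b<K) l≤k x≤k)
 module R = RChain W (<⇒≤ b<K) l≤k k≤f y≤l (r-run W (<⇒≤ b<K) y≤l)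
 WL = L.world 1≤x
 WR = R.world 1≤y
 k≤f′ : k ≤ suc f
 k≤f′ = ≤-trans k≤f (n≤1+n f)
 module LR = RChain WL b<K l≤k k≤f′ y≤l (r-run WL b<K y≤l)
 module RL = LChain WR b<K l≤k k≤f′ x≤k (l-run WR b<K l≤k x≤k)

 WLR = LR.world 1≤y
 WRL = RL.world 1≤x

 -- From the steps in the original grid, `square` produces steps of the two mixed runs; determinism
 -- identifies them with the steps actually taken.
 sq : ∀ t -> t ≤ k -> Sq (pos t) (L.st′ t) (R.st′ t) (LR.st′ t) (RL.st′ t)
 sq zero _ = idleL
 sq (suc t) t<k with square (row t) (slack (<⇒≤ b<K) t) t<k (L.pos′ t) (L.pos′ (suc t)) (R.pos′ t) (R.pos′ (suc t))
  (sq t (<⇒≤ t<k)) (L.valid t) (R.valid t) (LR.valid t) (R.valid (suc t))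
  (L.moved t) (R.moved t) (L.moved (suc t)) (R.moved (suc t)) (L.step t) (R.step t)
 ... | s₁ , s₂ , step₁ , step₂ , q =
  subst₂ (Sq (pos (suc t)) (L.st′ (suc t)) (R.st′ (suc t)))
   (R-det (L.row′ t) step₁ (LR.step t)) (L-det (R.row′ t) t<k step₂ (RL.step t)) q

 commutes : ∀ t -> t ≤ k -> ∀ p -> LR.pos′ t p ≡ RL.pos′ t p
 commutes t t≤k = sq-commutes (sq t t≤k) (L.moved t) (R.moved t) (LR.moved t) (RL.moved t)

 -- After row `k` pipes are vertical, so their columns are inherited from the row above. The pipe
 -- just leaving goes down in the first free column by rigidity, which is therefore the same in both
 -- orders.
 commutes-below : ∀ t p -> p < t -> LR.pos′ t p ≡ RL.pos′ t p
 commutes-below (suc t) p p< with suc t ≤? k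
 ... | yes h = commutes (suc t) h p
 ... | no h with p ≟ t
 ... | no n = trans (Rigid.upr (World.rig WLR t k≤t) p p<t) (trans (commutes-below t p p<t) (sym (Rigid.upr (World.rig WRL t k≤t) p p<t)))
  where
  k≤t : k ≤ t
  k≤t = ≤-pred (≰⇒> h)
  p<t : p < t
  p<t = ≤∧≢⇒< (≤-pred p<) n
 ... | yes refl = ≤-antisym (≮⇒≥ (above LR.pos′ RL.pos′ (LR.row′ t) (World.rig WLR t k≤t) (RL.row′ t) (World.rig WRL t k≤t) (commutes-below t)))
               (≮⇒≥ (above RL.pos′ LR.pos′ (RL.row′ t) (World.rig WRL t k≤t) (LR.row′ t) (World.rig WLR t k≤t) (\p p< -> sym (commutes-below t p p<))))
  where
  k≤t : k ≤ t
  k≤t = ≤-pred (≰⇒> h)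
  -- A smaller entering column in `Q` is occupied above in `P`, by rigidity of `P`; the upper
  -- positions agree, so it is occupied in `Q` as well, by a vertical pipe.
  above : ∀ (P Q : ℕ -> ℕ -> ℕ) {b} -> Row l b (wd K t) t (P t) (P (suc t)) -> Rigid t (P t) (P (suc t)) ->
   Row l b (wd K t) t (Q t) (Q (suc t)) -> Rigid t (Q t) (Q (suc t)) -> (∀ p -> p < t -> P t p ≡ Q t p) ->
   Q (suc t) t < P (suc t) t -> ⊥
  above P Q rowP rigP rowQ rigQ eq h with Rigid.full rigP (Q (suc t) t) (Row.lo rowQ t ≤-refl) h
  ... | p , p< , e = <⇒≢ p< (RowFacts.inj-B rowQ p t (<⇒≤ p<) ≤-refl
   (trans (Rigid.upr rigQ p p<) (trans (sym (eq p p<)) e)))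

-- The effect of a min-droop on the tiles

pattern WE = inW , outE
pattern SN = inS , outN
pattern SE = inS , outE
pattern WN = inW , outN

bind-just : ∀ {A B : Set} {m : Maybe A} {f : A -> Maybe B} {a} -> m ≡ just a -> (m >>= f) ≡ f a
bind-just refl = refl

≡ᵇ-refl : ∀ n -> (n ≡ᵇ n) ≡ true
≡ᵇ-refl zero = refl
≡ᵇ-refl (suc n) = ≡ᵇ-refl n

≡ᵇ-false : ∀ m n -> m ≢ n -> (m ≡ᵇ n) ≡ false
≡ᵇ-false zero zero h = ⊥-elim (h refl)
≡ᵇ-false zero (suc n) h = refl
≡ᵇ-false (suc m) zero h = refl
≡ᵇ-false (suc m) (suc n) h = ≡ᵇ-false m n (\e -> h (cong suc e))

set-at : ∀ G i j t -> set G i j t i j ≡ t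
set-at G i j t rewrite ≡ᵇ-refl i | ≡ᵇ-refl j = refl

set-off : ∀ G i j t i' j' -> i' ≢ i ⊎ j' ≢ j -> set G i j t i' j' ≡ G i' j'
set-off G i j t i' j' (inj₁ h) rewrite ≡ᵇ-false i' i h = refl
set-off G i j t i' j' (inj₂ h) rewrite ≡ᵇ-false j' j h with i' ≡ᵇ i
... | true = refl
... | false = refl

map-applyUpTo : ∀ {A B : Set} (g : A -> B) (f : ℕ -> A) n -> map g (applyUpTo f n) ≡ applyUpTo (\t -> g (f t)) n
map-applyUpTo g f zero = refl
map-applyUpTo g f (suc n) = cong (g (f 0) ∷_) (map-applyUpTo g (\t -> f (suc t)) n)

firstWhere-applyUpTo : ∀ p (f : ℕ -> ℕ) n i -> i < n -> (∀ j -> j < i -> p (f j) ≡ false) -> p (f i) ≡ true ->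
 firstWhere p (applyUpTo f n) ≡ just (f i)
firstWhere-applyUpTo p f (suc n) zero _ h e rewrite e = refl
firstWhere-applyUpTo p f (suc n) (suc i) (s≤s i<n) h e rewrite h 0 (s≤s z≤n) =
 firstWhere-applyUpTo p (\t -> f (suc t)) n i i<n (\j j<i -> h (suc j) (s≤s j<i)) e

firstWhere-range : ∀ p lo n i -> lo ≤ i -> i < lo + n -> (∀ j -> lo ≤ j -> j < i -> p j ≡ false) -> p i ≡ true ->
 firstWhere p (range lo n) ≡ just i
firstWhere-range p lo n i lo≤ i< h e = trans (cong (firstWhere p) (map-applyUpTo (lo +_) (\t -> t) n))
 (trans (firstWhere-applyUpTo p (lo +_) n (i ∸ lo) (+-cancelˡ-< lo (i ∸ lo) n (subst (_< lo + n) (sym eq) i<))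
  (\j j< -> h (lo + j) (m≤m+n lo j) (subst (lo + j <_) eq (+-monoʳ-< lo j<))) (trans (cong p eq) e)) (cong just eq))
 where
 eq : lo + (i ∸ lo) ≡ i
 eq = m+[n∸m]≡n lo≤

modifyAll-const : ∀ n (h : ℕ -> ℕ × ℕ) G u v f -> f u ≡ just v ->
 (∀ t -> t < n -> G (proj₁ (h t)) (proj₂ (h t)) ≡ u) ->
 (∀ s t -> s < n -> t < n -> s ≢ t -> proj₁ (h s) ≢ proj₁ (h t) ⊎ proj₂ (h s) ≢ proj₂ (h t)) ->
 ∃ \G' -> modifyAll G (applyUpTo h n) f ≡ just G' ×
  (∀ t -> t < n -> G' (proj₁ (h t)) (proj₂ (h t)) ≡ v) ×
  (∀ i j -> (∀ t -> t < n -> i ≢ proj₁ (h t) ⊎ j ≢ proj₂ (h t)) -> G' i j ≡ G i j)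
modifyAll-const zero h G u v f e old inj = G , refl , (\t ()) , (\i j _ -> refl)
modifyAll-const (suc n) h G u v f e old inj
 with modifyAll-const n (\t -> h (suc t)) (set G (proj₁ (h 0)) (proj₂ (h 0)) v) u v f e
  (\t t< -> trans (set-off G _ _ v _ _ (inj (suc t) 0 (s≤s t<) (s≤s z≤n) (\()))) (old (suc t) (s≤s t<)))
  (\s t s< t< ne -> inj (suc s) (suc t) (s≤s s<) (s≤s t<) (\e -> ne (suc-injective e)))
... | G' , eq , at , off = G' , trans (bind-just (trans (bind-just (trans (cong f (old 0 (s≤s z≤n))) e)) refl)) eq , at' , off'
 where
 at' : ∀ t -> t < suc n -> G' (proj₁ (h t)) (proj₂ (h t)) ≡ v
 at' zero _ = trans (off _ _ (\t t< -> inj 0 (suc t) (s≤s z≤n) (s≤s t<) (\()))) (set-at G _ _ v)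
 at' (suc t) (s≤s t<) = at t t<
 off' : ∀ i j -> (∀ t -> t < suc n -> i ≢ proj₁ (h t) ⊎ j ≢ proj₂ (h t)) -> G' i j ≡ G i j
 off' i j ne = trans (off i j (\t t< -> ne (suc t) (s≤s t<))) (set-off G _ _ v i j (ne 0 (s≤s z≤n)))

Box : (i₁ i₂ j₁ j₂ i j : ℕ) -> Set
Box i₁ i₂ j₁ j₂ i j = i₁ ≤ i × i ≤ i₂ × j₁ ≤ j × j ≤ j₂

record Paint (G G' : Grid) (v : Tile) (i₁ i₂ j₁ j₂ : ℕ) : Set where
 field
  on  : ∀ i j -> Box i₁ i₂ j₁ j₂ i j -> G' i j ≡ v
  off : ∀ i j -> i < i₁ ⊎ i₂ < i ⊎ j < j₁ ⊎ j₂ < j -> G' i j ≡ G i j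

paint-one : ∀ G i j f v -> f (G i j) ≡ just v -> ∃ \G' -> modify G i j f ≡ just G' × Paint G G' v i i j j
paint-one G i j f v e = set G i j v , bind-just e , record
 { on = \i' j' (a , b , c , d) -> subst₂ (\p q -> set G i j v p q ≡ v) (≤-antisym a b) (≤-antisym c d) (set-at G i j v)
 ; off = \i' j' h -> set-off G i j v i' j' (ne h) }
 where
 ne : ∀ {i' j'} -> i' < i ⊎ i < i' ⊎ j' < j ⊎ j < j' -> i' ≢ i ⊎ j' ≢ j
 ne (inj₁ h) = inj₁ (<⇒≢ h)
 ne (inj₂ (inj₁ h)) = inj₁ (\e -> <⇒≢ h (sym e))
 ne (inj₂ (inj₂ (inj₁ h))) = inj₂ (<⇒≢ h)
 ne (inj₂ (inj₂ (inj₂ h))) = inj₂ (\e -> <⇒≢ h (sym e))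

range-cells : ∀ (h : ℕ -> ℕ × ℕ) n -> map h (range 1 n) ≡ applyUpTo (\t -> h (suc t)) n
range-cells h n = trans (cong (map h) (map-applyUpTo suc (\t -> t) n)) (map-applyUpTo h suc n)

paint-column : ∀ G a b x f u v -> f u ≡ just v -> (∀ i -> a < i -> i ≤ a + x -> G i b ≡ u) ->
 ∃ \G' -> modifyAll G (map (\t -> (a + t , b)) (range 1 x)) f ≡ just G' × Paint G G' v (suc a) (a + x) b b
paint-column G a b x f u v e old
 with modifyAll-const x (\t -> (a + suc t , b)) G u v f e
  (\t t< -> old (a + suc t) (m<m+n a (s≤s z≤n)) (+-monoʳ-≤ a t<))
  (\s t _ _ ne -> inj₁ (\e -> ne (suc-injective (+-cancelˡ-≡ a _ _ e))))
... | G' , eq , at , off = G' , trans (cong (\cs -> modifyAll G cs f) (range-cells _ x)) eq , record { on = on' ; off = off' }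
 where
 on' : ∀ i j -> Box (suc a) (a + x) b b i j -> G' i j ≡ v
 on' i j (h₁ , h₂ , h₃ , h₄) with refl ← ≤-antisym h₃ h₄ =
  subst (\p -> G' p b ≡ v) eq' (at (i ∸ suc a) (+-cancelˡ-< a _ _ (≤-trans (≤-reflexive (trans (sym (+-suc a _)) eq')) h₂)))
  where
  eq' : a + suc (i ∸ suc a) ≡ i
  eq' = trans (+-suc a _) (m+[n∸m]≡n h₁)
 off' : ∀ i j -> i < suc a ⊎ a + x < i ⊎ j < b ⊎ b < j -> G' i j ≡ G i j
 off' i j h = off i j (\t t< -> ne t t< h)
  where
  ne : ∀ t -> t < x -> i < suc a ⊎ a + x < i ⊎ j < b ⊎ b < j -> i ≢ a + suc t ⊎ j ≢ b
  ne t t< (inj₁ h) = inj₁ (\e -> <⇒≱ (m<m+n a {suc t} (s≤s z≤n)) (≤-trans (≤-reflexive (sym e)) (≤-pred h)))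
  ne t t< (inj₂ (inj₁ h)) = inj₁ (\e -> <⇒≱ h (≤-trans (≤-reflexive e) (+-monoʳ-≤ a t<)))
  ne t t< (inj₂ (inj₂ (inj₁ h))) = inj₂ (<⇒≢ h)
  ne t t< (inj₂ (inj₂ (inj₂ h))) = inj₂ (\e -> <⇒≢ h (sym e))

paint-row : ∀ G a b y f u v -> f u ≡ just v -> (∀ j -> b < j -> j ≤ b + y -> G a j ≡ u) ->
 ∃ \G' -> modifyAll G (map (\s -> (a , b + s)) (range 1 y)) f ≡ just G' × Paint G G' v a a (suc b) (b + y)
paint-row G a b y f u v e old
 with modifyAll-const y (\t -> (a , b + suc t)) G u v f e
  (\t t< -> old (b + suc t) (m<m+n b (s≤s z≤n)) (+-monoʳ-≤ b t<))
  (\s t _ _ ne -> inj₂ (\e -> ne (suc-injective (+-cancelˡ-≡ b _ _ e))))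
... | G' , eq , at , off = G' , trans (cong (\cs -> modifyAll G cs f) (range-cells _ y)) eq , record { on = on' ; off = off' }
 where
 on' : ∀ i j -> Box a a (suc b) (b + y) i j -> G' i j ≡ v
 on' i j (h₃ , h₄ , h₁ , h₂) with refl ← ≤-antisym h₃ h₄ =
  subst (\p -> G' a p ≡ v) eq' (at (j ∸ suc b) (+-cancelˡ-< b _ _ (≤-trans (≤-reflexive (trans (sym (+-suc b _)) eq')) h₂)))
  where
  eq' : b + suc (j ∸ suc b) ≡ j
  eq' = trans (+-suc b _) (m+[n∸m]≡n h₁)
 off' : ∀ i j -> i < a ⊎ a < i ⊎ j < suc b ⊎ b + y < j -> G' i j ≡ G i j
 off' i j h = off i j (\t t< -> ne t t< h)
  where
  ne : ∀ t -> t < y -> i < a ⊎ a < i ⊎ j < suc b ⊎ b + y < j -> i ≢ a ⊎ j ≢ b + suc t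
  ne t t< (inj₁ h) = inj₁ (<⇒≢ h)
  ne t t< (inj₂ (inj₁ h)) = inj₁ (\e -> <⇒≢ h (sym e))
  ne t t< (inj₂ (inj₂ (inj₁ h))) = inj₂ (\e -> <⇒≱ (m<m+n b {suc t} (s≤s z≤n)) (≤-trans (≤-reflexive (sym e)) (≤-pred h)))
  ne t t< (inj₂ (inj₂ (inj₂ h))) = inj₂ (\e -> <⇒≱ h (≤-trans (≤-reflexive e) (+-monoʳ-≤ b t<)))

-- What makes all eight modifications in `minDroop` succeed: the old route consists of crosses up to
-- its corners, where the searches for `x` and `y` stop, and the opposite two sides have room for
-- the new route.
record DroopTiles (G : Grid) (a A b C : ℕ) : Set where
 field
  start : G a b ≡ relb ⊎ G a b ≡ bump
  leftC : ∀ i -> a < i -> i < A -> G i b ≡ cross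
  botL  : G A b ≡ vert ⊎ G A b ≡ jelb
  topR  : ∀ j -> b < j -> j < C -> G a j ≡ cross
  topC  : G a C ≡ horiz ⊎ G a C ≡ jelb
  botR  : ∀ j -> b < j -> j < C -> G A j ≡ vert
  end   : G A C ≡ blank ⊎ G A C ≡ relb
  rightC : ∀ i -> a < i -> i < A -> G i C ≡ horiz

record Drooped (G G' : Grid) (a A b C : ℕ) : Set where
 field
  start : (G a b ≡ relb × G' a b ≡ blank) ⊎ (G a b ≡ bump × G' a b ≡ jelb)
  leftC : ∀ i -> a < i -> i < A -> G i b ≡ cross × G' i b ≡ horiz
  botL  : (G A b ≡ vert × G' A b ≡ relb) ⊎ (G A b ≡ jelb × G' A b ≡ horiz)
  topR  : ∀ j -> b < j -> j < C -> G a j ≡ cross × G' a j ≡ vert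
  topC  : (G a C ≡ horiz × G' a C ≡ relb) ⊎ (G a C ≡ jelb × G' a C ≡ vert)
  botR  : ∀ j -> b < j -> j < C -> G A j ≡ vert × G' A j ≡ cross
  end   : (G A C ≡ blank × G' A C ≡ jelb) ⊎ (G A C ≡ relb × G' A C ≡ bump)
  rightC : ∀ i -> a < i -> i < A -> G i C ≡ horiz × G' i C ≡ cross
  row≢  : ∀ i j -> i < a ⊎ A < i ⊎ j < b ⊎ C < j -> G' i j ≡ G i j
  inner : ∀ i j -> a < i -> i < A -> b < j -> j < C -> G' i j ≡ G i j

pick : ∀ {G : Grid} {i j s t s' t'} (f : Tile -> Maybe Tile) -> f s ≡ just s' -> f t ≡ just t' ->
 G i j ≡ s ⊎ G i j ≡ t -> ∃ \u -> f (G i j) ≡ just u × ((G i j ≡ s × u ≡ s') ⊎ (G i j ≡ t × u ≡ t'))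
pick f e e' (inj₁ h) = _ , trans (cong f h) e , inj₁ (h , refl)
pick f e e' (inj₂ h) = _ , trans (cong f h) e' , inj₂ (h , refl)

-- Here `x` and `y` count the inner cells of the sides, one less than the offsets found by
-- `minDroop`.
module DroopStages (G : Grid) (a b x y A C : ℕ) (eA : A ≡ suc (a + x)) (eC : C ≡ suc (b + y)) (d : DroopTiles G a A b C) where
 module D = DroopTiles d
 aA : a < A
 aA = ≤-trans (s≤s (m≤m+n a x)) (≤-reflexive (sym eA))
 bC : b < C
 bC = ≤-trans (s≤s (m≤m+n b y)) (≤-reflexive (sym eC))
 <A : ∀ {i} -> i ≤ a + x -> i < A
 <A h = ≤-trans (s≤s h) (≤-reflexive (sym eA))
 <C : ∀ {j} -> j ≤ b + y -> j < C
 <C h = ≤-trans (s≤s h) (≤-reflexive (sym eC))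

 -- The changes at the bottom left and top right corners depend on how the pipe enters and leaves
 -- the rectangle. As parameters `f₃` and `f₅` they let the four combinations share one computation.
 Stages : (f₃ f₅ : Tile -> Maybe Tile) -> Set
 Stages f₃ f₅ = ∃ \G₁ -> ∃ \G₂ -> ∃ \G₃ -> ∃ \G₄ -> ∃ \G₅ -> ∃ \G₆ -> ∃ \G₇ -> ∃ \G₈ ->
  modify G a b (removeConn SE) ≡ just G₁ ×
  modifyAll G₁ (map (\t -> (a + t , b)) (range 1 x)) (removeConn SN) ≡ just G₂ ×
  modify G₂ A b f₃ ≡ just G₃ ×
  modifyAll G₃ (map (\s -> (a , b + s)) (range 1 y)) (removeConn WE) ≡ just G₄ ×
  modify G₄ a C f₅ ≡ just G₅ ×
  modifyAll G₅ (map (\s -> (A , b + s)) (range 1 y)) (addConn WE) ≡ just G₆ ×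
  modify G₆ A C (addConn WN) ≡ just G₇ ×
  modifyAll G₇ (map (\t -> (a + t , C)) (range 1 x)) (addConn SN) ≡ just G₈ ×
  Drooped G G₈ a A b C

 stages : ∀ f₃ f₅ {t₃ t₅} -> f₃ (G A b) ≡ just t₃ -> f₅ (G a C) ≡ just t₅ ->
  (G A b ≡ vert × t₃ ≡ relb) ⊎ (G A b ≡ jelb × t₃ ≡ horiz) ->
  (G a C ≡ horiz × t₅ ≡ relb) ⊎ (G a C ≡ jelb × t₅ ≡ vert) -> Stages f₃ f₅
 stages f₃ f₅ {t₃} {t₅} e₃ e₅ c₃ c₅
  with pick {G} {a} {b} (removeConn SE) refl refl D.start | pick {G} {A} {C} (addConn WN) refl refl D.end
 ... | t₁ , e₁ , c₁ | t₇ , e₇ , c₇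
  with paint-one G a b (removeConn SE) t₁ e₁
 ... | G₁ , m₁ , p₁
  with paint-column G₁ a b x (removeConn SN) cross horiz refl
   (\i h h' -> trans (Paint.off p₁ i b (inj₂ (inj₁ h))) (D.leftC i h (<A h')))
 ... | G₂ , m₂ , p₂
  with paint-one G₂ A b f₃ t₃ (trans (cong f₃ (trans (Paint.off p₂ A b (inj₂ (inj₁ (≤-reflexive (sym eA)))))
   (Paint.off p₁ A b (inj₂ (inj₁ aA))))) e₃)
 ... | G₃ , m₃ , p₃
  with paint-row G₃ a b y (removeConn WE) cross vert refl
   (\j h h' -> trans (Paint.off p₃ a j (inj₁ aA)) (trans (Paint.off p₂ a j (inj₁ ≤-refl))
    (trans (Paint.off p₁ a j (inj₂ (inj₂ (inj₂ h)))) (D.topR j h (<C h')))))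
 ... | G₄ , m₄ , p₄
  with paint-one G₄ a C f₅ t₅ (trans (cong f₅ (trans (Paint.off p₄ a C (inj₂ (inj₂ (inj₂ (≤-reflexive (sym eC))))))
   (trans (Paint.off p₃ a C (inj₁ aA)) (trans (Paint.off p₂ a C (inj₁ ≤-refl)) (Paint.off p₁ a C (inj₂ (inj₂ (inj₂ bC)))))))) e₅)
 ... | G₅ , m₅ , p₅
  with paint-row G₅ A b y (addConn WE) vert cross refl
   (\j h h' -> trans (Paint.off p₅ A j (inj₂ (inj₁ aA))) (trans (Paint.off p₄ A j (inj₂ (inj₁ aA)))
    (trans (Paint.off p₃ A j (inj₂ (inj₂ (inj₂ h)))) (trans (Paint.off p₂ A j (inj₂ (inj₂ (inj₂ h))))
    (trans (Paint.off p₁ A j (inj₂ (inj₁ aA))) (D.botR j h (<C h')))))))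
 ... | G₆ , m₆ , p₆
  with paint-one G₆ A C (addConn WN) t₇ (trans (cong (addConn WN) (trans (Paint.off p₆ A C (inj₂ (inj₂ (inj₂ (≤-reflexive (sym eC))))))
   (trans (Paint.off p₅ A C (inj₂ (inj₁ aA))) (trans (Paint.off p₄ A C (inj₂ (inj₁ aA))) (trans (Paint.off p₃ A C (inj₂ (inj₂ (inj₂ bC))))
   (trans (Paint.off p₂ A C (inj₂ (inj₂ (inj₂ bC)))) (Paint.off p₁ A C (inj₂ (inj₁ aA)))))))))
   e₇)
 ... | G₇ , m₇ , p₇
  with paint-column G₇ a C x (addConn SN) horiz cross refl
   (\i h h' -> trans (Paint.off p₇ i C (inj₁ (<A h'))) (trans (Paint.off p₆ i C (inj₁ (<A h'))) (trans (Paint.off p₅ i C (inj₂ (inj₁ h)))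
    (trans (Paint.off p₄ i C (inj₂ (inj₁ h))) (trans (Paint.off p₃ i C (inj₁ (<A h'))) (trans (Paint.off p₂ i C (inj₂ (inj₂ (inj₂ bC))))
    (trans (Paint.off p₁ i C (inj₂ (inj₁ h))) (D.rightC i h (<A h')))))))))
 ... | G₈ , m₈ , p₈ = G₁ , G₂ , G₃ , G₄ , G₅ , G₆ , G₇ , G₈ , m₁ , m₂ , m₃ , m₄ , m₅ , m₆ , m₇ , m₈ , record
   { start = resolve c₁ (trans (o₂ a b (lia "a<dc<f;a<1ab<ac<cc<c|||a<dd<ac<cc<c|||a<aa<ac<1ce<c|||a<aa<ac<ff<c|||a<dd<ac<1ce<c|||a<dd<ac<ff<c|||a<1ab<ac<ff<c||| 02130026300110027100293002a313" (a , a + x , b , A , b + y , C) (aA , bC))) (Paint.on p₁ a b (≤-refl , ≤-refl , ≤-refl , ≤-refl)))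
   ; leftC = \i h h' -> D.leftC i h h' , trans (o₃ i b (lia "c<fa<b;a<bb<ac<cc<c|||a<dd<ac<1ce<c|||a<dd<ac<ff<c|||a<bb<ac<1ce<c|||a<bb<ac<ff<c|||a<1dg<ac<ff<c||| 022430011002710027300283291" (i , A , b , a , b + y , C , a + x) (bC , h'))) (Paint.on p₂ i b (h , (lia "a<cc=1b;a-b 3321" (i , a + x , A) (h' , eA)) , ≤-refl , ≤-refl))
   ; botL = resolve c₃ (trans (o₄ A b (lia "c<e;a<bb<ac<1cd<c|||a<bb<ac<ee<c|||a<aa<ac<1cd<c|||a<aa<ac<ee<c|||a<1bf<ac<ee<c||| 011100251001100271271" (A , a , b , b + y , C , a + x) bC)) (Paint.on p₃ A b (≤-refl , ≤-refl , ≤-refl , ≤-refl)))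
   ; topR = \j h h' -> D.topR j h h' , trans (o₅ a j (lia "a<db<c;a<aa<ab<cc<b|||a<dd<ab<1ef<b|||a<dd<ab<cc<b|||a<1ag<ab<cc<b||| 02241002630027313" (a , j , C , A , b , b + y , a + x) (aA , h'))) (Paint.on p₄ a j (≤-refl , ≤-refl , h , (lia "a<cc=1b;a-b 3321" (j , b + y , C) (h' , eC))))
   ; topC = resolve c₅ (trans (o₆ a C (lia "a<b;a<bb<ac<1de<c|||a<bb<ac<cc<c|||a<1af<ac<cc<c||| 012430025313" (a , A , C , b , b + y , a + x) aA)) (Paint.on p₅ a C (≤-refl , ≤-refl , ≤-refl , ≤-refl)))
   ; botR = \j h h' -> D.botR j h h' , trans (o₇ A j (lia "b<c;a<aa<ab<cc<b|||a<1de<ab<cc<b||| 01241241" (A , j , C , a , a + x) h')) (Paint.on p₆ A j (≤-refl , ≤-refl , h , (lia "a<cc=1b;a-b 3321" (j , b + y , C) (h' , eC))))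
   ; end = resolve c₇ (trans (Paint.off p₈ A C (lia "a=1c;a<1bc<ad<dd<d||| 240" (A , a , a + x , C) eA)) (Paint.on p₇ A C (≤-refl , ≤-refl , ≤-refl , ≤-refl)))
   ; rightC = \i h h' -> D.rightC i h h' , Paint.on p₈ i C (h , (lia "a<cc=1b;a-b 3321" (i , a + x , A) (h' , eA)) , ≤-refl , ≤-refl)
   ; row≢ = \i j h -> trans (o₂ i j (lia "b<fe<hf=1ch=1ga<bf<ad<eh<d|||;a<1bc<ad<ee<d|||a<ff<ad<ee<d|||a<bb<ad<1eg<d|||a<bb<ad<hh<d|||a<ff<ad<1eg<d|||a<ff<ad<hh<d|||a<1bc<ad<hh<d||| 0704240003904002403c0300053c40004a04b002403d030006240003e04002403a030007240003f04003f404b03c00083f40004d04e002403c0300093g40004e04f003h404d03e09240003e04003h404d03e" (i , a , a + x , j , b , A , b + y , C) (aA , bC , eA , eC , h))) (Paint.off p₁ i j (lia "b<ed<fa<be<ac<df<c|||;a<bb<ac<dd<c||| 00270003740002703640" (i , a , j , b , A , C) (aA , bC , h)))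
   ; inner = \i j h h' g g' -> trans (o₂ i j (lia "d<he<da<fb<a;a<1bc<ad<ee<d|||a<ff<ad<ee<d|||a<bb<ad<1eg<d|||a<bb<ad<hh<d|||a<ff<ad<1eg<d|||a<ff<ad<hh<d|||a<1bc<ad<hh<d||| 0426000263002620027200293002a32c1" (i , a , a + x , j , b , A , b + y , C) (g' , g , h' , h))) (Paint.off p₁ i j (lia "d<c;a<bb<ac<dd<c||| 210" (i , a , j , b) g)) }
  where
  Clr : (i₁ i₂ j₁ j₂ i j : ℕ) -> Set
  Clr i₁ i₂ j₁ j₂ i j = i < i₁ ⊎ i₂ < i ⊎ j < j₁ ⊎ j₂ < j
  o₇ : ∀ i j -> Clr A A C C i j × Clr (suc a) (a + x) C C i j -> G₈ i j ≡ G₆ i j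
  o₇ i j (c , d) = trans (Paint.off p₈ i j d) (Paint.off p₇ i j c)
  o₆ : ∀ i j -> Clr A A (suc b) (b + y) i j × Clr A A C C i j × Clr (suc a) (a + x) C C i j -> G₈ i j ≡ G₅ i j
  o₆ i j (c , d) = trans (o₇ i j d) (Paint.off p₆ i j c)
  o₅ : ∀ i j -> Clr a a C C i j × Clr A A (suc b) (b + y) i j × Clr A A C C i j × Clr (suc a) (a + x) C C i j -> G₈ i j ≡ G₄ i j
  o₅ i j (c , d) = trans (o₆ i j d) (Paint.off p₅ i j c)
  o₄ : ∀ i j -> Clr a a (suc b) (b + y) i j × Clr a a C C i j × Clr A A (suc b) (b + y) i j × Clr A A C C i j × Clr (suc a) (a + x) C C i j -> G₈ i j ≡ G₃ i j
  o₄ i j (c , d) = trans (o₅ i j d) (Paint.off p₄ i j c)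
  o₃ : ∀ i j -> Clr A A b b i j × Clr a a (suc b) (b + y) i j × Clr a a C C i j × Clr A A (suc b) (b + y) i j × Clr A A C C i j × Clr (suc a) (a + x) C C i j -> G₈ i j ≡ G₂ i j
  o₃ i j (c , d) = trans (o₄ i j d) (Paint.off p₃ i j c)
  o₂ : ∀ i j -> Clr (suc a) (a + x) b b i j × Clr A A b b i j × Clr a a (suc b) (b + y) i j × Clr a a C C i j × Clr A A (suc b) (b + y) i j × Clr A A C C i j × Clr (suc a) (a + x) C C i j -> G₈ i j ≡ G₁ i j
  o₂ i j (c , d) = trans (o₃ i j d) (Paint.off p₂ i j c)
  resolve : ∀ {P Q : Set} {s t u w : Tile} -> (P × s ≡ t) ⊎ (Q × s ≡ u) -> w ≡ s -> (P × w ≡ t) ⊎ (Q × w ≡ u)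
  resolve (inj₁ (h , e)) e' = inj₁ (h , trans e' e)
  resolve (inj₂ (h , e)) e' = inj₂ (h , trans e' e)

minDroop-spec : ∀ G M a b x y -> x ≤ M -> y ≤ M -> DroopTiles G a (a + suc x) b (b + suc y) ->
 ∃ \G' -> minDroop G M a b ≡ just (G' , a + suc x , b + suc y) × Drooped G G' a (a + suc x) b (b + suc y)
minDroop-spec G M a b x y x≤M y≤M d = main (DroopTiles.botL d) (DroopTiles.topC d)
 where
 A C : ℕ
 A = a + suc x
 C = b + suc y
 open DroopStages G a b x y A C (+-suc a x) (+-suc b y) d
 not-cross : ∀ {i j} -> G i j ≡ cross -> not (isCross (G i j)) ≡ false
 not-cross e rewrite e = refl
 is-bar : ∀ {s t i j} -> isCross s ≡ false -> isCross t ≡ false -> G i j ≡ s ⊎ G i j ≡ t -> not (isCross (G i j)) ≡ true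
 is-bar e e' (inj₁ h) rewrite h | e = refl
 is-bar e e' (inj₂ h) rewrite h | e' = refl
 ex : firstWhere (\x -> not (isCross (G (a + x) b))) (range 1 (suc M)) ≡ just (suc x)
 ex = firstWhere-range (\x -> not (isCross (G (a + x) b))) 1 (suc M) (suc x) (s≤s z≤n) (s≤s (s≤s x≤M))
  (\j j₁ j₂ -> not-cross (D.leftC (a + j) (m<m+n a j₁) (+-monoʳ-< a j₂))) (is-bar {vert} {jelb} refl refl D.botL)
 ey : firstWhere (\y -> not (isCross (G a (b + y)))) (range 1 (suc M)) ≡ just (suc y)
 ey = firstWhere-range (\y -> not (isCross (G a (b + y)))) 1 (suc M) (suc y) (s≤s z≤n) (s≤s (s≤s y≤M))
  (\j j₁ j₂ -> not-cross (D.topR (b + j) (m<m+n b j₁) (+-monoʳ-< b j₂))) (is-bar {horiz} {jelb} refl refl D.topC)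

 result : Grid -> Maybe (Grid × ℕ × ℕ)
 result G' = just (G' , A , C)

 finish : ∀ e f -> Stages (\t -> removeConn (e , outN) t >>= addConn (e , outE)) (\t -> removeConn (inW , f) t >>= addConn (inS , f)) ->
  ∃ \G' -> (modify G a b (removeConn SE) >>= \G₁ ->
   modifyAll G₁ (map (\t -> (a + t , b)) (range 1 x)) (removeConn SN) >>= \G₂ ->
   modify G₂ A b (\t -> removeConn (e , outN) t >>= addConn (e , outE)) >>= \G₃ ->
   modifyAll G₃ (map (\s -> (a , b + s)) (range 1 y)) (removeConn WE) >>= \G₄ ->
   modify G₄ a C (\t -> removeConn (inW , f) t >>= addConn (inS , f)) >>= \G₅ ->
   modifyAll G₅ (map (\s -> (A , b + s)) (range 1 y)) (addConn WE) >>= \G₆ ->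
   modify G₆ A C (addConn WN) >>= \G₇ ->
   modifyAll G₇ (map (\t -> (a + t , C)) (range 1 x)) (addConn SN) >>= \G₈ ->
   result G₈) ≡ result G' × Drooped G G' a A b C
 finish e f (_ , _ , _ , _ , _ , _ , _ , G₈ , m₁ , m₂ , m₃ , m₄ , m₅ , m₆ , m₇ , m₈ , dr) =
  G₈ , trans (bind-just m₁) (trans (bind-just m₂) (trans (bind-just m₃) (trans (bind-just m₄)
   (trans (bind-just m₅) (trans (bind-just m₆) (trans (bind-just m₇) (bind-just m₈))))))) , dr

 main : G A b ≡ vert ⊎ G A b ≡ jelb -> G a C ≡ horiz ⊎ G a C ≡ jelb ->
  ∃ \G' -> minDroop G M a b ≡ just (G' , A , C) × Drooped G G' a A b C
 main (inj₁ h₃) (inj₁ h₅) rewrite ex | ey | h₃ | h₅ =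
  finish inS outE (stages (\t -> removeConn SN t >>= addConn SE) (\t -> removeConn WE t >>= addConn SE)
   (cong (\t -> removeConn SN t >>= addConn SE) h₃) (cong (\t -> removeConn WE t >>= addConn SE) h₅) (inj₁ (h₃ , refl)) (inj₁ (h₅ , refl)))
 main (inj₁ h₃) (inj₂ h₅) rewrite ex | ey | h₃ | h₅ =
  finish inS outN (stages (\t -> removeConn SN t >>= addConn SE) (\t -> removeConn WN t >>= addConn SN)
   (cong (\t -> removeConn SN t >>= addConn SE) h₃) (cong (\t -> removeConn WN t >>= addConn SN) h₅) (inj₁ (h₃ , refl)) (inj₂ (h₅ , refl)))
 main (inj₂ h₃) (inj₁ h₅) rewrite ex | ey | h₃ | h₅ =
  finish inW outE (stages (\t -> removeConn WN t >>= addConn WE) (\t -> removeConn WE t >>= addConn SE)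
   (cong (\t -> removeConn WN t >>= addConn WE) h₃) (cong (\t -> removeConn WE t >>= addConn SE) h₅) (inj₂ (h₃ , refl)) (inj₁ (h₅ , refl)))
 main (inj₂ h₃) (inj₂ h₅) rewrite ex | ey | h₃ | h₅ =
  finish inW outN (stages (\t -> removeConn WN t >>= addConn WE) (\t -> removeConn WN t >>= addConn SN)
   (cong (\t -> removeConn WN t >>= addConn WE) h₃) (cong (\t -> removeConn WN t >>= addConn SN) h₅) (inj₂ (h₃ , refl)) (inj₂ (h₅ , refl)))

-- Tiles and pipes

has : Conn -> Tile -> Bool
has κ t = hasConn κ (toConns t)

-- The way in which a pipe running from column b (bottom) to column t (top) of a row
-- passes through the cell in column j; nothing if it does not.
Kind : (j b t : ℕ) -> Maybe Conn -> Set
Kind j b t nothing = j < b ⊎ t < j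
Kind j b t (just WE) = b < j × j < t
Kind j b t (just SN) = b ≡ j × t ≡ j
Kind j b t (just SE) = b ≡ j × j < t
Kind j b t (just WN) = b < j × t ≡ j

kind? : ∀ j b t -> b ≤ t -> ∃ \m -> Kind j b t m
kind? j b t b≤t with <-cmp b j | <-cmp j t
... | tri> _ _ h | _ = nothing , inj₁ h
... | tri< _ _ _ | tri> _ _ h = nothing , inj₂ h
... | tri≈ _ _ _ | tri> _ _ h = nothing , inj₂ h
... | tri< h _ _ | tri< h' _ _ = just WE , h , h'
... | tri< h _ _ | tri≈ _ h' _ = just WN , h , sym h'
... | tri≈ _ h _ | tri< h' _ _ = just SE , h , h'
... | tri≈ _ h _ | tri≈ _ h' _ = just SN , h , sym h'

kind-unique : ∀ {j b t} m m' -> Kind j b t m -> Kind j b t m' -> m ≡ m'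
kind-unique nothing nothing h h' = refl
kind-unique {j} {b} {t} nothing (just WE) h h' = clash "a<bb<c&b<ac<b|; 00230220" (b , j , t) (h' , h)
kind-unique {j} {b} {t} nothing (just SN) h h' = clash "a=bc=b&b<ac<b|; 0025045204" (b , j , t) (h' , h)
kind-unique {j} {b} {t} nothing (just SE) h h' = clash "a=bb<c&b<ac<b|; 0024044203" (b , j , t) (h' , h)
kind-unique {j} {b} {t} nothing (just WN) h h' = clash "a<bc=b&b<ac<b|; 00240220" (b , j , t) (h' , h)
kind-unique {j} {b} {t} (just WE) nothing h h' = clash "a<bb<c&b<ac<b|; 00230220" (b , j , t) (h , h')
kind-unique {j} {b} {t} (just SN) nothing h h' = clash "a=bc=b&b<ac<b|; 0025045204" (b , j , t) (h , h')
kind-unique {j} {b} {t} (just SE) nothing h h' = clash "a=bb<c&b<ac<b|; 0024044203" (b , j , t) (h , h')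
kind-unique {j} {b} {t} (just WN) nothing h h' = clash "a<bc=b&b<ac<b|; 00240220" (b , j , t) (h , h')
kind-unique (just WE) (just WE) h h' = refl
kind-unique {j} {b} {t} (just WE) (just SN) h h' = clash "a=bc=b&a<bb<c; 241" (b , j , t) (h' , h)
kind-unique {j} {b} {t} (just WE) (just SE) h h' = clash "a=bb<c&a<bb<c; 231" (b , j , t) (h' , h)
kind-unique {j} {b} {t} (just WE) (just WN) h h' = clash "a<bc=b&a<bb<c; 230" (b , j , t) (h' , h)
kind-unique {j} {b} {t} (just SN) (just WE) h h' = clash "a<bb<c&a=bc=b; 252" (b , j , t) (h' , h)
kind-unique (just SN) (just SN) h h' = refl
kind-unique {j} {b} {t} (just SN) (just SE) h h' = clash "a=bb<c&a=bc=b; 46415" (b , j , t) (h' , h)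
kind-unique {j} {b} {t} (just SN) (just WN) h h' = clash "a<bc=b&a=bc=b; 262" (b , j , t) (h' , h)
kind-unique {j} {b} {t} (just SE) (just WE) h h' = clash "a<bb<c&a=bb<c; 241" (b , j , t) (h' , h)
kind-unique {j} {b} {t} (just SE) (just SN) h h' = clash "a=bc=b&a=bb<c; 46045" (b , j , t) (h' , h)
kind-unique (just SE) (just SE) h h' = refl
kind-unique {j} {b} {t} (just SE) (just WN) h h' = clash "a<bc=b&a=bb<c; 251" (b , j , t) (h' , h)
kind-unique {j} {b} {t} (just WN) (just WE) h h' = clash "a<bb<c&a<bc=b; 231" (b , j , t) (h' , h)
kind-unique {j} {b} {t} (just WN) (just SN) h h' = clash "a=bc=b&a<bc=b; 252" (b , j , t) (h' , h)
kind-unique {j} {b} {t} (just WN) (just SE) h h' = clash "a=bb<c&a<bc=b; 242" (b , j , t) (h' , h)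
kind-unique (just WN) (just WN) h h' = refl

-- The link between tiles and positions. A tile is a set of connections, so it is determined by the
-- pipes (`cell-det`); in the end this turns equal positions into equal grids.
record Cell (r : ℕ) (T B : ℕ -> ℕ) (j : ℕ) (t : Tile) : Set where
 field
  own  : ∀ κ -> has κ t ≡ true -> ∃ \p -> p ≤ r × Kind j (B p) (T p) (just κ)
  fits : ∀ κ p -> p ≤ r -> Kind j (B p) (T p) (just κ) -> has κ t ≡ true
  uniq : ∀ κ p q -> p ≤ r -> q ≤ r -> Kind j (B p) (T p) (just κ) -> Kind j (B q) (T q) (just κ) -> p ≡ q

conn≟ : (κ κ' : Conn) -> Dec (κ ≡ κ')
conn≟ WE WE = yes refl
conn≟ SN SN = yes refl
conn≟ SE SE = yes refl
conn≟ WN WN = yes refl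
conn≟ WE SN = no (\())
conn≟ WE SE = no (\())
conn≟ WE WN = no (\())
conn≟ SN WE = no (\())
conn≟ SN SE = no (\())
conn≟ SN WN = no (\())
conn≟ SE WE = no (\())
conn≟ SE SN = no (\())
conn≟ SE WN = no (\())
conn≟ WN WE = no (\())
conn≟ WN SN = no (\())
conn≟ WN SE = no (\())

is : Maybe Conn -> Conn -> Bool
is nothing κ = false
is (just κ') κ = Dec.does (conn≟ κ' κ)

-- The tile t' arises from t by replacing the connection m of one pipe by m'.
Replaces : Maybe Conn -> Maybe Conn -> Tile -> Tile -> Set
Replaces m m' t t' = ∀ κ -> has κ t' ≡ (is m' κ ∨ (has κ t ∧ not (is m κ))) × (has κ t ∧ is m' κ) ≡ false

agree : Bool -> Bool -> Bool
agree true b = b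
agree false b = not b

agree-true : ∀ a b -> agree a b ≡ true -> a ≡ b
agree-true true true e = refl
agree-true false false e = refl

-- A Boolean version, decided by `refl` on concrete tiles.
replaces : Maybe Conn -> Maybe Conn -> Tile -> Tile -> Bool
replaces m m' t t' = chk WE ∧ chk SN ∧ chk SE ∧ chk WN
 where
 chk : Conn -> Bool
 chk κ = agree (has κ t') (is m' κ ∨ (has κ t ∧ not (is m κ))) ∧ agree (has κ t ∧ is m' κ) false

replaces-sound : ∀ m m' t t' -> replaces m m' t t' ≡ true -> Replaces m m' t t'
replaces-sound m m' t t' e κ = split₂ (pick₄ κ)
 where
 ok : Conn -> Bool
 ok κ = agree (has κ t') (is m' κ ∨ (has κ t ∧ not (is m κ))) ∧ agree (has κ t ∧ is m' κ) false
 pick₄ : ∀ κ -> ok κ ≡ true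
 pick₄ WE = proj₁ (∧-true e)
 pick₄ SN = proj₁ (∧-true (proj₂ (∧-true {ok WE} e)))
 pick₄ SE = proj₁ (∧-true (proj₂ (∧-true {ok SN} (proj₂ (∧-true {ok WE} e)))))
 pick₄ WN = proj₂ (∧-true {ok SE} (proj₂ (∧-true {ok SN} (proj₂ (∧-true {ok WE} e)))))
 split₂ : ok κ ≡ true -> has κ t' ≡ (is m' κ ∨ (has κ t ∧ not (is m κ))) × (has κ t ∧ is m' κ) ≡ false
 split₂ h = agree-true _ _ (proj₁ (∧-true h)) , agree-true _ _ (proj₂ (∧-true {agree (has κ t') (is m' κ ∨ (has κ t ∧ not (is m κ)))} h))

is-true : ∀ m κ -> is m κ ≡ true -> m ≡ just κ
is-true (just κ') κ e with conn≟ κ' κ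
... | yes refl = refl

is-refl : ∀ κ -> is (just κ) κ ≡ true
is-refl κ with conn≟ κ κ
... | yes _ = refl
... | no n = ⊥-elim (n refl)

module _ {r T B j t} (c : Cell r T B j t) where
 open Cell c

 cell-upd : ∀ (T' B' : ℕ -> ℕ) z -> z ≤ r -> (∀ p -> p ≤ r -> p ≢ z -> T' p ≡ T p) -> (∀ p -> p ≤ r -> p ≢ z -> B' p ≡ B p) ->
  ∀ m m' {t'} -> Kind j (B z) (T z) m -> Kind j (B' z) (T' z) m' -> Replaces m m' t t' -> Cell r T' B' j t'
 cell-upd T' B' z z≤ eT eB m m' {t'} kz kz' rep = record { own = own' ; fits = fits' ; uniq = uniq' }
  where
  to : ∀ κ p -> p ≤ r -> p ≢ z -> Kind j (B p) (T p) (just κ) -> Kind j (B' p) (T' p) (just κ)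
  to κ p p≤ n = subst₂ (\b t -> Kind j b t (just κ)) (sym (eB p p≤ n)) (sym (eT p p≤ n))
  from : ∀ κ p -> p ≤ r -> p ≢ z -> Kind j (B' p) (T' p) (just κ) -> Kind j (B p) (T p) (just κ)
  from κ p p≤ n = subst₂ (\b t -> Kind j b t (just κ)) (eB p p≤ n) (eT p p≤ n)
  own' : ∀ κ -> has κ t' ≡ true -> ∃ \p -> p ≤ r × Kind j (B' p) (T' p) (just κ)
  own' κ h with is m' κ in e' | has κ t in e | is m κ in em | proj₁ (rep κ)
  ... | true | _ | _ | _ = z , z≤ , subst (Kind j (B' z) (T' z)) (is-true m' κ e') kz'
  ... | false | true | false | _ with own κ e
  ... | p , p≤ , k = p , p≤ , to κ p p≤ p≢ k
   where
   p≢ : p ≢ z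
   p≢ refl with refl ← kind-unique m (just κ) kz k with () ← trans (sym em) (is-refl κ)
  own' κ h | false | true | true | e₂ with () ← trans (sym h) e₂
  own' κ h | false | false | _ | e₂ with () ← trans (sym h) e₂
  fits' : ∀ κ p -> p ≤ r -> Kind j (B' p) (T' p) (just κ) -> has κ t' ≡ true
  fits' κ p p≤ k with p ≟ z
  ... | yes refl with refl ← kind-unique m' (just κ) kz' k = trans (proj₁ (rep κ)) (cong (_∨ (has κ t ∧ not (is m κ))) (is-refl κ))
  ... | no n with is m' κ | has κ t | fits κ p p≤ (from κ p p≤ n k) | is m κ in em | proj₁ (rep κ)
  ... | true | _ | _ | _ | e = e
  ... | false | true | _ | false | e = e
  ... | false | true | _ | true | _ with refl ← is-true m κ em = ⊥-elim (n (uniq κ p z p≤ z≤ (from κ p p≤ n k) kz))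
  uniq' : ∀ κ p q -> p ≤ r -> q ≤ r -> Kind j (B' p) (T' p) (just κ) -> Kind j (B' q) (T' q) (just κ) -> p ≡ q
  uniq' κ p q p≤ q≤ k k' with p ≟ z | q ≟ z
  ... | yes refl | yes refl = refl
  ... | no n | no n' = uniq κ p q p≤ q≤ (from κ p p≤ n k) (from κ q q≤ n' k')
  ... | yes refl | no n' with refl ← kind-unique m' (just κ) kz' k with () ← trans (sym (proj₂ (rep κ)))
     (trans (cong (_∧ is (just κ) κ) (fits κ q q≤ (from κ q q≤ n' k'))) (is-refl κ))
  uniq' κ p q p≤ q≤ k k' | no n | yes refl with refl ← kind-unique m' (just κ) kz' k' with () ← trans (sym (proj₂ (rep κ)))
     (trans (cong (_∧ is (just κ) κ) (fits κ p p≤ (from κ p p≤ n k))) (is-refl κ))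

 -- The involution `σ` renames pipes: the identity serves for a pipe that moves without changing its
 -- way through this cell, a transposition for two pipes that trade places.
 cell-map : ∀ (T' B' : ℕ -> ℕ) (σ : ℕ -> ℕ) -> (∀ p -> p ≤ r -> σ p ≤ r) -> (∀ p -> σ (σ p) ≡ p) ->
  (∀ p -> p ≤ r -> ∀ κ -> Kind j (B p) (T p) (just κ) -> Kind j (B' (σ p)) (T' (σ p)) (just κ)) ->
  (∀ p -> p ≤ r -> ∀ κ -> Kind j (B' p) (T' p) (just κ) -> Kind j (B (σ p)) (T (σ p)) (just κ)) -> Cell r T' B' j t
 cell-map T' B' σ σ≤ σσ to from = record
  { own = \κ h -> let (p , p≤ , k) = own κ h in σ p , σ≤ p p≤ , to p p≤ κ k
  ; fits = \κ p p≤ k -> fits κ (σ p) (σ≤ p p≤) (from p p≤ κ k)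
  ; uniq = \κ p q p≤ q≤ k k' -> trans (sym (σσ p)) (trans (cong σ
    (uniq κ (σ p) (σ q) (σ≤ p p≤) (σ≤ q q≤) (from p p≤ κ k) (from q q≤ κ k'))) (σσ q)) }

 cell-keep : ∀ (T' B' : ℕ -> ℕ) z -> (∀ p -> p ≤ r -> p ≢ z -> T' p ≡ T p) -> (∀ p -> p ≤ r -> p ≢ z -> B' p ≡ B p) ->
  ∀ m -> Kind j (B z) (T z) m -> Kind j (B' z) (T' z) m -> Cell r T' B' j t
 cell-keep T' B' z eT eB m kz kz' = cell-map T' B' (\p -> p) (\p h -> h) (\p -> refl) to from
  where
  to : ∀ p -> p ≤ r -> ∀ κ -> Kind j (B p) (T p) (just κ) -> Kind j (B' p) (T' p) (just κ)
  to p p≤ κ k with p ≟ z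
  ... | yes refl = subst (Kind j (B' p) (T' p)) (kind-unique m (just κ) kz k) kz'
  ... | no n = subst₂ (\b t -> Kind j b t (just κ)) (sym (eB p p≤ n)) (sym (eT p p≤ n)) k
  from : ∀ p -> p ≤ r -> ∀ κ -> Kind j (B' p) (T' p) (just κ) -> Kind j (B p) (T p) (just κ)
  from p p≤ κ k with p ≟ z
  ... | yes refl = subst (Kind j (B p) (T p)) (kind-unique m (just κ) kz' k) kz
  ... | no n = subst₂ (\b t -> Kind j b t (just κ)) (eB p p≤ n) (eT p p≤ n) k

 cell-ext : ∀ (T' B' : ℕ -> ℕ) -> (∀ p -> p ≤ r -> T' p ≡ T p) -> (∀ p -> p ≤ r -> B' p ≡ B p) -> Cell r T' B' j t
 cell-ext T' B' eT eB = cell-map T' B' (\p -> p) (\p h -> h) (\p -> refl)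
  (\p p≤ κ -> subst₂ (\b t -> Kind j b t (just κ)) (sym (eB p p≤)) (sym (eT p p≤)))
  (\p p≤ κ -> subst₂ (\b t -> Kind j b t (just κ)) (eB p p≤) (eT p p≤))

 absent : ∀ κ -> (∀ p -> p ≤ r -> Kind j (B p) (T p) (just κ) -> ⊥) -> has κ t ≡ false
 absent κ h with has κ t in e
 ... | false = refl
 ... | true with own κ e
 ... | p , p≤ , k = ⊥-elim (h p p≤ k)

Flags : (we sn se wn : Bool) -> Tile -> Set
Flags we sn se wn t = has WE t ≡ we × has SN t ≡ sn × has SE t ≡ se × has WN t ≡ wn

tile-unique : ∀ {we sn se wn} t t' -> Flags we sn se wn t -> Flags we sn se wn t' -> t ≡ t'
tile-unique t t' (a , b , c , d) (a' , b' , c' , d') = just-injective (trans (sym (from-to t)) (trans (cong fromConns eq) (from-to t')))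
 where
 from-to : ∀ t -> fromConns (toConns t) ≡ just t
 from-to blank = refl
 from-to horiz = refl
 from-to vert = refl
 from-to cross = refl
 from-to relb = refl
 from-to jelb = refl
 from-to bump = refl
 eq : toConns t ≡ toConns t'
 eq = conns-ext (trans a (sym a')) (trans b (sym b')) (trans c (sym c')) (trans d (sym d'))
  where
  conns-ext : ∀ {x y : Conns} -> Conns.we x ≡ Conns.we y -> Conns.sn x ≡ Conns.sn y -> Conns.se x ≡ Conns.se y ->
   Conns.wn x ≡ Conns.wn y -> x ≡ y
  conns-ext refl refl refl refl = refl

cell-det : ∀ {r T B j t t'} -> Cell r T B j t -> Cell r T B j t' -> t ≡ t'
cell-det {t = t} {t'} c c' = tile-unique t t' (refl , refl , refl , refl)
 (eq WE , eq SN , eq SE , eq WN)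
 where
 eq : ∀ κ -> has κ t' ≡ has κ t
 eq κ with has κ t in e | has κ t' in e'
 ... | true | true = refl
 ... | false | false = refl
 ... | true | false with Cell.own c κ e
 ... | p , p≤ , k with () ← trans (sym e') (Cell.fits c' κ p p≤ k)
 eq κ | false | true with Cell.own c' κ e'
 ... | p , p≤ , k with () ← trans (sym e) (Cell.fits c κ p p≤ k)

-- Reading off tiles

is-cross : ∀ t -> has WE t ≡ true -> has SN t ≡ true -> t ≡ cross
is-cross cross _ _ = refl

is-horiz : ∀ t -> has WE t ≡ true -> has SN t ≡ false -> t ≡ horiz
is-horiz horiz _ _ = refl

is-vert : ∀ t -> has SN t ≡ true -> has WE t ≡ false -> t ≡ vert
is-vert vert _ _ = refl

is-r-turn : ∀ t -> has SE t ≡ true -> t ≡ relb ⊎ t ≡ bump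
is-r-turn relb _ = inj₁ refl
is-r-turn bump _ = inj₂ refl

is-relb : ∀ t -> has SE t ≡ true -> has WN t ≡ false -> t ≡ relb
is-relb relb _ _ = refl

is-jelb : ∀ t -> has WN t ≡ true -> has SE t ≡ false -> t ≡ jelb
is-jelb jelb _ _ = refl

is-bump : ∀ t -> has WN t ≡ true -> has SE t ≡ true -> t ≡ bump
is-bump bump _ _ = refl

is-no-top : ∀ t -> has WE t ≡ false -> has SN t ≡ false -> has WN t ≡ false -> t ≡ blank ⊎ t ≡ relb
is-no-top blank _ _ _ = inj₁ refl
is-no-top relb _ _ _ = inj₂ refl

module Read {r T B j t} (c : Cell r T B j t) where
 open Cell c

 Goes : Conn -> ℕ -> Set
 Goes κ p = Kind j (B p) (T p) (just κ)

 sn∧we : ∀ p q -> p ≤ r -> q ≤ r -> Goes WE p -> Goes SN q -> t ≡ cross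
 sn∧we p q p≤ q≤ k k' = is-cross t (fits WE p p≤ k) (fits SN q q≤ k')

 we-only : ∀ p -> p ≤ r -> Goes WE p -> (∀ q -> q ≤ r -> Goes SN q -> ⊥) -> t ≡ horiz
 we-only p p≤ k h = is-horiz t (fits WE p p≤ k) (absent c SN h)

 sn-only : ∀ p -> p ≤ r -> Goes SN p -> (∀ q -> q ≤ r -> Goes WE q -> ⊥) -> t ≡ vert
 sn-only p p≤ k h = is-vert t (fits SN p p≤ k) (absent c WE h)

 se : ∀ p -> p ≤ r -> Goes SE p -> t ≡ relb ⊎ t ≡ bump
 se p p≤ k = is-r-turn t (fits SE p p≤ k)

 se-only : ∀ p -> p ≤ r -> Goes SE p -> (∀ q -> q ≤ r -> Goes WN q -> ⊥) -> t ≡ relb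
 se-only p p≤ k h = is-relb t (fits SE p p≤ k) (absent c WN h)

 wn-only : ∀ p -> p ≤ r -> Goes WN p -> (∀ q -> q ≤ r -> Goes SE q -> ⊥) -> t ≡ jelb
 wn-only p p≤ k h = is-jelb t (fits WN p p≤ k) (absent c SE h)

 se∧wn : ∀ p q -> p ≤ r -> q ≤ r -> Goes SE p -> Goes WN q -> t ≡ bump
 se∧wn p q p≤ q≤ k k' = is-bump t (fits WN q q≤ k') (fits SE p p≤ k)

 top-free : (∀ q -> q ≤ r -> Goes WE q -> ⊥) -> (∀ q -> q ≤ r -> T q ≢ j) -> t ≡ blank ⊎ t ≡ relb
 top-free h h' = is-no-top t (absent c WE h) (absent c SN (\q q≤ k -> h' q q≤ (proj₂ k))) (absent c WN (\q q≤ k -> h' q q≤ (proj₂ k)))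

Match : (K : ℕ) (G : Grid) (P : ℕ -> ℕ -> ℕ) -> Set
Match K G P = ∀ t j -> 1 ≤ j -> j < wd K t -> Cell t (P t) (P (suc t)) j (G (suc t) j)

wd-mono : ∀ K {s t} -> s ≤ t -> wd K s ≤ wd K t
wd-mono K h = s≤s (+-monoˡ-≤ K h)

-- Pipe z is about to be drooped from its r-turn in row a to row a', from column b to g.
record CanDroop (K : ℕ) (P P' : ℕ -> ℕ -> ℕ) (a a' z b g : ℕ) : Set where
 field
  a<a' : a < a'
  z≤   : z ≤ a
  1≤b  : 1 ≤ b
  b<g  : b < g
  g<w  : g < wd K a
  old  : ∀ t -> a < t -> t ≤ a' -> P t z ≡ b
  new  : ∀ t -> a < t -> t ≤ a' -> P' t z ≡ g
  off  : ∀ t p -> t ≤ a ⊎ a' < t ⊎ p ≢ z -> P' t p ≡ P t p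
  hop  : g ≤ P a z
  free : ∀ p -> p ≤ a -> P (suc a) p ≢ g
  fill : ∀ j -> b < j -> j < g -> Occ (suc a) (P (suc a)) j
  le   : ∀ p -> p ≤ a -> P (suc a) p ≤ P a p
  side : ∀ p -> p ≤ a -> p ≢ z -> P a p ≤ b ⊎ P a z < P (suc a) p ⊎ (P (suc a) p ≡ P a p × b < P a p × P a p < P a z)
  mid  : ∀ t -> a < t -> t < a' -> ∃ \s -> s ≤ t × P (suc t) s < b × g < P t s
  mid-free : ∀ t p -> a < t -> t < a' -> p ≤ t -> P t p ≢ g
  low  : P (suc a') z ≤ b
  last : ∀ p -> p ≤ a' -> p ≢ z -> P a' p < b ⊎ (P (suc a') p ≡ P a' p × b < P a' p × P a' p < g) ⊎ (g ≤ P (suc a') p × g < P a' p)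
  fill' : ∀ j -> b < j -> j < g -> Occ (suc a') (P a') j

module DroopMatch {K G P P' a a' z b g} (mt : Match K G P) (cd : CanDroop K P P' a a' z b g) where
 open CanDroop cd

 pb : P (suc a) z ≡ b
 pb = old (suc a) ≤-refl a<a'

 in-range : ∀ t j -> a ≤ t -> 1 ≤ j -> j ≤ g -> Cell t (P t) (P (suc t)) j (G (suc t) j)
 in-range t j a≤ j₁ j₂ = mt t j j₁ (≤-trans (s≤s j₂) (≤-trans g<w (wd-mono K a≤)))

 tiles : DroopTiles G (suc a) (suc a') b g
 tiles = record { start = start ; leftC = leftC ; botL = botL ; topR = topR ; topC = topC ; botR = botR ; end = end ; rightC = rightC }
  where
  a≤a' : a ≤ a'
  a≤a' = <⇒≤ a<a'
  z≤a' : z ≤ a'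
  z≤a' = ≤-trans z≤ a≤a'
  start : G (suc a) b ≡ relb ⊎ G (suc a) b ≡ bump
  start = Read.se (in-range a b ≤-refl 1≤b (<⇒≤ b<g)) z z≤ ((lia "a=b;a=b 02210220" (P (suc a) z , b) pb) , (lia "a<cc-b;a<b 3210" (b , P a z , g) (b<g , hop)))
  topR : ∀ j -> b < j -> j < g -> G (suc a) j ≡ cross
  topR j h h' with fill j h h'
  ... | w , w< , e = Read.sn∧we (in-range a j ≤-refl (≤-trans 1≤b (<⇒≤ h)) (<⇒≤ h')) z w z≤ (≤-pred w<)
    ((lia "c<ba=c;a<b 3312" (P (suc a) z , j , b) (h , pb)) , (lia "a<cc-b;a<b 3210" (j , P a z , g) (h' , hop))) (e , (lia "b<cd<bc-ef=bf-aa-de<ff=ad<aa<e&&||;a=b 07332001371000497063529" (P a w , j , g , b , P a z , P (suc a) w) (h' , h , hop , e , le w (≤-pred w<) , side w (≤-pred w<) w≢z)))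
   where
   w≢z : w ≢ z
   w≢z refl = clash "a<bc=ac=b; 3403" (b , j , P (suc a) z) (h , pb , e)
  topC : G (suc a) g ≡ horiz ⊎ G (suc a) g ≡ jelb
  topC with g ≟ P a z
  ... | yes e = inj₂ (Read.wn-only (in-range a g ≤-refl (≤-trans 1≤b (<⇒≤ b<g)) ≤-refl) z z≤ ((lia "c<ba=c;a<b 3312" (P (suc a) z , g , b) (b<g , pb)) , sym e)
    (\q q≤ k -> free q q≤ (proj₁ k)))
  ... | no n = inj₁ (Read.we-only (in-range a g ≤-refl (≤-trans 1≤b (<⇒≤ b<g)) ≤-refl) z z≤ ((lia "c<ba=c;a<b 3312" (P (suc a) z , g , b) (b<g , pb)) , ≤∧≢⇒< hop n)
    (\q q≤ k -> free q q≤ (proj₁ k)))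
  leftC : ∀ i -> suc a < i -> i < suc a' -> G i b ≡ cross
  leftC (suc t) (s≤s h) (s≤s h') with mid t h h'
  ... | s , s≤ , i₁ , i₂ = Read.sn∧we (in-range t b (<⇒≤ h) 1≤b (<⇒≤ b<g)) s z s≤ (≤-trans z≤ (<⇒≤ h))
    (i₁ , (lia "a<cc<b;a<b 3210" (b , P t s , g) (b<g , i₂))) (old (suc t) (<-trans h ≤-refl) h' , old t h (<⇒≤ h'))
  rightC : ∀ i -> suc a < i -> i < suc a' -> G i g ≡ horiz
  rightC (suc t) (s≤s h) (s≤s h') with mid t h h'
  ... | s , s≤ , i₁ , i₂ = Read.we-only (in-range t g (<⇒≤ h) (≤-trans 1≤b (<⇒≤ b<g)) ≤-refl) s s≤ ((lia "c<ba<c;a<b 3201" (P (suc t) s , g , b) (b<g , i₁)) , i₂)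
    (\q q≤ k -> mid-free t q h h' q≤ (proj₂ k))
  -- The reason why the droop ends in this row: the moving pipe is not crossed here, and the bottom
  -- side is free for its new horizontal part.
  no-ins : ∀ j -> b ≤ j -> j ≤ g -> ∀ p -> p ≤ a' -> P (suc a') p < j × j < P a' p -> ⊥
  no-ins j h h' p p≤ (k , k') with p ≟ z
  ... | yes refl = clash "a-bc=ab<c; 3302" (b , j , P a' p) (h , old a' a<a' ≤-refl , k')
  ... | no n = clash "a-bc-aa<de<ad<ce=dc<dd<b&&b-eb<d&||; 0034300037263714" (j , g , b , P a' p , P (suc a') p) (h' , h , k' , k , last p p≤ n)
  botL : G (suc a') b ≡ vert ⊎ G (suc a') b ≡ jelb
  botL with P (suc a') z ≟ b
  ... | yes e = inj₁ (Read.sn-only (in-range a' b a≤a' 1≤b (<⇒≤ b<g)) z z≤a' (e , old a' a<a' ≤-refl) (no-ins b ≤-refl (<⇒≤ b<g)))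
  ... | no n = inj₂ (Read.wn-only (in-range a' b a≤a' 1≤b (<⇒≤ b<g)) z z≤a' (≤∧≢⇒< low n , old a' a<a' ≤-refl) noS)
   where
   noS : ∀ p -> p ≤ a' -> P (suc a') p ≡ b × b < P a' p -> ⊥
   noS p p≤ (k , k') with p ≟ z
   ... | yes refl = clash "a=ba≠b; 00220230" (P (suc a') p , b) (k , n)
   ... | no n' = clash "a<ba<cd=ac<ad=ca<cc<b&&b-db<c&||; 002400038273715" (b , g , P a' p , P (suc a') p) (b<g , k' , k , last p p≤ n')
  botR : ∀ j -> b < j -> j < g -> G (suc a') j ≡ vert
  botR j h h' with fill' j h h'
  ... | w , w< , e = Read.sn-only (in-range a' j a≤a' (≤-trans 1≤b (<⇒≤ h)) (<⇒≤ h')) w (≤-pred w<)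
    ((lia "b<cd<be=be<da=ed<ee<c&&c-ac<e&||;a=b 003420000a373038043705" (P (suc a') w , j , g , b , P a' w) (h' , h , e , last w (≤-pred w<) w≢z)) , e) (no-ins j (<⇒≤ h) (<⇒≤ h'))
   where
   w≢z : w ≢ z
   w≢z refl = clash "a<bc=ac=b; 3403" (b , j , P a' z) (h , old a' a<a' ≤-refl , e)
  end : G (suc a') g ≡ blank ⊎ G (suc a') g ≡ relb
  end = Read.top-free (in-range a' g a≤a' (≤-trans 1≤b (<⇒≤ b<g)) ≤-refl) (no-ins g (<⇒≤ b<g) ≤-refl) noT
   where
   noT : ∀ p -> p ≤ a' -> P a' p ≢ g
   noT p p≤ e with p ≟ z
   ... | yes refl = clash "a<bc=ac=b; 3403" (b , g , P a' p) (b<g , old a' a<a' ≤-refl , e)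
   ... | no n = clash "a<bc=bc<ad=ca<cc<b&&b-db<c&||; 00342000260250" (b , g , P a' p , P (suc a') p) (b<g , e , last p p≤ n)

 module _ {G'} (dr : Drooped G G' (suc a) (suc a') b g) where
  open Drooped dr

  T-off : ∀ t p -> p ≢ z -> P' t p ≡ P t p
  T-off t p n = off t p (inj₂ (inj₂ n))

  -- A cell is settled by naming the way of `z` through it and its tile, each before and after; what
  -- is left is a finite check.
  update : ∀ t j m m' s s' -> 1 ≤ j -> j < wd K t -> z ≤ t -> Kind j (P (suc t) z) (P t z) m -> Kind j (P' (suc t) z) (P' t z) m' ->
   G (suc t) j ≡ s -> G' (suc t) j ≡ s' -> replaces m m' s s' ≡ true -> Cell t (P' t) (P' (suc t)) j (G' (suc t) j)
  update t j m m' s s' j₁ j₂ z≤t k k' e e' rp = subst (Cell t (P' t) (P' (suc t)) j) (sym e')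
   (cell-upd (subst (Cell t (P t) (P (suc t)) j) e (mt t j j₁ j₂)) (P' t) (P' (suc t)) z z≤t
    (\p _ n -> T-off t p n) (\p _ n -> T-off (suc t) p n) m m' k k' (replaces-sound m m' s s' rp))

  keep : ∀ t j m -> 1 ≤ j -> j < wd K t -> Kind j (P (suc t) z) (P t z) m -> Kind j (P' (suc t) z) (P' t z) m ->
   G' (suc t) j ≡ G (suc t) j -> Cell t (P' t) (P' (suc t)) j (G' (suc t) j)
  keep t j m j₁ j₂ k k' e = subst (Cell t (P' t) (P' (suc t)) j) (sym e)
   (cell-keep (mt t j j₁ j₂) (P' t) (P' (suc t)) z (\p _ n -> T-off t p n) (\p _ n -> T-off (suc t) p n) m k k')

  drooped-top : ∀ j -> 1 ≤ j -> j < wd K a -> Cell a (P' a) (P' (suc a)) j (G' (suc a) j)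
  drooped-top j j₁ j₂ with <-cmp j b | <-cmp j g
  ... | tri< h _ _ | _ = keep a j nothing j₁ j₂ (inj₁ (lia "a<cb=c;a<b 3320" (j , P (suc a) z , b) (h , pb))) (inj₁ (lia "c<da<cb=d;a<b 43042" (j , P' (suc a) z , b , g) (b<g , h , pb'))) (row≢ (suc a) j (inj₂ (inj₂ (inj₁ h))))
   where
   pb' : P' (suc a) z ≡ g
   pb' = new (suc a) ≤-refl a<a'
  ... | tri≈ _ refl _ | _ with start
  ... | inj₁ (e , e') = update a j (just SE) nothing relb blank j₁ j₂ z≤ (pb , (lia "a<cc-b;a<b 3210" (j , P a z , g) (b<g , hop)))
    (inj₁ (lia "a<cb=c;a<b 3320" (j , P' (suc a) z , g) (b<g , new (suc a) ≤-refl a<a'))) e e' refl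
  ... | inj₂ (e , e') = update a j (just SE) nothing bump jelb j₁ j₂ z≤ (pb , (lia "a<cc-b;a<b 3210" (j , P a z , g) (b<g , hop)))
    (inj₁ (lia "a<cb=c;a<b 3320" (j , P' (suc a) z , g) (b<g , new (suc a) ≤-refl a<a'))) e e' refl
  drooped-top j j₁ j₂ | tri> _ _ h | tri< h' _ _ = update a j (just WE) nothing cross vert j₁ j₂ z≤
    ((lia "c<ba=c;a<b 3312" (P (suc a) z , j , b) (h , pb)) , (lia "a<cc-b;a<b 3210" (j , P a z , g) (h' , hop))) (inj₁ (lia "a<cb=c;a<b 3320" (j , P' (suc a) z , g) (h' , new (suc a) ≤-refl a<a'))) (proj₁ (topR j h h')) (proj₂ (topR j h h')) refl
  drooped-top j j₁ j₂ | tri> _ _ h | tri≈ _ refl _ with topC | g ≟ P a z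
  ... | inj₁ (e , e') | no n = update a j (just WE) (just SE) horiz relb j₁ j₂ z≤
    ((lia "c<ba=c;a<b 3312" (P (suc a) z , j , b) (h , pb)) , (lia "a-ba≠b;a<b 00230220" (j , P a z) (hop , n))) ((lia "a=b;a=b 02210220" (P' (suc a) z , j) (new (suc a) ≤-refl a<a')) , (lia "a-cb=ca≠c;a<b 003502554042" (j , P' a z , P a z) (hop , off a z (inj₁ ≤-refl) , n))) e e' refl
  ... | inj₁ (e , e') | yes n with () ← trans (sym (cong (has WN) e))
    (Cell.fits (mt a j j₁ j₂) WN z z≤ ((lia "c<ba=c;a<b 3312" (P (suc a) z , j , b) (h , pb)) , sym n))
  ... | inj₂ (e , e') | yes n = update a j (just WN) (just SN) jelb vert j₁ j₂ z≤
    ((lia "c<ba=c;a<b 3312" (P (suc a) z , j , b) (h , pb)) , sym n) ((lia "a=b;a=b 02210220" (P' (suc a) z , j) (new (suc a) ≤-refl a<a')) , (lia "b=ca=c;a=b 0434103302" (P' a z , j , P a z) (n , off a z (inj₁ ≤-refl)))) e e' refl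
  ... | inj₂ (e , e') | no n with () ← trans (sym (cong (has WE) e))
    (Cell.fits (mt a j j₁ j₂) WE z z≤ ((lia "c<ba=c;a<b 3312" (P (suc a) z , j , b) (h , pb)) , (lia "a-ba≠b;a<b 00230220" (j , P a z) (hop , n))))
  drooped-top j j₁ j₂ | tri> _ _ h | tri> _ _ h' with kind? j b (P a z) (≤-trans (<⇒≤ b<g) hop)
  ... | nothing , inj₁ k = clash "a<bb<a; 210" (b , j) (h , k)
  ... | nothing , inj₂ k = keep a j nothing j₁ j₂ (inj₂ k) (inj₂ (lia "c<ba=c;a<b 3312" (P' a z , j , P a z) (k , off a z (inj₁ ≤-refl)))) (row≢ (suc a) j (inj₂ (inj₂ (inj₂ h'))))
  ... | just WE , k = keep a j (just WE) j₁ j₂ ((lia "c<ba=c;a<b 3312" (P (suc a) z , j , b) (h , pb)) , (lia "c<aa<b;a<b 220" (j , P a z , b) k)) ((lia "c<ba=c;a<b 3312" (P' (suc a) z , j , g) (h' , new (suc a) ≤-refl a<a')) , (lia "b=cd<aa<c;a<b 3402" (j , P' a z , P a z , b) (off a z (inj₁ ≤-refl) , k))) (row≢ (suc a) j (inj₂ (inj₂ (inj₂ h'))))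
  ... | just WN , k = keep a j (just WN) j₁ j₂ ((lia "c<ba=c;a<b 3312" (P (suc a) z , j , b) (h , pb)) , (lia "c<ba=b;a=b 03210220" (P a z , j , b) k)) ((lia "c<ba=c;a<b 3312" (P' (suc a) z , j , g) (h' , new (suc a) ≤-refl a<a')) , (lia "a=cd<bc=b;a=b 0534013520" (P' a z , j , P a z , b) (off a z (inj₁ ≤-refl) , k))) (row≢ (suc a) j (inj₂ (inj₂ (inj₂ h'))))
  ... | just SE , k = clash "a<ba=bb<c; 231" (b , j , P a z) (h , k)
  ... | just SN , k = clash "a<ba=bc=b; 242" (b , j , P a z) (h , k)

  drooped-mid : ∀ t j -> a < t -> t < a' -> 1 ≤ j -> j < wd K t -> Cell t (P' t) (P' (suc t)) j (G' (suc t) j)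
  drooped-mid t j h h' j₁ j₂ with <-cmp j b | <-cmp j g
  ... | tri≈ _ refl _ | _ = update t j (just SN) nothing cross horiz j₁ j₂ z≤t (o' , o)
    (inj₁ (lia "a<cb=c;a<b 3320" (j , P' (suc t) z , g) (b<g , n'))) (proj₁ (leftC (suc t) (s≤s h) (s≤s h'))) (proj₂ (leftC (suc t) (s≤s h) (s≤s h'))) refl
   where
   z≤t : z ≤ t
   z≤t = ≤-trans z≤ (<⇒≤ h)
   o : P t z ≡ b
   o = old t h (<⇒≤ h')
   o' : P (suc t) z ≡ b
   o' = old (suc t) (<-trans h ≤-refl) h'
   n' : P' (suc t) z ≡ g
   n' = new (suc t) (<-trans h ≤-refl) h'
  ... | tri< i _ _ | _ = keep t j nothing j₁ j₂ (inj₁ (lia "a<cb=c;a<b 3320" (j , P (suc t) z , b) (i , old (suc t) (<-trans h ≤-refl) h')))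
    (inj₁ (lia "c<da<cb=d;a<b 43042" (j , P' (suc t) z , b , g) (b<g , i , new (suc t) (<-trans h ≤-refl) h'))) (row≢ (suc t) j (inj₂ (inj₂ (inj₁ i))))
  ... | tri> _ _ i | tri< i' _ _ = keep t j nothing j₁ j₂ (inj₂ (lia "c<ba=c;a<b 3312" (P t z , j , b) (i , old t h (<⇒≤ h'))))
    (inj₁ (lia "a<cb=c;a<b 3320" (j , P' (suc t) z , g) (i' , new (suc t) (<-trans h ≤-refl) h'))) (inner (suc t) j (s≤s h) (s≤s h') i i')
  ... | tri> _ _ i | tri> _ _ i' = keep t j nothing j₁ j₂ (inj₂ (lia "c<ba=c;a<b 3312" (P t z , j , b) (i , old t h (<⇒≤ h'))))
    (inj₂ (lia "c<ba=c;a<b 3312" (P' t z , j , g) (i' , new t h (<⇒≤ h')))) (row≢ (suc t) j (inj₂ (inj₂ (inj₂ i'))))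
  ... | tri> _ _ i | tri≈ _ refl _ = update t j nothing (just SN) horiz cross j₁ j₂ (≤-trans z≤ (<⇒≤ h))
    (inj₂ (lia "c<ba=c;a<b 3312" (P t z , j , b) (i , old t h (<⇒≤ h')))) (new (suc t) (<-trans h ≤-refl) h' , new t h (<⇒≤ h'))
    (proj₁ (rightC (suc t) (s≤s h) (s≤s h'))) (proj₂ (rightC (suc t) (s≤s h) (s≤s h'))) refl

  drooped-last : ∀ j -> 1 ≤ j -> j < wd K a' -> Cell a' (P' a') (P' (suc a')) j (G' (suc a') j)
  drooped-last j j₁ j₂ with <-cmp j b | <-cmp j g
  ... | tri< i _ _ | _ with kind? j (P (suc a') z) b low
  ... | nothing , k = keep a' j nothing j₁ j₂ (lia "a<da<bd<a|;a<bc<a| 00240220" (j , P (suc a') z , P a' z , b) (i , k)) (inj₁ (lia "a<cb=da<dc<a|;a<b 003502240" (j , P' (suc a') z , b , P (suc a') z) (i , off (suc a') z (inj₂ (inj₁ ≤-refl)) , k))) (row≢ (suc a') j (inj₂ (inj₂ (inj₁ i))))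
  ... | just WE , k = keep a' j (just WE) j₁ j₂ ((lia "a<bb<c;a<b 221" (P (suc a') z , j , b) k) , (lia "a<cb=c;a<b 3320" (j , P a' z , b) (i , old a' a<a' ≤-refl))) ((lia "a=cc<bb<d;a<b 3431" (P' (suc a') z , j , P (suc a') z , b) (off (suc a') z (inj₂ (inj₁ ≤-refl)) , k)) , (lia "c<da<cb=d;a<b 43042" (j , P' a' z , b , g) (b<g , i , new a' a<a' ≤-refl))) (row≢ (suc a') j (inj₂ (inj₂ (inj₁ i))))
  ... | just SE , k = keep a' j (just SE) j₁ j₂ ((lia "a=bb<c;a=b 03220230" (P (suc a') z , j , b) k) , (lia "a<cb=c;a<b 3320" (j , P a' z , b) (i , old a' a<a' ≤-refl))) ((lia "a=cc=bb<d;a=b 0534023530" (P' (suc a') z , j , P (suc a') z , b) (off (suc a') z (inj₂ (inj₁ ≤-refl)) , k)) , (lia "c<da<cb=d;a<b 43042" (j , P' a' z , b , g) (b<g , i , new a' a<a' ≤-refl))) (row≢ (suc a') j (inj₂ (inj₂ (inj₁ i))))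
  ... | just SN , k = clash "a<bc=ab=a; 241" (j , b , P (suc a') z) (i , k)
  ... | just WN , k = clash "a<bc<ab=a; 231" (j , b , P (suc a') z) (i , k)
  drooped-last j j₁ j₂ | tri≈ _ refl _ | _ with botL | P (suc a') z ≟ j
  ... | inj₁ (e , e') | yes o = update a' j (just SN) (just SE) vert relb j₁ j₂ (≤-trans z≤ (<⇒≤ a<a'))
    (o , old a' a<a' ≤-refl) (trans (off (suc a') z (inj₂ (inj₁ ≤-refl))) o , (lia "a<cb=c;a<b 3320" (j , P' a' z , g) (b<g , new a' a<a' ≤-refl))) e e' refl
  ... | inj₁ (e , e') | no o with () ← trans (sym (cong (has WN) e))
    (Cell.fits (mt a' j j₁ j₂) WN z (≤-trans z≤ (<⇒≤ a<a')) (≤∧≢⇒< low o , old a' a<a' ≤-refl))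
  ... | inj₂ (e , e') | no o = update a' j (just WN) (just WE) jelb horiz j₁ j₂ (≤-trans z≤ (<⇒≤ a<a'))
    (≤∧≢⇒< low o , old a' a<a' ≤-refl) ((lia "c-ba=cc≠b;a<b 003530240" (P' (suc a') z , j , P (suc a') z) (low , off (suc a') z (inj₂ (inj₁ ≤-refl)) , o)) , (lia "a<cb=c;a<b 3320" (j , P' a' z , g) (b<g , new a' a<a' ≤-refl))) e e' refl
  ... | inj₂ (e , e') | yes o with () ← trans (sym (cong (has SN) e))
    (Cell.fits (mt a' j j₁ j₂) SN z (≤-trans z≤ (<⇒≤ a<a')) (o , old a' a<a' ≤-refl))
  drooped-last j j₁ j₂ | tri> _ _ i | tri< i' _ _ = update a' j nothing (just WE) vert cross j₁ j₂ (≤-trans z≤ (<⇒≤ a<a'))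
    (inj₂ (lia "c<ba=c;a<b 3312" (P a' z , j , b) (i , old a' a<a' ≤-refl))) ((lia "c<bd-ca=d;a<b 44123" (P' (suc a') z , j , b , P (suc a') z) (i , low , off (suc a') z (inj₂ (inj₁ ≤-refl)))) , (lia "a<cb=c;a<b 3320" (j , P' a' z , g) (i' , new a' a<a' ≤-refl)))
    (proj₁ (botR j i i')) (proj₂ (botR j i i')) refl
  drooped-last j j₁ j₂ | tri> _ _ i | tri> _ _ i' = keep a' j nothing j₁ j₂ (inj₂ (lia "c<ba=c;a<b 3312" (P a' z , j , b) (i , old a' a<a' ≤-refl)))
    (inj₂ (lia "c<ba=c;a<b 3312" (P' a' z , j , g) (i' , new a' a<a' ≤-refl))) (row≢ (suc a') j (inj₂ (inj₂ (inj₂ i'))))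
  drooped-last j j₁ j₂ | tri> _ _ i | tri≈ _ refl _ with end
  ... | inj₁ (e , e') = update a' j nothing (just WN) blank jelb j₁ j₂ (≤-trans z≤ (<⇒≤ a<a'))
    (inj₂ (lia "c<ba=c;a<b 3312" (P a' z , j , b) (i , old a' a<a' ≤-refl))) ((lia "c<bd-ca=d;a<b 44123" (P' (suc a') z , j , b , P (suc a') z) (i , low , off (suc a') z (inj₂ (inj₁ ≤-refl)))) , new a' a<a' ≤-refl) e e' refl
  ... | inj₂ (e , e') = update a' j nothing (just WN) relb bump j₁ j₂ (≤-trans z≤ (<⇒≤ a<a'))
    (inj₂ (lia "c<ba=c;a<b 3312" (P a' z , j , b) (i , old a' a<a' ≤-refl))) ((lia "c<bd-ca=d;a<b 44123" (P' (suc a') z , j , b , P (suc a') z) (i , low , off (suc a') z (inj₂ (inj₁ ≤-refl)))) , new a' a<a' ≤-refl) e e' refl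

  drooped-match : Match K G' P'
  drooped-match t j j₁ j₂ with <-cmp t a | <-cmp t a'
  ... | tri< h _ _ | _ = subst (Cell t (P' t) (P' (suc t)) j) (sym (row≢ (suc t) j (inj₁ (s≤s h))))
    (cell-ext (mt t j j₁ j₂) (P' t) (P' (suc t)) (\p _ -> off t p (inj₁ (<⇒≤ h))) (\p _ -> off (suc t) p (inj₁ h)))
  ... | tri≈ _ refl _ | _ = drooped-top j j₁ j₂
  ... | tri> _ _ h | tri< h' _ _ = drooped-mid t j h h' j₁ j₂
  ... | tri> _ _ h | tri≈ _ refl _ = drooped-last j j₁ j₂
  ... | tri> _ _ h | tri> _ _ h' = subst (Cell t (P' t) (P' (suc t)) j) (sym (row≢ (suc t) j (inj₂ (inj₁ (s≤s h')))))
    (cell-ext (mt t j j₁ j₂) (P' t) (P' (suc t)) (\p _ -> off t p (inj₂ (inj₁ h'))) (\p _ -> off (suc t) p (inj₂ (inj₁ (<-trans h' ≤-refl)))))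

 do-droop : ∀ M -> a' ≤ M -> g ≤ suc M ->
  ∃ \G' -> minDroop G M (suc a) b ≡ just (G' , suc a' , g) × Drooped G G' (suc a) (suc a') b g × Match K G' P'
 do-droop M a'≤ g≤ = finish (subst₂ (\A C -> ∃ \G' -> minDroop G M (suc a) b ≡ just (G' , A , C) × Drooped G G' (suc a) A b C) eA eC
  (minDroop-spec G M (suc a) b (a' ∸ suc a) (g ∸ suc b) (≤-trans (m∸n≤m a' (suc a)) a'≤) (≤-trans (∸-monoˡ-≤ (suc b) g≤) (m∸n≤m M b))
   (subst₂ (\A C -> DroopTiles G (suc a) A b C) (sym eA) (sym eC) tiles)))
  where
  eA : suc a + suc (a' ∸ suc a) ≡ suc a'
  eA = trans (+-suc (suc a) _) (cong suc (m+[n∸m]≡n a<a'))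
  eC : b + suc (g ∸ suc b) ≡ g
  eC = trans (+-suc b _) (m+[n∸m]≡n b<g)
  finish : (∃ \G' -> minDroop G M (suc a) b ≡ just (G' , suc a' , g) × Drooped G G' (suc a) (suc a') b g) ->
   ∃ \G' -> minDroop G M (suc a) b ≡ just (G' , suc a' , g) × Drooped G G' (suc a) (suc a') b g × Match K G' P'
  finish (G' , e , dr) = G' , e , dr , drooped-match dr

-- Tracing pipes

StdOut : Grid -> ℕ -> Set
StdOut G M = ∀ i j -> 1 ≤ i -> 1 ≤ j -> M < i ⊎ M < j -> G i j ≡ std i j

<ᵇ-true : ∀ {m n} -> m < n -> (m <ᵇ n) ≡ true
<ᵇ-true {m} {n} h with m <ᵇ n in e
... | true = refl
... | false = ⊥-elim (subst Bool.T e (<⇒<ᵇ h))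

<ᵇ-false : ∀ {m n} -> n ≤ m -> (m <ᵇ n) ≡ false
<ᵇ-false {m} {n} h with m <ᵇ n in e
... | false = refl
... | true = ⊥-elim (<⇒≱ (<ᵇ⇒< m n (subst Bool.T (sym e) tt)) h)

≤ᵇ-true : ∀ {m n} -> m ≤ n -> (m ≤ᵇ n) ≡ true
≤ᵇ-true {zero} h = refl
≤ᵇ-true {suc m} h = <ᵇ-true h

≤ᵇ-false : ∀ {m n} -> n < m -> (m ≤ᵇ n) ≡ false
≤ᵇ-false {suc m} h = <ᵇ-false (≤-pred h)

std-horiz : ∀ {i j} -> i < j -> std i j ≡ horiz
std-horiz h rewrite <ᵇ-true h = refl

std-vert : ∀ {i j} -> j < i -> std i j ≡ vert
std-vert {i} {j} h rewrite <ᵇ-false {i} {j} (<⇒≤ h) | <ᵇ-true h = refl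

std-relb : ∀ i -> std i i ≡ relb
std-relb i rewrite <ᵇ-false {i} {i} ≤-refl = refl

exit-N : ∀ t -> has SN t ≡ true -> exitDir t inS ≡ just outN
exit-N vert _ = refl
exit-N cross _ = refl

exit-E : ∀ t -> has SE t ≡ true -> exitDir t inS ≡ just outE
exit-E relb _ = refl
exit-E bump _ = refl

go-E : ∀ t -> has WE t ≡ true -> exitDir t inW ≡ just outE
go-E horiz _ = refl
go-E cross _ = refl

go-N : ∀ t -> has WN t ≡ true -> exitDir t inW ≡ just outN
go-N jelb _ = refl
go-N bump _ = refl

firstWhere-some : ∀ p M c -> 1 ≤ c -> c ≤ M -> p c ≡ true ->
 ∃ \c' -> firstWhere p (range 1 M) ≡ just c' × 1 ≤ c' × c' ≤ M × p c' ≡ true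
firstWhere-some p M c c₁ c₂ e with argmin {\d -> 1 ≤ d × p d ≡ true} (\d -> ×-dec (1 ≤? d) (p d Bool.≟ true)) (\d -> d) (suc M) (c , s≤s c₂ , c₁ , e)
... | d , s≤s d≤ , (d₁ , e') , mn = d , firstWhere-range p 1 M d d₁ (s≤s d≤) least e' , d₁ , d≤ , e'
 where
 least : ∀ j -> 1 ≤ j -> j < d -> p j ≡ false
 least j j₁ j< with p j in ej
 ... | false = refl
 ... | true = ⊥-elim (<⇒≱ j< (mn j (≤-trans j< (≤-trans d≤ (n≤1+n M))) (j₁ , ej)))

inEq-refl : ∀ s -> inEq s s ≡ true
inEq-refl inW = refl
inEq-refl inS = refl

inEq⇒ : ∀ s s' -> inEq s s' ≡ true -> s ≡ s'
inEq⇒ inW inW e = refl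
inEq⇒ inS inS e = refl

∨-true : ∀ {a b} -> a ∨ b ≡ true -> a ≡ true ⊎ b ≡ true
∨-true {true} e = inj₁ refl
∨-true {false} e = inj₂ e

∨-right : ∀ a {b} -> b ≡ true -> a ∨ b ≡ true
∨-right true e = refl
∨-right false e = e

∈⇒visits : ∀ {i j s cs} -> (i , j , s) ∈ cs -> visits i j s cs ≡ true
∈⇒visits {i} {j} {s} (here refl) rewrite ≡ᵇ-refl i | ≡ᵇ-refl j | inEq-refl s = refl
∈⇒visits {i} {j} {s} {(i' , j' , s') ∷ cs} (there h) = ∨-right ((i ≡ᵇ i') ∧ (j ≡ᵇ j') ∧ inEq s s') (∈⇒visits h)

visits⇒∈ : ∀ {i j s} cs -> visits i j s cs ≡ true -> (i , j , s) ∈ cs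
visits⇒∈ {i} {j} {s} ((i' , j' , s') ∷ cs) e with ∨-true e
... | inj₂ h = there (visits⇒∈ cs h)
... | inj₁ h with ∧-true {i ≡ᵇ i'} h
... | a , b with ∧-true {j ≡ᵇ j'} b
... | b' , c with refl ← ≡ᵇ-true {i} a | refl ← ≡ᵇ-true {j} b' | refl ← inEq⇒ s s' c = here refl

∈⇒visitsCell : ∀ {i j s cs} -> (i , j , s) ∈ cs -> visitsCell i j cs ≡ true
∈⇒visitsCell {i} {j} (here refl) rewrite ≡ᵇ-refl i | ≡ᵇ-refl j = refl
∈⇒visitsCell {i} {j} {s} {(i' , j' , s') ∷ cs} (there h) = ∨-right ((i ≡ᵇ i') ∧ (j ≡ᵇ j')) (∈⇒visitsCell h)

visitsCell⇒∈ : ∀ {i j} cs -> visitsCell i j cs ≡ true -> ∃ \s -> (i , j , s) ∈ cs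
visitsCell⇒∈ {i} {j} ((i' , j' , s') ∷ cs) e with ∨-true e
... | inj₂ h with visitsCell⇒∈ cs h
... | s , m = s , there m
visitsCell⇒∈ {i} {j} ((i' , j' , s') ∷ cs) e | inj₁ h with ∧-true {i ≡ᵇ i'} h
... | a , b with refl ← ≡ᵇ-true {i} a | refl ← ≡ᵇ-true {j} b = s' , here refl

crossingsIn⇒ : ∀ G cs ds {i j} -> (i , j) ∈ crossingsIn G cs ds ->
 isCross (G i j) ≡ true × (∃ \s -> (i , j , s) ∈ cs) × (∃ \s -> (i , j , s) ∈ ds)
crossingsIn⇒ G ((i' , j' , s') ∷ cs) ds h with isCross (G i' j') ∧ visitsCell i' j' ds in e
... | false with crossingsIn⇒ G cs ds h
... | a , (s , m) , b = a , (s , there m) , b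
crossingsIn⇒ G ((i' , j' , s') ∷ cs) ds (here refl) | true with ∧-true {isCross (G i' j')} e
... | a , b = a , (s' , here refl) , visitsCell⇒∈ ds b
crossingsIn⇒ G ((i' , j' , s') ∷ cs) ds (there h) | true with crossingsIn⇒ G cs ds h
... | a , (s , m) , b = a , (s , there m) , b

⇒crossingsIn : ∀ G cs ds {i j s s'} -> isCross (G i j) ≡ true -> (i , j , s) ∈ cs -> (i , j , s') ∈ ds -> (i , j) ∈ crossingsIn G cs ds
⇒crossingsIn G ((i' , j' , s) ∷ cs) ds e (here refl) m rewrite e | ∈⇒visitsCell m = here refl
⇒crossingsIn G ((i' , j' , s) ∷ cs) ds e (there h) m with isCross (G i' j') ∧ visitsCell i' j' ds
... | true = there (⇒crossingsIn G cs ds e h m)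
... | false = ⇒crossingsIn G cs ds e h m

isCross⇒ : ∀ {t} -> isCross t ≡ true -> t ≡ cross
isCross⇒ {cross} e = refl

-- The part of a pipe dream inside the square of side M, with all pipes in it.
record Flow (G : Grid) (M : ℕ) (P : ℕ -> ℕ -> ℕ) : Set where
 field
  cell : ∀ t j -> t < M -> 1 ≤ j -> j ≤ M -> Cell t (P t) (P (suc t)) j (G (suc t) j)
  far  : ∀ t -> t < M -> M < P t t
  le   : ∀ t p -> p ≤ t -> P (suc t) p ≤ P t p
  lo   : ∀ t p -> p ≤ t -> 1 ≤ P (suc t) p
  hi   : ∀ t p -> t ≤ M -> p < t -> P t p ≤ M
  all  : ∀ c -> 1 ≤ c -> c ≤ M -> Occ M (P M) c

module Tracing {G M P} (fl : Flow G M P) where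
 open Flow fl

 -- The cells of pipe `p` with its side of entry, as its positions predict them: from the south in
 -- its bottom column, from the west in the following ones up to its top column, cut off at column
 -- `M`.
 data Vis (p : ℕ) : ℕ -> ℕ -> In -> Set where
  vS : ∀ {t j} -> p ≤ t -> t < M -> P (suc t) p ≡ j -> Vis p (suc t) j inS
  vW : ∀ {t j} -> p ≤ t -> t < M -> P (suc t) p < j -> j ≤ P t p -> j ≤ M -> Vis p (suc t) j inW

 -- The order in which a trace, running north and east, meets cells; relative to it the list traced
 -- from an arbitrary cell is complete.
 Later : (i j : ℕ) (s : In) (i' j' : ℕ) (s' : In) -> Set
 Later i j s i' j' s' = i' < i ⊎ (i' ≡ i × j ≤ j' × (s ≡ inS ⊎ s' ≡ inW))

 Cells = List (ℕ × ℕ × In)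

 Traced : ℕ -> ℕ -> ℕ -> ℕ -> In -> Set
 Traced fuel p i j s = ∃ \(cs : Cells) -> trace fuel G M i j s ≡ just (cs , suc p) ×
  (∀ {i' j' s'} -> (i' , j' , s') ∈ cs -> Vis p i' j' s') ×
  (∀ {i' j' s'} -> Vis p i' j' s' -> Later i j s i' j' s' -> (i' , j' , s') ∈ cs)

 B≤M : ∀ {t p} -> p ≤ t -> t < M -> P (suc t) p ≤ M
 B≤M p≤ t< = hi _ _ t< (s≤s p≤)

 T<M : ∀ {t p} -> p ≤ t -> t < M -> P t p ≤ M -> p < t
 T<M {t} {p} p≤ t< h with p ≟ t
 ... | yes refl = ⊥-elim (<⇒≱ (far t t<) h)
 ... | no n = ≤∧≢⇒< p≤ n

 north : ∀ fuel {p t j s} -> p ≤ t -> t < M -> 1 ≤ t -> p < t -> j ≤ M -> P t p ≡ j -> Vis p (suc t) j s ->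
  exitDir (G (suc t) j) s ≡ just outN -> (∀ {j' s'} -> Vis p (suc t) j' s' -> j ≤ j' -> s ≡ inS ⊎ s' ≡ inW -> j' ≡ j × s' ≡ s) ->
  Traced fuel p t j inS -> Traced (suc fuel) p (suc t) j s
 north fuel {p} {suc t} {j} {s} p≤ t< (s≤s z≤n) p<t j≤ e v ex here! (cs , tr , so , co) = (suc (suc t) , j , s) ∷ cs , eq , so' , co'
  where
  eq : trace (suc fuel) G M (suc (suc t)) j s ≡ just ((suc (suc t) , j , s) ∷ cs , suc p)
  eq rewrite ex | tr = refl
  so' : ∀ {i' j' s'} -> (i' , j' , s') ∈ (suc (suc t) , j , s) ∷ cs -> Vis p i' j' s'
  so' (here refl) = v
  so' (there h) = so h
  co' : ∀ {i' j' s'} -> Vis p i' j' s' -> Later (suc (suc t)) j s i' j' s' -> (i' , j' , s') ∈ (suc (suc t) , j , s) ∷ cs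
  co' v' (inj₂ (refl , h , h')) with refl , refl ← here! v' h h' = here refl
  co' {i'} v' (inj₁ h) with i' ≟ suc t
  ... | no n = there (co v' (inj₁ (≤∧≢⇒< (≤-pred h) n)))
  co' (vS p≤' t<' e') (inj₁ h) | yes refl = there (co (vS p≤' t<' e') (inj₂ (refl , ≤-reflexive (trans (sym e) e') , inj₁ refl)))
  co' (vW p≤' t<' h₁ h₂ h₃) (inj₁ h) | yes refl = there (co (vW p≤' t<' h₁ h₂ h₃) (inj₂ (refl , ≤-trans (≤-reflexive (sym e)) (<⇒≤ h₁) , inj₁ refl)))

 east : ∀ fuel {p t j s} -> p ≤ t -> t < M -> j < M -> Vis p (suc t) j s -> exitDir (G (suc t) j) s ≡ just outE ->
  (∀ {j' s'} -> Vis p (suc t) j' s' -> j ≤ j' -> s ≡ inS ⊎ s' ≡ inW -> (j' ≡ j × s' ≡ s) ⊎ (s' ≡ inW × suc j ≤ j')) ->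
  Traced fuel p (suc t) (suc j) inW -> Traced (suc fuel) p (suc t) j s
 east fuel {p} {t} {j} {s} p≤ t< j< v ex here! (cs , tr , so , co) = (suc t , j , s) ∷ cs , eq , so' , co'
  where
  eq : trace (suc fuel) G M (suc t) j s ≡ just ((suc t , j , s) ∷ cs , suc p)
  eq rewrite ex | ≤ᵇ-false j< | tr = refl
  so' : ∀ {i' j' s'} -> (i' , j' , s') ∈ (suc t , j , s) ∷ cs -> Vis p i' j' s'
  so' (here refl) = v
  so' (there h) = so h
  co' : ∀ {i' j' s'} -> Vis p i' j' s' -> Later (suc t) j s i' j' s' -> (i' , j' , s') ∈ (suc t , j , s) ∷ cs
  co' v' (inj₁ h) = there (co v' (inj₁ h))
  co' v' (inj₂ (refl , h , h')) with here! v' h h'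
  ... | inj₁ (refl , refl) = here refl
  ... | inj₂ (refl , h'') = there (co v' (inj₂ (refl , h'' , inj₂ refl)))

 stop-east : ∀ fuel {t j s} -> t < M -> M ≤ j -> Vis t (suc t) j s -> exitDir (G (suc t) j) s ≡ just outE ->
  (∀ {j' s'} -> Vis t (suc t) j' s' -> j ≤ j' -> s ≡ inS ⊎ s' ≡ inW -> j' ≡ j × s' ≡ s) -> Traced (suc fuel) t (suc t) j s
 stop-east fuel {t} {j} {s} t< M≤ v ex here! = (suc t , j , s) ∷ [] , eq , (\{ (here refl) -> v }) , co'
  where
  eq : trace (suc fuel) G M (suc t) j s ≡ just ((suc t , j , s) ∷ [] , suc t)
  eq rewrite ex | ≤ᵇ-true M≤ = refl
  co' : ∀ {i' j' s'} -> Vis t i' j' s' -> Later (suc t) j s i' j' s' -> (i' , j' , s') ∈ (suc t , j , s) ∷ []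
  co' (vS p≤ _ _) (inj₁ (s≤s h)) = ⊥-elim (<⇒≱ h p≤)
  co' (vW p≤ _ _ _ _) (inj₁ (s≤s h)) = ⊥-elim (<⇒≱ h p≤)
  co' v' (inj₂ (refl , h , h')) with refl , refl ← here! v' h h' = here refl

 -- Every step north or east lowers `i + (M ∸ j)`, the distance to the top right corner, which
 -- therefore bounds the fuel.
 trace-ok : ∀ fuel p i j s -> Vis p i j s -> i + (M ∸ j) < fuel -> Traced fuel p i j s
 trace-ok zero p i j s v ()
 trace-ok (suc fuel) p (suc t) j inS v@(vS p≤ t< e) (s≤s h) with P t p ≟ j
 ... | yes e' = north fuel p≤ t< (≤-trans (s≤s z≤n) p<t) p<t j≤ e' v
   (exit-N (G (suc t) j) (Cell.fits (cell t j t< 1≤j j≤) SN p p≤ (e , e')))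
   (\{ (vS _ _ e₁) _ _ -> trans (sym e₁) e , refl ; {j'} (vW _ _ h₁ h₂ _) _ _ -> (clash "a=bc-ad=bd<c; 45103" (P t p , j , j' , P (suc t) p) (e' , h₂ , e , h₁)) })
   (trace-ok fuel p t j inS (vS′ t p<t t< e') h)
  where
  j≤ : j ≤ M
  j≤ = subst (_≤ M) e (B≤M p≤ t<)
  1≤j : 1 ≤ j
  1≤j = subst (1 ≤_) e (lo t p p≤)
  p<t : p < t
  p<t = T<M p≤ t< (subst (_≤ M) (sym e') j≤)
  vS′ : ∀ t -> p < t -> t < M -> P t p ≡ j -> Vis p t j inS
  vS′ (suc t) (s≤s h) t< e = vS h (<⇒≤ t<) e
 ... | no n = go (j <? M)
  where
  j≤ : j ≤ M
  j≤ = subst (_≤ M) e (B≤M p≤ t<)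
  j<T = lia "c=ac-bb≠a;a<b 003320250" (j , P t p , P (suc t) p) (e , le t p p≤ , n)
  ex : exitDir (G (suc t) j) inS ≡ just outE
  ex = exit-E (G (suc t) j) (Cell.fits (cell t j t< (subst (1 ≤_) e (lo t p p≤)) j≤) SE p p≤ (e , j<T))
  go : Dec (j < M) -> Traced (suc fuel) p (suc t) j inS
  go (yes j<M) = east fuel p≤ t< j<M v ex
   (\{ (vS _ _ e₁) _ _ -> inj₁ (trans (sym e₁) e , refl) ; (vW _ _ h₁ h₂ _) _ _ -> inj₂ (refl , subst (_< _) e h₁) })
   (trace-ok fuel p (suc t) (suc j) inW (vW p≤ t< (s≤s (≤-reflexive e)) j<T j<M)
    (≤-trans (≤-reflexive (cong suc (trans (sym (+-suc t _)) (cong (t +_) (sym (+-∸-assoc 1 j<M)))))) h))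
  go (no j≮M) with p ≟ t
  ... | yes refl = stop-east fuel t< (≮⇒≥ j≮M) v ex
   (\{ (vS _ _ e₁) _ _ -> trans (sym e₁) e , refl ; {j'} (vW _ _ h₁ _ h₃) _ _ -> (clash "a<1bc-ad=bd<c; 44103" (M , j , j' , P (suc p) p) (≰⇒> j≮M , h₃ , e , h₁)) })
  ... | no n' = clash "a<1bb<cc-a; 3210" (M , j , P t p) (≰⇒> j≮M , j<T , hi t p (<⇒≤ t<) (≤∧≢⇒< p≤ n'))
 trace-ok (suc fuel) p (suc t) j inW v@(vW p≤ t< h₁ h₂ j≤) (s≤s h) with P t p ≟ j
 ... | yes e' = north fuel p≤ t< (≤-trans (s≤s z≤n) p<t) p<t j≤ e' v
   (go-N (G (suc t) j) (Cell.fits (cell t j t< 1≤j j≤) WN p p≤ (h₁ , e')))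
   (\{ (vS _ _ e₁) g (inj₂ ()) ; (vS _ _ e₁) g (inj₁ ()) ; {j'} (vW _ _ _ g' _) g _ -> (lia "b-ac=ba-c;a=b 042403301" (j' , j , P t p) (g , e' , g')) , refl })
   (trace-ok fuel p t j inS (vS′ t p<t t< e') h)
  where
  1≤j : 1 ≤ j
  1≤j = ≤-trans (s≤s z≤n) h₁
  p<t : p < t
  p<t = T<M p≤ t< (subst (_≤ M) (sym e') j≤)
  vS′ : ∀ t -> p < t -> t < M -> P t p ≡ j -> Vis p t j inS
  vS′ (suc t) (s≤s h) t< e = vS h (<⇒≤ t<) e
 ... | no n = go (j <? M)
  where
  j<T = lia "a-bb≠a;a<b 00220230" (j , P t p) (h₂ , n)
  ex : exitDir (G (suc t) j) inW ≡ just outE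
  ex = go-E (G (suc t) j) (Cell.fits (cell t j t< (≤-trans (s≤s z≤n) h₁) j≤) WE p p≤ (h₁ , j<T))
  go : Dec (j < M) -> Traced (suc fuel) p (suc t) j inW
  go (yes j<M) = east fuel p≤ t< j<M v ex
   (\{ (vS _ _ e₁) g (inj₂ ()) ; (vS _ _ e₁) g (inj₁ ()) ; {j'} (vW _ _ _ _ _) g _ -> east-or {j'} g })
   (trace-ok fuel p (suc t) (suc j) inW (vW p≤ t< (<-trans h₁ ≤-refl) j<T j<M)
    (≤-trans (≤-reflexive (cong suc (trans (sym (+-suc t _)) (cong (t +_) (sym (+-∸-assoc 1 j<M)))))) h))
   where
   east-or : ∀ {j'} -> j ≤ j' -> (j' ≡ j × inW ≡ inW) ⊎ (inW ≡ inW × suc j ≤ j')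
   east-or {j'} g with j' ≟ j
   ... | yes e = inj₁ (e , refl)
   ... | no n = inj₂ (refl , ≤∧≢⇒< g (≢-sym n))
  go (no j≮M) with p ≟ t
  ... | yes refl = stop-east fuel t< (≮⇒≥ j≮M) v ex
   (\{ (vS _ _ e₁) g (inj₂ ()) ; (vS _ _ e₁) g (inj₁ ()) ; {j'} (vW _ _ _ _ h₃) g _ -> (lia "c<1bb-aa-c;a=b 035320213301" (j' , j , M) (≰⇒> j≮M , g , h₃)) , refl })
  ... | no n' = clash "a<1bc-ab-cc≠b; 005420233403" (M , j , P t p) (≰⇒> j≮M , hi t p (<⇒≤ t<) (≤∧≢⇒< p≤ n') , h₂ , n)

 bottom-vis : ∀ p -> p < M -> Vis p M (P M p) inS
 bottom-vis p p< = go M ≤-refl p<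
  where
  go : ∀ m -> m ≤ M -> p < m -> Vis p m (P m p) inS
  go (suc m) m≤ (s≤s h) = vS h m≤ refl

 traced : ∀ p -> p < M -> Traced (2 * M + 2) p M (P M p) inS
 traced p p< = trace-ok (2 * M + 2) p M (P M p) inS (bottom-vis p p<)
  (≤-trans (s≤s (+-monoʳ-≤ M (m∸n≤m M (P M p)))) (≤-trans (≤-reflexive (cong (\m -> suc (M + m)) (sym (+-identityʳ M))))
   (≤-trans (n≤1+n _) (≤-reflexive (+-comm 2 (2 * M))))))

 vis-later : ∀ {p i j s} -> Vis p i j s -> Later M (P M p) inS i j s
 vis-later {p} (vS {t} p≤ t< e) with suc t ≟ M
 ... | yes h = inj₂ (h , subst (\m -> P m p ≤ _) h (≤-reflexive e) , inj₁ refl)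
 ... | no n = inj₁ (≤∧≢⇒< t< n)
 vis-later {p} (vW {t} p≤ t< h₁ h₂ h₃) with suc t ≟ M
 ... | yes h = inj₂ (h , subst (\m -> P m p ≤ _) h (<⇒≤ h₁) , inj₁ refl)
 ... | no n = inj₁ (≤∧≢⇒< t< n)

 exit-row : ∀ p -> p < M -> exitRow G M (P M p) ≡ just (suc p)
 exit-row p p< = bind-just (proj₁ (proj₂ (traced p p<)))

 pipe-cells : ∀ p (p< : p < M) -> pipeCells G M (P M p) ≡ proj₁ (traced p p<)
 pipe-cells p p< with pipeTrace G M (P M p) | proj₁ (proj₂ (traced p p<))
 ... | just _ | refl = refl

 cells⇒vis : ∀ {p i j s} -> p < M -> (i , j , s) ∈ pipeCells G M (P M p) -> Vis p i j s
 cells⇒vis {p} p< h = proj₁ (proj₂ (proj₂ (traced p p<))) (subst (_ ∈_) (pipe-cells p p<) h)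

 vis⇒cells : ∀ {p i j s} -> p < M -> Vis p i j s -> (i , j , s) ∈ pipeCells G M (P M p)
 vis⇒cells {p} p< v = subst (_ ∈_) (sym (pipe-cells p p<)) (proj₂ (proj₂ (proj₂ (traced p p<))) v (vis-later v))

 vis< : ∀ {p i j s} -> Vis p i j s -> p < M
 vis< (vS p≤ t< _) = ≤-trans (s≤s p≤) t<
 vis< (vW p≤ t< _ _ _) = ≤-trans (s≤s p≤) t<

 -- A tile leads each side of entry to only one exit, so pipes entering alike use the same
 -- connection, and `uniq` identifies them.
 vis-unique : ∀ {p q i j s} -> Vis p i j s -> Vis q i j s -> p ≡ q
 vis-unique {p} {q} (vS {t} {j} p≤ t< e) (vS q≤ _ e') = go (P t p ≟ j) (P t q ≟ j)
  where
  c : Cell t (P t) (P (suc t)) j (G (suc t) j)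
  c = cell t j t< (subst (1 ≤_) e (lo t p p≤)) (subst (_≤ M) e (B≤M p≤ t<))
  sn-se-clash : has SN (G (suc t) j) ≡ true -> has SE (G (suc t) j) ≡ true -> ⊥
  sn-se-clash h h' with G (suc t) j
  sn-se-clash () h' | relb
  sn-se-clash () h' | bump
  go : Dec (P t p ≡ j) -> Dec (P t q ≡ j) -> p ≡ q
  go (yes a) (yes b) = Cell.uniq c SN p q p≤ q≤ (e , a) (e' , b)
  go (no a) (no b) = Cell.uniq c SE p q p≤ q≤ (e , (lia "c=ac-bb≠a;a<b 003320250" (j , P t p , P (suc t) p) (e , le t p p≤ , a))) (e' , (lia "c=ac-bb≠a;a<b 003320250" (j , P t q , P (suc t) q) (e' , le t q q≤ , b)))
  go (yes a) (no b) = ⊥-elim (sn-se-clash (Cell.fits c SN p p≤ (e , a)) (Cell.fits c SE q q≤ (e' , (lia "c=ac-bb≠a;a<b 003320250" (j , P t q , P (suc t) q) (e' , le t q q≤ , b)))))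
  go (no a) (yes b) = ⊥-elim (sn-se-clash (Cell.fits c SN q q≤ (e' , b)) (Cell.fits c SE p p≤ (e , (lia "c=ac-bb≠a;a<b 003320250" (j , P t p , P (suc t) p) (e , le t p p≤ , a)))))
 vis-unique {p} {q} (vW {t} {j} p≤ t< a b j≤) (vW q≤ _ a' b' _) = go (P t p ≟ j) (P t q ≟ j)
  where
  c : Cell t (P t) (P (suc t)) j (G (suc t) j)
  c = cell t j t< (≤-trans (s≤s z≤n) a) j≤
  sn-se-clash : has WN (G (suc t) j) ≡ true -> has WE (G (suc t) j) ≡ true -> ⊥
  sn-se-clash h h' with G (suc t) j
  sn-se-clash () h' | horiz
  sn-se-clash () h' | cross
  go : Dec (P t p ≡ j) -> Dec (P t q ≡ j) -> p ≡ q
  go (yes e) (yes e') = Cell.uniq c WN p q p≤ q≤ (a , e) (a' , e')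
  go (no n) (no n') = Cell.uniq c WE p q p≤ q≤ (a , (lia "a-bb≠a;a<b 00220230" (j , P t p) (b , n))) (a' , (lia "a-bb≠a;a<b 00220230" (j , P t q) (b' , n')))
  go (yes e) (no n') = ⊥-elim (sn-se-clash (Cell.fits c WN p p≤ (a , e)) (Cell.fits c WE q q≤ (a' , (lia "a-bb≠a;a<b 00220230" (j , P t q) (b' , n')))))
  go (no n) (yes e') = ⊥-elim (sn-se-clash (Cell.fits c WN q q≤ (a' , e')) (Cell.fits c WE p p≤ (a , (lia "a-bb≠a;a<b 00220230" (j , P t p) (b , n)))))

 -- The search stops at some column; since every column up to `M` is the foot of a pipe,
 -- `vis-unique` shows that it is the right one.
 pipe-through : ∀ {p i j s} -> Vis p i j s -> pipeThrough G M i j s ≡ just (P M p)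
 pipe-through {p} {i} {j} {s} v = found (firstWhere-some (\c -> visits i j s (pipeCells G M c)) M (P M p)
   (lo′ M (vis< v)) (hi M p ≤-refl (vis< v)) (∈⇒visits (vis⇒cells (vis< v) v)))
  where
  lo′ : ∀ m -> p < m -> 1 ≤ P m p
  lo′ (suc m) (s≤s h) = lo m p h
  found : (∃ \c -> firstWhere (\c -> visits i j s (pipeCells G M c)) (range 1 M) ≡ just c × 1 ≤ c × c ≤ M × visits i j s (pipeCells G M c) ≡ true) ->
   pipeThrough G M i j s ≡ just (P M p)
  found (c , e , c₁ , c₂ , vis) with all c c₁ c₂
  ... | q , q< , refl = trans e (cong (\r -> just (P M r)) (vis-unique (cells⇒vis q< (visits⇒∈ _ vis)) v))

 Crossing : ℕ -> ℕ -> ℕ -> ℕ -> Set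
 Crossing p q i j = isCross (G i j) ≡ true × (∃ \s -> Vis p i j s) × (∃ \s -> Vis q i j s)

 cross-sound : ∀ {p q i j} -> p < M -> q < M -> (i , j) ∈ crossings G M (P M p) (P M q) -> Crossing p q i j
 cross-sound {p} {q} p< q< h with crossingsIn⇒ G (pipeCells G M (P M p)) (pipeCells G M (P M q)) h
 ... | e , (s , m) , (s' , m') = e , (s , cells⇒vis p< m) , (s' , cells⇒vis q< m')

 cross-complete : ∀ {p q i j} -> Crossing p q i j -> (i , j) ∈ crossings G M (P M p) (P M q)
 cross-complete (e , (s , v) , (s' , v')) = ⇒crossingsIn G _ _ e (vis⇒cells (vis< v) v) (vis⇒cells (vis< v') v')

 first-crossing-none : ∀ {p q} -> p < M -> q < M -> (∀ i j -> Crossing p q i j -> ⊥) -> firstCrossing G M (P M p) (P M q) ≡ nothing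
 first-crossing-none {p} {q} p< q< h with crossings G M (P M p) (P M q) | (\{i} {j} -> cross-sound {p} {q} {i} {j} p< q<)
 ... | [] | _ = refl
 ... | (i , j) ∷ _ | so = ⊥-elim (h i j (so (here refl)))

 first-crossing-at : ∀ {p q a b} -> Crossing p q a b -> (∀ i j -> Crossing p q i j -> i ≡ a × j ≡ b) ->
  firstCrossing G M (P M p) (P M q) ≡ just (a , b)
 first-crossing-at {p} {q} {a} {b} cr h with crossings G M (P M p) (P M q)
   | (\{i} {j} -> cross-sound {p} {q} {i} {j} (vis< (proj₂ (proj₁ (proj₂ cr)))) (vis< (proj₂ (proj₂ (proj₂ cr))))) | cross-complete cr
 ... | (i , j) ∷ _ | so | _ with refl , refl ← h i j (so (here refl)) = refl

 crossing-WS : ∀ {p q t j} -> isCross (G (suc t) j) ≡ true -> Vis p (suc t) j inW -> Vis q (suc t) j inS ->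
  (p ≤ t × q ≤ t × t < M × j ≤ M) × (P (suc t) p < j × j < P t p × P (suc t) q ≡ j × P t q ≡ j)
 crossing-WS {p} {q} {t} {j} e (vW p≤ t< a b j≤) (vS q≤ _ c) =
  (p≤ , q≤ , t< , j≤) , (a , cross-kind e WN (\()) p≤ t< (≤-trans (s≤s z≤n) a) j≤ (\h -> a , sym h) b , c , cross-up e q≤ t< c)
  where
  cross-kind : isCross (G (suc t) j) ≡ true -> ∀ κ -> has κ cross ≢ true -> ∀ {p} -> p ≤ t -> t < M -> 1 ≤ j -> j ≤ M -> (j ≡ P t p -> Kind j (P (suc t) p) (P t p) (just κ)) -> j ≤ P t p -> j < P t p
  cross-kind ic κ nk {p} p≤ t< j₁ j₂ f le' with j ≟ P t p
  ... | no n = ≤∧≢⇒< le' n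
  ... | yes h = ⊥-elim (nk (subst (\s -> has κ s ≡ true) (isCross⇒ ic) (Cell.fits (cell t j t< j₁ j₂) κ p p≤ (f h))))
  cross-up : isCross (G (suc t) j) ≡ true -> ∀ {q} -> q ≤ t -> t < M -> P (suc t) q ≡ j -> P t q ≡ j
  cross-up ic {q} q≤ t< c with P t q ≟ j
  ... | yes h = h
  ... | no n with () ← subst (\s -> has SE s ≡ true) (isCross⇒ ic)
     (Cell.fits (cell t j t< (subst (1 ≤_) c (lo t q q≤)) (subst (_≤ M) c (B≤M q≤ t<))) SE q q≤ (c , (lia "c=ac-bb≠a;a<b 003320250" (j , P t q , P (suc t) q) (c , le t q q≤ , n))))

 crossing-kinds : ∀ {p q t j} -> p ≢ q -> Crossing p q (suc t) j -> (p ≤ t × q ≤ t × t < M × j ≤ M) ×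
  ((P (suc t) p < j × j < P t p × P (suc t) q ≡ j × P t q ≡ j) ⊎ (P (suc t) q < j × j < P t q × P (suc t) p ≡ j × P t p ≡ j))
 crossing-kinds p≢q (e , (inS , v) , (inS , v')) = ⊥-elim (p≢q (vis-unique v v'))
 crossing-kinds p≢q (e , (inW , v) , (inW , v')) = ⊥-elim (p≢q (vis-unique v v'))
 crossing-kinds p≢q (e , (inW , v) , (inS , v')) with crossing-WS e v v'
 ... | a , h = a , inj₁ h
 crossing-kinds p≢q (e , (inS , v) , (inW , v')) with crossing-WS e v' v
 ... | (a , b , c) , h = (b , a , c) , inj₂ h

record Shape (K : ℕ) (P : ℕ -> ℕ -> ℕ) : Set where
 field
  far : ∀ t -> P t t ≡ wd K t
  le  : ∀ t p -> p ≤ t -> P (suc t) p ≤ P t p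
  lo  : ∀ t p -> p ≤ t -> 1 ≤ P (suc t) p
  hi  : ∀ t p -> p < t -> P t p < wd K t

flow : ∀ {K G M P} -> Match K G P -> Shape K P -> StdOut G M -> M ≤ K -> Flow G M P
flow {K} {G} {M} {P} mt sh so M≤K = record
 { cell = \t j _ j₁ j₂ -> mt t j j₁ (≤-trans (s≤s j₂) (w t)) ; far = \t _ -> subst (M <_) (sym (far t)) (w t)
 ; le = le ; lo = lo ; hi = hi' ; all = all' }
 where
 open Shape sh
 w : ∀ t -> M < wd K t
 w t = s≤s (≤-trans M≤K (m≤n+m K t))
 no-N : ∀ {i j} -> i ≤ j -> has SN (std i j) ≡ false × has WN (std i j) ≡ false
 no-N {i} {j} h with i ≟ j
 ... | yes refl rewrite std-relb i = refl , refl
 ... | no n rewrite std-horiz (≤∧≢⇒< h n) = refl , refl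
 -- A larger column would lie in the standard part, on or above the diagonal, where no tile has a
 -- north edge for the pipe.
 hi' : ∀ t p -> t ≤ M -> p < t -> P t p ≤ M
 hi' t p t≤ p< with P t p ≤? M
 ... | yes h = h
 ... | no h with mt t (P t p) (≤-trans (s≤s z≤n) (≰⇒> h)) (hi t p p<) | so (suc t) (P t p) (s≤s z≤n) (≤-trans (s≤s z≤n) (≰⇒> h)) (inj₂ (≰⇒> h)) | P (suc t) p ≟ P t p
 ... | c | e | yes e' with () ← trans (sym (proj₁ (no-N (≤-trans (s≤s t≤) (≰⇒> h))))) (trans (cong (has SN) (sym e)) (Cell.fits c SN p (<⇒≤ p<) (e' , refl)))
 ... | c | e | no n with () ← trans (sym (proj₂ (no-N (≤-trans (s≤s t≤) (≰⇒> h))))) (trans (cong (has WN) (sym e)) (Cell.fits c WN p (<⇒≤ p<) (≤∧≢⇒< (le t p (<⇒≤ p<)) n , refl)))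
 -- Row `M + 1` is standard, so its tile in column `c` is vertical; the pipe through that tile is
 -- the one sought.
 all' : ∀ c -> 1 ≤ c -> c ≤ M -> Occ M (P M) c
 all' c c₁ c₂ with Cell.own (mt M c c₁ (≤-trans (s≤s c₂) (w M))) SN
   (trans (cong (has SN) (trans (so (suc M) c (s≤s z≤n) c₁ (inj₁ ≤-refl)) (std-vert (s≤s c₂)))) refl)
 ... | p , p≤ , _ , e with p ≟ M
 ... | no n = p , ≤∧≢⇒< p≤ n , e
 ... | yes refl = ⊥-elim (<⇒≱ (w M) (≤-trans (≤-reflexive (trans (sym (far M)) e)) c₂))

-- Exchanging the continuations of two pipes

exch : ℕ -> ℕ -> ℕ -> ℕ
exch q z p = if Dec.does (p ≟ q) then z else (if Dec.does (p ≟ z) then q else p)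

exch-l : ∀ q z -> exch q z q ≡ z
exch-l q z = if-yes (q ≟ q) refl

exch-r : ∀ q z -> exch q z z ≡ q
exch-r q z with z ≟ q
... | yes refl = if-yes (q ≟ q) refl
... | no n = trans (if-no (z ≟ q) n) (if-yes (z ≟ z) refl)

exch-o : ∀ q z p -> p ≢ q -> p ≢ z -> exch q z p ≡ p
exch-o q z p n n' = trans (if-no (p ≟ q) n) (if-no (p ≟ z) n')

exch-elim : (Q : ℕ -> ℕ -> Set) (q z : ℕ) -> Q q z -> Q z q -> (∀ p -> p ≢ q -> p ≢ z -> Q p p) -> ∀ p -> Q p (exch q z p)
exch-elim Q q z a b c p with p ≟ q | p ≟ z
... | yes refl | _ = subst (Q q) (sym (exch-l q z)) a
... | no _ | yes refl = subst (Q z) (sym (exch-r q z)) b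
... | no n | no n' = subst (Q p) (sym (exch-o q z p n n')) (c p n n')

exch-exch : ∀ q z p -> exch q z (exch q z p) ≡ p
exch-exch q z = exch-elim (\p p' -> exch q z p' ≡ p) q z (exch-r q z) (exch-l q z) (exch-o q z)

module _ {r T B j t} (c : Cell r T B j t) where
 open Cell c

 cell-exch : ∀ (T' B' : ℕ -> ℕ) q z -> q ≤ r -> z ≤ r ->
  (∀ κ -> (Kind j (B q) (T q) (just κ) -> Kind j (B' z) (T' z) (just κ)) × (Kind j (B' z) (T' z) (just κ) -> Kind j (B q) (T q) (just κ))) ->
  (∀ κ -> (Kind j (B z) (T z) (just κ) -> Kind j (B' q) (T' q) (just κ)) × (Kind j (B' q) (T' q) (just κ) -> Kind j (B z) (T z) (just κ))) ->
  (∀ p -> p ≢ q -> p ≢ z -> T' p ≡ T p × B' p ≡ B p) -> Cell r T' B' j t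
 cell-exch T' B' q z q≤ z≤ h h' e = cell-map c T' B' (exch q z)
  (exch-elim (\p p' -> p ≤ r -> p' ≤ r) q z (\_ -> z≤) (\_ -> q≤) (\p _ _ x -> x)) (exch-exch q z)
  (\p _ κ -> exch-elim (\p p' -> Kind j (B p) (T p) (just κ) -> Kind j (B' p') (T' p') (just κ)) q z (proj₁ (h κ)) (proj₁ (h' κ))
   (\p n n' -> subst₂ (\b t -> Kind j b t (just κ)) (sym (proj₂ (e p n n'))) (sym (proj₁ (e p n n')))) p)
  (\p _ κ -> exch-elim (\p p' -> Kind j (B' p) (T' p) (just κ) -> Kind j (B p') (T p') (just κ)) q z (proj₂ (h' κ)) (proj₂ (h κ))
   (\p n n' -> subst₂ (\b t -> Kind j b t (just κ)) (proj₂ (e p n n')) (proj₁ (e p n n'))) p)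

 cell-keep₂ : ∀ (T' B' : ℕ -> ℕ) q z ->
  (∀ κ -> (Kind j (B q) (T q) (just κ) -> Kind j (B' q) (T' q) (just κ)) × (Kind j (B' q) (T' q) (just κ) -> Kind j (B q) (T q) (just κ))) ->
  (∀ κ -> (Kind j (B z) (T z) (just κ) -> Kind j (B' z) (T' z) (just κ)) × (Kind j (B' z) (T' z) (just κ) -> Kind j (B z) (T z) (just κ))) ->
  (∀ p -> p ≢ q -> p ≢ z -> T' p ≡ T p × B' p ≡ B p) -> Cell r T' B' j t
 cell-keep₂ T' B' q z h h' e = cell-map c T' B' (\p -> p) (\p x -> x) (\p -> refl) (\p _ κ -> proj₁ (iff p κ)) (\p _ κ -> proj₂ (iff p κ))
  where
  iff : ∀ p κ -> (Kind j (B p) (T p) (just κ) -> Kind j (B' p) (T' p) (just κ)) × (Kind j (B' p) (T' p) (just κ) -> Kind j (B p) (T p) (just κ))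
  iff p κ with p ≟ q | p ≟ z
  ... | yes refl | _ = h κ
  ... | no _ | yes refl = h' κ
  ... | no n | no n' rewrite proj₁ (e p n n') | proj₂ (e p n n') = (\k -> k) , (\k -> k)

 -- The two pipes are the only ones in the cell before and after, so a bump and a cross can be
 -- exchanged for each other by comparing connections.
 cell-retile : ∀ (T' B' : ℕ -> ℕ) {t'} p q κ κ' μ μ' -> p ≤ r -> q ≤ r -> μ ≢ μ' ->
  Kind j (B p) (T p) (just κ) -> Kind j (B q) (T q) (just κ') -> Kind j (B' p) (T' p) (just μ) -> Kind j (B' q) (T' q) (just μ') ->
  (∀ ν -> has ν t ≡ true -> ν ≡ κ ⊎ ν ≡ κ') -> (∀ ν -> has ν t' ≡ true -> ν ≡ μ ⊎ ν ≡ μ') ->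
  has μ t' ≡ true -> has μ' t' ≡ true -> (∀ o -> o ≢ p -> o ≢ q -> T' o ≡ T o × B' o ≡ B o) -> Cell r T' B' j t'
 cell-retile T' B' {t'} p q κ κ' μ μ' p≤ q≤ μ≢ kp kq kp' kq' ft ft' hμ hμ' e = record { own = own' ; fits = fits' ; uniq = uniq' }
  where
  which : ∀ ν o -> o ≤ r -> Kind j (B' o) (T' o) (just ν) -> (o ≡ p × ν ≡ μ) ⊎ (o ≡ q × ν ≡ μ')
  which ν o o≤ k with o ≟ p | o ≟ q
  ... | yes refl | _ = inj₁ (refl , just-injective (kind-unique (just ν) (just μ) k kp'))
  ... | no _ | yes refl = inj₂ (refl , just-injective (kind-unique (just ν) (just μ') k kq'))
  ... | no n | no n' with subst₂ (\b t -> Kind j b t (just ν)) (proj₂ (e o n n')) (proj₁ (e o n n')) k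
  ... | k₀ with ft ν (fits ν o o≤ k₀)
  ... | inj₁ refl = ⊥-elim (n (uniq ν o p o≤ p≤ k₀ kp))
  ... | inj₂ refl = ⊥-elim (n' (uniq ν o q o≤ q≤ k₀ kq))
  own' : ∀ ν -> has ν t' ≡ true -> ∃ \o -> o ≤ r × Kind j (B' o) (T' o) (just ν)
  own' ν h with ft' ν h
  ... | inj₁ refl = p , p≤ , kp'
  ... | inj₂ refl = q , q≤ , kq'
  fits' : ∀ ν o -> o ≤ r -> Kind j (B' o) (T' o) (just ν) -> has ν t' ≡ true
  fits' ν o o≤ k with which ν o o≤ k
  ... | inj₁ (refl , refl) = hμ
  ... | inj₂ (refl , refl) = hμ'
  uniq' : ∀ ν o o' -> o ≤ r -> o' ≤ r -> Kind j (B' o) (T' o) (just ν) -> Kind j (B' o') (T' o') (just ν) -> o ≡ o'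
  uniq' ν o o' o≤ o'≤ k k' with which ν o o≤ k | which ν o' o'≤ k'
  ... | inj₁ (refl , _) | inj₁ (refl , _) = refl
  ... | inj₂ (refl , _) | inj₂ (refl , _) = refl
  ... | inj₁ (_ , e₁) | inj₂ (_ , e₂) = ⊥-elim (μ≢ (trans (sym e₁) e₂))
  ... | inj₂ (_ , e₁) | inj₁ (_ , e₂) = ⊥-elim (μ≢ (trans (sym e₂) e₁))

bump-flags : ∀ ν -> has ν bump ≡ true -> ν ≡ WN ⊎ ν ≡ SE
bump-flags WN _ = inj₁ refl
bump-flags SE _ = inj₂ refl

cross-flags : ∀ ν -> has ν cross ≡ true -> ν ≡ SN ⊎ ν ≡ WE
cross-flags SN _ = inj₁ refl
cross-flags WE _ = inj₂ refl

-- Left of its top column a pipe looks the same wherever that column is, and right of its bottom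
-- column likewise (`kind-B`). This settles the rest of a row in which a bump and a cross are
-- interchanged.
kind-T : ∀ j b t t' -> j < t -> j < t' -> ∀ κ -> Kind j b t (just κ) -> Kind j b t' (just κ)
kind-T _ _ _ _ h h' WE (a , b) = a , h'
kind-T _ _ _ _ h h' SE (a , b) = a , h'
kind-T _ _ _ _ h h' SN (a , refl) = ⊥-elim (<-irrefl refl h)
kind-T _ _ _ _ h h' WN (a , refl) = ⊥-elim (<-irrefl refl h)

kind-B : ∀ j b b' t -> b < j -> b' < j -> ∀ κ -> Kind j b t (just κ) -> Kind j b' t (just κ)
kind-B _ _ _ _ h h' WE (a , b) = h' , b
kind-B _ _ _ _ h h' WN (a , b) = h' , b
kind-B _ _ _ _ h h' SN (refl , b) = ⊥-elim (<-irrefl refl h)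
kind-B _ _ _ _ h h' SE (refl , b) = ⊥-elim (<-irrefl refl h)

kind-off : ∀ j b t b' t' -> j < b ⊎ t < j -> ∀ κ -> Kind j b t (just κ) -> Kind j b' t' (just κ)
kind-off _ _ _ _ _ o κ k with () ← kind-unique nothing (just κ) o k

Swapped : (P P' : ℕ -> ℕ -> ℕ) (q z t : ℕ) -> Set
Swapped P P' q z t = P' t q ≡ P t z × P' t z ≡ P t q × (∀ p -> p ≢ q -> p ≢ z -> P' t p ≡ P t p)

module Swapping {K G P} {q z : ℕ} (P' : ℕ -> ℕ -> ℕ) (mt : Match K G P) where

 same-row : ∀ t -> (∀ p -> p ≤ t -> P' t p ≡ P t p) -> (∀ p -> p ≤ t -> P' (suc t) p ≡ P (suc t) p) ->
  ∀ j -> 1 ≤ j -> j < wd K t -> Cell t (P' t) (P' (suc t)) j (G (suc t) j)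
 same-row t e e' j j₁ j₂ = cell-ext (mt t j j₁ j₂) (P' t) (P' (suc t)) e e'

 exch-row : ∀ t -> q ≤ t -> z ≤ t -> Swapped P P' q z t -> Swapped P P' q z (suc t) ->
  ∀ j -> 1 ≤ j -> j < wd K t -> Cell t (P' t) (P' (suc t)) j (G (suc t) j)
 exch-row t q≤ z≤ (a , b , c) (a' , b' , c') j j₁ j₂ = cell-exch (mt t j j₁ j₂) (P' t) (P' (suc t)) q z q≤ z≤
  (\κ -> subst₂ (\x y -> Kind j x y (just κ)) (sym b') (sym b) , subst₂ (\x y -> Kind j x y (just κ)) b' b)
  (\κ -> subst₂ (\x y -> Kind j x y (just κ)) (sym a') (sym a) , subst₂ (\x y -> Kind j x y (just κ)) a' a)
  (\p n n' -> c p n n' , c' p n n')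

 -- The bump in row e (pipe q turning north, pipe z turning east) becomes a crossing.
 cross-row : ∀ e {c} -> q ≤ e -> z ≤ e -> P e q ≡ c -> P (suc e) z ≡ c -> P (suc e) q < c -> c < P e z ->
  (∀ p -> P' e p ≡ P e p) -> Swapped P P' q z (suc e) ->
  ∀ (G' : Grid) -> (∀ j -> j ≢ c -> G' (suc e) j ≡ G (suc e) j) -> G' (suc e) c ≡ cross ->
  ∀ j -> 1 ≤ j -> j < wd K e -> Cell e (P' e) (P' (suc e)) j (G' (suc e) j)
 cross-row e {c} q≤ z≤ tq bz bq tz eT (a , b , o) G' off at j j₁ j₂ with <-cmp j c
 ... | tri< h ne _ = subst (Cell e (P' e) (P' (suc e)) j) (sym (off j ne)) (cell-exch (mt e j j₁ j₂) (P' e) (P' (suc e)) q z q≤ z≤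
   (\κ -> (\k -> subst₂ (\x y -> Kind j x y (just κ)) (sym b) (sym (eT z)) (kind-T j (P (suc e) q) (P e q) (P e z) (lia "a<cb=c;a<b 3320" (j , P e q , c) (h , tq)) (lia "a<cc<b;a<b 3210" (j , P e z , c) (h , tz)) κ k))
     , (\k -> kind-T j (P (suc e) q) (P e z) (P e q) (lia "a<cc<b;a<b 3210" (j , P e z , c) (h , tz)) (lia "a<cb=c;a<b 3320" (j , P e q , c) (h , tq)) κ (subst₂ (\x y -> Kind j x y (just κ)) b (eT z) k)))
   (\κ -> kind-off j (P (suc e) z) (P e z) (P' (suc e) q) (P' e q) (inj₁ (lia "a<cb=c;a<b 3320" (j , P (suc e) z , c) (h , bz))) κ , kind-off j (P' (suc e) q) (P' e q) (P (suc e) z) (P e z) (inj₁ (lia "a<cd=cb=d;a<b 45420" (j , P' (suc e) q , c , P (suc e) z) (h , bz , a))) κ)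
   (\p n n' -> eT p , o p n n'))
 ... | tri> _ ne h = subst (Cell e (P' e) (P' (suc e)) j) (sym (off j (\x -> ne x))) (cell-keep₂ (mt e j j₁ j₂) (P' e) (P' (suc e)) q z
   (\κ -> kind-off j (P (suc e) q) (P e q) (P' (suc e) q) (P' e q) (inj₂ (lia "c<ba=c;a<b 3312" (P e q , j , c) (h , tq))) κ , kind-off j (P' (suc e) q) (P' e q) (P (suc e) q) (P e q) (inj₂ (lia "c<bd=ca=d;a<b 45134" (P' e q , j , c , P e q) (h , tq , eT q))) κ)
   (\κ -> (\k -> subst₂ (\x y -> Kind j x y (just κ)) (sym b) (sym (eT z)) (kind-B j (P (suc e) z) (P (suc e) q) (P e z) (lia "c<ba=c;a<b 3312" (P (suc e) z , j , c) (h , bz)) (lia "c<ba<c;a<b 3201" (P (suc e) q , j , c) (h , bq)) κ k))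
     , (\k -> kind-B j (P (suc e) q) (P (suc e) z) (P e z) (lia "c<ba<c;a<b 3201" (P (suc e) q , j , c) (h , bq)) (lia "c<ba=c;a<b 3312" (P (suc e) z , j , c) (h , bz)) κ (subst₂ (\x y -> Kind j x y (just κ)) b (eT z) k)))
   (\p n n' -> eT p , o p n n'))
 ... | tri≈ _ refl _ = subst (Cell e (P' e) (P' (suc e)) j) (sym at) (cell-retile (subst (Cell e (P e) (P (suc e)) j) bmp (mt e j j₁ j₂)) (P' e) (P' (suc e)) q z
   WN SE SN WE q≤ z≤ (\()) (bq , tq) (bz , tz) ((lia "c=ba=c;a=b 0433103402" (P' (suc e) q , c , P (suc e) z) (bz , a)) , (lia "c=ba=c;a=b 0433103402" (P' e q , c , P e q) (tq , eT q))) ((lia "c<ba=c;a<b 3312" (P' (suc e) z , c , P (suc e) q) (bq , b)) , (lia "a<cb=c;a<b 3320" (c , P' e z , P e z) (tz , eT z)))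
   bump-flags cross-flags refl refl (\p n n' -> eT p , o p n n'))
  where
  bmp : G (suc e) j ≡ bump
  bmp = Read.se∧wn (mt e j j₁ j₂) z q z≤ q≤ (bz , tz) (bq , tq)

 -- The crossing in row e of q (vertical) and z (horizontal) becomes a bump.
 bump-row : ∀ e {c} -> q ≤ e -> z ≤ e -> P e q ≡ c -> P (suc e) q ≡ c -> P (suc e) z < c -> c < P e z ->
  Swapped P P' q z e -> (∀ p -> P' (suc e) p ≡ P (suc e) p) ->
  ∀ (G' : Grid) -> (∀ j -> j ≢ c -> G' (suc e) j ≡ G (suc e) j) -> G' (suc e) c ≡ bump ->
  ∀ j -> 1 ≤ j -> j < wd K e -> Cell e (P' e) (P' (suc e)) j (G' (suc e) j)
 bump-row e {c} q≤ z≤ tq bq bz tz (a , b , o) eB G' off at j j₁ j₂ with <-cmp j c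
 ... | tri< h ne _ = subst (Cell e (P' e) (P' (suc e)) j) (sym (off j ne)) (cell-keep₂ (mt e j j₁ j₂) (P' e) (P' (suc e)) q z
   (\κ -> kind-off j (P (suc e) q) (P e q) (P' (suc e) q) (P' e q) (inj₁ (lia "a<cb=c;a<b 3320" (j , P (suc e) q , c) (h , bq))) κ , kind-off j (P' (suc e) q) (P' e q) (P (suc e) q) (P e q) (inj₁ (lia "a<cd=cb=d;a<b 45420" (j , P' (suc e) q , c , P (suc e) q) (h , bq , eB q))) κ)
   (\κ -> (\k -> subst₂ (\x y -> Kind j x y (just κ)) (sym (eB z)) (sym b) (kind-T j (P (suc e) z) (P e z) (P e q) (lia "a<cc<b;a<b 3210" (j , P e z , c) (h , tz)) (lia "a<cb=c;a<b 3320" (j , P e q , c) (h , tq)) κ k))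
     , (\k -> kind-T j (P (suc e) z) (P e q) (P e z) (lia "a<cb=c;a<b 3320" (j , P e q , c) (h , tq)) (lia "a<cc<b;a<b 3210" (j , P e z , c) (h , tz)) κ (subst₂ (\x y -> Kind j x y (just κ)) (eB z) b k)))
   (\p n n' -> o p n n' , eB p))
 ... | tri> _ ne h = subst (Cell e (P' e) (P' (suc e)) j) (sym (off j (\x -> ne x))) (cell-exch (mt e j j₁ j₂) (P' e) (P' (suc e)) q z q≤ z≤
   (\κ -> kind-off j (P (suc e) q) (P e q) (P' (suc e) z) (P' e z) (inj₂ (lia "c<ba=c;a<b 3312" (P e q , j , c) (h , tq))) κ , kind-off j (P' (suc e) z) (P' e z) (P (suc e) q) (P e q) (inj₂ (lia "c<bd=ca=d;a<b 45134" (P' e z , j , c , P e q) (h , tq , b))) κ)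
   (\κ -> (\k -> subst₂ (\x y -> Kind j x y (just κ)) (sym (eB q)) (sym a) (kind-B j (P (suc e) z) (P (suc e) q) (P e z) (lia "c<ba<c;a<b 3201" (P (suc e) z , j , c) (h , bz)) (lia "c<ba=c;a<b 3312" (P (suc e) q , j , c) (h , bq)) κ k))
     , (\k -> kind-B j (P (suc e) q) (P (suc e) z) (P e z) (lia "c<ba=c;a<b 3312" (P (suc e) q , j , c) (h , bq)) (lia "c<ba<c;a<b 3201" (P (suc e) z , j , c) (h , bz)) κ (subst₂ (\x y -> Kind j x y (just κ)) (eB q) a k)))
   (\p n n' -> o p n n' , eB p))
 ... | tri≈ _ refl _ = subst (Cell e (P' e) (P' (suc e)) j) (sym at) (cell-retile (subst (Cell e (P e) (P (suc e)) j) crs (mt e j j₁ j₂)) (P' e) (P' (suc e)) q z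
   SN WE SE WN q≤ z≤ (\()) (bq , tq) (bz , tz) ((lia "c=ba=c;a=b 0433103402" (P' (suc e) q , c , P (suc e) q) (bq , eB q)) , (lia "a<cb=c;a<b 3320" (c , P' e q , P e z) (tz , a))) ((lia "c<ba=c;a<b 3312" (P' (suc e) z , c , P (suc e) z) (bz , eB z)) , (lia "c=ba=c;a=b 0433103402" (P' e z , c , P e q) (tq , b)))
   cross-flags (\ν h -> [ inj₂ , inj₁ ]′ (bump-flags ν h)) refl refl (\p n n' -> o p n n' , eB p))
  where
  crs : G (suc e) j ≡ cross
  crs = Read.sn∧we (mt e j j₁ j₂) z q z≤ q≤ (bz , tz) (bq , tq)

-- Grids that realise given positions

Edge : Grid -> Grid -> Set
Edge G G' = ∀ i j -> i ≡ 0 ⊎ j ≡ 0 -> G' i j ≡ G i j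

-- The invariant of a run on tiles. Row 0 and column 0 carry no pipes but count in the final
-- equality of grids, so the agreement with the initial grid `G₀` there is recorded.
record Placed (K : ℕ) (G₀ : Grid) (P : ℕ -> ℕ -> ℕ) (G : Grid) (M : ℕ) : Set where
 field
  match : Match K G P
  std!  : StdOut G M
  edge  : Edge G₀ G
  M≤    : M ≤ K

module Bounds (M i j : ℕ) where
 old≤ : M ≤ M ⊔ i ⊔ j
 old≤ = ≤-trans (m≤m⊔n M i) (m≤m⊔n (M ⊔ i) j)
 row≤ : i ≤ M ⊔ i ⊔ j
 row≤ = ≤-trans (m≤n⊔m M i) (m≤m⊔n (M ⊔ i) j)
 col≤ : j ≤ M ⊔ i ⊔ j
 col≤ = m≤n⊔m (M ⊔ i) j

droop-step : ∀ {K G₀ G M P P' a a' z b g} -> Placed K G₀ P G M -> CanDroop K P P' a a' z b g -> suc a ≤ M -> b ≤ M -> suc a' ≤ K -> g ≤ K ->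
 ∃ \G' -> minDroop G M (suc a) b ≡ just (G' , suc a' , g) × Placed K G₀ P' G' (M ⊔ suc a' ⊔ g)
droop-step {K} {G₀} {G} {M} {a = a} {a'} {z} {b} {g} pl cd a≤ b≤ a'K gK with DroopMatch.do-droop (Placed.match pl) cd M a'≤ g≤
 where
 open Placed pl
 tl = DroopMatch.tiles {G = G} match cd
 -- The inner cells of the left side are crosses, while in row `M + 1` the standard tile in column
 -- `b ≤ M` is vertical. So the rectangle does not extend past that row.
 a'≤ : a' ≤ M
 a'≤ with a' ≤? M
 ... | yes h = h
 ... | no h with () ← trans (sym (DroopTiles.leftC tl (suc M) (s≤s a≤) (s≤s (≰⇒> h))))
    (trans (std! (suc M) b (s≤s z≤n) (CanDroop.1≤b cd) (inj₁ ≤-refl)) (std-vert (s≤s b≤)))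
 g≤ : g ≤ suc M
 g≤ with g ≤? suc M
 ... | yes h = h
 ... | no h with () ← trans (sym (DroopTiles.topR tl (suc M) (s≤s b≤) (≰⇒> h)))
    (trans (std! (suc a) (suc M) (s≤s z≤n) (s≤s z≤n) (inj₂ ≤-refl)) (std-horiz (s≤s a≤)))
... | G' , e , dr , mt = G' , e , record { match = mt ; std! = out ; edge = \i j o -> trans (Drooped.row≢ dr i j (border i j o)) (Placed.edge pl i j o)
   ; M≤ = ⊔-lub (⊔-lub (Placed.M≤ pl) a'K) gK }
 where
 open Bounds M (suc a') g
 border : ∀ i j -> i ≡ 0 ⊎ j ≡ 0 -> i < suc a ⊎ suc a' < i ⊎ j < b ⊎ g < j
 border i j (inj₁ refl) = inj₁ (s≤s z≤n)
 border i j (inj₂ refl) = inj₂ (inj₂ (inj₁ (CanDroop.1≤b cd)))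
 out : StdOut G' (M ⊔ suc a' ⊔ g)
 out i j i₁ j₁ (inj₁ h) = trans (Drooped.row≢ dr i j (inj₂ (inj₁ (≤-trans (s≤s row≤) h)))) (Placed.std! pl i j i₁ j₁ (inj₁ (≤-trans (s≤s old≤) h)))
 out i j i₁ j₁ (inj₂ h) = trans (Drooped.row≢ dr i j (inj₂ (inj₂ (inj₂ (≤-trans (s≤s col≤) h))))) (Placed.std! pl i j i₁ j₁ (inj₂ (≤-trans (s≤s old≤) h)))

isRelb⇒ : ∀ {t} -> isRelb t ≡ true -> t ≡ relb
isRelb⇒ {relb} e = refl

Turns : (r : ℕ) (T B : ℕ -> ℕ) (p c : ℕ) -> Set
Turns r T B p c = p ≤ r × B p ≡ c × c < T p

module _ {K G₀ P G M} (pl : Placed K G₀ P G M) where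
 open Placed pl

 place-⊔ : ∀ N -> N ≤ K -> Placed K G₀ P G (M ⊔ N)
 place-⊔ N N≤ = record
  { match = match ; edge = edge ; M≤ = ⊔-lub M≤ N≤
  ; std! = \{ i j i₁ j₁ (inj₁ h) -> std! i j i₁ j₁ (inj₁ (≤-trans (s≤s (m≤m⊔n M N)) h)) ; i j i₁ j₁ (inj₂ h) -> std! i j i₁ j₁ (inj₂ (≤-trans (s≤s (m≤m⊔n M N)) h)) } }

 in-width : ∀ t j -> j ≤ M -> j < wd K t
 in-width t j h = s≤s (≤-trans h (≤-trans M≤ (m≤n+m K t)))

 place-ext : ∀ P' -> (∀ t p -> P' t p ≡ P t p) -> Placed K G₀ P' G M
 place-ext P' h = record { match = \t j j₁ j₂ -> cell-ext (match t j j₁ j₂) (P' t) (P' (suc t)) (\p _ -> h t p) (\p _ -> h (suc t) p) ; std! = std! ; edge = edge ; M≤ = M≤ }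

 no-relb : ∀ t j -> 1 ≤ j -> suc t ≤ M -> (∀ p -> Turns t (P t) (P (suc t)) p j -> ⊥) -> isRelbAt G (suc t) j ≡ false
 no-relb t j j₁ t< h with j ≤? M
 ... | no n = cong isRelb (trans (std! (suc t) j (s≤s z≤n) j₁ (inj₂ (≰⇒> n))) (std-horiz (≤-trans (s≤s t<) (≰⇒> n))))
 ... | yes j₂ with isRelbAt G (suc t) j in e
 ... | false = refl
 ... | true with p , p≤ , k ← Cell.own (match t j j₁ (in-width t j j₂)) SE (cong (has SE) (isRelb⇒ e)) = ⊥-elim (h p (p≤ , k))

 relb-at : ∀ t c -> 1 ≤ c -> c < wd K t -> ∀ p -> Turns t (P t) (P (suc t)) p c -> (∀ q -> q ≤ t -> P (suc t) q < c -> P t q ≢ c) -> G (suc t) c ≡ relb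
 relb-at t c c₁ c₂ p (p≤ , k) h = Read.se-only (match t c c₁ c₂) p p≤ k (\q q≤ k' -> h q q≤ (proj₁ k') (proj₂ k'))

 relb-in : ∀ t c -> 1 ≤ c -> suc t ≤ M -> G (suc t) c ≡ relb -> c ≤ M
 relb-in t c c₁ t< e with c ≤? M
 ... | yes h = h
 ... | no h with () ← trans (sym e) (trans (std! (suc t) c (s≤s z≤n) c₁ (inj₂ (≰⇒> h))) (std-horiz (≤-trans (s≤s t<) (≰⇒> h))))

 -- The bump in row e becomes a crossing, pipes q and z exchanging their parts below.
 uncross : ∀ {P' q z e c} -> q ≤ e -> z ≤ e -> P e q ≡ c -> P (suc e) z ≡ c -> P (suc e) q < c -> c < P e z ->
  (∀ t -> t ≤ e -> ∀ p -> P' t p ≡ P t p) -> (∀ t -> e < t -> Swapped P P' q z t) ->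
  suc e ≤ M -> c ≤ M -> Placed K G₀ P' (set G (suc e) c cross) M
 uncross {P'} {q} {z} {e} {c} q≤ z≤ tq bz bq tz eT sw e≤ c≤ = record { match = mt ; std! = out ; edge = ed ; M≤ = M≤ }
  where
  module S = Swapping {K} {G} {P} {q} {z} P' match
  off : ∀ i j -> i ≢ suc e ⊎ j ≢ c -> set G (suc e) c cross i j ≡ G i j
  off = set-off G (suc e) c cross
  out : StdOut (set G (suc e) c cross) M
  out i j i₁ j₁ o = trans (off i j ([ (\h -> inj₁ (>⇒≢ (≤-trans (s≤s e≤) h))) , (\h -> inj₂ (>⇒≢ (≤-trans (s≤s c≤) h))) ]′ o)) (std! i j i₁ j₁ o)
  ed : Edge G₀ (set G (suc e) c cross)
  ed i j (inj₁ refl) = trans (off i j (inj₁ (\()))) (edge i j (inj₁ refl))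
  ed i j (inj₂ refl) = trans (off i j (inj₂ (<⇒≢ (≤-trans (s≤s z≤n) bq)))) (edge i j (inj₂ refl))
  mt : Match K (set G (suc e) c cross) P'
  mt t j j₁ j₂ with <-cmp t e
  ... | tri≈ _ refl _ = S.cross-row t q≤ z≤ tq bz bq tz (eT t ≤-refl) (sw (suc t) ≤-refl) (set G (suc t) c cross) (\j n -> off (suc t) j (inj₂ n)) (set-at G (suc t) c cross) j j₁ j₂
  ... | tri< h n _ = subst (Cell t (P' t) (P' (suc t)) j) (sym (off (suc t) j (inj₁ (\e -> n (suc-injective e)))))
     (S.same-row t (\p _ -> eT t (<⇒≤ h) p) (\p _ -> eT (suc t) h p) j j₁ j₂)
  ... | tri> _ n h = subst (Cell t (P' t) (P' (suc t)) j) (sym (off (suc t) j (inj₁ (\e -> n (suc-injective e)))))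
     (S.exch-row t (≤-trans q≤ (<⇒≤ h)) (≤-trans z≤ (<⇒≤ h)) (sw t h) (sw (suc t) (<-trans h ≤-refl)) j j₁ j₂)

 -- The bump in row e and the crossing in row e' are exchanged.
 exchange : ∀ {P' q z e c e' c'} -> q ≤ e -> z ≤ e -> P e q ≡ c -> P (suc e) z ≡ c -> P (suc e) q < c -> c < P e z ->
  e < e' -> P e' q ≡ c' -> P (suc e') q ≡ c' -> P (suc e') z < c' -> c' < P e' z ->
  (∀ t -> t ≤ e ⊎ e' < t -> ∀ p -> P' t p ≡ P t p) -> (∀ t -> e < t -> t ≤ e' -> Swapped P P' q z t) ->
  suc e' ≤ M -> c ≤ M -> c' ≤ M -> Placed K G₀ P' (swapAt G (suc e) c (suc e') c') M
 exchange {P'} {q} {z} {e} {c} {e'} {c'} q≤ z≤ tq bz bq tz e<e' tq' bq' bz' tz' eT sw e≤ c≤ c'≤ = record { match = mt ; std! = out ; edge = ed ; M≤ = M≤ }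
  where
  module S = Swapping {K} {G} {P} {q} {z} P' match
  G' = swapAt G (suc e) c (suc e') c'
  off : ∀ i j -> i ≢ suc e' ⊎ j ≢ c' -> i ≢ suc e ⊎ j ≢ c -> G' i j ≡ G i j
  off i j h h' = trans (set-off (set G (suc e) c cross) (suc e') c' bump i j h) (set-off G (suc e) c cross i j h')
  out : StdOut G' M
  out i j i₁ j₁ o = trans (off i j ([ (\h -> inj₁ (>⇒≢ (≤-trans (s≤s e≤) h))) , (\h -> inj₂ (>⇒≢ (≤-trans (s≤s c'≤) h))) ]′ o)
   ([ (\h -> inj₁ (>⇒≢ (≤-trans (s≤s (≤-trans (s≤s (<⇒≤ e<e')) e≤)) h))) , (\h -> inj₂ (>⇒≢ (≤-trans (s≤s c≤) h))) ]′ o)) (std! i j i₁ j₁ o)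
  ed : Edge G₀ G'
  ed i j (inj₁ refl) = trans (off i j (inj₁ (\())) (inj₁ (\()))) (edge i j (inj₁ refl))
  ed i j (inj₂ refl) = trans (off i j (inj₂ (<⇒≢ (≤-trans (s≤s z≤n) bz'))) (inj₂ (<⇒≢ (≤-trans (s≤s z≤n) bq)))) (edge i j (inj₂ refl))
  plain : ∀ t j -> t ≢ e' -> t ≢ e -> Cell t (P' t) (P' (suc t)) j (G (suc t) j) -> Cell t (P' t) (P' (suc t)) j (G' (suc t) j)
  plain t j n n' = subst (Cell t (P' t) (P' (suc t)) j) (sym (off (suc t) j (inj₁ (\x -> n (suc-injective x))) (inj₁ (\x -> n' (suc-injective x)))))
  mt : Match K G' P'
  mt t j j₁ j₂ with <-cmp t e | <-cmp t e'
  ... | tri< h n _ | _ = plain t j (\{ refl -> <-asym h e<e' }) n (S.same-row t (\p _ -> eT t (inj₁ (<⇒≤ h)) p) (\p _ -> eT (suc t) (inj₁ h) p) j j₁ j₂)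
  ... | tri≈ _ refl _ | _ = S.cross-row t q≤ z≤ tq bz bq tz (eT t (inj₁ ≤-refl)) (sw (suc t) ≤-refl e<e') G'
     (\j n -> off (suc t) j (inj₁ (\x -> <⇒≢ e<e' (suc-injective x))) (inj₂ n))
     (trans (set-off (set G (suc t) c cross) (suc e') c' bump (suc t) c (inj₁ (\x -> <⇒≢ e<e' (suc-injective x)))) (set-at G (suc t) c cross)) j j₁ j₂
  ... | tri> _ n h | tri< h' n' _ = plain t j n' n (S.exch-row t (≤-trans q≤ (<⇒≤ h)) (≤-trans z≤ (<⇒≤ h)) (sw t h (<⇒≤ h')) (sw (suc t) (<-trans h ≤-refl) h') j j₁ j₂)
  ... | tri> _ n h | tri≈ _ refl _ = S.bump-row t (≤-trans q≤ (<⇒≤ h)) (≤-trans z≤ (<⇒≤ h)) tq' bq' bz' tz' (sw t h ≤-refl) (eT (suc t) (inj₂ ≤-refl)) G'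
     (\j n' -> off (suc t) j (inj₂ n') (inj₁ (\x -> n (suc-injective x)))) (set-at (set G (suc e) c cross) (suc t) c' bump) j j₁ j₂
  ... | tri> _ n h | tri> _ n' h' = plain t j n' n (S.same-row t (\p _ -> eT t (inj₂ h') p) (\p _ -> eT (suc t) (inj₂ (<-trans h' ≤-refl)) p) j j₁ j₂)

 module Bump (sh : Shape K P) {q z e c} (q≤ : q ≤ e) (z≤ : z ≤ e) (tq : P e q ≡ c) (bq : P (suc e) q < c)
  (bz : P (suc e) z ≡ c) (tz : c < P e z) (e< : suc e ≤ M) (c≤ : c ≤ M) where
  open Tracing (flow match sh std! M≤) public
  is-bump! : G (suc e) c ≡ bump
  is-bump! = Read.se∧wn (match e c (≤-trans (s≤s z≤n) bq) (in-width e c c≤)) z q z≤ q≤ (bz , tz) (bq , tq)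
  rpipe : rPipe G M (suc e) c ≡ just (P M z)
  rpipe = pipe-through (vS z≤ e< bz)
  wpipe : wPipe G M (suc e) c ≡ just (P M q)
  wpipe = pipe-through (vW q≤ e< bq (≤-reflexive (sym tq)) c≤)
  rexit : exitRow G M (P M z) ≡ just (suc z)
  rexit = exit-row z (≤-trans (s≤s z≤) e<)

 jelb-at : ∀ {e c} q -> q ≤ e -> P e q ≡ c -> P (suc e) q < c -> c ≤ M -> (∀ z -> Turns e (P e) (P (suc e)) z c -> ⊥) -> G (suc e) c ≡ jelb
 jelb-at {e} {c} q q≤ tq bq c≤ h = Read.wn-only (match e c (≤-trans (s≤s z≤n) bq) (in-width e c c≤)) q q≤ (bq , tq) (\z z≤ k -> h z (z≤ , k))

lastWhere-range : ∀ p n i -> 1 ≤ i -> i ≤ n -> p i ≡ true -> (∀ j -> i < j -> j ≤ n -> p j ≡ false) -> lastWhere p (range 1 n) ≡ just i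
lastWhere-range p n i i₁ i≤ e h = trans (cong (firstWhere p) (trans (cong reverse (map-applyUpTo suc (\t -> t) n)) (reverse-applyUpTo suc n))) (go n i≤ h)
 where
 go : ∀ n -> i ≤ n -> (∀ j -> i < j -> j ≤ n -> p j ≡ false) -> firstWhere p (applyDownFrom suc n) ≡ just i
 go zero i≤ h = ⊥-elim (<⇒≱ i₁ i≤)
 go (suc n) i≤ h with i ≟ suc n
 ... | yes refl rewrite e = refl
 ... | no ne rewrite h (suc n) (≤∧≢⇒< i≤ ne) ≤-refl = go n (≤-pred (≤∧≢⇒< i≤ ne)) (\j a b -> h j a (≤-trans b (n≤1+n n)))

-- One pipe z on the move: the rows a + 1, …, a' in which it is passed by other pipes.
record Stretch (pos : ℕ -> ℕ -> ℕ) (On : ℕ -> Set) (z a a' : ℕ) : Set where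
 field
  a<a' : a < a'
  state : ∀ t -> a < t -> t ≤ a' -> On t
  col  : ∀ t -> a < t -> t ≤ a' -> pos t z ≡ pos (suc a) z
  ins  : ∀ t -> a < t -> t < a' -> Inside t (pos t) (pos (suc t)) (pos t z)

module Track {l b K f z : ℕ} (pos pos′ : ℕ -> ℕ -> ℕ) (row : ∀ t -> Row l (b + t) (wd K t) t (pos t) (pos (suc t)))
 {On E : ℕ -> Set} (z< : ∀ t -> On t -> z < t) (on≤ : ∀ t -> On t -> t ≤ f)
 (advance : ∀ t -> On t -> (Inside t (pos t) (pos (suc t)) (pos t z) × On (suc t)) ⊎ E t) where

 -- The moving state does not last beyond row `f`, so `f < n + t` leaves enough fuel.
 grow : ∀ {a} n t -> f < n + t -> Stretch pos On z a t -> ∃ \a' -> Stretch pos On z a a' × E a'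
 grow zero t h sr = ⊥-elim (<⇒≱ h (on≤ t (Stretch.state sr t (Stretch.a<a' sr) ≤-refl)))
 grow {a} (suc n) t h sr with advance t (Stretch.state sr t (Stretch.a<a' sr) ≤-refl)
 ... | inj₂ en = t , sr , en
 ... | inj₁ (i@(u , u≤ , i₁ , i₂) , e) = grow n (suc t) (subst (f <_) (sym (+-suc n t)) h)
   (record { a<a' = <-trans a<a' ≤-refl ; state = state' ; col = col' ; ins = ins' })
  where
  open Stretch sr
  z≤ : z ≤ t
  z≤ = <⇒≤ (z< t (state t a<a' ≤-refl))
  state' : ∀ t' -> a < t' -> t' ≤ suc t -> On t'
  state' t' h h' with t' ≟ suc t
  ... | yes refl = e
  ... | no n = state t' h (≤-pred (≤∧≢⇒< h' n))
  u≢z : u ≢ z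
  u≢z refl = <-irrefl refl i₂
  col' : ∀ t' -> a < t' -> t' ≤ suc t -> pos t' z ≡ pos (suc a) z
  col' t' h h' with t' ≟ suc t
  -- A pipe that is crossed is vertical in that row, so the column does not change.
  ... | yes refl = lia "c<da-cc=be<chfgdeca@;a=b 0601481250046157002e238b03540" (pos (suc t) z , pos (suc a) z , pos t z , pos t u , pos (suc t) u , u , z , l) (i₂ , Row.le (row t) z z≤ , col t a<a' ≤-refl , i₁ , Row.pair (row t) u z u≤ z≤ u≢z)
  ... | no n = col t' h (≤-pred (≤∧≢⇒< h' n))
  ins' : ∀ t' -> a < t' -> t' < suc t -> Inside t' (pos t') (pos (suc t')) (pos t' z)
  ins' t' h h' with t' ≟ t
  ... | yes refl = i
  ... | no n = ins t' h (≤∧≢⇒< (≤-pred h') n)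

 find : ∀ n a -> f < n + suc a -> On (suc a) -> ∃ \a' -> Stretch pos On z a a' × E a'
 find n a h o = grow n (suc a) h (record { a<a' = ≤-refl ; state = \t h h' -> subst On (≤-antisym h h') o
  ; col = \t h h' -> cong (\t -> pos t z) (≤-antisym h' h) ; ins = \t h h' -> ⊥-elim (<⇒≱ h' h) })

-- P below row a, P′ down to row a
module Hybrid {l b b' K : ℕ} (P P′ : ℕ -> ℕ -> ℕ) (H : ℕ -> ℕ -> ℕ -> ℕ)
 (hy≤ : ∀ {a t} p -> t ≤ a -> H a t p ≡ P′ t p) (hy> : ∀ {a t} p -> a < t -> H a t p ≡ P t p)
 (row : ∀ t -> Row l (b + t) (wd K t) t (P t) (P (suc t))) (row′ : ∀ t -> Row l (b' + t) (wd K t) t (P′ t) (P′ (suc t))) where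

 hy-shape : ∀ a -> (∀ p -> p ≤ a -> P (suc a) p ≤ P′ a p) -> Shape K (H a)
 hy-shape a join = record { far = far ; le = le ; lo = lo ; hi = hi }
  where
  far : ∀ t -> H a t t ≡ wd K t
  far t with t ≤? a
  ... | yes h = trans (hy≤ t h) (Row.top (row′ t))
  ... | no h = trans (hy> t (≰⇒> h)) (Row.top (row t))
  hi : ∀ t p -> p < t -> H a t p < wd K t
  hi t p p< with t ≤? a
  ... | yes h = subst (_< wd K t) (sym (hy≤ p h)) (Row.hi (row′ t) p p<)
  ... | no h = subst (_< wd K t) (sym (hy> p (≰⇒> h))) (Row.hi (row t) p p<)
  lo : ∀ t p -> p ≤ t -> 1 ≤ H a (suc t) p
  lo t p p≤ with suc t ≤? a
  ... | yes h = subst (1 ≤_) (sym (hy≤ p h)) (Row.lo (row′ t) p p≤)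
  ... | no h = subst (1 ≤_) (sym (hy> p (≰⇒> h))) (Row.lo (row t) p p≤)
  le : ∀ t p -> p ≤ t -> H a (suc t) p ≤ H a t p
  le t p p≤ with <-cmp t a
  ... | tri< h _ _ = subst₂ _≤_ (sym (hy≤ p h)) (sym (hy≤ p (<⇒≤ h))) (Row.le (row′ t) p p≤)
  ... | tri≈ _ refl _ = subst₂ _≤_ (sym (hy> p ≤-refl)) (sym (hy≤ p ≤-refl)) (join p p≤)
  ... | tri> _ _ h = subst₂ _≤_ (sym (hy> p (<-trans h ≤-refl))) (sym (hy> p h)) (Row.le (row t) p p≤)

 hy-off : ∀ {On z a a'} -> Stretch P On z a a' -> (∀ t -> On t -> ∀ p -> p ≢ z -> P′ t p ≡ P t p) -> ∀ t p -> t ≤ a ⊎ a' < t ⊎ p ≢ z -> H a' t p ≡ H a t p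
 hy-off {a = a} {a'} sr still = off
  where
  open Stretch sr
  off : ∀ t p -> t ≤ a ⊎ a' < t ⊎ p ≢ _ -> H a' t p ≡ H a t p
  off t p (inj₁ h) = trans (hy≤ p (≤-trans h (<⇒≤ a<a'))) (sym (hy≤ p h))
  off t p (inj₂ (inj₁ h)) = trans (hy> p h) (sym (hy> p (<-trans a<a' h)))
  off t p (inj₂ (inj₂ n)) with t ≤? a | t ≤? a'
  ... | yes h | _ = trans (hy≤ p (≤-trans h (<⇒≤ a<a'))) (sym (hy≤ p h))
  ... | no h | no h' = trans (hy> p (≰⇒> h')) (sym (hy> p (≰⇒> h)))
  ... | no h | yes h' = trans (trans (hy≤ p h') (still t (state t (≰⇒> h) h') p n)) (sym (hy> p (≰⇒> h)))

 hy-same : ∀ r -> (∀ t -> t ≤ r -> ∀ p -> P′ t p ≡ P t p) -> ∀ t p -> H r t p ≡ P t p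
 hy-same r same t p with t ≤? r
 ... | yes h = trans (hy≤ p h) (same t h p)
 ... | no h = hy> p (≰⇒> h)

hybrid : (P P′ : ℕ -> ℕ -> ℕ) -> ℕ -> ℕ -> ℕ -> ℕ
hybrid P P′ a t p = if Dec.does (t ≤? a) then P′ t p else P t p

hybrid-≤ : ∀ P P′ {a t} p -> t ≤ a -> hybrid P P′ a t p ≡ P′ t p
hybrid-≤ P P′ {a} {t} p h = if-yes (t ≤? a) h

hybrid-> : ∀ P P′ {a t} p -> a < t -> hybrid P P′ a t p ≡ P t p
hybrid-> P P′ {a} {t} p h = if-no (t ≤? a) (<⇒≱ h)

-- Left insertion on tiles

module _ {k : ℕ} {G M i j G' i₁ j₁} (dr : minDroop G M i j ≡ just (G' , i₁ , j₁)) where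

 stepL-jelb : ∀ {c} -> G' i₁ j₁ ≡ jelb -> i₁ ≤ k -> firstWhere (isRelbAt G' i₁) (range (suc j₁) (M ⊔ i₁ ⊔ j₁ + i₁)) ≡ just c ->
  stepL k (st G M i j) ≡ continue (st G' (M ⊔ i₁ ⊔ j₁) i₁ c)
 stepL-jelb e h e' rewrite dr | e | ≤ᵇ-true h | e' = refl

 stepL-bump : ∀ {p q r} -> G' i₁ j₁ ≡ bump -> rPipe G' (M ⊔ i₁ ⊔ j₁) i₁ j₁ ≡ just p -> wPipe G' (M ⊔ i₁ ⊔ j₁) i₁ j₁ ≡ just q ->
  exitRow G' (M ⊔ i₁ ⊔ j₁) p ≡ just r -> r ≤ k -> stepL k (st G M i j) ≡ continue (st G' (M ⊔ i₁ ⊔ j₁) i₁ j₁)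
 stepL-bump e a b c h rewrite dr | e | a | b | c | ≤ᵇ-true h = refl

 stepL-stop : ∀ {p q r} -> G' i₁ j₁ ≡ bump -> rPipe G' (M ⊔ i₁ ⊔ j₁) i₁ j₁ ≡ just p -> wPipe G' (M ⊔ i₁ ⊔ j₁) i₁ j₁ ≡ just q ->
  exitRow G' (M ⊔ i₁ ⊔ j₁) p ≡ just r -> k < r -> firstCrossing G' (M ⊔ i₁ ⊔ j₁) p q ≡ nothing ->
  stepL k (st G M i j) ≡ done (set G' i₁ j₁ cross) (M ⊔ i₁ ⊔ j₁)
 stepL-stop e a b c h d rewrite dr | e | a | b | c | ≤ᵇ-false h | d = refl

module LeftRun {l k x K b f : ℕ} (pos pos′ : ℕ -> ℕ -> ℕ) (H : ℕ -> ℕ -> ℕ -> ℕ) (s : ℕ -> LState)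
 (hy≤ : ∀ {a t} p -> t ≤ a -> H a t p ≡ pos′ t p) (hy> : ∀ {a t} p -> a < t -> H a t p ≡ pos t p)
 (row : ∀ t -> Row l (b + t) (wd K t) t (pos t) (pos (suc t))) (row′ : ∀ t -> Row l (suc b + t) (wd K t) t (pos′ t) (pos′ (suc t)))
 (rig : ∀ t -> k ≤ t -> Rigid t (pos t) (pos (suc t)))
 (valid : ∀ t -> LValid k (wd K t) t (pos t) (s t)) (step : ∀ t -> LStep k x t (pos t) (pos (suc t)) (s t) (s (suc t)))
 (moved : ∀ t -> LMoved (pos t) (pos′ t) (s t)) (dies : ∀ t -> suc f ≤ t -> ∃ \m -> ∃ \z -> s t ≡ dead m z)
 (k≤f : k ≤ f) (big : 2 + (b + f) ≤ K) (G₀ : Grid) where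

 open Hybrid pos pos′ H hy≤ hy> row row′

 f<K : suc f ≤ K
 f<K = ≤-trans (s≤s (m≤n+m f b)) (<⇒≤ big)

 data End (t z g : ℕ) : Set where
  hops : ∀ m' g' -> t < k -> Outside t (pos t) (pos (suc t)) (pos t z) -> First t (pos t) (pos (suc t)) g m' ->
   Gap (suc t) (pos (suc t)) (pos (suc t) m') g' -> s (suc t) ≡ mov m' g' -> End t z g
  ends : k ≤ t -> pos (suc t) t ≡ g -> s (suc t) ≡ dead z t -> End t z g

 cases : ∀ t {z g} -> s t ≡ mov z g -> (Inside t (pos t) (pos (suc t)) (pos t z) × s (suc t) ≡ mov z g) ⊎ End t z g
 cases t e with s t | s (suc t) in e' | step t
 cases t refl | _ | _ | l1 i = inj₁ (i , refl)
 cases t refl | _ | _ | l2 m' g' a b c d = inj₂ (hops m' g' a b c d e')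
 cases t refl | _ | _ | lf a b = inj₂ (ends a b e')

 lmove-at : ∀ {t z g} -> s t ≡ mov z g -> LMove (wd K t) t (pos t) z g
 lmove-at {t} e = subst (LValid k (wd K t) t (pos t)) e (valid t)

 lmoved-at : ∀ {t z g} -> s t ≡ mov z g -> pos′ t z ≡ g × (∀ p -> p ≢ z -> pos′ t p ≡ pos t p)
 lmoved-at {t} e with subst (LMoved (pos t) (pos′ t)) e (moved t)
 ... | mmov a b = a , b

 on≤ : ∀ {z g} t -> s t ≡ mov z g -> t ≤ f
 on≤ t e with t ≤? f
 ... | yes h = h
 ... | no h with _ , _ , e' ← dies t (≰⇒> h) with () ← trans (sym e') e

 Held : ℕ -> ℕ -> ℕ -> ℕ -> Set
 Held a a' z g = Stretch pos (\t -> s t ≡ mov z g) z a a'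

 -- During a run the part above the current turn has moved and the part below has not; these
 -- conditions make the two fit together. Pipes are displaced only to the right (`join`), and a
 -- displaced pipe is still weakly left of the turn of `z` (`away`).
 record Entry (a z g : ℕ) : Set where
  field
   state : s (suc a) ≡ mov z g
   hop : pos (suc a) z < pos a z
   keep : pos′ a z ≡ pos a z
   join : ∀ p -> p ≤ a -> pos a p ≤ pos′ a p
   away : ∀ p -> p ≤ a -> pos′ a p ≡ pos a p ⊎ pos′ a p ≤ pos (suc a) z

 module _ {a a' z g} (en : Entry a z g) (sr : Held a a' z g) (ed : End a' z g) where
  open Stretch sr
  private
   mv = lmove-at (Entry.state en)
   z≤ : z ≤ a
   z≤ = ≤-pred (LMove.m<r mv)
   module HG = HopGap (row a) z≤ (Entry.hop en) (LMove.gap mv)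

  can-droop : CanDroop K (H a) (H a') a a' z (pos (suc a) z) g
  can-droop = record
   { a<a' = a<a' ; z≤ = z≤ ; 1≤b = Row.lo (row a) z z≤ ; b<g = Gap.lt (LMove.gap mv)
   ; g<w = ≤-trans (s≤s HG.g≤b) (slack (≤-trans (s≤s (m≤m+n b f)) (<⇒≤ big)) a)
   ; old = \t h h' -> trans (hy> z h) (col t h h')
   ; new = \t h h' -> trans (hy≤ z h') (proj₁ (lmoved-at (state t h h')))
   ; off = hy-off sr (\t e -> proj₂ (lmoved-at e)) ; hop = lia "a-cb=dd=c;a-b 45402" (g , H a a z , pos a z , pos′ a z) (HG.g≤T , hy≤ {a} {a} z ≤-refl , Entry.keep en)
   ; free = \p p≤ e -> Gap.free (LMove.gap mv) p (s≤s p≤) (trans (sym (hy> p ≤-refl)) e)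
   ; fill = \j h h' -> let (p , p< , e) = Gap.fill (LMove.gap mv) j h h' in p , p< , trans (hy> p ≤-refl) e
   ; le = \p p≤ -> (lia "b=cd-ce-da=e;a-b 561234" (H a (suc a) p , H a a p , pos′ a p , pos a p , pos (suc a) p) (hy≤ {a} {a} p ≤-refl , Entry.join en p p≤ , Row.le (row a) p p≤ , hy> {a} {suc a} p ≤-refl))
   ; side = \p p≤ n -> (lia "a=ec=ff=gb<gd=he=ie-b|ljkihgb@;a-bc<dd=ab<aa<c&&|| 01024he31005hdb17000l005e0mb25l0f3a002p0af34hj0mb2e6ig0efh3eb0" (H a a p , pos (suc a) z , H a a z , H a (suc a) p , pos′ a p , pos′ a z , pos a z , pos (suc a) p , pos a p , p , z , l) (hy≤ {a} {a} p ≤-refl , hy≤ {a} {a} z ≤-refl , Entry.keep en , Entry.hop en , hy> {a} {suc a} p ≤-refl , Entry.away en p p≤ , Row.pair (row a) p z p≤ z≤ n))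
   ; mid = mid
   ; mid-free = \t p h h' p≤ e -> MoveFacts.free≤ (row t) (lmove-at (state t h (<⇒≤ h'))) p p≤ (trans (sym (hy> p h)) e)
   ; low = lia "c=bd-ca=d;a-b 45124" (H a (suc a') z , pos (suc a) z , pos a' z , pos (suc a') z) (col a' a<a' ≤-refl , Row.le (row a') z z≤' , hy> {a} {suc a'} z (<-trans a<a' ≤-refl))
   ; last = \p p≤ n -> last p p≤ n ed
   ; fill' = \j h h' -> let (p , p< , e) = Gap.fill (LMove.gap mv') j (subst (_< j) (sym (col a' a<a' ≤-refl)) h) h' in p , <-trans p< ≤-refl , trans (hy> p a<a') e }
   where
   mv' = lmove-at (state a' a<a' ≤-refl)
   z≤' : z ≤ a'
   z≤' = ≤-trans z≤ (<⇒≤ a<a')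
   mid : ∀ t -> a < t -> t < a' -> ∃ \u -> u ≤ t × H a (suc t) u < pos (suc a) z × g < H a t u
   mid t h h' with ins t h h'
   ... | u , u≤ , i₁ , i₂ = u , u≤ , (lia "c=bd<ca=d;a<b 45124" (H a (suc t) u , pos (suc a) z , pos t z , pos (suc t) u) (col t h (<⇒≤ h') , i₁ , hy> {a} {suc t} u (<-trans h ≤-refl))) ,
     (lia "b=cd<ce-df<dc-da<cg<h||ighcfde@;a<b 0147056003907025a178900271004g2ef285" (g , H a t u , pos t u , pos t z , pos (suc t) z , pos (suc t) u , u , z , l) (hy> {a} {t} u h , i₂ , Row.le (row t) z zt , i₁ , MoveFacts.low≤ (row t) mvt u u≤ , Row.pair (row t) u z u≤ zt u≢z))
    where
    mvt = lmove-at (state t h (<⇒≤ h'))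
    zt : z ≤ t
    zt = ≤-trans z≤ (<⇒≤ h)
    u≢z : u ≢ z
    u≢z refl = <-irrefl refl i₂
   last : ∀ p -> p ≤ a' -> p ≢ z -> End a' z g -> H a a' p < pos (suc a) z ⊎ (H a (suc a') p ≡ H a a' p × pos (suc a) z < H a a' p × H a a' p < g) ⊎ (g ≤ H a (suc a') p × g < H a a' p)
   last p p≤ n (hops m' g' _ out fst _ _) = lia "a=ef=bg-eh-fc=ge≠df-ge-f|e-gg-fd-g||kijegfh@;a<bc=ab<aa<d&&d-cd<a&|| 005gd18b000g00064h0a1004c05b0j3c016i01c3j4f0ac005d3cf0083h010i086j0c12i004e07d3d203h01004mj2h0a4h04i4h30i" (H a a' p , pos (suc a) z , H a (suc a') p , g , pos a' p , pos a' z , pos (suc a') p , pos (suc a') z , p , z , l) (hy> {a} {a'} p a<a' , col a' a<a' ≤-refl , Row.le (row a') p p≤ , Row.le (row a') z z≤' , hy> {a} {suc a'} p (<-trans a<a' ≤-refl) , MoveFacts.free≤ (row a') mv' p p≤ , out p p≤ , MoveFacts.no-start (row a') mv' p p≤ , Row.pair (row a') p z p≤ z≤' n)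
   last p p≤ n (ends k≤ e _) with p ≟ a'
   ... | yes refl = lia "d<ef=ea=fg=dc=g;a<bc=ab<aa<d&&d-cd<a&|| 09331049750" (H a p p , pos (suc a) z , H a (suc p) p , g , wd K p , pos p p , pos (suc p) p) (LMove.g<w mv' , Row.top (row p) , hy> {a} {p} p a<a' , e , hy> {a} {suc p} p (<-trans a<a' ≤-refl))
   ... | no n' = lia "a=ef=bg=eh-fc=ge≠dkijegfh@;a<bc=ab<aa<d&&d-cd<a&|| 005fc16a000f004fa704e08b005c3be00g5gb801073h023g10004li2g5lid3g" (H a a' p , pos (suc a) z , H a (suc a') p , g , pos a' p , pos a' z , pos (suc a') p , pos (suc a') z , p , z , l) (hy> {a} {a'} p a<a' , col a' a<a' ≤-refl , Rigid.upr (rig a' k≤) p (≤∧≢⇒< p≤ n') , Row.le (row a') z z≤' , hy> {a} {suc a'} p (<-trans a<a' ≤-refl) , MoveFacts.free≤ (row a') mv' p p≤ , Row.pair (row a') p z p≤ z≤' n)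

  join' : ∀ p -> p ≤ a' -> pos (suc a') p ≤ pos′ a' p
  join' p p≤ with p ≟ z
  ... | yes refl = lia "c<db=da-c;a-b 44031" (pos (suc a') p , pos′ a' p , pos a' p , g) (Gap.lt (LMove.gap (lmove-at (state a' a<a' ≤-refl))) , proj₁ (lmoved-at (state a' a<a' ≤-refl)) , Row.le (row a') p p≤)
  ... | no n = lia "b=ca-c;a-b 3301" (pos (suc a') p , pos′ a' p , pos a' p) (proj₂ (lmoved-at (state a' a<a' ≤-refl)) p n , Row.le (row a') p p≤)

  g≤K : g ≤ K
  g≤K = ≤-trans (≤-trans HG.g≤b (s≤s (+-monoʳ-≤ b (≤-trans (<⇒≤ a<a') (on≤ a' (state a' a<a' ≤-refl)))))) (<⇒≤ big)

 entry-hop : ∀ {t z g m' g'} -> s t ≡ mov z g -> Outside t (pos t) (pos (suc t)) (pos t z) -> First t (pos t) (pos (suc t)) g m' -> s (suc t) ≡ mov m' g' -> Entry t m' g'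
 entry-hop {t} {z} {g} {m'} {g'} e out (m'≤ , g≤ , hop , fst) e' = record { state = e' ; hop = hop ; keep = proj₂ (lmoved-at e) m' m'≢z ; join = join ; away = away }
  where
  mv = lmove-at e
  m'≢z : m' ≢ z
  m'≢z refl = clash "a<bb-cc-a; 3210" (pos t z , g , pos (suc t) z) (Gap.lt (LMove.gap mv) , g≤ , Row.le (row t) m' m'≤)
  join : ∀ p -> p ≤ t -> pos t p ≤ pos′ t p
  join p p≤ with p ≟ z
  ... | yes refl = lia "a<cb=c;a-b 3320" (pos t p , pos′ t p , g) (Gap.lt (LMove.gap mv) , proj₁ (lmoved-at e))
  ... | no n = ≤-reflexive (sym (proj₂ (lmoved-at e) p n))
  away : ∀ p -> p ≤ t -> pos′ t p ≡ pos t p ⊎ pos′ t p ≤ pos (suc t) m'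
  away p p≤ with p ≟ z
  ... | yes refl = inj₂ (subst (_≤ pos (suc t) m') (sym (proj₁ (lmoved-at e))) g≤)
  ... | no n = inj₁ (proj₂ (lmoved-at e) p n)

 Finishes : State -> Set
 Finishes c = ∃ \G -> ∃ \M -> Runs (stepL k) c (G , M) × Placed K G₀ pos′ G M

 stay-dead : ∀ {z e} -> s (suc e) ≡ dead z e -> ∀ t -> e < t -> s t ≡ dead z e
 stay-dead {z} {e} h (suc t) e<t with t ≟ e
 ... | yes refl = h
 ... | no n with s t | stay-dead h t (≤∧≢⇒< (≤-pred e<t) (≢-sym n)) | s (suc t) | step t
 ... | _ | refl | _ | ld = refl

 -- The grid realises the positions moved down to height `a` and the original ones below. A round
 -- performs one droop and increases `a`, which pays for the fuel.
 loop : ∀ n {G M} a z g -> f < n + suc a -> Entry a z g -> Placed K G₀ (H a) G M -> suc a ≤ M -> pos (suc a) z ≤ M ->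
  Finishes (st G M (suc a) (pos (suc a) z))
 loop zero {G} {M} a z g h en pl a≤ b≤ = ⊥-elim (<⇒≱ h (on≤ (suc a) (Entry.state en)))
 loop (suc n) {G} {M} a z g h en pl a≤ b≤ with Track.find pos pos′ row (\t e -> LMove.m<r (lmove-at e)) on≤ (\t -> cases t) (suc n) a h (Entry.state en)
 ... | a' , sr , ed with droop-step pl (can-droop en sr ed) a≤ b≤ (≤-trans (s≤s (on≤ a' (Stretch.state sr a' (Stretch.a<a' sr) ≤-refl))) f<K) (g≤K en sr ed)
 ... | G' , dr , pl' = go ed
  where
  open Stretch sr
  open Bounds M (suc a') g
  M' = M ⊔ suc a' ⊔ g
  fuel : f < n + suc a'
  fuel = ≤-trans h (≤-trans (≤-reflexive (sym (+-suc n (suc a)))) (+-monoʳ-≤ n (s≤s a<a')))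
  sz : s a' ≡ mov z g
  sz = state a' a<a' ≤-refl
  mv = lmove-at sz
  z≤ : z ≤ a'
  z≤ = <⇒≤ (LMove.m<r mv)
  sh : Shape K (H a')
  sh = hy-shape a' (join' en sr ed)
  tz : H a' a' z ≡ g
  tz = trans (hy≤ z ≤-refl) (proj₁ (lmoved-at sz))
  tp : ∀ p -> p ≢ z -> H a' a' p ≡ pos a' p
  tp p n = trans (hy≤ p ≤-refl) (proj₂ (lmoved-at sz) p n)
  bp : ∀ p -> H a' (suc a') p ≡ pos (suc a') p
  bp p = hy> p ≤-refl
  bz = lia "c<bd-ca=d;a<b 44123" (H a' (suc a') z , g , pos a' z , pos (suc a') z) (Gap.lt (LMove.gap mv) , Row.le (row a') z z≤ , bp z)
  go : End a' z g -> Finishes (st G M (suc a) (pos (suc a) z))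
  go (hops m' g' a'<k out fst@(m'≤ , g≤ , hop , least) gap e') with pos (suc a') m' ≟ g
  -- The turn of `m'` is in the landing cell, so this is a bump; `m'` leaves in row `m' + 1`, which
  -- is at most `k`.
  ... | yes refl = let (G₁ , M₁ , r , p) = loop n a' m' g' fuel en' pl' row≤ col≤ in
     G₁ , M₁ , next (stepL-bump {k} {G} {M} {suc a} {pos (suc a) z} dr is-bump! rpipe wpipe rexit (≤-trans (s≤s m'≤) a'<k)) r , p
   where
   en' = entry-hop sz out fst e'
   m'≢z : m' ≢ z
   m'≢z refl = <-irrefl (bp z) bz
   tm = lia "b=ca<c;a<b 3301" (pos (suc a') m' , H a' a' m' , pos a' m') (tp m' m'≢z , hop)
   open Bump pl' sh z≤ m'≤ tz bz (bp m') tm row≤ col≤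
  -- Otherwise the landing cell is a j-elbow, and the search to the right of it finds the turn of
  -- `m'`.
  ... | no n≢ = let (G₁ , M₁ , r , p) = loop n a' m' g' fuel en' pl' row≤ c≤ in
     G₁ , M₁ , next (stepL-jelb {k} {G} {M} {suc a} {pos (suc a) z} dr (jelb-at pl' z z≤ tz bz col≤ noS) a'<k found) r , p
   where
   c = pos (suc a') m'
   en' = entry-hop sz out fst e'
   m'≢z : m' ≢ z
   m'≢z refl = clash "a<bb-cc-a; 3210" (pos a' m' , g , pos (suc a') m') (Gap.lt (LMove.gap mv) , g≤ , Row.le (row a') m' m'≤)
   turn : ∀ p j -> Turns a' (H a' a') (H a' (suc a')) p j -> g ≤ j -> c ≤ j
   turn p j (p≤ , b , t) h with p ≟ z
   ... | yes refl = ⊥-elim (<⇒≱ bz (≤-trans h (≤-reflexive (sym b))))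
   ... | no n = lia "c-bb<de=bd=fe=gg<cf-ga-g||;a-b 0049630005960384b038" (pos (suc a') m' , j , g , H a' a' p , H a' (suc a') p , pos a' p , pos (suc a') p) (h , t , b , tp p n , bp p , least p p≤)
   noS : ∀ p -> Turns a' (H a' a') (H a' (suc a')) p g -> ⊥
   noS p tn = n≢ (≤-antisym (turn p g tn ≤-refl) g≤)
   c₁ : 1 ≤ c
   c₁ = Row.lo (row a') m' m'≤
   isr : G' (suc a') c ≡ relb
   isr = relb-at pl' a' c c₁ (≤-trans (s≤s (Row.bd (row a') m' m'≤)) (Row.bw (row a'))) m' (m'≤ , bp m' , <-≤-trans hop (≤-reflexive (sym (tp m' m'≢z)))) noN
    where
    noN : ∀ q -> q ≤ a' -> H a' (suc a') q < c -> H a' a' q ≢ c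
    noN q q≤ h e with q ≟ z | q ≟ m'
    ... | yes refl | _ = n≢ (trans (sym e) tz)
    ... | no n | yes refl = clash "a=ba<b; 210" (H a' (suc a') q , pos (suc a') q) (bp q , h)
    ... | no n | no n' = clash "a=bc-ba=dd<ehfgbced@; 00381400586417003db34db92" (H a' a' q , pos a' q , pos (suc a') q , pos (suc a') m' , pos a' m' , q , m' , l) (tp q n , Row.le (row a') q q≤ , e , hop , Row.pair (row a') q m' q≤ m'≤ n')
   c≤ : c ≤ M'
   c≤ = relb-in pl' a' c c₁ row≤ isr
   found : firstWhere (isRelbAt G' (suc a')) (range (suc g) (M' + suc a')) ≡ just c
   found = firstWhere-range (isRelbAt G' (suc a')) (suc g) (M' + suc a') c (≤∧≢⇒< g≤ (≢-sym n≢))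
    (s≤s (≤-trans c≤ (≤-trans (m≤m+n M' (suc a')) (m≤n+m (M' + suc a') g))))
    (\j h h' -> no-relb pl' a' j (≤-trans (s≤s z≤n) h) row≤ (\p tn -> <⇒≱ h' (turn p j tn (<⇒≤ h))))
    (cong isRelb isr)
  go (ends k≤ e e') = set G' (suc a') g cross , M' , stop (stepL-stop {k} {G} {M} {suc a} {pos (suc a) z} dr is-bump! rpipe wpipe rexit (s≤s k≤) nocross) ,
    uncross pl' z≤ ≤-refl tz (trans (bp a') e) bz ta (\t h p -> sym (hy≤ p h)) swapped row≤ col≤
   where
   a'≢z : a' ≢ z
   a'≢z e = <⇒≢ (LMove.m<r mv) (sym e)
   ta : g < H a' a' a'
   ta = lia "a<cd=cb=d;a<b 45420" (g , H a' a' a' , wd K a' , pos a' a') (LMove.g<w mv , Row.top (row a') , tp a' a'≢z)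
   open Bump pl' sh z≤ ≤-refl tz bz (trans (bp a') e) ta row≤ col≤
   swapped : ∀ t -> a' < t -> Swapped (H a') pos′ z a' t
   swapped t h with subst (LMoved (pos t) (pos′ t)) (stay-dead e' t h) (moved t)
   ... | mdead p q r = trans p (sym (hy> a' h)) , trans q (sym (hy> z h)) , (\o n n' -> trans (r o n n') (sym (hy> o h)))
   -- Both pipes are present only from row `a' + 1` on. There they bump, and in all later rows both
   -- are vertical.
   nocross : firstCrossing G' M' (H a' M' a') (H a' M' z) ≡ nothing
   nocross = first-crossing-none row≤ (≤-trans (s≤s z≤) row≤) none!
    where
    none! : ∀ i j -> Crossing a' z i j -> ⊥
    none! zero j (_ , (_ , ()) , _)
    none! (suc t) j cr with crossing-kinds a'≢z cr
    ... | (a'≤ , z≤' , _) , kinds with t ≟ a'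
    ... | yes refl = clash "a=bc=bd=cd<ee<fg=ea=e&&&g<ee<ad=ef=e&&&|; 005c97505c9734" (H t t z , g , pos (suc t) t , H t (suc t) t , j , H t t t , H t (suc t) z) (tz , e , bp a' , kinds)
    ... | no n = clash "a=bc=de=bf=dg=eh=fh<ii<cg=ia=i&&&g<ii<ah=ic=i&&&|; 005gb7545id954" (H a' t z , pos t z , H a' t a' , pos t a' , pos (suc t) z , pos (suc t) a' , H a' (suc t) z , H a' (suc t) a' , j) (hy> {a'} {t} z (≤∧≢⇒< a'≤ (≢-sym n)) , hy> {a'} {t} a' (≤∧≢⇒< a'≤ (≢-sym n)) , Rigid.upr (rig t (≤-trans k≤ a'≤)) z (≤-trans (LMove.m<r mv) a'≤) , Rigid.upr (rig t (≤-trans k≤ a'≤)) a' (≤∧≢⇒< a'≤ (≢-sym n)) , hy> {a'} {suc t} z (s≤s a'≤) , hy> {a'} {suc t} a' (s≤s a'≤) , kinds)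

 starts : s 0 ≡ none -> ∀ t -> t < x -> s t ≡ none
 starts h zero t< = h
 starts h (suc t) t< with s t | starts h t (<-trans ≤-refl t<) | s (suc t) | step t
 ... | _ | refl | _ | ln _ = refl
 ... | _ | refl | _ | ls _ _ e _ _ = ⊥-elim (<⇒≢ t< e)

 insert : s 0 ≡ none -> 1 ≤ x -> x ≤ k -> ∀ {G M} -> Placed K G₀ pos G M -> ∃ \out -> LeftIns x k (G , M) out × Placed K G₀ pos′ (proj₁ out) (proj₂ out)
 insert h₀ (s≤s {n = r} _) x≤ {G} {M} pl with s r in er | starts h₀ r ≤-refl | s (suc r) in e | step r
 ... | _ | refl | _ | ln n = ⊥-elim (n refl)
 ... | _ | refl | _ | ls m g _ (m≤ , _ , hop , least) gap = (G₁ , M₁) , (c , found , runs) , placed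
  where
  c = pos (suc r) m
  same : ∀ t -> t ≤ r -> ∀ p -> pos′ t p ≡ pos t p
  same t h p with subst (LMoved (pos t) (pos′ t)) (starts h₀ t (s≤s h)) (moved t)
  ... | mnone eq = eq p
  M' = M ⊔ suc r
  pl' : Placed K G₀ pos G M'
  pl' = place-⊔ pl (suc r) (≤-trans x≤ (≤-trans k≤f (<⇒≤ f<K)))
  r< : suc r ≤ M'
  r< = m≤n⊔m M (suc r)
  c₁ : 1 ≤ c
  c₁ = Row.lo (row r) m m≤
  isr : G (suc r) c ≡ relb
  isr = relb-at pl' r c c₁ (≤-trans (s≤s (Row.bd (row r) m m≤)) (Row.bw (row r))) m (m≤ , refl , hop) noN
   where
   noN : ∀ q -> q ≤ r -> pos (suc r) q < c -> pos r q ≢ c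
   noN q q≤ h e with q ≟ m
   ... | yes refl = <-irrefl refl h
   ... | no n = clash "a-bb=cc<dgefbadc@; 002410047641002b33b92" (pos (suc r) q , pos r q , pos (suc r) m , pos r m , q , m , l) (Row.le (row r) q q≤ , e , hop , Row.pair (row r) q m q≤ m≤ n)
  c≤ : c ≤ M'
  c≤ = relb-in pl' r c c₁ r< isr
  found : firstWhere (isRelbAt G (suc r)) (range 1 (M + suc r)) ≡ just c
  found = firstWhere-range (isRelbAt G (suc r)) 1 (M + suc r) c c₁ (s≤s (≤-trans c≤ (m⊔n≤m+n M (suc r))))
   (\j j₁ j< -> no-relb pl' r j j₁ r< (noT j j<)) (cong isRelb isr)
   where
   noT : ∀ j -> j < pos (suc r) m -> ∀ p -> Turns r (pos r) (pos (suc r)) p j -> ⊥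
   noT j j< p (p≤ , b , t) = clash "a<bc=aa<d`-cc<`b-cd-c||; 00440250037063640" (j , pos r p , pos (suc r) p , pos (suc r) m) (t , b , j< , z≤n , least p p≤)
  res = loop (suc f) r m g (s≤s (m≤m+n f (suc r)))
   (record { state = e ; hop = hop ; keep = same r ≤-refl m ; join = \p _ -> ≤-reflexive (sym (same r ≤-refl p)) ; away = \p _ -> inj₁ (same r ≤-refl p) })
   (place-ext pl' (H r) (hy-same r same)) r< c≤
  G₁ = proj₁ res
  M₁ = proj₁ (proj₂ res)
  runs = proj₁ (proj₂ (proj₂ res))
  placed = proj₂ (proj₂ (proj₂ res))

left-insertion : ∀ {l k K b f} (W : World l k K b f) (b<K : b < K) (l≤k : l ≤ k) (k≤f : k ≤ f) {x} (x≤k : x ≤ k) (run : LRun k K x (World.pos W)) ->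
 1 ≤ x -> 2 + (b + f) ≤ K -> ∀ {G₀ G M} -> Placed K G₀ (World.pos W) G M ->
 ∃ \out -> LeftIns x k (G , M) out × Placed K G₀ (LChain.pos′ W b<K l≤k k≤f x≤k run) (proj₁ out) (proj₂ out)
left-insertion W b<K l≤k k≤f x≤k run 1≤x big {G₀} = LeftRun.insert pos pos′ (hybrid pos pos′) st′ (hybrid-≤ pos pos′) (hybrid-> pos pos′)
 row row′ rig valid step moved (dies 1≤x) k≤f big G₀ start 1≤x x≤k
 where
 open World W
 open LChain W b<K l≤k k≤f x≤k run

-- Right insertion on tiles

module _ {l w z tw bw tz bz} (ap : Apart l w z tw bw tz bz) (w≤ : bw ≤ tw) (z≤ : bz ≤ tz) where

 Cross! : ℕ -> Set
 Cross! j = (bw < j × j < tw × bz ≡ j × tz ≡ j) ⊎ (bz < j × j < tz × bw ≡ j × tw ≡ j)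

 red-uncrossed : ∀ j -> w < l -> z < l -> Cross! j -> ⊥
 red-uncrossed j h h' c = clash "a<bc<bd<ee<fg=eh=e&&&g<ee<hd=ef=e&&&|bcafdhg@; 01063615003831002h42g4063721003716002h42g4" (z , l , w , bw , j , tw , bz , tz) (h' , h , c , ap)

 -- As `z < w`, the vertical pipe of a crossing could only be `z`, and then `w` would start to the
 -- left of it.
 right-uncrossed : ∀ j -> z < w -> bz < bw -> Cross! j -> ⊥
 right-uncrossed j h h' c = clash "a<bc<dd<ee<fc=eg=e&&&c<ee<gd=ef=e&&&|hbafdgc@; 013852063721003716002h53c29" (z , w , bz , bw , j , tw , tz , l) (h , h' , c , ap)

 left-uncrossed : ∀ j -> z < w -> tw < tz -> Cross! j -> ⊥
 left-uncrossed j h h' c = clash "a<bc<de<ff<cg=fd=f&&&g<ff<de=fc=f&&&|hbacedg@; 013814063721004b163002h52g2" (z , w , tw , tz , bw , j , bz , l) (h , h' , c , ap)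

 vertical-column : ∀ j -> bw < tw -> Cross! j -> j ≡ bz
 vertical-column j h c = lia "c<dc<aa<db=ae=a&&&b<aa<ec=ad=a&&&|;a=b 00082402303712" (j , bz , bw , tw , tz) (h , c)

 right-up : z < w -> bz < bw -> tz < tw
 right-up h h' = lia "c<de<ff-bgdcbfae@;a<b 003431003714002b52c2" (tz , tw , z , w , bz , bw , l) (h , h' , w≤ , ap)

 left-down : z < w -> tw < tz -> bw < bz
 left-down h h' = lia "c<de<fa-egdceafb@;a<b 003631003514002b52a2" (bw , bz , z , w , tw , tz , l) (h , h' , w≤ , ap)

module _ {k : ℕ} {G M i j G' i₁ j₁} (dr : minDroop G M i j ≡ just (G' , i₁ , j₁)) where

 stepR-jelb : ∀ {c} -> G' i₁ j₁ ≡ jelb -> lastWhere (isRelbAt G' i₁) (range 1 (j₁ ∸ 1)) ≡ just c ->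
  stepR k (st G M i j) ≡ continue (st G' (M ⊔ i₁ ⊔ j₁) i₁ c)
 stepR-jelb e e' rewrite dr | e | e' = refl

 module _ {p q} (e : G' i₁ j₁ ≡ bump) (a : rPipe G' (M ⊔ i₁ ⊔ j₁) i₁ j₁ ≡ just p) (b : wPipe G' (M ⊔ i₁ ⊔ j₁) i₁ j₁ ≡ just q) where

  stepR-swap : ∀ {a' b'} -> firstCrossing G' (M ⊔ i₁ ⊔ j₁) p q ≡ just (a' , b') ->
   stepR k (st G M i j) ≡ continue (st (swapAt G' i₁ j₁ a' b') (M ⊔ i₁ ⊔ j₁) a' b')
  stepR-swap c rewrite dr | e | a | b | c = refl

  stepR-bump : ∀ {r} -> firstCrossing G' (M ⊔ i₁ ⊔ j₁) p q ≡ nothing -> exitRow G' (M ⊔ i₁ ⊔ j₁) p ≡ just r -> r ≤ k ->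
   stepR k (st G M i j) ≡ continue (st G' (M ⊔ i₁ ⊔ j₁) i₁ j₁)
  stepR-bump c d h rewrite dr | e | a | b | c | d | ≤ᵇ-true h = refl

  stepR-stop : ∀ {r} -> firstCrossing G' (M ⊔ i₁ ⊔ j₁) p q ≡ nothing -> exitRow G' (M ⊔ i₁ ⊔ j₁) p ≡ just r -> k < r ->
   stepR k (st G M i j) ≡ done (set G' i₁ j₁ cross) (M ⊔ i₁ ⊔ j₁)
  stepR-stop c d h rewrite dr | e | a | b | c | d | ≤ᵇ-false h = refl

module RightRun {l y K b f : ℕ} (pos pos′ : ℕ -> ℕ -> ℕ) (H : ℕ -> ℕ -> ℕ -> ℕ) (s : ℕ -> RState)
 (hy≤ : ∀ {a t} p -> t ≤ a -> H a t p ≡ pos′ t p) (hy> : ∀ {a t} p -> a < t -> H a t p ≡ pos t p)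
 (row : ∀ t -> Row l (b + t) (wd K t) t (pos t) (pos (suc t))) (row′ : ∀ t -> Row l (suc b + t) (wd K t) t (pos′ t) (pos′ (suc t)))
 (valid : ∀ t -> RValid l (wd K t) t (pos t) (s t)) (step : ∀ t -> RStep l y t (pos t) (pos (suc t)) (s t) (s (suc t)))
 (moved : ∀ t -> RMoved (pos t) (pos′ t) (s t)) (waits : ∀ t -> suc f ≤ t -> ∃ \q -> ∃ \z -> s t ≡ wait q z)
 (big : 2 + (b + f) ≤ K) (G₀ : Grid) where

 open Hybrid pos pos′ H hy≤ hy> row row′

 f<K : suc f ≤ K
 f<K = ≤-trans (s≤s (m≤n+m f b)) (<⇒≤ big)

 act-at : ∀ {t z} -> s t ≡ act z -> RAct l (wd K t) t (pos t) z
 act-at {t} e = subst (RValid l (wd K t) t (pos t)) e (valid t)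

 acted-at : ∀ {t z} -> s t ≡ act z -> pos′ t z ≡ suc (pos t z) × (∀ p -> p ≢ z -> pos′ t p ≡ pos t p)
 acted-at {t} e with subst (RMoved (pos t) (pos′ t)) e (moved t)
 ... | mact a b = a , b

 wait-at : ∀ {t q z} -> s t ≡ wait q z -> RWait l t (pos t) q z
 wait-at {t} e = subst (RValid l (wd K t) t (pos t)) e (valid t)

 waited-at : ∀ {t q z} -> s t ≡ wait q z -> Swapped pos pos′ q z t
 waited-at {t} e with subst (RMoved (pos t) (pos′ t)) e (moved t)
 ... | mwait a b c = a , b , c

 act≤f : ∀ {t z} -> s t ≡ act z -> t ≤ f
 act≤f {t} e with t ≤? f
 ... | yes h = h
 ... | no h with _ , _ , e' ← waits t (≰⇒> h) with () ← trans (sym e') e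

 data End (t z : ℕ) : Set where
  turns : (∀ p -> p ≤ t -> pos (suc t) p ≢ suc (pos t z)) -> s (suc t) ≡ act z -> End t z
  bumps : ∀ w -> w ≤ t -> pos (suc t) w ≡ suc (pos t z) -> (w < l × s (suc t) ≡ act w) ⊎ (l ≤ w × s (suc t) ≡ wait z w) -> End t z

 -- Pipe `w` turns in the cell just right of column `T z`, so no pipe can run across that column
 -- into it. Hence the droop of `z` lands in this row.
 bumped : ∀ t {z} -> s t ≡ act z -> ∀ w -> w ≤ t -> pos (suc t) w ≡ suc (pos t z) -> Outside t (pos t) (pos (suc t)) (pos t z)
 bumped t {z} e w w≤ bw u u≤ with u ≟ w
 ... | yes refl = lia "b=1a;a-bc-a| 230" (pos t z , pos (suc t) w , pos t w) bw
 ... | no n = lia "d-ed=1ae≠1ahfgcbed@;a-bc-a| 013503013816005731a6004fb303c80" (pos t z , pos (suc t) u , pos t u , pos (suc t) w , pos t w , u , w , l) (Row.le (row t) w w≤ , bw , ActFacts.free≤ (row t) (act-at e) w w≤ , Row.pair (row t) u w u≤ w≤ n)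

 cases : ∀ t {z} -> s t ≡ act z -> (Inside t (pos t) (pos (suc t)) (pos t z) × s (suc t) ≡ act z) ⊎ (Outside t (pos t) (pos (suc t)) (pos t z) × End t z)
 cases t {z} e with s t in e₀ | s (suc t) in e' | step t
 cases t {z} refl | _ | _ | ra h with inside? t (pos t) (pos (suc t)) (pos t z)
 ... | inj₁ i = inj₁ (i , refl)
 ... | inj₂ o = inj₂ (o , turns h e')
 cases t {z} refl | _ | _ | rb w w≤ bw red = inj₂ (bumped t e₀ w w≤ bw , bumps w w≤ bw (inj₁ (red , e')))
 cases t {z} refl | _ | _ | rc w w≤ bw blue = inj₂ (bumped t e₀ w w≤ bw , bumps w w≤ bw (inj₂ (blue , e')))

 Held : ℕ -> ℕ -> ℕ -> Set
 Held a a' z = Stretch pos (\t -> s t ≡ act z) z a a'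

 record Entry (a z : ℕ) : Set where
  field
   state : s (suc a) ≡ act z
   hop : pos (suc a) z < pos′ a z
   join : ∀ p -> p ≤ a -> pos (suc a) p ≤ pos′ a p
   side : ∀ p -> p ≤ a -> p ≢ z -> pos′ a p ≤ pos (suc a) z ⊎ pos′ a z < pos (suc a) p ⊎ (pos (suc a) p ≡ pos′ a p × pos (suc a) z < pos′ a p × pos′ a p < pos′ a z)

 module _ {a a' z} (en : Entry a z) (sr : Held a a' z) (out : Outside a' (pos a') (pos (suc a')) (pos a' z)) where
  open Stretch sr
  private
   ac = act-at (Entry.state en)
   z≤ : z ≤ a
   z≤ = ≤-pred (RAct.q<r ac)

  can-droop : CanDroop K (H a) (H a') a a' z (pos (suc a) z) (suc (pos (suc a) z))
  can-droop = record
   { a<a' = a<a' ; z≤ = z≤ ; 1≤b = Row.lo (row a) z z≤ ; b<g = ≤-refl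
   ; g<w = ≤-trans (s≤s (s≤s (Row.bd (row a) z z≤))) (slack (≤-trans (s≤s (m≤m+n b f)) (<⇒≤ big)) a)
   ; old = \t h h' -> trans (hy> z h) (col t h h')
   ; new = \t h h' -> trans (hy≤ z h') (trans (proj₁ (acted-at (state t h h'))) (cong suc (col t h h')))
   ; off = hy-off sr (\t e -> proj₂ (acted-at e)) ; hop = subst (pos (suc a) z <_) (sym (hy≤ z ≤-refl)) (Entry.hop en)
   ; free = \p p≤ e -> RAct.free ac p (s≤s p≤) (trans (sym (hy> p ≤-refl)) e)
   ; fill = \j h h' -> ⊥-elim (<⇒≱ h' h)
   ; le = \p p≤ -> subst₂ _≤_ (sym (hy> p ≤-refl)) (sym (hy≤ p ≤-refl)) (Entry.join en p p≤)
   ; side = \p p≤ n -> (lia "a=ec=fd=ge-bf<gg=eb<ee<f&&||;a-bc<dd=ab<aa<c&&|| 003a70004a6030c00480d44c095002g08952a0d48" (H a a p , pos (suc a) z , H a a z , H a (suc a) p , pos′ a p , pos′ a z , pos (suc a) p) (hy≤ {a} {a} p ≤-refl , hy≤ {a} {a} z ≤-refl , hy> {a} {suc a} p ≤-refl , Entry.side en p p≤ n))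
   ; mid = mid
   ; mid-free = \t p h h' p≤ e -> ActFacts.free≤ (row t) (act-at (state t h (<⇒≤ h'))) p p≤ (trans (sym (hy> p h)) (trans e (cong suc (sym (col t h (<⇒≤ h'))))))
   ; low = lia "c=bd-ca=d;a-b 45124" (H a (suc a') z , pos (suc a) z , pos a' z , pos (suc a') z) (col a' a<a' ≤-refl , Row.le (row a') z z≤' , hy> {a} {suc a'} z (<-trans a<a' ≤-refl))
   ; last = \p p≤ n -> (lia "a=de=bf-dg-ec=fd≠1ee-fd-e|jhidfeg@;a<bc=ab<aa<1b&&b<c1b<a&|| 005fc17a000e470b2065c3b0d4c0e1004li2g0a4g30h0a4h05i4h10i" (H a a' p , pos (suc a) z , H a (suc a') p , pos a' p , pos a' z , pos (suc a') p , pos (suc a') z , p , z , l) (hy> {a} {a'} p a<a' , col a' a<a' ≤-refl , Row.le (row a') p p≤ , Row.le (row a') z z≤' , hy> {a} {suc a'} p (<-trans a<a' ≤-refl) , ActFacts.free≤ (row a') ac' p p≤ , out p p≤ , Row.pair (row a') p z p≤ z≤' n))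
   ; fill' = \j h h' -> ⊥-elim (<⇒≱ h' h) }
   where
   ac' = act-at (state a' a<a' ≤-refl)
   z≤' : z ≤ a'
   z≤' = ≤-trans z≤ (<⇒≤ a<a')
   mid : ∀ t -> a < t -> t < a' -> ∃ \u -> u ≤ t × H a (suc t) u < pos (suc a) z × suc (pos (suc a) z) < H a t u
   mid t h h' with ins t h h'
   ... | u , u≤ , i₁ , i₂ = u , u≤ , (lia "c=bd<ca=d;a<b 45124" (H a (suc t) u , pos (suc a) z , pos t z , pos (suc t) u) (col t h (<⇒≤ h') , i₁ , hy> {a} {suc t} u (<-trans h ≤-refl))) ,
     (lia "b=cd<cd=ac≠1d;1a<b 004604547205" (pos (suc a) z , H a t u , pos t u , pos t z) (hy> {a} {t} u h , i₂ , col t h (<⇒≤ h') , ActFacts.free≤ (row t) (act-at (state t h (<⇒≤ h'))) u u≤))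

  g≤K : suc (pos (suc a) z) ≤ K
  g≤K = ≤-trans (s≤s (Row.bd (row a) z z≤)) (≤-trans (s≤s (+-monoʳ-≤ b (≤-trans (<⇒≤ a<a') (act≤f (state a' a<a' ≤-refl))))) (<⇒≤ big))

 join-act : ∀ {t z} -> s t ≡ act z -> ∀ p -> p ≤ t -> pos (suc t) p ≤ pos′ t p
 join-act {t} {z} e p p≤ with p ≟ z
 ... | yes refl = lia "b=1ca-c;a-b 3301" (pos (suc t) z , pos′ t z , pos t z) (proj₁ (acted-at e) , Row.le (row t) p p≤)
 ... | no ne = lia "b=ca-c;a-b 3301" (pos (suc t) p , pos′ t p , pos t p) (proj₂ (acted-at e) p ne , Row.le (row t) p p≤)

 Finishes : State -> Set
 Finishes c = ∃ \G -> ∃ \M -> Runs (stepR l) c (G , M) × Placed K G₀ pos′ G M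

 -- Decides between cross-bump-swap and the final cross: the pipe `z` on the move and the pipe `w`
 -- it bumped into cross in a later row, or never.
 data Fate (e z w : ℕ) : Set where
  meets : ∀ e' -> e < e' -> (∀ t -> e < t -> t ≤ e' -> s t ≡ wait z w) -> pos (suc e') w < pos (suc e') z -> s (suc e') ≡ act z -> Fate e z w
  never : (∀ t -> e < t -> s t ≡ wait z w) -> Fate e z w

 -- Past row `f` no pipe moves any more, so a pair that is still waiting then waits forever; this
 -- bounds the search.
 fate : ∀ {e z w} n t -> f < n + t -> e < t -> (∀ t' -> e < t' -> t' ≤ t -> s t' ≡ wait z w) -> Fate e z w
 fate {e} {z} {w} zero t f<t e<t st! = never on
  where
  on : ∀ t' -> e < t' -> s t' ≡ wait z w
  on (suc t') h with suc t' ≤? t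
  ... | yes h' = st! (suc t') h h'
  ... | no h' with s t' | on t' (≤-trans e<t (≤-pred (≰⇒> h'))) | s (suc t') in e₁ | step t'
  ... | _ | refl | _ | ww _ = refl
  ... | _ | refl | _ | wx _ = ⊥-elim (<⇒≱ (≤-trans f<t (<⇒≤ (≰⇒> h'))) (act≤f e₁))
 fate {e} {z} {w} (suc n) t h e<t st! with s t | st! t e<t ≤-refl | s (suc t) in e₁ | step t
 ... | _ | refl | _ | wx lt = meets t e<t st! lt e₁
 ... | _ | refl | _ | ww lt = fate n (suc t) (subst (f <_) (sym (+-suc n t)) h) (<-trans e<t ≤-refl) more
  where
  more : ∀ t' -> e < t' -> t' ≤ suc t -> s t' ≡ wait z w
  more t' a b with t' ≟ suc t
  ... | yes refl = e₁
  ... | no ne = st! t' a (≤-pred (≤∧≢⇒< b ne))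

 -- A round consists of a droop and, after a bump with a pipe crossed later, of the swap to that
 -- crossing. Since the crossing lies further down, the height increases in either case.
 loop : ∀ n {G M} a z -> f < n + suc a -> Entry a z -> Placed K G₀ (H a) G M -> suc a ≤ M -> pos (suc a) z ≤ M ->
  Finishes (st G M (suc a) (pos (suc a) z))
 loop zero a z h en pl a≤ b≤ = ⊥-elim (<⇒≱ h (act≤f (Entry.state en)))
 loop (suc n) {G} {M} a z h en pl a≤ b≤ with Track.find pos pos′ row (\t e -> RAct.q<r (act-at e)) (\t -> act≤f) (\t -> cases t) (suc n) a h (Entry.state en)
 ... | a' , sr , out , ed with droop-step pl (can-droop en sr out) a≤ b≤ (≤-trans (s≤s (act≤f (Stretch.state sr a' (Stretch.a<a' sr) ≤-refl))) f<K) (g≤K en sr out)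
 ... | G' , dr , pl' = go ed
  where
  open Stretch sr
  g = suc (pos (suc a) z)
  M' = M ⊔ suc a' ⊔ g
  open Bounds M (suc a') g
  fuel : ∀ {e} -> a < e -> f < n + suc e
  fuel a<e = ≤-trans h (≤-trans (≤-reflexive (sym (+-suc n (suc a)))) (+-monoʳ-≤ n (s≤s a<e)))
  sz : s a' ≡ act z
  sz = state a' a<a' ≤-refl
  z≤ : z ≤ a'
  z≤ = <⇒≤ (RAct.q<r (act-at sz))
  cz : pos a' z ≡ pos (suc a) z
  cz = col a' a<a' ≤-refl
  nz : pos′ a' z ≡ suc (pos a' z)
  nz = proj₁ (acted-at sz)
  np : ∀ p -> p ≢ z -> pos′ a' p ≡ pos a' p
  np = proj₂ (acted-at sz)
  join' = join-act sz
  sh : Shape K (H a')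
  sh = hy-shape a' join'
  tz = lia "c=1da=cd=b;a=1b 064530146204" (H a' a' z , pos (suc a) z , pos′ a' z , pos a' z) (nz , hy≤ {a'} {a'} z ≤-refl , cz)
  tp : ∀ p -> p ≢ z -> H a' a' p ≡ pos a' p
  tp p ne = trans (hy≤ p ≤-refl) (np p ne)
  bp : ∀ p -> H a' (suc a') p ≡ pos (suc a') p
  bp p = hy> p ≤-refl
  bz = lia "c=bd-ca=d;a<1b 45124" (H a' (suc a') z , pos (suc a) z , pos a' z , pos (suc a') z) (cz , Row.le (row a') z z≤ , bp z)
  go : End a' z -> Finishes (st G M (suc a) (pos (suc a) z))
  go (turns nb e') = let (G₁ , M₁ , r , p) = loop n a' z (fuel a<a') en' pl' row≤ c≤ in
    G₁ , M₁ , next (stepR-jelb {l} {G} {M} {suc a} {pos (suc a) z} dr (jelb-at pl' z z≤ tz bz col≤ (\p tn -> nb p (proj₁ tn) (lia "b=cd=1cd=a;a=1b 064632045014" (pos (suc a') p , pos a' z , pos (suc a) z , H a' (suc a') p) (cz , proj₁ (proj₂ tn) , bp p)))) found) r , p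
   where
   en' : Entry a' z
   en' = record { state = e' ; hop = (lia "b=1ca-c;a<b 3301" (pos (suc a') z , pos′ a' z , pos a' z) (nz , Row.le (row a') z z≤)) ; join = join'
    ; side = \p p≤ ne -> (lia "c=1ea=fd≠1ee-df-e|ighfdeb@;a-bc<dd=ab<aa<c&&|| 02013c7100231000g003f203e03002k0634g0f20a2404je013970" (pos′ a' p , pos (suc a') z , pos′ a' z , pos (suc a') p , pos a' z , pos a' p , p , z , l) (nz , np p ne , nb p p≤ , out p p≤ , Row.pair (row a') p z p≤ z≤ ne)) }
   c₁ : 1 ≤ pos (suc a') z
   c₁ = Row.lo (row a') z z≤
   isr : G' (suc a') (pos (suc a') z) ≡ relb
   isr = relb-at pl' a' (pos (suc a') z) c₁ (≤-trans (s≤s (Row.bd (row a') z z≤)) (Row.bw (row a'))) z (z≤ , bp z , (lia "b=1cd<1cd=a;a<b 45023" (pos (suc a') z , H a' a' z , pos (suc a) z , H a' (suc a') z) (tz , bz , bp z))) noN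
    where
    noN : ∀ q -> q ≤ a' -> H a' (suc a') q < pos (suc a') z -> H a' a' q ≢ pos (suc a') z
    noN q q≤ h e with q ≟ z
    ... | yes refl = clash "a=ba<b; 210" (H a' (suc a') q , pos (suc a') q) (bp q , h)
    ... | no ne = clash "a=bc-bd-ea=dhfgbced@; 00381300561785003da34b2da" (H a' a' q , pos a' q , pos (suc a') q , pos (suc a') z , pos a' z , q , z , l) (tp q ne , Row.le (row a') q q≤ , Row.le (row a') z z≤ , e , Row.pair (row a') q z q≤ z≤ ne)
   c≤ : pos (suc a') z ≤ M'
   c≤ = relb-in pl' a' (pos (suc a') z) c₁ row≤ isr
   -- The droop moved `z` by one column, so the search left of the landing cell ends in the old
   -- column of `z`.
   found : lastWhere (isRelbAt G' (suc a')) (range 1 (pos (suc a) z)) ≡ just (pos (suc a') z)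
   found = lastWhere-range (isRelbAt G' (suc a')) (pos (suc a) z) (pos (suc a') z) c₁ (lia "c=ba-c;a-b 3302" (pos (suc a') z , pos (suc a) z , pos a' z) (cz , Row.le (row a') z z≤)) (cong isRelb isr)
     (\j h h' -> no-relb pl' a' j (≤-trans c₁ (<⇒≤ h)) row≤ (noT j h h'))
    where
    noT : ∀ j -> pos (suc a') z < j -> j ≤ pos (suc a) z -> ∀ p -> Turns a' (H a' a') (H a' (suc a')) p j -> ⊥
    noT j h h' p (p≤ , b , t) with p ≟ z
    ... | yes refl = clash "a<bc=bc=a; 3421" (pos (suc a') p , j , H a' (suc a') p) (h , b , bp p)
    ... | no ne = clash "a<ba-cd<ae=ab=fg=ce=hkijfhgd@; 004d81b005d614b005je09g5fa30h" (j , H a' a' p , pos (suc a) z , pos (suc a') z , H a' (suc a') p , pos a' p , pos a' z , pos (suc a') p , p , z , l) (t , h' , h , b , tp p ne , cz , bp p , Row.pair (row a') p z p≤ z≤ ne)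
  go (bumps w w≤ bw fin) = finish fin
   where
   w≢z : w ≢ z
   w≢z refl = clash "a-ba=1b; 220" (pos (suc a') z , pos a' z) (Row.le (row a') w w≤ , bw)
   tw = lia "b=cd=ae=1de-cc≠1d;1a<b 0058032749507" (pos (suc a) z , H a' a' w , pos a' w , pos a' z , pos (suc a') w) (tp w w≢z , cz , bw , Row.le (row a') w w≤ , ActFacts.free≤ (row a') (act-at sz) w w≤)
   bw' = lia "c=bd=1ca=d;a=1b 064531046024" (H a' (suc a') w , pos (suc a) z , pos a' z , pos (suc a') w) (cz , bw , bp w)
   open Bump pl' sh z≤ w≤ tz bz bw' tw row≤ col≤
   w<M : w < M'
   w<M = ≤-trans (s≤s w≤) row≤
   z<M : z < M'
   z<M = ≤-trans (s≤s z≤) row≤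
   -- Except in the row of the bump, the hybrid positions of a row are either all moved or all
   -- original, so the row invariant is available.
   H-row : ∀ t -> t ≢ a' -> w ≤ t -> z ≤ t -> Apart l w z (H a' t w) (H a' (suc t) w) (H a' t z) (H a' (suc t) z) × H a' (suc t) w ≤ H a' t w × H a' (suc t) z ≤ H a' t z
   H-row t ne w≤ z≤ with <-cmp t a'
   ... | tri≈ _ e _ = ⊥-elim (ne e)
   ... | tri< h _ _ = lia "a=hf=ij-hk-ig=jb=kecdhjik@;ecdagfb@g-ab-f 0b03054h18200064c0h202220210000a26000260004p0i6004o0r6004l0s54r0mo0926000260004n0k6004q0p6004j0q54p0kn040700250240004i1d3002a529408002604650400002503760002b5295004b06849047" (H a' t w , H a' (suc t) z , w , z , l , H a' t z , H a' (suc t) w , pos′ t w , pos′ t z , pos′ (suc t) w , pos′ (suc t) z) (hy≤ {a'} {t} w (<⇒≤ h) , hy≤ {a'} {t} z (<⇒≤ h) , Row.le (row′ t) w w≤ , Row.le (row′ t) z z≤ , hy≤ {a'} {suc t} w h , hy≤ {a'} {suc t} z h , Row.pair (row′ t) w z w≤ z≤ w≢z)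
   ... | tri> _ _ h = lia "a=hf=ij-hk-ig=jb=kecdhjik@;ecdagfb@g-ab-f 0b03054h18200064c0h202220210000a26000260004p0i6004o0r6004l0s54r0mo0926000260004n0k6004q0p6004j0q54p0kn040700250240004i1d3002a529408002604650400002503760002b5295004b06849047" (H a' t w , H a' (suc t) z , w , z , l , H a' t z , H a' (suc t) w , pos t w , pos t z , pos (suc t) w , pos (suc t) z) (hy> {a'} {t} w h , hy> {a'} {t} z h , Row.le (row t) w w≤ , Row.le (row t) z z≤ , hy> {a'} {suc t} w (<-trans h ≤-refl) , hy> {a'} {suc t} z (<-trans h ≤-refl) , Row.pair (row t) w z w≤ z≤ w≢z)
   here-free : ∀ j -> Crossing w z (suc a') j -> ⊥
   here-free j cr with crossing-kinds w≢z cr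
   ... | _ , kinds = clash "1a<bc=1ad<1ac<ee<bd=ef=e&&&d<ee<fc=eb=e&&&|; 00485274a129" (pos (suc a) z , H a' a' w , H a' (suc a') w , H a' (suc a') z , j , H a' a' z) (tw , bw' , bz , kinds)
   finish : (w < l × s (suc a') ≡ act w) ⊎ (l ≤ w × s (suc a') ≡ wait z w) -> Finishes (st G M (suc a) (pos (suc a) z))
   finish (inj₁ (red , e')) = cont
    where
    en' : Entry a' w
    en' = record { state = e' ; hop = (lia "b=ca-ca=1dc≠1d;a<b 0056024547305" (pos (suc a') w , pos′ a' w , pos a' w , pos a' z) (np w w≢z , Row.le (row a') w w≤ , bw , ActFacts.free≤ (row a') (act-at sz) w w≤)) ; join = join' ; side = side' }
     where
     side' : ∀ p -> p ≤ a' -> p ≢ w -> pos′ a' p ≤ pos (suc a') w ⊎ pos′ a' w < pos (suc a') p ⊎ (pos (suc a') p ≡ pos′ a' p × pos (suc a') w < pos′ a' p × pos′ a' p < pos′ a' w)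
     side' p p≤ ne with p ≟ z
     ... | yes refl = lia "a=1eb=1e;a-bc<dd=ab<aa<c&&|| 3630" (pos′ a' p , pos (suc a') w , pos′ a' w , pos (suc a') p , pos a' p) (nz , bw)
     ... | no ne' = lia "a=ec=fb=1gf≠1gjhiedfb@;a-bc<dd=ab<aa<c&&|| 003c91003c81000g003h203g03002k0634e0h2095e0b2d3c01" (pos′ a' p , pos (suc a') w , pos′ a' w , pos (suc a') p , pos a' p , pos a' w , pos a' z , p , w , l) (np p ne' , np w w≢z , bw , ActFacts.free≤ (row a') (act-at sz) w w≤ , Row.pair (row a') p w p≤ w≤ ne)
    nocross : firstCrossing G' M' (H a' M' w) (H a' M' z) ≡ nothing
    nocross = first-crossing-none w<M z<M none!
     where
     none! : ∀ i j -> Crossing w z i j -> ⊥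
     none! zero j (_ , (_ , ()) , _)
     none! (suc t) j cr with t ≟ a'
     ... | yes refl = here-free j cr
     ... | no ne with crossing-kinds w≢z cr
     ... | (w≤t , z≤t , _) , kinds = let (ap , a , b) = H-row t ne w≤t z≤t in red-uncrossed {w = w} {z} ap a b j red (RAct.red (act-at sz)) kinds
    cont : Finishes (st G M (suc a) (pos (suc a) z))
    cont with loop n a' w (fuel a<a') en' pl' row≤ (subst (_≤ M') (trans (sym bw') (bp w)) col≤)
    ... | G₁ , M₁ , r , p = G₁ , M₁ , next (stepR-bump {l} {G} {M} {suc a} {pos (suc a) z} dr is-bump! rpipe wpipe nocross rexit red)
       (subst (\c -> Runs (stepR l) (st G' M' (suc a') c) (G₁ , M₁)) (trans (sym (bp w)) bw') r) , p
   finish (inj₂ (blue , e')) = decide! (fate (suc n) (suc a') fuel' ≤-refl (\t h h' -> subst (\t -> s t ≡ wait z w) (≤-antisym h h') e'))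
    where
    fuel' : f < suc n + suc a'
    fuel' = ≤-trans (fuel a<a') (n≤1+n (n + suc a'))
    z<w : z < w
    z<w = ≤-trans (RAct.red (act-at sz)) blue
    -- Pipe w, to the right of z at the bottom of a row, has not crossed z above.
    above : ∀ n t -> n + t ≡ a' -> w < t -> z < t -> H a' t z < H a' t w
    above zero t refl w< z< = subst (_< H a' a' w) (sym tz) tw
    above (suc n) t e w< z< = let (ap , a , b) = H-row t ne (<⇒≤ w<) (<⇒≤ z<) in
      right-up {w = w} {z} ap a b z<w (above n (suc t) (trans (+-suc n t) e) (<-trans w< ≤-refl) (<-trans z< ≤-refl))
     where
     ne : t ≢ a'
     ne refl = <-irrefl refl (≤-trans (s≤s (m≤n+m t n)) (≤-reflexive e))
    above-free : ∀ t j -> t < a' -> Crossing w z (suc t) j -> ⊥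
    above-free t j t< cr with crossing-kinds w≢z cr
    ... | (w≤t , z≤t , _) , kinds = let (ap , a , b) = H-row t (<⇒≢ t<) w≤t z≤t in
      right-uncrossed {w = w} {z} ap a b j z<w (above (a' ∸ suc t) (suc t) (m∸n+n≡m t<) (s≤s w≤t) (s≤s z≤t)) kinds
    wait-free : ∀ t j -> a' < t -> H a' (suc t) z < H a' (suc t) w -> Crossing w z (suc t) j -> ⊥
    wait-free t j h lt cr with crossing-kinds w≢z cr
    ... | (w≤t , z≤t , _) , kinds = let (ap , a , b) = H-row t (>⇒≢ h) w≤t z≤t in right-uncrossed {w = w} {z} ap a b j z<w lt kinds
    wait-lt : ∀ t -> a' < t -> s t ≡ wait z w -> H a' t z < H a' t w
    wait-lt t h e = subst₂ _<_ (sym (hy> z h)) (sym (hy> w h)) (RWait.lt (wait-at e))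
    decide! : Fate a' z w -> Finishes (st G M (suc a) (pos (suc a) z))
    decide! (never st!) = set G' (suc a') g cross , M' ,
      stop (stepR-stop {l} {G} {M} {suc a} {pos (suc a) z} dr is-bump! rpipe wpipe nocross rexit (s≤s blue)) ,
      uncross pl' z≤ w≤ tz bw' bz tw (\t h p -> sym (hy≤ p h)) swapped row≤ col≤
     where
     swapped : ∀ t -> a' < t -> Swapped (H a') pos′ z w t
     swapped t h with waited-at (st! t h)
     ... | p , q , r = trans p (sym (hy> w h)) , trans q (sym (hy> z h)) , (\o n n' -> trans (r o n n') (sym (hy> o h)))
     nocross : firstCrossing G' M' (H a' M' w) (H a' M' z) ≡ nothing
     nocross = first-crossing-none w<M z<M none!
      where
      none! : ∀ i j -> Crossing w z i j -> ⊥
      none! zero j (_ , (_ , ()) , _)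
      none! (suc t) j cr with <-cmp t a'
      ... | tri< h _ _ = above-free t j h cr
      ... | tri≈ _ refl _ = here-free j cr
      ... | tri> _ _ h = wait-free t j h (wait-lt (suc t) (<-trans h ≤-refl) (st! (suc t) (<-trans h ≤-refl))) cr
    decide! (meets e a'<e st! lt eact) = proj₁ res , proj₁ (proj₂ res) ,
      next (stepR-swap {l} {G} {M} {suc a} {pos (suc a) z} dr is-bump! rpipe wpipe crossing) (proj₁ (proj₂ (proj₂ res))) , proj₂ (proj₂ (proj₂ res))
     where
     w≤e : w ≤ e
     w≤e = ≤-trans w≤ (<⇒≤ a'<e)
     z≤e : z ≤ e
     z≤e = ≤-trans z≤ (<⇒≤ a'<e)
     we = waited-at (st! e a'<e ≤-refl)
     low = lia "b<cd-ba<dgefcabd@;a<bb<cd=b 0433020025000033812003317002e2280250" (pos (suc e) w , pos e z , pos e w , pos (suc e) z , w , z , l) (RWait.lt (wait-at (st! e a'<e ≤-refl)) , Row.le (row e) z z≤e , lt , Row.pair (row e) w z w≤e z≤e w≢z)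
     en' : Entry e z
     en' = record { state = eact ; hop = (lia "b=cd<ee<ca=e;a<b 46124" (pos (suc e) z , pos′ e z , pos e w , pos (suc e) w , pos e z) (proj₁ we , low)) ; join = join″ ; side = side' }
      where
      join″ : ∀ p -> p ≤ e -> pos (suc e) p ≤ pos′ e p
      join″ p p≤ with p ≟ z | p ≟ w
      ... | yes refl | _ = lia "b=cd<ee<ca=e;a-b 46124" (pos (suc e) p , pos′ e p , pos e w , pos (suc e) w , pos e p) (proj₁ we , low)
      ... | no _ | yes refl = lia "b=ca<cc<de=c;a-b 3634" (pos (suc e) p , pos′ e p , pos e z , pos e p , pos (suc e) z) (proj₁ (proj₂ we) , low)
      ... | no n | no n' = lia "b=ca-c;a-b 3301" (pos (suc e) p , pos′ e p , pos e p) (proj₂ (proj₂ we) p n n' , Row.le (row e) p p≤)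
      side' : ∀ p -> p ≤ e -> p ≢ z -> pos′ e p ≤ pos (suc e) z ⊎ pos′ e z < pos (suc e) p ⊎ (pos (suc e) p ≡ pos′ e p × pos (suc e) z < pos′ e p × pos′ e p < pos′ e z)
      side' p p≤ n with p ≟ w
      ... | yes refl = lia "a=ed<ee<fb=e;a-bc<dd=ab<aa<c&&|| 3850" (pos′ e p , pos (suc e) z , pos′ e z , pos (suc e) p , pos e z , pos e p) (proj₁ (proj₂ we) , low)
      ... | no n' = lia "a=ec=fg<hh<fb=h&&kijedfg@;a-bc<dd=ab<aa<c&&|| 005da163003d91000h003i203h03002l0634f0i25e0cbd" (pos′ e p , pos (suc e) z , pos′ e z , pos (suc e) p , pos e p , pos e w , pos (suc e) w , pos e z , p , w , l) (proj₂ (proj₂ we) p n n' , proj₁ we , low , Row.pair (row e) p w p≤ w≤e n')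
     cell! : G' (suc e) (pos e z) ≡ cross
     cell! = Read.sn∧we (Placed.match pl' e (pos e z) (subst (1 ≤_) (proj₂ (proj₂ low)) (Row.lo (row e) z z≤e)) (Row.hi (row e) z (≤-trans (s≤s z≤) a'<e))) w z w≤e z≤e
      ((lia "a=cc<bb<de=b;a<b 3653" (H a' (suc e) w , pos e z , pos (suc e) w , pos e w , pos (suc e) z) (hy> {a'} {suc e} w (<-trans a'<e ≤-refl) , low)) , (lia "b=cd<aa<ce=a;a<b 3624" (pos e z , H a' e w , pos e w , pos (suc e) w , pos (suc e) z) (hy> {a'} {e} w a'<e , low))) ((lia "a=cd<bb<ec=b;a=b 0635013620" (H a' (suc e) z , pos e z , pos (suc e) z , pos (suc e) w , pos e w) (hy> {a'} {suc e} z (<-trans a'<e ≤-refl) , low)) , hy> z a'<e)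
     std-cross : ∀ i j -> std i j ≢ cross
     std-cross i j h with i <ᵇ j | j <ᵇ i
     std-cross i j () | true | _
     std-cross i j () | false | true
     std-cross i j () | false | false
     -- The standard part contains no cross, so the crossing lies within the bound.
     inM : suc e ≤ M' × pos e z ≤ M'
     inM with suc e ≤? M' | pos e z ≤? M'
     ... | yes h | yes h' = h , h'
     ... | no h | _ = ⊥-elim (std-cross (suc e) (pos e z) (trans (sym (Placed.std! pl' (suc e) (pos e z) (s≤s z≤n) (subst (1 ≤_) (proj₂ (proj₂ low)) (Row.lo (row e) z z≤e)) (inj₁ (≰⇒> h)))) cell!))
     ... | yes _ | no h = ⊥-elim (std-cross (suc e) (pos e z) (trans (sym (Placed.std! pl' (suc e) (pos e z) (s≤s z≤n) (subst (1 ≤_) (proj₂ (proj₂ low)) (Row.lo (row e) z z≤e)) (inj₂ (≰⇒> h)))) cell!))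
     e≤ : suc e ≤ M'
     e≤ = proj₁ inM
     c≤ : pos (suc e) z ≤ M'
     c≤ = subst (_≤ M') (sym (proj₂ (proj₂ low))) (proj₂ inM)
     keep : ∀ t -> t ≤ a' ⊎ e < t -> ∀ p -> H e t p ≡ H a' t p
     keep t (inj₁ h) p = trans (hy≤ p (≤-trans h (<⇒≤ a'<e))) (sym (hy≤ p h))
     keep t (inj₂ h) p = trans (hy> p h) (sym (hy> p (<-trans a'<e h)))
     sw : ∀ t -> a' < t -> t ≤ e -> Swapped (H a') (H e) z w t
     sw t h h' with waited-at (st! t h h')
     ... | p , q , r = trans (hy≤ z h') (trans p (sym (hy> w h))) , trans (hy≤ w h') (trans q (sym (hy> z h))) , (\o n n' -> trans (hy≤ o h') (trans (r o n n') (sym (hy> o h))))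
     swapped : Placed K G₀ (H e) (swapAt G' (suc a') g (suc e) (pos (suc e) z)) M'
     swapped = exchange pl' z≤ w≤ tz bw' bz tw a'<e (trans (hy> z a'<e) (sym (proj₂ (proj₂ low)))) (hy> z (<-trans a'<e ≤-refl))
      (lia "c<ba=c;a<b 3312" (H a' (suc e) w , pos (suc e) z , pos (suc e) w) (lt , hy> {a'} {suc e} w (<-trans a'<e ≤-refl))) (lia "b=cd<ee<ca=e;a<b 46124" (pos (suc e) z , H a' e w , pos e w , pos (suc e) w , pos e z) (hy> {a'} {e} w a'<e , low)) keep sw e≤ col≤ c≤
     hop-w = lia "b=ca=dd<ee<cf=e;a<b 585326" (H a' (suc e) w , H a' e w , pos e w , pos (suc e) w , pos e z , pos (suc e) z) (hy> {a'} {e} w a'<e , hy> {a'} {suc e} w (<-trans a'<e ≤-refl) , low)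
     res = loop n e z (fuel (<-trans a<a' a'<e)) en' swapped e≤ c≤
     -- Below the crossing `w` stays to the left of `z`: to get back, `z` would have to be the
     -- horizontal pipe of a crossing, against `z < w`.
     after : ∀ t -> e < t -> H a' t w < H a' t z
     after (suc t) e<t with t ≟ e
     ... | yes refl = lia "c<da=cb=d;a<b 44053" (H a' (suc t) w , H a' (suc t) z , pos (suc t) w , pos (suc t) z) (lt , hy> {a'} {suc t} w (<-trans a'<e ≤-refl) , hy> {a'} {suc t} z (<-trans a'<e ≤-refl))
     ... | no ne = let (ap , a , b) = H-row t (>⇒≢ (<-trans a'<e e<t')) (≤-trans w≤e (<⇒≤ e<t')) (≤-trans z≤e (<⇒≤ e<t')) in left-down {w = w} {z} ap a b z<w (after t e<t')
      where
      e<t' : e < t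
      e<t' = ≤∧≢⇒< (≤-pred e<t) (≢-sym ne)
     crossing : firstCrossing G' M' (H a' M' w) (H a' M' z) ≡ just (suc e , pos (suc e) z)
     crossing = first-crossing-at (cong isCross (trans (cong (G' (suc e)) (proj₂ (proj₂ low))) cell!) ,
       (inW , vW w≤e e≤ (lia "c<ba=c;a<b 3312" (H a' (suc e) w , pos (suc e) z , pos (suc e) w) (lt , hy> {a'} {suc e} w (<-trans a'<e ≤-refl))) (lia "b=cd<ee<ca=e;a-b 46124" (pos (suc e) z , H a' e w , pos e w , pos (suc e) w , pos e z) (hy> {a'} {e} w a'<e , low)) c≤) ,
       (inS , vS z≤e e≤ (hy> z (<-trans a'<e ≤-refl)))) only
      where
      only : ∀ i j -> Crossing w z i j -> i ≡ suc e × j ≡ pos (suc e) z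
      only zero j (_ , (_ , ()) , _)
      only (suc t) j cr with <-cmp t a' | <-cmp t e
      ... | tri< h _ _ | _ = ⊥-elim (above-free t j h cr)
      ... | tri≈ _ refl _ | _ = ⊥-elim (here-free j cr)
      ... | tri> _ _ h | tri< h' _ _ = ⊥-elim (wait-free t j h (wait-lt (suc t) (<-trans h ≤-refl) (st! (suc t) (<-trans h ≤-refl) h')) cr)
      ... | tri> _ _ h | tri≈ _ refl _ with crossing-kinds w≢z cr
      ... | (w≤t , z≤t , _) , kinds = let (ap , a , b) = H-row t (>⇒≢ h) w≤t z≤t in refl , trans (vertical-column {w = w} {z} ap a b j hop-w kinds) (hy> z (<-trans h ≤-refl))
      only (suc t) j cr | tri> _ _ h | tri> _ _ h' with crossing-kinds w≢z cr
      ... | (w≤t , z≤t , _) , kinds = let (ap , a , b) = H-row t (>⇒≢ h) w≤t z≤t in ⊥-elim (left-uncrossed {w = w} {z} ap a b j z<w (after t h') kinds)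

 starts : s 0 ≡ none -> ∀ t -> t < y -> s t ≡ none
 starts h zero t< = h
 starts h (suc t) t< with s t | starts h t (<-trans ≤-refl t<) | s (suc t) | step t
 ... | _ | refl | _ | rn _ = refl
 ... | _ | refl | _ | rs e = ⊥-elim (<⇒≢ t< e)

 insert : s 0 ≡ none -> 1 ≤ y -> y ≤ f -> ∀ {G M} -> Placed K G₀ pos G M -> ∃ \out -> RightIns y l (G , M) out × Placed K G₀ pos′ (proj₁ out) (proj₂ out)
 insert h₀ (s≤s {n = r} _) y≤ {G} {M} pl with s r in er | starts h₀ r ≤-refl | s (suc r) in e | step r
 ... | _ | refl | _ | rn n = ⊥-elim (n refl)
 ... | _ | refl | _ | rs _ = (proj₁ res , proj₁ (proj₂ res)) , (c , found , proj₁ (proj₂ (proj₂ res))) , proj₂ (proj₂ (proj₂ res))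
  where
  c = pos (suc r) r
  same : ∀ t -> t ≤ r -> ∀ p -> pos′ t p ≡ pos t p
  same t h p with subst (RMoved (pos t) (pos′ t)) (starts h₀ t (s≤s h)) (moved t)
  ... | mnone eq = eq p
  M' = M ⊔ suc r
  pl' : Placed K G₀ pos G M'
  pl' = place-⊔ pl (suc r) (≤-trans y≤ (<⇒≤ f<K))
  r< : suc r ≤ M'
  r< = m≤n⊔m M (suc r)
  hop : pos (suc r) r < pos r r
  hop = RowFacts.r-hop (row r)
  c₁ : 1 ≤ c
  c₁ = Row.lo (row r) r ≤-refl
  isr : G (suc r) c ≡ relb
  isr = relb-at pl' r c c₁ (≤-trans (s≤s (Row.bd (row r) r ≤-refl)) (Row.bw (row r))) r (≤-refl , refl , hop) noN
   where
   noN : ∀ q -> q ≤ r -> pos (suc r) q < c -> pos r q ≢ c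
   noN q q≤ h e with q ≟ r
   ... | yes refl = <-irrefl refl h
   ... | no n = clash "a-bc<db=cgefbadc@; 002310046175002a33b2a" (pos (suc r) q , pos r q , pos (suc r) r , pos r r , q , r , l) (Row.le (row r) q q≤ , hop , e , Row.pair (row r) q r q≤ ≤-refl n)
  c≤ : c ≤ M'
  c≤ = relb-in pl' r c c₁ r< isr
  found : lastWhere (isRelbAt G (suc r)) (range 1 (M + suc r)) ≡ just c
  found = lastWhere-range (isRelbAt G (suc r)) (M + suc r) c c₁ (≤-trans c≤ (m⊔n≤m+n M (suc r))) (cong isRelb isr)
    (\j h h' -> no-relb pl' r j (≤-trans c₁ (<⇒≤ h)) r< (noT j h))
   where
   -- The pipe leaving in this row occupies every cell east of its own turn, which leaves no room
   -- for another turn.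
   noT : ∀ j -> c < j -> ∀ p -> Turns r (pos r) (pos (suc r)) p j -> ⊥
   noT j h p (p≤ , b , t) with p ≟ r
   ... | yes refl = <⇒≢ h b
   ... | no n = clash "a<bc=1db<1de=af<aighbecf@; 003913005816a7003f0b3d2c" (j , pos r p , pos r r , r + K , pos (suc r) p , pos (suc r) r , p , r , l) (t , Row.top (row r) , Row.hi (row r) p (≤∧≢⇒< p≤ n) , b , h , Row.pair (row r) p r p≤ ≤-refl n)
  res = loop (suc f) r r (s≤s (m≤m+n f (suc r)))
   (record { state = e ; hop = subst (c <_) (sym (same r ≤-refl r)) hop ; join = \p p≤ -> subst (pos (suc r) p ≤_) (sym (same r ≤-refl p)) (Row.le (row r) p p≤)
       ; side = \p p≤ n -> (lia "e-fa=gc=hiefgdhb@;a-bc<dd=ab<aa<c&&|| 003a61003a51000e003e203d03002i0634b0e22d5" (pos′ r p , pos (suc r) r , pos′ r r , pos (suc r) p , p , r , pos r p , pos r r , l) (p≤ , same r ≤-refl p , same r ≤-refl r , Row.pair (row r) p r p≤ ≤-refl n)) })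
   (place-ext pl' (H r) (hy-same r same)) r< c≤

right-insertion : ∀ {l k K b f} (W : World l k K b f) (b<K : b < K) (l≤k : l ≤ k) (k≤f : k ≤ f) {y} (y≤l : y ≤ l) (run : RRun l K y (World.pos W)) ->
 1 ≤ y -> 2 + (b + f) ≤ K -> ∀ {G₀ G M} -> Placed K G₀ (World.pos W) G M ->
 ∃ \out -> RightIns y l (G , M) out × Placed K G₀ (RChain.pos′ W b<K l≤k k≤f y≤l run) (proj₁ out) (proj₂ out)
right-insertion W b<K l≤k k≤f y≤l run 1≤y big {G₀} = RightRun.insert pos pos′ (hybrid pos pos′) st′ (hybrid-≤ pos pos′) (hybrid-> pos pos′)
 row row′ valid step moved (waits 1≤y) big G₀ start 1≤y (≤-trans y≤l (≤-trans l≤k k≤f))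
 where
 open World W
 open RChain W b<K l≤k k≤f y≤l run

-- The pipes of a bumpless pipe dream, followed row by row from their exits

N-split : ∀ t -> hasN t ≡ true -> has SN t ≡ true ⊎ (has SN t ≡ false × has WN t ≡ true)
N-split vert e = inj₁ refl
N-split cross e = inj₁ refl
N-split jelb e = inj₂ (refl , refl)
N-split bump e = inj₂ (refl , refl)

E-split : ∀ t -> t ≢ bump -> hasE t ≡ true -> (has SE t ≡ true × hasN t ≡ false) ⊎ (has SE t ≡ false × has WE t ≡ true)
E-split horiz n e = inj₂ (refl , refl)
E-split cross n e = inj₂ (refl , refl)
E-split relb n e = inj₁ (refl , refl)
E-split bump n e = ⊥-elim (n refl)

W-split : ∀ t -> t ≢ bump -> hasW t ≡ true -> (has WE t ≡ true × hasE t ≡ true) ⊎ (has WN t ≡ true × has SN t ≡ false × hasN t ≡ true)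
W-split horiz n e = inj₁ (refl , refl)
W-split cross n e = inj₁ (refl , refl)
W-split jelb n e = inj₂ (refl , refl , refl)
W-split bump n e = ⊥-elim (n refl)

S-split : ∀ t -> t ≢ bump -> hasS t ≡ true -> (has SN t ≡ true × hasN t ≡ true) ⊎ (has SE t ≡ true × hasE t ≡ true)
S-split vert n e = inj₁ (refl , refl)
S-split cross n e = inj₁ (refl , refl)
S-split relb n e = inj₂ (refl , refl)
S-split bump n e = ⊥-elim (n refl)

conn-N : ∀ s t -> has (s , outN) t ≡ true -> hasN t ≡ true
conn-N inS vert e = refl
conn-N inS cross e = refl
conn-N inW jelb e = refl
conn-N inW bump e = refl

conn-E : ∀ s t -> has (s , outE) t ≡ true -> hasE t ≡ true
conn-E inW horiz e = refl
conn-E inW cross e = refl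
conn-E inS relb e = refl
conn-E inS bump e = refl

conn-W : ∀ o t -> has (inW , o) t ≡ true -> hasW t ≡ true
conn-W outE horiz e = refl
conn-W outE cross e = refl
conn-W outN jelb e = refl
conn-W outN bump e = refl

conn-S : ∀ o t -> has (inS , o) t ≡ true -> hasS t ≡ true
conn-S outN vert e = refl
conn-S outN cross e = refl
conn-S outE relb e = refl
conn-S outE bump e = refl

we∧N : ∀ t -> has WE t ≡ true -> hasN t ≡ true -> has SN t ≡ true
we∧N cross e e' = refl

wn∧sn : ∀ t -> has WN t ≡ true -> has SN t ≢ true
wn∧sn jelb e ()
wn∧sn bump e ()

se∧N : ∀ t -> t ≢ bump -> has SE t ≡ true -> hasN t ≢ true
se∧N relb n e ()
se∧N bump n e _ = n refl

we∧se : ∀ t -> has WE t ≡ true -> has SE t ≢ true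
we∧se horiz e ()
we∧se cross e ()

-- The way of a pipe through a row in terms of tiles: straight up, or an r-turn in column `b`
-- followed by horizontal connections. At the end in column `t` only verticality is denied, because
-- for the pipe leaving in the row that column stands for ∞.
data Strand (g : ℕ -> Tile) (b t : ℕ) : Set where
 up  : b ≡ t -> has SN (g t) ≡ true -> Strand g b t
 hop : b < t -> 1 ≤ b -> has SN (g t) ≡ false -> has SE (g b) ≡ true ->
  (∀ m -> b < m -> m < t -> has WE (g m) ≡ true) -> Strand g b t

module StrandRow {t w : ℕ} (g : ℕ -> Tile) (T B : ℕ -> ℕ) (top : T t ≡ w) (hi : ∀ p -> p < t -> T p < w)
 (nobump : ∀ j -> 1 ≤ j -> g j ≢ bump) (ew : ∀ j -> 1 ≤ j -> hasE (g j) ≡ hasW (g (suc j))) (edge : has SN (g w) ≡ false)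
 (lo : ∀ p -> p < t -> 1 ≤ T p) (north : ∀ p -> p < t -> hasN (g (T p)) ≡ true) (occ : ∀ j -> 1 ≤ j -> hasN (g j) ≡ true -> Occ t T j)
 (inj : ∀ p q -> p < t -> q < t -> T p ≡ T q -> p ≡ q) (strand : ∀ p -> p ≤ t -> Strand g (B p) (T p)) where

 le : ∀ p -> p ≤ t -> B p ≤ T p
 le p p≤ with strand p p≤
 ... | up e _ = ≤-reflexive e
 ... | hop h _ _ _ _ = <⇒≤ h

 below : ∀ p -> p ≤ t -> T p < w -> p < t
 below p p≤ h with p ≟ t
 ... | yes refl = ⊥-elim (<⇒≢ h top)
 ... | no n = ≤∧≢⇒< p≤ n

 T≤w : ∀ p -> p ≤ t -> T p ≤ w
 T≤w p p≤ with p ≟ t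
 ... | yes refl = ≤-reflexive top
 ... | no n = <⇒≤ (hi p (≤∧≢⇒< p≤ n))

 inj-T : ∀ p q -> p ≤ t -> q ≤ t -> T p ≡ T q -> p ≡ q
 inj-T p q p≤ q≤ e with p ≟ t | q ≟ t
 ... | yes refl | yes refl = refl
 ... | yes refl | no n = ⊥-elim (<⇒≢ (hi q (≤∧≢⇒< q≤ n)) (trans (sym e) top))
 ... | no n | yes refl = ⊥-elim (<⇒≢ (hi p (≤∧≢⇒< p≤ n)) (trans e top))
 ... | no n | no n' = inj p q (≤∧≢⇒< p≤ n) (≤∧≢⇒< q≤ n') e

 lo-B : ∀ p -> p ≤ t -> 1 ≤ B p
 lo-B p p≤ with strand p p≤
 ... | hop _ h _ _ _ = h
 ... | up e s with p ≟ t
 ... | no n = subst (1 ≤_) (sym e) (lo p (≤∧≢⇒< p≤ n))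
 ... | yes refl with () ← trans (sym s) (trans (cong (\c -> has SN (g c)) top) edge)

 tri : ∀ p q -> p ≤ t -> q ≤ t -> T p < T q -> T p < B q ⊎ (B p ≡ T p × B q < T p)
 tri p q p≤ q≤ h with strand q q≤ | below p p≤ (≤-trans h (T≤w q q≤))
 ... | up e _ | _ = inj₁ (subst (T p <_) (sym e) h)
 ... | hop _ b₁ _ s run | p< with <-cmp (T p) (B q)
 ... | tri< a _ _ = inj₁ a
 ... | tri≈ _ e _ = ⊥-elim (se∧N (g (B q)) (nobump (B q) b₁) s (subst (\c -> hasN (g c) ≡ true) e (north p p<)))
 ... | tri> _ _ a with strand p p≤
 ... | up e _ = inj₂ (e , a)
 ... | hop _ _ ns _ _ with () ← trans (sym ns) (we∧N (g (T p)) (run (T p) a h) (north p p<))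

 inj-B : ∀ p q -> p ≤ t -> q ≤ t -> B p ≡ B q -> p ≡ q
 inj-B p q p≤ q≤ e with <-cmp (T p) (T q)
 ... | tri≈ _ h _ = inj-T p q p≤ q≤ h
 ... | tri< h _ _ = lia "c-dc=ed<ec=de<d&|;a=b 0034023501" (p , q , B p , T p , B q) (le p p≤ , e , tri p q p≤ q≤ h)
 ... | tri> _ _ h = lia "c-de=cd<ec=de<d&|;a=b 0034033401" (p , q , B q , T q , B p) (le q q≤ , e , tri q p q≤ p≤ h)

 -- Follows a horizontal run eastwards until it turns north, at the latest to `w`, where the pipe
 -- leaving in this row ends; `n` measures the distance.
 carrier : ∀ n j -> n + suc j ≡ w -> 1 ≤ j -> hasE (g j) ≡ true -> ∃ \p -> p ≤ t × j < T p × has SN (g (T p)) ≡ false ×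
  (∀ m -> j < m -> m < T p -> has WE (g m) ≡ true)
 carrier zero j refl j₁ e = t , ≤-refl , ≤-reflexive (sym top) , trans (cong (\c -> has SN (g c)) top) edge ,
  (\m h h' -> ⊥-elim (<⇒≱ (subst (m <_) top h') h))
 carrier (suc n) j eq j₁ e with W-split (g (suc j)) (nobump (suc j) (s≤s z≤n)) (trans (sym (ew j j₁)) e)
 ... | inj₂ (wn , ns , N) with occ (suc j) (s≤s z≤n) N
 ... | p , p< , tp = p , <⇒≤ p< , ≤-reflexive (sym tp) , trans (cong (\c -> has SN (g c)) tp) ns ,
   (\m h h' -> ⊥-elim (<⇒≱ (subst (m <_) tp h') h))
 carrier (suc n) j eq j₁ e | inj₁ (we , e') with carrier n (suc j) (trans (+-suc n (suc j)) eq) (s≤s z≤n) e'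
 ... | p , p≤ , j< , ns , run = p , p≤ , <-trans ≤-refl j< , ns , run'
  where
  run' : ∀ m -> j < m -> m < T p -> has WE (g m) ≡ true
  run' m h h' with m ≟ suc j
  ... | yes refl = we
  ... | no n = run m (≤∧≢⇒< h (≢-sym n)) h'

 east : ∀ j -> 1 ≤ j -> j < w -> hasE (g j) ≡ true -> ∃ \p -> p ≤ t × B p ≤ j × j < T p × (has SE (g j) ≡ true -> B p ≡ j)
 east j j₁ j< e with carrier (w ∸ suc j) j (m∸n+n≡m j<) j₁ e
 ... | p , p≤ , j<T , ns , run with strand p p≤
 ... | up _ s with () ← trans (sym ns) s
 ... | hop b< b₁ _ s run' with <-cmp (B p) j
 ... | tri≈ _ e' _ = p , p≤ , ≤-reflexive e' , j<T , (\_ -> e')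
 ... | tri< a _ _ = p , p≤ , <⇒≤ a , j<T , (\s' -> ⊥-elim (we∧se (g j) (run' j a j<T) s'))
 ... | tri> _ _ a = ⊥-elim (we∧se (g (B p)) (run (B p) a b<) s)

 cell : ∀ j -> 1 ≤ j -> j < w -> Cell t T B j (g j)
 cell j j₁ j< = record { own = own ; fits = fits ; uniq = uniq }
  where
  own : ∀ κ -> has κ (g j) ≡ true -> ∃ \p -> p ≤ t × Kind j (B p) (T p) (just κ)
  own WE h with east j j₁ j< (conn-E inW (g j) h)
  ... | p , p≤ , b≤ , j<T , se with B p ≟ j
  ... | no n = p , p≤ , ≤∧≢⇒< b≤ n , j<T
  ... | yes e with strand p p≤
  ... | up e' _ = ⊥-elim (<⇒≢ j<T (trans (sym e) e'))
  ... | hop _ _ _ s _ = ⊥-elim (we∧se (g j) h (subst (\c -> has SE (g c) ≡ true) e s))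
  own SE h with east j j₁ j< (conn-E inS (g j) h)
  ... | p , p≤ , b≤ , j<T , se = p , p≤ , se h , j<T
  own SN h with occ j j₁ (conn-N inS (g j) h)
  ... | p , p< , refl with strand p (<⇒≤ p<)
  ... | up e _ = p , <⇒≤ p< , e , refl
  ... | hop _ _ ns _ _ with () ← trans (sym ns) h
  own WN h with occ j j₁ (conn-N inW (g j) h)
  ... | p , p< , refl with strand p (<⇒≤ p<)
  ... | up _ s = ⊥-elim (wn∧sn (g j) h s)
  ... | hop b< _ _ _ _ = p , <⇒≤ p< , b< , refl
  fits : ∀ κ p -> p ≤ t -> Kind j (B p) (T p) (just κ) -> has κ (g j) ≡ true
  fits κ p p≤ k with strand p p≤
  fits WE p p≤ (a , b) | up e _ = ⊥-elim (<⇒≢ (<-trans a b) e)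
  fits SN p p≤ (a , refl) | up e s = s
  fits SE p p≤ (a , b) | up e _ = ⊥-elim (<⇒≢ b (trans (sym a) e))
  fits WN p p≤ (a , refl) | up e _ = ⊥-elim (<⇒≢ a e)
  fits WE p p≤ (a , b) | hop _ _ _ _ run = run j a b
  fits SN p p≤ (a , b) | hop h _ _ _ _ = ⊥-elim (<⇒≢ h (trans a (sym b)))
  fits SE p p≤ (refl , b) | hop _ _ _ s _ = s
  fits WN p p≤ (a , refl) | hop _ _ ns _ _ with N-split (g (T p)) (north p (below p p≤ j<))
  ... | inj₂ (_ , h) = h
  ... | inj₁ s with () ← trans (sym ns) s
  uniq : ∀ κ p q -> p ≤ t -> q ≤ t -> Kind j (B p) (T p) (just κ) -> Kind j (B q) (T q) (just κ) -> p ≡ q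
  uniq SN p q p≤ q≤ (_ , a) (_ , b) = inj-T p q p≤ q≤ (trans a (sym b))
  uniq WN p q p≤ q≤ (_ , a) (_ , b) = inj-T p q p≤ q≤ (trans a (sym b))
  uniq SE p q p≤ q≤ (a , _) (b , _) = inj-B p q p≤ q≤ (trans a (sym b))
  uniq WE p q p≤ q≤ (a , b) (c , d) with <-cmp (T p) (T q)
  ... | tri≈ _ e _ = inj-T p q p≤ q≤ e
  ... | tri< h _ _ = lia "c<dd<ef<de<cf=ec<e&|;a=b 0034303514" (p , q , B q , j , T p , B p) (c , b , a , tri p q p≤ q≤ h)
  ... | tri> _ _ h = lia "c<de<cf<cd<fe=df<d&|;a=b 0034023615" (p , q , j , T q , B q , B p) (d , c , a , tri q p q≤ p≤ h)

 south : ∀ p -> p ≤ t -> hasS (g (B p)) ≡ true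
 south p p≤ with strand p p≤
 ... | up e s = conn-S outN (g (B p)) (trans (cong (\c -> has SN (g c)) e) s)
 ... | hop _ _ _ s _ = conn-S outE (g (B p)) s

 occ-B : ∀ j -> 1 ≤ j -> (w ≤ j -> hasS (g j) ≡ false) -> hasS (g j) ≡ true -> Occ (suc t) B j
 occ-B j j₁ out h with j <? w
 ... | no n with () ← trans (sym h) (out (≮⇒≥ n))
 ... | yes j< with S-split (g j) (nobump j j₁) h
 ... | inj₁ (s , _) with p , p≤ , k ← Cell.own (cell j j₁ j<) SN s = p , s≤s p≤ , proj₁ k
 ... | inj₂ (s , _) with p , p≤ , k ← Cell.own (cell j j₁ j<) SE s = p , s≤s p≤ , proj₁ k

std-EW : ∀ i j -> hasE (std i j) ≡ hasW (std i (suc j))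
std-EW i j with <-cmp i j | <-cmp i (suc j)
... | tri< h _ _ | _ rewrite std-horiz h | std-horiz (<-trans h ≤-refl) = refl
... | tri≈ _ refl _ | _ rewrite std-relb i | std-horiz (≤-refl {suc i}) = refl
... | tri> _ _ h | tri< h' _ _ = ⊥-elim (<⇒≱ h (≤-pred h'))
... | tri> _ _ h | tri≈ _ refl _ rewrite std-vert h | std-relb (suc j) = refl
... | tri> _ _ h | tri> _ _ h' rewrite std-vert h | std-vert h' = refl

std-SN : ∀ i j -> hasS (std i j) ≡ hasN (std (suc i) j)
std-SN i j with <-cmp i j | <-cmp (suc i) j
... | tri> _ _ h | _ rewrite std-vert h | std-vert (<-trans h ≤-refl) = refl
... | tri≈ _ refl _ | _ rewrite std-relb i | std-vert (≤-refl {suc i}) = refl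
... | tri< h _ _ | tri> _ _ h' = ⊥-elim (<⇒≱ h (≤-pred h'))
... | tri< h _ _ | tri≈ _ refl _ rewrite std-horiz h | std-relb (suc i) = refl
... | tri< h _ _ | tri< h' _ _ rewrite std-horiz h | std-horiz h' = refl

std-bump : ∀ i j -> std i j ≢ bump
std-bump i j e with i <ᵇ j | j <ᵇ i
std-bump i j () | true | _
std-bump i j () | false | true
std-bump i j () | false | false

std-N : ∀ i j -> hasN (std i j) ≡ true -> j < i
std-N i j e with <-cmp i j
... | tri> _ _ h = h
... | tri≈ _ refl _ with () ← subst (\t -> hasN t ≡ true) (std-relb i) e
... | tri< h _ _ with () ← subst (\t -> hasN t ≡ true) (std-horiz h) e

two-elements : ∀ {A : Set} {x y : A} xs -> x ∈ xs -> y ∈ xs -> x ≢ y -> 2 ≤ length xs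
two-elements (_ ∷ _) (here refl) (here refl) n = ⊥-elim (n refl)
two-elements (_ ∷ _ ∷ _) (here _) (there _) n = s≤s (s≤s z≤n)
two-elements (_ ∷ _ ∷ _) (there _) (here _) n = s≤s (s≤s z≤n)
two-elements (_ ∷ xs) (there h) (there h') n = ≤-trans (two-elements xs h h' n) (n≤1+n _)

module _ {P : ℕ -> Set} (P? : ∀ i -> Dec (P i)) where

 least-such : ∀ {i} -> P i -> ∃ \d -> P d × (∀ j -> P j -> d ≤ j)
 least-such {i} h = go i 0 (+-identityʳ i) (\j ())
  where
  go : ∀ m lo -> m + lo ≡ i -> (∀ j -> j < lo -> ¬ P j) -> ∃ \d -> P d × (∀ j -> P j -> d ≤ j)
  go m lo e no! with P? lo
  ... | yes p = lo , p , (\j pj -> ≮⇒≥ (\j< -> no! j j< pj))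
  go zero lo refl no! | no np = ⊥-elim (np h)
  go (suc m) lo e no! | no np = go m (suc lo) (trans (+-suc m lo) e) more
   where
   more : ∀ j -> j < suc lo -> ¬ P j
   more j j< with j ≟ lo
   ... | yes refl = np
   ... | no n = no! j (≤∧≢⇒< (≤-pred j<) n)

 greatest-such : ∀ n -> (∀ j -> P j -> j < n) -> ∀ {i} -> P i -> ∃ \d -> P d × (∀ j -> P j -> j ≤ d)
 greatest-such zero bd h with () ← bd _ h
 greatest-such (suc n) bd h with P? n
 ... | yes p = n , p , (\j pj -> ≤-pred (bd j pj))
 ... | no np = greatest-such n (\j pj -> ≤∧≢⇒< (≤-pred (bd j pj)) (\{ refl -> np pj })) h

descent? : ∀ n π i -> Dec (Descent n π i)
descent? n π i = ×-dec (1 ≤? i) (×-dec (i <? n) (π (suc i) <? π i))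

-- Positions read off from a bumpless pipe dream

module Setup {n π D} (bpd : IsBPD n π D) (K : ℕ) (n<K : n < K) where
 open IsBPD bpd

 G : Grid
 G = ext n D

 ext-in : ∀ {i j} -> i ≤ n -> j ≤ n -> G i j ≡ D i j
 ext-in h h' rewrite ≤ᵇ-true h | ≤ᵇ-true h' = refl

 ext-out : ∀ {i j} -> n < i ⊎ n < j -> G i j ≡ std i j
 ext-out (inj₁ h) rewrite ≤ᵇ-false h = refl
 ext-out {i} {j} (inj₂ h) rewrite ≤ᵇ-false h with i ≤ᵇ n
 ... | true = refl
 ... | false = refl

 nobump : ∀ i j -> 1 ≤ i -> 1 ≤ j -> G i j ≢ bump
 nobump i j i₁ j₁ e with i ≤? n | j ≤? n
 ... | yes h | yes h' = noBump i j i₁ h j₁ h' (trans (sym (ext-in h h')) e)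
 ... | no h | _ = std-bump i j (trans (sym (ext-out (inj₁ (≰⇒> h)))) e)
 ... | yes _ | no h = std-bump i j (trans (sym (ext-out (inj₂ (≰⇒> h)))) e)

 EW-edge : ∀ i j -> 1 ≤ i -> 1 ≤ j -> hasE (G i j) ≡ hasW (G i (suc j))
 EW-edge i j i₁ j₁ with i ≤? n | <-cmp j n
 ... | no h | _ rewrite ext-out {i} {j} (inj₁ (≰⇒> h)) | ext-out {i} {suc j} (inj₁ (≰⇒> h)) = std-EW i j
 ... | yes _ | tri> _ _ h rewrite ext-out {i} {j} (inj₂ h) | ext-out {i} {suc j} (inj₂ (<-trans h ≤-refl)) = std-EW i j
 ... | yes h | tri≈ _ refl _ rewrite ext-in {i} {j} h ≤-refl | ext-out {i} {suc j} (inj₂ ≤-refl) | std-horiz (s≤s h) = right i i₁ h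
 ... | yes h | tri< h' _ _ rewrite ext-in {i} {j} h (<⇒≤ h') | ext-in {i} {suc j} h h' = compatEW i j i₁ h j₁ h'

 NS-edge : ∀ i j -> 1 ≤ i -> 1 ≤ j -> hasS (G i j) ≡ hasN (G (suc i) j)
 NS-edge i j i₁ j₁ with j ≤? n | <-cmp i n
 ... | no h | _ rewrite ext-out {i} {j} (inj₂ (≰⇒> h)) | ext-out {suc i} {j} (inj₂ (≰⇒> h)) = std-SN i j
 ... | yes _ | tri> _ _ h rewrite ext-out {i} {j} (inj₁ h) | ext-out {suc i} {j} (inj₁ (<-trans h ≤-refl)) = std-SN i j
 ... | yes h | tri≈ _ refl _ rewrite ext-in {i} {j} ≤-refl h | ext-out {suc i} {j} (inj₁ ≤-refl) | std-vert (s≤s h) = bottom j j₁ h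
 ... | yes h | tri< h' _ _ rewrite ext-in {i} {j} (<⇒≤ h') h | ext-in {suc i} {j} h' h = compatSN i j i₁ h' j₁ h

 N-bound : ∀ i j -> hasN (G i j) ≡ true -> j ≤ n ⊎ j < i
 N-bound i j e with j ≤? n
 ... | yes h = inj₁ h
 ... | no h = inj₂ (std-N i j (subst (\t -> hasN t ≡ true) (ext-out (inj₂ (≰⇒> h))) e))

 no-top : ∀ j -> 1 ≤ j -> hasN (G 1 j) ≢ true
 no-top j j₁ e with 1 ≤? n | j ≤? n
 ... | yes h | yes h' with () ← trans (sym (top j j₁ h')) (subst (\t -> hasN t ≡ true) (ext-in h h') e)
 ... | yes h | no h' = <⇒≱ (std-N 1 j (subst (\t -> hasN t ≡ true) (ext-out (inj₂ (≰⇒> h'))) e)) j₁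
 ... | no h | _ = <⇒≱ (std-N 1 j (subst (\t -> hasN t ≡ true) (ext-out (inj₁ (≰⇒> h))) e)) j₁

 no-left : ∀ i -> 1 ≤ i -> hasW (G i 1) ≢ true
 no-left i i₁ e with i ≤? n
 ... | yes h with () ← trans (sym (left i i₁ h)) (subst (\t -> hasW t ≡ true) (ext-in h (≤-trans i₁ h)) e)
 ... | no h with i ≟ 1
 ... | yes refl with () ← subst (\t -> hasW t ≡ true) (trans (ext-out (inj₁ (≰⇒> h))) (std-relb 1)) e
 ... | no ne with () ← subst (\t -> hasW t ≡ true) (trans (ext-out (inj₁ (≰⇒> h))) (std-vert (≤∧≢⇒< i₁ (≢-sym ne)))) e

 -- The r-turn at which the horizontal run arriving in column `j` begins, found by walking west. The
 -- value 0 is only a default, as no run comes from the west edge.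
 turn : ℕ -> ℕ -> ℕ
 turn i zero = 0
 turn i (suc j) = if has SE (G i j) then j else turn i j

 turn-spec : ∀ i j -> 1 ≤ i -> hasW (G i (suc j)) ≡ true -> turn i (suc j) < suc j × 1 ≤ turn i (suc j) × has SE (G i (turn i (suc j))) ≡ true ×
  (∀ m -> turn i (suc j) < m -> m < suc j -> has WE (G i m) ≡ true)
 turn-spec i zero i₁ e = ⊥-elim (no-left i i₁ e)
 turn-spec i (suc j) i₁ e with has SE (G i (suc j)) in s | E-split (G i (suc j)) (nobump i (suc j) i₁ (s≤s z≤n)) (trans (EW-edge i (suc j) i₁ (s≤s z≤n)) e)
 ... | true | _ = ≤-refl , s≤s z≤n , s , (\m h h' -> ⊥-elim (<⇒≱ h' h))
 ... | false | inj₁ (() , _)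
 ... | false | inj₂ (_ , we) with turn-spec i j i₁ (conn-W outE (G i (suc j)) we)
 ... | a , b , c , d = <-trans a ≤-refl , b , c , run
  where
  run : ∀ m -> turn i (suc j) < m -> m < suc (suc j) -> has WE (G i m) ≡ true
  run m h h' with m ≟ suc j
  ... | yes refl = we
  ... | no n = d m h (≤∧≢⇒< (≤-pred h') n)

 down : ℕ -> ℕ -> ℕ
 down t c = if has SN (G (suc t) c) then c else turn (suc t) c

 -- Followed downwards, pipe `p` begins in its exit row `p + 1`; the value `wd K p` at the top of
 -- that row makes it come in from the east.
 pos : ℕ -> ℕ -> ℕ
 pos zero p = wd K 0
 pos (suc t) p = if Dec.does (p ≤? t) then down t (pos t p) else wd K (suc t)

 pos-far : ∀ t -> pos t t ≡ wd K t
 pos-far zero = refl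
 pos-far (suc t) = if-no (suc t ≤? t) (<-irrefl refl)

 n<wd : ∀ t -> n < wd K t
 n<wd t = ≤-trans n<K (≤-trans (m≤n+m K t) (n≤1+n _))

 far-tile : ∀ t j -> wd K t ≤ j -> G (suc t) j ≡ horiz
 far-tile t j h = trans (ext-out (inj₂ (≤-trans (n<wd t) h))) (std-horiz (≤-trans (s≤s (≤-trans (s≤s (m≤m+n t 0)) (≤-trans (≤-reflexive (sym (+-suc t 0))) (+-monoʳ-≤ t (≤-trans (s≤s z≤n) n<K))))) h))

 -- The pipes at height `t` correspond one to one to the north edges in use in row `t + 1`. This is
 -- the induction hypothesis by which pipes are followed down.
 record Level (t : ℕ) : Set where
  field
   lo    : ∀ p -> p < t -> 1 ≤ pos t p
   north : ∀ p -> p < t -> hasN (G (suc t) (pos t p)) ≡ true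
   occ   : ∀ j -> 1 ≤ j -> hasN (G (suc t) j) ≡ true -> Occ t (pos t) j
   inj   : ∀ p q -> p < t -> q < t -> pos t p ≡ pos t q -> p ≡ q

  bound : ∀ p -> p < t -> pos t p ≤ n ⊎ pos t p ≤ t
  bound p p< with N-bound (suc t) (pos t p) (north p p<)
  ... | inj₁ h = inj₁ h
  ... | inj₂ h = inj₂ (≤-pred h)

  hi : ∀ p -> p < t -> pos t p < wd K t
  hi p p< with bound p p<
  ... | inj₁ h = ≤-trans (s≤s h) (n<wd t)
  ... | inj₂ h = s≤s (≤-trans h (m≤m+n t K))

  strand : ∀ p -> p ≤ t -> Strand (G (suc t)) (pos (suc t) p) (pos t p)
  strand p p≤ = subst (\b -> Strand (G (suc t)) b (pos t p)) (sym (if-yes (p ≤? t) p≤)) (go tile)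
   where
   tile : has SN (G (suc t) (pos t p)) ≡ true ⊎ (has SN (G (suc t) (pos t p)) ≡ false × hasW (G (suc t) (pos t p)) ≡ true × 1 ≤ pos t p)
   tile with p ≟ t
   ... | yes refl rewrite pos-far t | far-tile t (wd K t) ≤-refl = inj₂ (refl , refl , s≤s z≤n)
   ... | no ne with N-split (G (suc t) (pos t p)) (north p (≤∧≢⇒< p≤ ne))
   ... | inj₁ s = inj₁ s
   ... | inj₂ (ns , wn) = inj₂ (ns , conn-W outN (G (suc t) (pos t p)) wn , lo p (≤∧≢⇒< p≤ ne))
   go : has SN (G (suc t) (pos t p)) ≡ true ⊎ (has SN (G (suc t) (pos t p)) ≡ false × hasW (G (suc t) (pos t p)) ≡ true × 1 ≤ pos t p) ->
    Strand (G (suc t)) (down t (pos t p)) (pos t p)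
   go (inj₁ s) = up (cong (\b -> if b then pos t p else turn (suc t) (pos t p)) s) s
   go (inj₂ (ns , w , c₁)) with pos t p | c₁
   ... | suc c₀ | _ with turn-spec (suc t) c₀ (s≤s z≤n) w
   ... | a , b , c , d = subst (\x -> Strand (G (suc t)) x (suc c₀)) (sym (cong (\b -> if b then suc c₀ else turn (suc t) (suc c₀)) ns)) (hop a b ns c d)

  module Here = StrandRow {t} {wd K t} (G (suc t)) (pos t) (pos (suc t)) (pos-far t) hi (\j -> nobump (suc t) j (s≤s z≤n)) (\j -> EW-edge (suc t) j (s≤s z≤n))
   (cong (has SN) (far-tile t (wd K t) ≤-refl)) lo north occ inj strand

 level : ∀ t -> Level t
 level zero = record { lo = \p () ; north = \p () ; occ = \j j₁ e -> ⊥-elim (no-top j j₁ e) ; inj = \p q () }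
 level (suc t) = record
  { lo = \p p< -> lo-B p (≤-pred p<)
  ; north = \p p< -> trans (sym (NS-edge (suc t) (pos (suc t) p) (s≤s z≤n) (lo-B p (≤-pred p<)))) (south p (≤-pred p<))
  ; occ = \j j₁ e -> occ-B j j₁ (\h -> cong hasS (far-tile t j h)) (trans (NS-edge (suc t) j (s≤s z≤n) j₁) e)
  ; inj = \p q p< q< -> inj-B p q (≤-pred p<) (≤-pred q<) }
  where open Level.Here (level t)

 module At (t : ℕ) where
  open Level (level t) public using (bound; hi; occ)
  open Level.Here (level t) public

 match : Match K G pos
 match t = At.cell t

 shape : Shape K pos
 shape = record { far = pos-far ; le = At.le ; lo = At.lo-B ; hi = At.hi }

 stdOut : StdOut G n
 stdOut i j i₁ j₁ h = ext-out h

 full : ∀ t -> n ≤ t -> Full t (pos t)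
 full t n≤ = (\p p< -> [ (\h -> ≤-trans h n≤) , (\h -> h) ]′ (At.bound t p p<)) ,
  (\j j₁ j≤ -> At.occ t j j₁ (cong hasN (trans (ext-out (inj₁ (s≤s n≤))) (std-vert (s≤s j≤)))))

 flowD : Flow D n pos
 flowD = record { cell = \t j t< j₁ j₂ -> subst (Cell t (pos t) (pos (suc t)) j) (ext-in t< j₂) (cell t j t< j₁ j₂) ; far = far ; le = le ; lo = lo ; hi = hi ; all = all }
  where open Flow (flow match shape stdOut (<⇒≤ n<K))

 open Tracing flowD

 -- Connects the names with one-line notation: the trace from the foot of pipe `p` leaves in row
 -- `p + 1`.
 π-pos : ∀ p -> p < n -> π (suc p) ≡ pos n p
 π-pos p p< with exits (pos n p) (lo′ n p p< ≤-refl) (Flow.hi flowD n p ≤-refl p<)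
  where
  lo′ : ∀ m p -> p < m -> m ≤ n -> 1 ≤ pos m p
  lo′ (suc m) p (s≤s h) _ = At.lo-B m p h
 ... | r , e , e' with refl ← trans (sym e) (exit-row p p<) = e'

 Over : ℕ -> ℕ -> ℕ -> Set
 Over t p q = p ≤ t × q ≤ t × pos t p < pos t q × pos (suc t) p ≡ pos t p × pos (suc t) q < pos t p

 -- Below the block the tiles in occupied columns are vertical. Hence crossings lie in the block,
 -- where `crossOnce` applies.
 over-below : ∀ {t p q} -> Over t p q -> t < n
 over-below {t} {p} {q} (p≤ , q≤ , lt , e , h) with t <? n
 ... | yes h' = h'
 ... | no h' with () ← trans (sym (trans (ext-out (inj₁ (s≤s (≮⇒≥ h')))) (std-vert (s≤s (proj₁ (full t (≮⇒≥ h')) p (At.below t p p≤ (≤-trans lt (At.T≤w t q q≤))))))))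
    (Read.sn∧we (match t (pos t p) (subst (1 ≤_) e (At.lo-B t p p≤)) (≤-trans lt (At.T≤w t q q≤))) q p q≤ p≤ (h , lt) (e , refl))

 over-crossing : ∀ {t p q} -> Over t p q -> Crossing p q (suc t) (pos t p)
 over-crossing {t} {p} {q} o@(p≤ , q≤ , lt , e , h) = cong isCross tile , (inS , vS p≤ t< e) , (inW , vW q≤ t< h (<⇒≤ lt) c≤)
  where
  t< = over-below o
  c≤ : pos t p ≤ n
  c≤ = subst (_≤ n) e (Flow.hi flowD (suc t) p t< (s≤s p≤))
  tile = trans (sym (ext-in t< c≤)) (Read.sn∧we (match t (pos t p) (subst (1 ≤_) e (At.lo-B t p p≤)) (≤-trans lt (At.T≤w t q q≤))) q p q≤ p≤ (h , lt) (e , refl))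

 step-order : ∀ {t p q} -> p ≤ t -> q ≤ t -> pos t p < pos t q -> pos (suc t) p < pos (suc t) q ⊎ Over t p q
 step-order {t} {p} {q} p≤ q≤ h with At.tri t p q p≤ q≤ h
 ... | inj₁ h' = inj₁ (≤-trans (s≤s (At.le t p p≤)) h')
 ... | inj₂ (e , h') = inj₂ (p≤ , q≤ , h , e , h')

 flip : ∀ m u {t p q} -> m + u ≡ t -> p ≤ u -> q ≤ u -> pos u q < pos u p -> pos t p < pos t q -> ∃ \v -> v < t × Over v q p
 flip zero u refl p≤ q≤ h h' = ⊥-elim (<-asym h h')
 flip (suc m) u {t} e p≤ q≤ h h' with step-order q≤ p≤ h
 ... | inj₂ o = u , ≤-trans (s≤s (m≤n+m u m)) (≤-reflexive e) , o
 ... | inj₁ h″ = flip m (suc u) (trans (+-suc m u) e) (≤-trans p≤ (n≤1+n u)) (≤-trans q≤ (n≤1+n u)) h″ h'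

 -- Otherwise q, exiting above p, would cross p a second time further up.
 over-label : ∀ {t p q} -> Over t p q -> p < q
 over-label {t} {p} {q} o@(p≤ , q≤ , lt , _) with <-cmp p q
 ... | tri< h _ _ = h
 ... | tri≈ _ refl _ = ⊥-elim (<-irrefl refl lt)
 ... | tri> _ n≢ h with flip (t ∸ p) p (m∸n+n≡m p≤) ≤-refl (<⇒≤ h) (subst (pos p q <_) (sym (pos-far p)) (At.hi p q h)) lt
 ... | v , v< , o' = ⊥-elim (<⇒≱ (two-elements _ (cross-complete (over-crossing o)) (cross-complete cr') (\x -> <⇒≢ v< (suc-injective (sym (cong proj₁ x)))))
    (crossOnce (pos n p) (pos n q) (in₁ p p<) (hi n p ≤-refl p<) (in₁ q q<) (hi n q ≤-refl q<) ne))
  where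
  open Flow flowD using (hi)
  p< : p < n
  p< = ≤-trans (s≤s p≤) (over-below o)
  q< : q < n
  q< = <-trans h p<
  in₁ : ∀ p -> p < n -> 1 ≤ pos n p
  in₁ p p< = Level.lo (level n) p p<
  ne : pos n p ≢ pos n q
  ne x = n≢ (Level.inj (level n) p q p< q< x)
  cr' : Crossing p q (suc v) (pos v q)
  cr' with over-crossing o'
  ... | a , b , c = a , c , b

 -- By `over-label` a crossing, seen downwards, always turns increasing names into decreasing ones.
 -- An increasing order below was therefore never disturbed above.
 order-up : ∀ m t {p q} -> p < q -> q < t -> pos (m + t) p < pos (m + t) q -> pos t p < pos t q
 order-up zero t _ _ h = h
 order-up (suc m) t {p} {q} p<q q<t h with <-cmp (pos t p) (pos t q)
 ... | tri< h' _ _ = h'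
 ... | tri≈ _ e _ = ⊥-elim (<⇒≢ p<q (Level.inj (level t) p q (<-trans p<q q<t) q<t e))
 ... | tri> _ _ h' with step-order (<⇒≤ q<t) (<⇒≤ (<-trans p<q q<t)) h'
 ... | inj₂ o = ⊥-elim (<-asym p<q (over-label o))
 ... | inj₁ h″ = ⊥-elim (<-asym h″ (order-up m (suc t) p<q (<-trans q<t ≤-refl) (subst (\u -> pos u p < pos u q) (sym (+-suc m t)) h)))

 row-std : ∀ t -> n ≤ t -> (∀ p -> p < t -> pos (suc t) p ≡ pos t p) × pos (suc t) t ≡ suc t
 row-std t n≤ = upr , last
  where
  upr : ∀ p -> p < t -> pos (suc t) p ≡ pos t p
  upr p p< with Level.strand (level t) p (<⇒≤ p<)
  ... | up e _ = e
  ... | hop _ _ ns _ _ with () ← trans (sym ns) (cong (has SN) (trans (ext-out (inj₁ (s≤s n≤))) (std-vert (s≤s (proj₁ (full t n≤) p p<)))))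
  last : pos (suc t) t ≡ suc t
  last with proj₂ (full (suc t) (≤-trans n≤ (n≤1+n t))) (suc t) (s≤s z≤n) ≤-refl
  ... | z , z< , e with z ≟ t
  ... | yes refl = e
  ... | no ne = ⊥-elim (<⇒≱ (≤-reflexive (sym e)) (≤-trans (At.le t z (≤-pred z<)) (proj₁ (full t n≤) z (≤∧≢⇒< (≤-pred z<) ne))))

 module Labels {k l : ℕ} (descents : ∀ i -> Descent n π i -> l ≤ i × i ≤ k) where

  -- Two names with no descent between them: the rows they leave in are both up to the first descent
  -- or both after the last one, so that the feet of the pipes are in increasing order.
  Calm : ℕ -> ℕ -> Set
  Calm p q = p < q × (q < l ⊎ k ≤ p)

  ascent : ∀ p -> suc p < n -> suc p < l ⊎ k ≤ p -> pos n p < pos n (suc p)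
  ascent p p< c with <-cmp (pos n p) (pos n (suc p))
  ... | tri< h _ _ = h
  ... | tri≈ _ e _ = ⊥-elim (<⇒≢ ≤-refl (Level.inj (level n) p (suc p) (<-trans ≤-refl p<) p< e))
  ... | tri> _ _ h with descents (suc p) (s≤s z≤n , p< , subst₂ _<_ (sym (π-pos (suc p) p<)) (sym (π-pos p (<-trans ≤-refl p<))) h) | c
  ... | a , b | inj₁ r = ⊥-elim (<⇒≱ r a)
  ... | a , b | inj₂ r = ⊥-elim (<⇒≱ b r)

  calm-bottom : ∀ p q -> Calm p q -> q < n -> pos n p < pos n q
  calm-bottom p (suc q) (s≤s p≤ , c) q< with p ≟ q
  ... | yes refl = ascent p q< c
  ... | no ne = <-trans (calm-bottom p q (≤∧≢⇒< p≤ ne , [ (\h -> inj₁ (<-trans ≤-refl h)) , inj₂ ]′ c) (<-trans ≤-refl q<)) (ascent q q< ([ inj₁ , (\h -> inj₂ (≤-trans h p≤)) ]′ c))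

  calm-late : ∀ m p q -> Calm p q -> q < m + n -> pos (m + n) p < pos (m + n) q
  calm-late zero p q c q< = calm-bottom p q c q<
  calm-late (suc m) p q c q< with q ≟ m + n
  ... | no ne = subst₂ _<_ (sym (proj₁ (row-std (m + n) (m≤n+m n m)) p (<-trans (proj₁ c) q<'))) (sym (proj₁ (row-std (m + n) (m≤n+m n m)) q q<')) (calm-late m p q c q<')
   where
   q<' : q < m + n
   q<' = ≤∧≢⇒< (≤-pred q<) ne
  ... | yes refl = subst₂ _<_ (sym (proj₁ (row-std q (m≤n+m n m)) p (proj₁ c))) (sym (proj₂ (row-std q (m≤n+m n m)))) (s≤s (proj₁ (full q (m≤n+m n m)) p (proj₁ c)))

  -- The order is known far below the block, from the permutation and the standard part, and is
  -- carried up by `order-up`.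
  calm : ∀ t p q -> Calm p q -> q < t -> pos t p < pos t q
  calm t p q c q< = order-up n t (proj₁ c) q< (subst (\u -> pos u p < pos u q) (+-comm t n) (calm-late t p q c (≤-trans q< (m≤m+n t n))))

  apart : ∀ t p q -> p ≤ t -> q ≤ t -> pos t p < pos t q -> Apart l p q (pos t p) (pos (suc t) p) (pos t q) (pos (suc t) q)
  apart t p q p≤ q≤ h with At.tri t p q p≤ q≤ h
  ... | inj₁ h' with p <? q | l ≤? p
  ... | yes a | _ = inj₁ (h' , inj₁ a)
  ... | no _ | yes a = inj₁ (h' , inj₂ a)
  ... | no a | no b with p ≟ q
  ... | yes refl = ⊥-elim (<-irrefl refl h)
  ... | no ne = ⊥-elim (<-asym h' (≤-trans (calm (suc t) q p (≤∧≢⇒< (≮⇒≥ a) (≢-sym ne) , inj₁ (≰⇒> b)) (s≤s p≤)) (At.le t p p≤)))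
  apart t p q p≤ q≤ h | inj₂ (e , h') with over-label (p≤ , q≤ , h , e , h') | l ≤? q
  ... | p<q | yes a = inj₂ (inj₂ (inj₁ (p<q , a , h' , h , e)))
  ... | p<q | no a = ⊥-elim (<-asym (calm (suc t) p q (p<q , inj₁ (≰⇒> a)) (s≤s q≤)) (subst (pos (suc t) q <_) (sym e) h'))

  row : ∀ t -> Row l (suc n + t) (wd K t) t (pos t) (pos (suc t))
  row t = record { top = pos-far t ; lo = At.lo-B t ; le = At.le t ; hi = At.hi t ; bd = bd ; bw = s≤s (subst (suc n + t ≤_) (+-comm K t) (+-monoˡ-≤ t n<K)) ; pair = pair }
   where
   bd : ∀ p -> p ≤ t -> pos (suc t) p ≤ suc n + t
   bd p p≤ with At.bound (suc t) p (s≤s p≤)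
   ... | inj₁ h = ≤-trans h (≤-trans (n≤1+n n) (m≤m+n (suc n) t))
   ... | inj₂ h = ≤-trans h (s≤s (m≤n+m t n))
   pair : ∀ p q -> p ≤ t -> q ≤ t -> p ≢ q -> Apart l p q (pos t p) (pos (suc t) p) (pos t q) (pos (suc t) q)
   pair p q p≤ q≤ ne with <-cmp (pos t p) (pos t q)
   ... | tri< h _ _ = apart t p q p≤ q≤ h
   ... | tri≈ _ e _ = ⊥-elim (ne (At.inj-T t p q p≤ q≤ e))
   ... | tri> _ _ h = apart-sym {l} {q} {p} (apart t q p q≤ p≤ h)

  -- A turning pipe `p` would leave its top column to another pipe from below, since no column is
  -- free there. That pipe would have to turn in a cell whose north edge `p` uses, which is a bump.
  rigid-row : ∀ t -> (∀ j -> 1 ≤ j -> j ≤ pos (suc t) t -> Occ (suc t) (pos (suc t)) j) -> Rigid t (pos t) (pos (suc t))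
  rigid-row t occ = record { upr = upr ; full = full! }
   where
   upr : ∀ p -> p < t -> pos (suc t) p ≡ pos t p
   upr p p< with At.tri t p t (<⇒≤ p<) ≤-refl (subst (pos t p <_) (sym (pos-far t)) (At.hi t p p<))
   ... | inj₂ (e , _) = e
   ... | inj₁ h with occ (pos t p) (≤-trans (At.lo-B t p (<⇒≤ p<)) (At.le t p (<⇒≤ p<))) (<⇒≤ h)
   ... | u , u< , e with <-cmp (pos t u) (pos t p)
   ... | tri< a _ _ = ⊥-elim (<⇒≱ a (≤-trans (≤-reflexive (sym e)) (At.le t u (≤-pred u<))))
   ... | tri≈ _ a _ with refl ← At.inj-T t u p (≤-pred u<) (<⇒≤ p<) a = e
   ... | tri> _ _ a with At.tri t p u (<⇒≤ p<) (≤-pred u<) a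
   ... | inj₁ h' = ⊥-elim (<⇒≢ h' (sym e))
   ... | inj₂ (_ , h') = ⊥-elim (<⇒≢ h' e)
   full! : ∀ j -> 1 ≤ j -> j < pos (suc t) t -> Occ t (pos t) j
   full! j j₁ j< with occ j j₁ (<⇒≤ j<)
   ... | u , u< , e with u ≟ t
   ... | yes refl = ⊥-elim (<⇒≢ j< (sym e))
   ... | no ne = u , ≤∧≢⇒< (≤-pred u<) ne , trans (sym (upr u (≤∧≢⇒< (≤-pred u<) ne))) e

  -- No column to the left of the last pipe is empty, by induction upwards from row n.
  dense : ∀ m t -> n ≤ m + t -> k ≤ t -> ∀ j -> 1 ≤ j -> j ≤ pos (suc t) t -> Occ (suc t) (pos (suc t)) j
  dense zero t n≤ k≤ j j₁ j≤ = proj₂ (full (suc t) (≤-trans n≤ (n≤1+n t))) j j₁ (subst (j ≤_) (proj₂ (row-std t n≤)) j≤)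
  dense (suc m) t n≤ k≤ j j₁ j≤ = Rigid.full rg j j₁ (≤-trans (s≤s j≤) (subst (_< pos (suc (suc t)) (suc t)) (Rigid.upr rg t ≤-refl) (calm (suc (suc t)) t (suc t) (≤-refl , inj₂ k≤) ≤-refl)))
   where
   rg = rigid-row (suc t) (dense m (suc t) (subst (n ≤_) (sym (+-suc m t)) n≤) (≤-trans k≤ (n≤1+n t)))

  world : World l k K (suc n) (n ⊔ k)
  world = record { pos = pos ; row = row ; rig = \t k≤ -> rigid-row t (dense n t (m≤m+n n t) k≤) ; full = \t h -> full t (≤-trans (m≤m⊔n n k) h) }

  placed : Placed K G pos G n
  placed = record { match = match ; std! = stdOut ; edge = \i j _ -> refl ; M≤ = <⇒≤ n<K }

-- From equal positions to equal grids

same-grid : ∀ {K G₀ P P' G G' M M'} -> Placed K G₀ P G M -> Placed K G₀ P' G' M' -> (∀ t p -> p ≤ t -> P t p ≡ P' t p) -> (∀ i j -> G i j ≡ G' i j)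
same-grid pl pl' h zero j = trans (Placed.edge pl 0 j (inj₁ refl)) (sym (Placed.edge pl' 0 j (inj₁ refl)))
same-grid pl pl' h (suc t) zero = trans (Placed.edge pl (suc t) 0 (inj₂ refl)) (sym (Placed.edge pl' (suc t) 0 (inj₂ refl)))
same-grid {K} {P = P} {P'} {M = M} {M'} pl pl' h (suc t) (suc j) with suc j <? wd K t
... | yes j< = cell-det (cell-ext (Placed.match pl t (suc j) (s≤s z≤n) j<) (P' t) (P' (suc t)) (\p p≤ -> sym (h t p p≤)) (\p p≤ -> sym (h (suc t) p (≤-trans p≤ (n≤1+n t)))))
  (Placed.match pl' t (suc j) (s≤s z≤n) j<)
... | no j≥ = trans (Placed.std! pl (suc t) (suc j) (s≤s z≤n) (s≤s z≤n) (inj₂ (far (Placed.M≤ pl)))) (sym (Placed.std! pl' (suc t) (suc j) (s≤s z≤n) (s≤s z≤n) (inj₂ (far (Placed.M≤ pl')))))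
 where
 far : ∀ {M} -> M ≤ K -> M < suc j
 far M≤ = ≤-trans (s≤s (≤-trans M≤ (m≤n+m K t))) (≮⇒≥ j≥)

-- One insertion needs `2 + (b + f) ≤ K` and raises `b` and `f` by one each, so two in a row need
-- `4 + (b + f) ≤ K`.
insertions-commute : ∀ {l k K b f} (W : World l k K b f) -> suc b < K -> 4 + (b + f) ≤ K -> k ≤ f ->
 ∀ {x y} -> 1 ≤ x -> x ≤ k -> 1 ≤ y -> y ≤ l -> l ≤ k -> ∀ {G M} -> Placed K G (World.pos W) G M ->
 Σ (Grid × ℕ) \F₁ -> Σ (Grid × ℕ) \E₁ -> Σ (Grid × ℕ) \F₂ -> Σ (Grid × ℕ) \E₂ ->
  (LeftIns x k (G , M) F₁ × RightIns y l F₁ E₁) × (RightIns y l (G , M) F₂ × LeftIns x k F₂ E₂) × (∀ i j -> proj₁ E₁ i j ≡ proj₁ E₂ i j)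
insertions-commute {b = b} {f} W b<K big k≤f 1≤x x≤k 1≤y y≤l l≤k pl
 with left-insertion W (<⇒≤ b<K) l≤k k≤f x≤k (l-run W (<⇒≤ b<K) l≤k x≤k) 1≤x (≤-trans (m≤n+m (2 + (b + f)) 2) big) pl
  | right-insertion W (<⇒≤ b<K) l≤k k≤f y≤l (r-run W (<⇒≤ b<K) y≤l) 1≤y (≤-trans (m≤n+m (2 + (b + f)) 2) big) pl
... | F₁ , i₁ , pl₁ | F₂ , i₂ , pl₂
 with right-insertion C.WL b<K l≤k C.k≤f′ y≤l (r-run C.WL b<K y≤l) 1≤y big₂ pl₁ | left-insertion C.WR b<K l≤k C.k≤f′ x≤k (l-run C.WR b<K l≤k x≤k) 1≤x big₂ pl₂
 where
 module C = Commute W b<K l≤k k≤f 1≤x x≤k 1≤y y≤l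
 big₂ = ≤-trans (≤-reflexive (cong (3 +_) (+-suc b f))) big
... | E₁ , j₁ , pl₁₂ | E₂ , j₂ , pl₂₁ = F₁ , E₁ , F₂ , E₂ , (i₁ , j₁) , (i₂ , j₂) , same-grid pl₁₂ pl₂₁ equal
 where
 module C = Commute W b<K l≤k k≤f 1≤x x≤k 1≤y y≤l
 equal : ∀ t p -> p ≤ t -> C.LR.pos′ t p ≡ C.RL.pos′ t p
 equal t p p≤ with p ≟ t
 ... | yes refl = trans (Row.top (C.LR.row′ t)) (sym (Row.top (C.RL.row′ t)))
 ... | no ne = C.commutes-below t p (≤∧≢⇒< p≤ ne)

theorem3p14 : (n : ℕ) (π : ℕ → ℕ) (D : Grid) → IsBPD n π D →
 (x k y l : ℕ) → Biletter x k → Biletter y l → l ≤ k →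
 (¬ IsId n π → (d₁ d₂ : ℕ) → FirstDescent n π d₁ → LastDescent n π d₂ → (d₂ ≤ k) × (l ≤ d₁)) →
 Σ (Grid × ℕ) λ F₁ → Σ (Grid × ℕ) λ E₁ → Σ (Grid × ℕ) λ F₂ → Σ (Grid × ℕ) λ E₂ →
  (LeftIns x k (ext n D , n) F₁ × RightIns y l F₁ E₁)
  × (RightIns y l (ext n D , n) F₂ × LeftIns x k F₂ E₂)
  × (∀ i j → proj₁ E₁ i j ≡ proj₁ E₂ i j)
theorem3p14 n π D bpd x k y l (1≤x , x≤k) (1≤y , y≤l) l≤k hyp =
 insertions-commute world (s≤s (s≤s (≤-trans (m≤m+n (suc n) f) (m≤n+m (suc n + f) 2)))) ≤-refl (m≤n⊔m n k) 1≤x x≤k 1≤y y≤l l≤k placed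
 where
 -- The grid is standard beyond `n`, and `f` must also be at least `k`. The constant used for `K` is
 -- `4 + (b + f)` with `b = suc n`, the bound from `world`.
 f = n ⊔ k
 n<K : n < 4 + (suc n + f)
 n<K = ≤-trans (m≤m+n (suc n) f) (m≤n+m (suc n + f) 4)
 -- Any descent shows that the permutation is not the identity; the hypothesis then applies to the
 -- first and last descents, found by search, and bounds all others.
 descents : ∀ i -> Descent n π i -> l ≤ i × i ≤ k
 descents i d with least-such (descent? n π) d | greatest-such (descent? n π) n (\j h -> proj₁ (proj₂ h)) d
 ... | d₁ , e₁ , h₁ | d₂ , e₂ , h₂ with hyp (\id -> <-asym (proj₂ (proj₂ d))
   (subst₂ _<_ (sym (id i (proj₁ d) (<⇒≤ (proj₁ (proj₂ d))))) (sym (id (suc i) (s≤s z≤n) (proj₁ (proj₂ d)))) ≤-refl)) d₁ d₂ (e₁ , h₁) (e₂ , h₂)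
 ... | d₂≤k , l≤d₁ = ≤-trans l≤d₁ (h₁ i d) , ≤-trans (h₂ i d) d₂≤k
 open Setup.Labels bpd (4 + (suc n + f)) n<K descents using (world; placed)
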